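{- All of the following tuples are universal: $(8,2,3,1,2,0)$, $(8,2,3,1,3,1)$, $(8,2,4,2,2,0)$, $(8,2,4,2,4,0)$, $(8,2,5,1,4,2)$, $(8,2,5,3,5,1)$, $(8,4,6,4,6,2)$, $(8,4,8,2,3,1)$, $(8,4,8,4,6,4)$, $(8,6,3,1,2,0)$, $(8,6,4,2,4,0)$, $(8,6,4,2,4,2)$, $(8,6,5,1,4,2)$, $(8,6,8,4,3,1)$.
   Context: For $a_1,b_1,c_1$ positive integers and $a_2,b_2,c_2$ integers with $a_1-a_2$, $b_1-b_2$, $c_1-c_2$ all even, the tuple $(a_1,a_2,b_1,b_2,c_1,c_2)$ is called universal if every nonnegative integer $n$ can be written as $\frac{x(a_1x+a_2)}2+\frac{y(b_1y+b_2)}2+\frac{z(c_1z+c_2)}2$ with $x,y,z\in\mathbb{Z}$. -}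

module Defs where

open import Data.Nat using (ℕ)
open import Data.Integer using (ℤ; +_; _+_; _*_)
open import Data.Product using (∃; ∃-syntax; _×_)
open import Relation.Binary.PropositionalEquality using (_≡_)

-- Twice the generalized polygonal value x(a₁x + a₂)/2, i.e. x(a₁x + a₂).
-- Under the standing parity assumption (a₁ - a₂ even) x(a₁x+a₂) is always
-- even, so  n = Σ x(a₁x+a₂)/2  iff  2n = Σ x(a₁x+a₂).
twicePoly : ℤ → ℤ → ℤ → ℤ
twicePoly a₁ a₂ x = x * (a₁ * x + a₂)

Universal : ℤ → ℤ → ℤ → ℤ → ℤ → ℤ → Set
Universal a₁ a₂ b₁ b₂ c₁ c₂ =
  (n : ℕ) → ∃[ x ] ∃[ y ] ∃[ z ]
    (+ 2 * + n ≡ twicePoly a₁ a₂ x + twicePoly b₁ b₂ y + twicePoly c₁ c₂ z)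

{-# OPTIONS --safe #-}
module Submission where

-- Completing squares turns each statement into the representation of an arithmetic progression by
-- an even ternary lattice of half-discriminant 2, 3 or 5, and reduction theory shows that each of
-- these lattices is alone in its genus.  A positive integer m is represented as soon as some α
-- satisfies a congruence condition together with the solvability of x² ≡ κ modulo α, with κ
-- determined by m: one then writes down a lattice of the right discriminant that represents m.
-- To find α no prime in a progression is needed.  Comparing Σ χ(d) (X - de)₊ over de ≡ c with the
-- same sum over de ≡ 1, which the squares make large, shows that some A ≡ c has a nonzero divisor
-- sum Σ χ(d), so up to a square A is a product of primes p with χ(p) = 1.  The character
-- χ(a) = (κ / a) is computed with Gauss's lemma, extended to composite moduli by Schering, and
-- Eisenstein's proof of quadratic reciprocity.

open import Defs
open import Data.Bool.Base using (Bool; true; false; if_then_else_; T)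
open import Data.Empty using (⊥; ⊥-elim)
open import Data.Fin.Base as Fin using (Fin; toℕ; fromℕ<)
import Data.Fin.Properties as Finₚ
open import Data.Fin.Permutation using (Permutation; permutation)
open import Data.Integer.Base as ℤ
  using (ℤ; +_; -[1+_]; 0ℤ; 1ℤ; -1ℤ; _+_; _*_; _-_; -_; _≤_; _<_; ∣_∣; +≤+; +<+)
open import Data.Integer.DivMod using (_%ℕ_; _/ℕ_; a≡a%ℕn+[a/ℕn]*n; n%ℕd<d)
open import Data.Integer.Divisibility.Signed as ℤ∣ using (divides)
import Data.Integer.Properties as ℤₚ
open import Data.Integer.Tactic.RingSolver using (solve-∀)
open import Data.List.Base using (List; []; _∷_; cartesianProduct)
open import Data.List.Membership.Propositional using (_∈_)
open import Data.List.Relation.Unary.Any using (here; there)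
open import Data.List.Relation.Unary.All using (All; []; _∷_)
open import Data.Nat.Base as ℕ using (ℕ; zero; suc; z≤n; s≤s)
import Data.Nat.Coprimality as Coprimality
open import Data.Nat.Coprimality using (Coprime)
import Data.Nat.Divisibility as ℕ∣
open import Data.Nat.DivMod as ℕ÷ using (_/_; _%_)
open import Data.Nat.GCD using (module Bézout)
open import Data.Nat.Primality using (Prime; euclidsLemma)
import Data.Nat.Primality as Primality
open import Data.Nat.Primality.Factorisation using (factorise)
import Data.Nat.Properties as ℕₚ
import Data.Nat.Tactic.RingSolver as ℕ-Ring
open import Data.Product using (∃-syntax; _×_; _,_; proj₁; proj₂)
open import Data.Sum.Base using (_⊎_; inj₁; inj₂; [_,_]′)
open import Data.Unit.Base using (tt)
open import Data.Vec.Base as Vec using (Vec; []; _∷_)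
open import Function.Base using (_∘_; _$_; case_of_; id)
open import Relation.Binary.PropositionalEquality
  using (_≡_; _≢_; refl; sym; trans; cong; cong₂; subst; subst₂; module ≡-Reasoning)
open import Relation.Binary.Definitions using (tri<; tri≈; tri>)
open import Relation.Nullary using (¬_; Dec; yes; no)
open import Relation.Nullary.Decidable using (_×-dec_)
open import Relation.Nullary.Decidable.Core using (toWitness; map′)
import Algebra.Properties.CommutativeMonoid.Sum as CMSum

private
  module ∏ = CMSum ℤₚ.*-1-commutativeMonoid

-- ∏ₖ₌₁ʰ f k
prod : ℕ → (ℕ → ℤ) → ℤ
prod h f = ∏.sum {h} (λ i → f (suc (toℕ i)))

prod-cong : ∀ {h f g} → (∀ k → 1 ℕ.≤ k → k ℕ.≤ h → f k ≡ g k) → prod h f ≡ prod h g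
prod-cong f≗g = ∏.sum-cong-≗ (λ i → f≗g (suc (toℕ i)) (s≤s z≤n) (Finₚ.toℕ<n i))

prod-* : ∀ h f g → prod h (λ k → f k * g k) ≡ prod h f * prod h g
prod-* h f g = ∏.∑-distrib-+ {h} (λ i → f (suc (toℕ i))) (λ i → g (suc (toℕ i)))

prod-comm : ∀ h l (f : ℕ → ℕ → ℤ) →
            prod h (λ k → prod l (f k)) ≡ prod l (λ j → prod h (λ k → f k j))
prod-comm h l f = ∏.∑-comm {h} {l} (λ i j → f (suc (toℕ i)) (suc (toℕ j)))

prod-const : ∀ h c → prod h (λ _ → c) ≡ c ℤ.^ h
prod-const zero    c = refl
prod-const (suc h) c = cong (c *_) (prod-const h c)

prod-one : ∀ h → prod h (λ _ → 1ℤ) ≡ 1ℤ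
prod-one h = trans (prod-const h 1ℤ) (ℤₚ.^-zeroˡ h)

prod-permute : ∀ h (f : ℕ → ℤ) (π π⁻¹ : ℕ → ℕ) →
               (∀ k → 1 ℕ.≤ k → k ℕ.≤ h → 1 ℕ.≤ π k × π k ℕ.≤ h) →
               (∀ k → 1 ℕ.≤ k → k ℕ.≤ h → 1 ℕ.≤ π⁻¹ k × π⁻¹ k ℕ.≤ h) →
               (∀ k → 1 ℕ.≤ k → k ℕ.≤ h → π⁻¹ (π k) ≡ k) →
               (∀ k → 1 ℕ.≤ k → k ℕ.≤ h → π (π⁻¹ k) ≡ k) →
               prod h (f ∘ π) ≡ prod h f
prod-permute h f π π⁻¹ r r⁻¹ inv inv⁻¹ =
  sym (trans (∏.sum-permute (λ i → f (suc (toℕ i))) perm)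
             (∏.sum-cong-≗ (λ i → cong f (suc-restrict π r i))))
  where
  restrict : (σ : ℕ → ℕ) → (∀ k → 1 ℕ.≤ k → k ℕ.≤ h → 1 ℕ.≤ σ k × σ k ℕ.≤ h) → Fin h → Fin h
  restrict σ s i =
    let (lo , hi) = s (suc (toℕ i)) (s≤s z≤n) (Finₚ.toℕ<n i)
    in fromℕ< (ℕₚ.≤-trans (ℕₚ.≤-reflexive (ℕₚ.suc-pred (σ (suc (toℕ i))) {{ℕ.>-nonZero lo}})) hi)

  suc-restrict : ∀ σ s i → suc (toℕ (restrict σ s i)) ≡ σ (suc (toℕ i))
  suc-restrict σ s i =
    let (lo , _) = s (suc (toℕ i)) (s≤s z≤n) (Finₚ.toℕ<n i)
    in trans (cong suc (Finₚ.toℕ-fromℕ< _)) (ℕₚ.suc-pred (σ (suc (toℕ i))) {{ℕ.>-nonZero lo}})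

  cancel : ∀ σ s τ t → (∀ k → 1 ℕ.≤ k → k ℕ.≤ h → τ (σ k) ≡ k) →
           ∀ i → restrict τ t (restrict σ s i) ≡ i
  cancel σ s τ t τσ i = Finₚ.toℕ-injective (ℕₚ.suc-injective (begin
    suc (toℕ (restrict τ t (restrict σ s i))) ≡⟨ suc-restrict τ t (restrict σ s i) ⟩
    τ (suc (toℕ (restrict σ s i)))            ≡⟨ cong τ (suc-restrict σ s i) ⟩
    τ (σ (suc (toℕ i)))                       ≡⟨ τσ _ (s≤s z≤n) (Finₚ.toℕ<n i) ⟩
    suc (toℕ i)                               ∎))
    where open ≡-Reasoning

  perm : Permutation h h
  perm = permutation (restrict π r) (restrict π⁻¹ r⁻¹)
    (cancel π⁻¹ r⁻¹ π r inv⁻¹) (cancel π r π⁻¹ r⁻¹ inv)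

IsSign : ℤ → Set
IsSign ε = ε ≡ 1ℤ ⊎ ε ≡ -1ℤ

sign-* : ∀ {ε δ} → IsSign ε → IsSign δ → IsSign (ε * δ)
sign-* (inj₁ refl) (inj₁ refl) = inj₁ refl
sign-* (inj₁ refl) (inj₂ refl) = inj₂ refl
sign-* (inj₂ refl) (inj₁ refl) = inj₂ refl
sign-* (inj₂ refl) (inj₂ refl) = inj₁ refl

sign-square : ∀ {ε} → IsSign ε → ε * ε ≡ 1ℤ
sign-square (inj₁ refl) = refl
sign-square (inj₂ refl) = refl

prod-sign : ∀ h f → (∀ k → IsSign (f k)) → IsSign (prod h f)
prod-sign zero    f s = inj₁ refl
prod-sign (suc h) f s = sign-* (s 1) (prod-sign h (f ∘ suc) (s ∘ suc))

0≤* : ∀ {i j} → 0ℤ ≤ i → 0ℤ ≤ j → 0ℤ ≤ i * j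
0≤* {+ m} {+ n} _ _ = subst (0ℤ ≤_) (ℤₚ.pos-* m n) (+≤+ z≤n)

0≤+ : ∀ {i j} → 0ℤ ≤ i → 0ℤ ≤ j → 0ℤ ≤ i + j
0≤+ = ℤₚ.+-mono-≤

half : ∀ n → ∃[ j ] (n ≡ j ℕ.+ j ⊎ n ≡ suc (j ℕ.+ j))
half zero    = 0 , inj₁ refl
half (suc n) with half n
... | j , inj₁ e = j , inj₂ (cong suc e)
... | j , inj₂ e = suc j , inj₁ (trans (cong suc e) (cong suc (sym (ℕₚ.+-suc j j))))

-- Congruences

x≡y+z⇒x-y≡z : ∀ x y {z} → x ≡ y + z → x - y ≡ z
x≡y+z⇒x-y≡z _ y {z} refl = lemma y z
  where
  lemma : ∀ y z → y + z - y ≡ z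
  lemma = solve-∀

infix 4 _≈_mod_

record _≈_mod_ (x y : ℤ) (n : ℕ) : Set where
  constructor multiple
  field
    quotient : ℤ
    equation : x ≡ y + quotient * + n

open _≈_mod_ public

module _ {n : ℕ} where

  ≈-reflexive : ∀ {x y} → x ≡ y → x ≈ y mod n
  ≈-reflexive {x} refl = multiple 0ℤ $ sym (ℤₚ.+-identityʳ x)

  ≈-refl : ∀ {x} → x ≈ x mod n
  ≈-refl = ≈-reflexive refl

  ≈-sym : ∀ {x y} → x ≈ y mod n → y ≈ x mod n
  ≈-sym {y = y} (multiple q refl) = multiple (- q) $ lemma y q (+ n)
    where
    lemma : ∀ y q m → y ≡ y + q * m + (- q) * m
    lemma = solve-∀

  ≈-trans : ∀ {x y z} → x ≈ y mod n → y ≈ z mod n → x ≈ z mod n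
  ≈-trans {z = z} (multiple q refl) (multiple r refl) = multiple (r + q) $ lemma z q r (+ n)
    where
    lemma : ∀ z q r m → z + r * m + q * m ≡ z + (r + q) * m
    lemma = solve-∀

  ≈-+ : ∀ {x y z w} → x ≈ y mod n → z ≈ w mod n → x + z ≈ y + w mod n
  ≈-+ {y = y} {w = w} (multiple q refl) (multiple r refl) = multiple (q + r) $ lemma y w q r (+ n)
    where
    lemma : ∀ y w q r m → y + q * m + (w + r * m) ≡ y + w + (q + r) * m
    lemma = solve-∀

  ≈-* : ∀ {x y z w} → x ≈ y mod n → z ≈ w mod n → x * z ≈ y * w mod n
  ≈-* {y = y} {w = w} (multiple q refl) (multiple r refl) = multiple (y * r + q * w + q * r * + n) $ lemma y w q r (+ n)
    where
    lemma : ∀ y w q r m → (y + q * m) * (w + r * m) ≡ y * w + (y * r + q * w + q * r * m) * m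
    lemma = solve-∀

  ≈-*ˡ : ∀ c {x y} → x ≈ y mod n → c * x ≈ c * y mod n
  ≈-*ˡ c = ≈-* (≈-refl {c})

  ≈-*ʳ : ∀ c {x y} → x ≈ y mod n → x * c ≈ y * c mod n
  ≈-*ʳ c x≈y = ≈-* x≈y (≈-refl {c})

small-multiple : ∀ x q n → x ≡ q * + n → ∣ x ∣ ℕ.< n → x ≡ 0ℤ
small-multiple x q n refl lt = by-size ∣ q ∣ refl
  where
  by-size : ∀ m → ∣ q ∣ ≡ m → q * + n ≡ 0ℤ
  by-size zero    eq = cong (_* + n) (ℤₚ.∣i∣≡0⇒i≡0 {q} eq)
  by-size (suc m) eq = ⊥-elim (ℕₚ.<⇒≱ lt (subst (n ℕ.≤_)
    (sym (trans (ℤₚ.abs-* q (+ n)) (cong (ℕ._* n) eq))) (ℕₚ.m≤m+n n (m ℕ.* n))))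

rem-unique : ∀ {n r r′} → r ℕ.< n → r′ ℕ.< n → + r ≈ + r′ mod n → r ≡ r′
rem-unique {n} {r} {r′} r<n r′<n (multiple q eq) =
  ℤₚ.+-injective (ℤₚ.i-j≡0⇒i≡j (+ r) (+ r′) (small-multiple _ q n (x≡y+z⇒x-y≡z (+ r) (+ r′) eq)
    (ℕₚ.≤-<-trans (subst (ℕ._≤ r ℕ.⊔ r′) (cong ∣_∣ (sym (ℤₚ.m-n≡m⊖n r r′))) (ℤₚ.∣m⊝n∣≤m⊔n r r′))
      (ℕₚ.⊔-lub r<n r′<n))))

%ℕ-≈ : ∀ x n .{{_ : ℕ.NonZero n}} → x ≈ + (x %ℕ n) mod n
%ℕ-≈ x n = multiple (x /ℕ n) $ a≡a%ℕn+[a/ℕn]*n x n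

%ℕ-unique : ∀ {x r n} .{{_ : ℕ.NonZero n}} → r ℕ.< n → x ≈ + r mod n → x %ℕ n ≡ r
%ℕ-unique {x} {r} {n} r<n x≈r = rem-unique (n%ℕd<d x n) r<n (≈-trans (≈-sym (%ℕ-≈ x n)) x≈r)

modulus : ℕ → ℕ
modulus h = suc (h ℕ.+ h)

module _ (h : ℕ) where

  abstract
    -- x ≡ ± k modulo 2h + 1 with 0 ≤ k ≤ h; the sign is `halfSign x` and k is `halfAbs x`.
    halfSign : ℤ → ℤ
    halfSign x = if (x %ℕ modulus h) ℕ.≤ᵇ h then 1ℤ else -1ℤ

    halfAbs : ℤ → ℕ
    halfAbs x = if (x %ℕ modulus h) ℕ.≤ᵇ h then x %ℕ modulus h else modulus h ℕ.∸ x %ℕ modulus h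

    halfSign-sign : ∀ x → IsSign (halfSign x)
    halfSign-sign x with (x %ℕ modulus h) ℕ.≤ᵇ h
    ... | true  = inj₁ refl
    ... | false = inj₂ refl

    halfAbs≤h : ∀ x → halfAbs x ℕ.≤ h
    halfAbs≤h x with (x %ℕ modulus h) ℕ.≤ᵇ h in eq
    ... | true  = ℕₚ.≤ᵇ⇒≤ _ _ (subst T (sym eq) tt)
    ... | false = ℕₚ.+-cancelˡ-≤ (x %ℕ modulus h) _ _ (begin
      x %ℕ modulus h ℕ.+ (modulus h ℕ.∸ x %ℕ modulus h) ≡⟨ ℕₚ.m+[n∸m]≡n (ℕₚ.<⇒≤ (n%ℕd<d x (modulus h))) ⟩
      suc h ℕ.+ h                                       ≤⟨ ℕₚ.+-monoˡ-≤ h (ℕₚ.≰⇒> λ le → subst T eq (ℕₚ.≤⇒≤ᵇ le)) ⟩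
      x %ℕ modulus h ℕ.+ h                              ∎)
      where open ℕₚ.≤-Reasoning

    half-split : ∀ x → x ≈ halfSign x * + halfAbs x mod modulus h
    half-split x with (x %ℕ modulus h) ℕ.≤ᵇ h
    ... | true  = ≈-trans (%ℕ-≈ x (modulus h)) (≈-reflexive (sym (ℤₚ.*-identityˡ _)))
    ... | false = ≈-trans (%ℕ-≈ x (modulus h)) (multiple 1ℤ (begin
      + r                              ≡⟨ lemma (+ r) (+ modulus h) ⟩
      -1ℤ * (+ modulus h - + r) + 1ℤ * + modulus h
        ≡⟨ cong (λ z → -1ℤ * z + 1ℤ * + modulus h)
             (trans (ℤₚ.m-n≡m⊖n (modulus h) r) (ℤₚ.⊖-≥ (ℕₚ.<⇒≤ (n%ℕd<d x (modulus h))))) ⟩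
      -1ℤ * + (modulus h ℕ.∸ r) + 1ℤ * + modulus h ∎))
      where
      open ≡-Reasoning
      r : ℕ
      r = x %ℕ modulus h
      lemma : ∀ r m → r ≡ -1ℤ * (m - r) + 1ℤ * m
      lemma = solve-∀

  half-unique : ∀ {x ε k} → IsSign ε → 1 ℕ.≤ k → k ℕ.≤ h → x ≈ ε * + k mod modulus h →
                halfSign x ≡ ε × halfAbs x ≡ k
  half-unique {x} {ε} {k} sε 1≤k k≤h x≈ =
    conclude (halfSign-sign x) sε (ℤₚ.i-j≡0⇒i≡j _ _
      (small-multiple _ (quotient d) (modulus h) (x≡y+z⇒x-y≡z (halfSign x * + halfAbs x) (ε * + k) (equation d)) (s≤s bound)))
    where
    d : halfSign x * + halfAbs x ≈ ε * + k mod modulus h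
    d = ≈-trans (≈-sym (half-split x)) x≈

    abs-sign : ∀ {δ} m → IsSign δ → ∣ δ * + m ∣ ≡ m
    abs-sign m (inj₁ refl) = cong ∣_∣ (ℤₚ.*-identityˡ (+ m))
    abs-sign m (inj₂ refl) = trans (ℤₚ.abs-* -1ℤ (+ m)) (ℕₚ.*-identityˡ m)

    bound : ∣ halfSign x * + halfAbs x - ε * + k ∣ ℕ.≤ h ℕ.+ h
    bound = ℕₚ.≤-trans (ℤₚ.∣i-j∣≤∣i∣+∣j∣ (halfSign x * + halfAbs x) (ε * + k))
      (ℕₚ.+-mono-≤ (subst (ℕ._≤ h) (sym (abs-sign _ (halfSign-sign x))) (halfAbs≤h x))
                   (subst (ℕ._≤ h) (sym (abs-sign _ sε)) k≤h))

    conclude : ∀ {δ a} → IsSign δ → IsSign ε → δ * + a ≡ ε * + k → δ ≡ ε × a ≡ k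
    conclude {a = a} (inj₁ refl) (inj₁ refl) eq =
      refl , ℤₚ.+-injective (ℤₚ.*-cancelˡ-≡ 1ℤ (+ a) (+ k) eq)
    conclude {a = a} (inj₂ refl) (inj₂ refl) eq =
      refl , ℤₚ.+-injective (ℤₚ.*-cancelˡ-≡ -1ℤ (+ a) (+ k) eq)
    conclude {a = a} (inj₁ refl) (inj₂ refl) eq = ⊥-elim (absurd a k 1≤k eq)
      where
      absurd : ∀ a k → 1 ℕ.≤ k → 1ℤ * + a ≡ -1ℤ * + k → ⊥
      absurd zero    (suc k) _ ()
      absurd (suc a) (suc k) _ ()
    conclude {a = a} (inj₂ refl) (inj₁ refl) eq = ⊥-elim (absurd a k 1≤k eq)
      where
      absurd : ∀ a k → 1 ℕ.≤ k → -1ℤ * + a ≡ 1ℤ * + k → ⊥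
      absurd zero    (suc k) _ ()
      absurd (suc a) (suc k) _ ()

-- The Schering–Jacobi symbol

record Unit (h : ℕ) (a : ℤ) : Set where
  constructor unit
  field
    inverse : ℤ
    inverseˡ : inverse * a ≈ 1ℤ mod modulus h

open Unit public

unit-inverse : ∀ {h a} (u : Unit h a) → Unit h (inverse u)
unit-inverse {a = a} (unit a⁻¹ eq) = unit a (≈-trans (≈-reflexive (ℤₚ.*-comm a a⁻¹)) eq)

unit-≈ : ∀ {h a b} → a ≈ b mod modulus h → Unit h a → Unit h b
unit-≈ a≈b (unit a⁻¹ eq) = unit a⁻¹ (≈-trans (≈-*ˡ a⁻¹ (≈-sym a≈b)) eq)

-- Jacobi's symbol (a / 2h + 1), given by Gauss's lemma, which for a composite
-- modulus is a theorem of Schering.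
jacobi : ℕ → ℤ → ℤ
jacobi h a = prod h (λ k → halfSign h (a * + k))

jacobi-sign : ∀ h a → IsSign (jacobi h a)
jacobi-sign h a = prod-sign h _ (λ k → halfSign-sign h (a * + k))

module _ (h : ℕ) where

  private
    shift : ∀ ε c k → ε * (c * k) ≡ c * (ε * k)
    shift = solve-∀

    swap : ∀ c s v → c * (s * v) ≡ s * (c * v)
    swap = solve-∀

  halfAbs≥1 : ∀ {a k} → Unit h a → 1 ℕ.≤ k → k ℕ.≤ h → 1 ℕ.≤ halfAbs h (a * + k)
  halfAbs≥1 {a} {k} (unit a⁻¹ inv) 1≤k k≤h with halfAbs h (a * + k) in eq
  ... | suc _ = s≤s z≤n
  ... | zero  = ⊥-elim (ℕₚ.<-irrefl (sym (rem-unique (s≤s (ℕₚ.≤-trans k≤h (ℕₚ.m≤m+n h h))) (s≤s z≤n) k≈0)) 1≤k)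
    where
    ak≈0 : a * + k ≈ 0ℤ mod modulus h
    ak≈0 = ≈-trans (half-split h (a * + k))
      (≈-reflexive (trans (cong (λ v → halfSign h (a * + k) * + v) eq) (ℤₚ.*-zeroʳ (halfSign h (a * + k)))))
    k≈0 : + k ≈ 0ℤ mod modulus h
    k≈0 = ≈-trans (≈-reflexive (sym (ℤₚ.*-identityˡ (+ k))))
      (≈-trans (≈-*ʳ (+ k) (≈-sym inv))
        (≈-trans (≈-reflexive (ℤₚ.*-assoc a⁻¹ a (+ k)))
          (≈-trans (≈-*ˡ a⁻¹ ak≈0) (≈-reflexive (ℤₚ.*-zeroʳ a⁻¹)))))

  halfAbs-inverse : ∀ {a} (u : Unit h a) k → 1 ℕ.≤ k → k ℕ.≤ h →
                    halfAbs h (inverse u * + halfAbs h (a * + k)) ≡ k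
  halfAbs-inverse {a} (unit a⁻¹ inv) k 1≤k k≤h = proj₂ (half-unique h s 1≤k k≤h
    (≈-trans (≈-reflexive undo)
      (≈-trans (≈-*ˡ σ (≈-*ˡ a⁻¹ (≈-sym (half-split h (a * + k)))))
        (≈-trans (≈-reflexive (regroup σ a⁻¹ a (+ k)))
          (≈-trans (≈-*ˡ σ (≈-*ʳ (+ k) inv)) (≈-reflexive (cong (σ *_) (ℤₚ.*-identityˡ (+ k)))))))))
    where
    σ = halfSign h (a * + k)
    v = + halfAbs h (a * + k)
    s = halfSign-sign h (a * + k)
    undo : a⁻¹ * v ≡ σ * (a⁻¹ * (σ * v))
    undo = sym (trans (regroup₂ σ a⁻¹ v) (trans (cong (_* (a⁻¹ * v)) (sign-square s)) (ℤₚ.*-identityˡ _)))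
      where
      regroup₂ : ∀ s a v → s * (a * (s * v)) ≡ s * s * (a * v)
      regroup₂ = solve-∀
    regroup : ∀ s b a k → s * (b * (a * k)) ≡ s * (b * a * k)
    regroup = solve-∀

  -- Multiplication by a unit permutes {1, …, h} up to sign.
  prod-transfer : ∀ {a} → Unit h a → (e : ℤ → ℤ) →
    (∀ {x ε k} → IsSign ε → 1 ℕ.≤ k → k ℕ.≤ h → x ≈ ε * + k mod modulus h → e x ≡ ε * e (+ k)) →
    prod h (λ k → e (a * + k)) ≡ jacobi h a * prod h (λ k → e (+ k))
  prod-transfer {a} u@(unit a⁻¹ inv) e odd = begin
    prod h (λ k → e (a * + k))
      ≡⟨ prod-cong {h} {λ k → e (a * + k)} (λ k 1≤k k≤h → odd (halfSign-sign h (a * + k)) (halfAbs≥1 u 1≤k k≤h)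
                                       (halfAbs≤h h (a * + k)) (half-split h (a * + k))) ⟩
    prod h (λ k → halfSign h (a * + k) * e (+ halfAbs h (a * + k)))
      ≡⟨ prod-* h (λ k → halfSign h (a * + k)) (λ k → e (+ halfAbs h (a * + k))) ⟩
    jacobi h a * prod h (λ k → e (+ halfAbs h (a * + k)))
      ≡⟨ cong (jacobi h a *_) (prod-permute h (λ k → e (+ k)) (λ k → halfAbs h (a * + k)) (λ k → halfAbs h (a⁻¹ * + k))
           (λ k 1≤k k≤h → halfAbs≥1 u 1≤k k≤h , halfAbs≤h h (a * + k))
           (λ k 1≤k k≤h → halfAbs≥1 (unit-inverse u) 1≤k k≤h , halfAbs≤h h (a⁻¹ * + k))
           (halfAbs-inverse u) (halfAbs-inverse (unit-inverse u))) ⟩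
    jacobi h a * prod h (λ k → e (+ k)) ∎
    where open ≡-Reasoning

  halfSign-odd : ∀ {b} → Unit h b → ∀ {x ε k} → IsSign ε → 1 ℕ.≤ k → k ℕ.≤ h → x ≈ ε * + k mod modulus h →
                 halfSign h (b * x) ≡ ε * halfSign h (b * + k)
  halfSign-odd {b} u {x} {ε} {k} sε 1≤k k≤h x≈ =
    proj₁ (half-unique h (sign-* sε (halfSign-sign h (b * + k))) (halfAbs≥1 u 1≤k k≤h) (halfAbs≤h h (b * + k))
      (≈-trans (≈-*ˡ b x≈) (≈-trans (≈-reflexive (sym (shift ε b (+ k))))
        (≈-trans (≈-*ˡ ε (half-split h (b * + k))) (≈-reflexive (sym (ℤₚ.*-assoc ε (halfSign h (b * + k)) (+ halfAbs h (b * + k)))))))))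

  jacobi-* : ∀ {a b} → Unit h a → Unit h b → jacobi h (a * b) ≡ jacobi h a * jacobi h b
  jacobi-* {a} {b} ua ub = trans
    (prod-cong {h} {λ k → halfSign h (a * b * + k)} {λ k → halfSign h (b * (a * + k))} (λ k _ _ → cong (halfSign h) (lemma a b (+ k))))
    (prod-transfer ua (λ x → halfSign h (b * x)) (halfSign-odd ub))
    where
    lemma : ∀ a b k → a * b * k ≡ b * (a * k)
    lemma = solve-∀

  jacobi-≈ : ∀ {a b} → Unit h a → a ≈ b mod modulus h → jacobi h a ≡ jacobi h b
  jacobi-≈ {a} {b} u a≈b = prod-cong {h} (λ k 1≤k k≤h →
    sym (proj₁ (half-unique h (halfSign-sign h (a * + k)) (halfAbs≥1 u 1≤k k≤h) (halfAbs≤h h (a * + k))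
      (≈-trans (≈-*ʳ (+ k) (≈-sym a≈b)) (half-split h (a * + k))))))

  jacobi-1 : jacobi h 1ℤ ≡ 1ℤ
  jacobi-1 = trans (prod-cong {h} (λ k 1≤k k≤h → proj₁ (half-unique h (inj₁ refl) 1≤k k≤h ≈-refl))) (prod-one h)

  jacobi-neg1 : jacobi h -1ℤ ≡ -1ℤ ℤ.^ h
  jacobi-neg1 = trans (prod-cong {h} (λ k 1≤k k≤h → proj₁ (half-unique h (inj₂ refl) 1≤k k≤h ≈-refl))) (prod-const h -1ℤ)

  jacobi-square : ∀ {a} → Unit h a → jacobi h (a * a) ≡ 1ℤ
  jacobi-square {a} u = trans (jacobi-* u u) (sign-square (jacobi-sign h a))

-1^-sign : ∀ n → IsSign (-1ℤ ℤ.^ n)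
-1^-sign zero    = inj₁ refl
-1^-sign (suc n) = sign-* (inj₂ refl) (-1^-sign n)

-1^-double : ∀ n → -1ℤ ℤ.^ (n ℕ.+ n) ≡ 1ℤ
-1^-double n = trans (ℤₚ.^-distribˡ-+-* -1ℤ n n) (sign-square (-1^-sign n))

-1^-odd-* : ∀ h q → -1ℤ ℤ.^ (modulus h ℕ.* q) ≡ -1ℤ ℤ.^ q
-1^-odd-* h q = begin
  -1ℤ ℤ.^ (q ℕ.+ (h ℕ.+ h) ℕ.* q)           ≡⟨ ℤₚ.^-distribˡ-+-* -1ℤ q ((h ℕ.+ h) ℕ.* q) ⟩
  -1ℤ ℤ.^ q * -1ℤ ℤ.^ ((h ℕ.+ h) ℕ.* q)     ≡⟨ cong (λ e → -1ℤ ℤ.^ q * -1ℤ ℤ.^ e) (ℕₚ.*-distribʳ-+ q h h) ⟩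
  -1ℤ ℤ.^ q * -1ℤ ℤ.^ (h ℕ.* q ℕ.+ h ℕ.* q) ≡⟨ cong (-1ℤ ℤ.^ q *_) (-1^-double (h ℕ.* q)) ⟩
  -1ℤ ℤ.^ q * 1ℤ                            ≡⟨ ℤₚ.*-identityʳ _ ⟩
  -1ℤ ℤ.^ q                                 ∎
  where open ≡-Reasoning

-- Parity of the least residue: an odd function on the nonzero classes, since 2h + 1 is odd.
residueParity : ℕ → ℤ → ℤ
residueParity h x = -1ℤ ℤ.^ (x %ℕ modulus h)

k<modulus : ∀ {h k} → k ℕ.≤ h → k ℕ.< modulus h
k<modulus {h} k≤h = s≤s (ℕₚ.≤-trans k≤h (ℕₚ.m≤m+n h h))

residueParity-pos : ∀ {h k} → k ℕ.≤ h → residueParity h (+ k) ≡ -1ℤ ℤ.^ k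
residueParity-pos {h} {k} k≤h = cong (-1ℤ ℤ.^_) (%ℕ-unique {+ k} {k} {modulus h} (k<modulus {h} k≤h) ≈-refl)

residueParity-odd : ∀ h {x ε k} → IsSign ε → 1 ℕ.≤ k → k ℕ.≤ h → x ≈ ε * + k mod modulus h →
                    residueParity h x ≡ ε * residueParity h (+ k)
residueParity-odd h {x} {k = k} (inj₁ refl) 1≤k k≤h x≈ = trans
  (cong (-1ℤ ℤ.^_) (%ℕ-unique {x} {k} {modulus h} (k<modulus {h} k≤h) (≈-trans x≈ (≈-reflexive (ℤₚ.*-identityˡ (+ k))))))
  (trans (sym (residueParity-pos {h} k≤h)) (sym (ℤₚ.*-identityˡ _)))
residueParity-odd h {x} {k = k} (inj₂ refl) 1≤k k≤h x≈ = begin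
  residueParity h x                  ≡⟨ cong (-1ℤ ℤ.^_) (%ℕ-unique {x} {modulus h ℕ.∸ k} {modulus h}
                                          (ℕₚ.∸-monoʳ-< 1≤k (ℕₚ.<⇒≤ (k<modulus {h} k≤h))) x≈′) ⟩
  -1ℤ ℤ.^ (modulus h ℕ.∸ k)          ≡⟨ sym (ℤₚ.*-identityˡ _) ⟩
  1ℤ * -1ℤ ℤ.^ (modulus h ℕ.∸ k)     ≡⟨ cong (_* -1ℤ ℤ.^ (modulus h ℕ.∸ k)) (sym (sign-square (-1^-sign k))) ⟩
  -1ℤ ℤ.^ k * -1ℤ ℤ.^ k * -1ℤ ℤ.^ (modulus h ℕ.∸ k) ≡⟨ ℤₚ.*-assoc (-1ℤ ℤ.^ k) (-1ℤ ℤ.^ k) _ ⟩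
  -1ℤ ℤ.^ k * (-1ℤ ℤ.^ k * -1ℤ ℤ.^ (modulus h ℕ.∸ k))
    ≡⟨ cong (-1ℤ ℤ.^ k *_) (trans (sym (ℤₚ.^-distribˡ-+-* -1ℤ k (modulus h ℕ.∸ k)))
         (cong (-1ℤ ℤ.^_) (ℕₚ.m+[n∸m]≡n (ℕₚ.<⇒≤ (k<modulus {h} k≤h))))) ⟩
  -1ℤ ℤ.^ k * -1ℤ ℤ.^ modulus h      ≡⟨ cong (λ z → -1ℤ ℤ.^ k * (-1ℤ * z)) (-1^-double h) ⟩
  -1ℤ ℤ.^ k * -1ℤ                    ≡⟨ ℤₚ.*-comm (-1ℤ ℤ.^ k) -1ℤ ⟩
  -1ℤ * -1ℤ ℤ.^ k                    ≡⟨ cong (-1ℤ *_) (sym (residueParity-pos {h} k≤h)) ⟩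
  -1ℤ * residueParity h (+ k)        ∎
  where
  open ≡-Reasoning
  x≈′ : x ≈ + (modulus h ℕ.∸ k) mod modulus h
  x≈′ = ≈-trans x≈ (multiple -1ℤ (trans (lemma (+ k) (+ modulus h)) (cong (_+ -1ℤ * + modulus h)
    (trans (ℤₚ.m-n≡m⊖n (modulus h) k) (ℤₚ.⊖-≥ (ℕₚ.<⇒≤ (k<modulus {h} k≤h)))))))
    where
    lemma : ∀ k m → -1ℤ * k ≡ (m - k) + -1ℤ * m
    lemma = solve-∀

below : ℕ → ℕ → ℤ
below m n = if m ℕ.≤ᵇ n then -1ℤ else 1ℤ

below-≤ : ∀ {m n} → m ℕ.≤ n → below m n ≡ -1ℤ
below-≤ {m} {n} le with m ℕ.≤ᵇ n | ℕₚ.≤⇒≤ᵇ le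
... | true | _ = refl

below-> : ∀ {m n} → n ℕ.< m → below m n ≡ 1ℤ
below-> {m} {n} lt with m ℕ.≤ᵇ n in eq
... | true  = ⊥-elim (ℕₚ.<⇒≱ lt (ℕₚ.≤ᵇ⇒≤ m n (subst T (sym eq) tt)))
... | false = refl

below-trichotomy : ∀ {m n} → m ≢ n → below m n * below n m ≡ -1ℤ
below-trichotomy {m} {n} m≢n with ℕₚ.<-cmp m n
... | tri< lt _ _ = cong₂ _*_ (below-≤ (ℕₚ.<⇒≤ lt)) (below-> lt)
... | tri≈ _ eq _ = ⊥-elim (m≢n eq)
... | tri> _ _ gt = cong₂ _*_ (below-> gt) (below-≤ (ℕₚ.<⇒≤ gt))

prod-initial : ∀ l q (f : ℕ → ℤ) → q ℕ.≤ l → (∀ j → 1 ℕ.≤ j → j ℕ.≤ q → f j ≡ -1ℤ) → (∀ j → q ℕ.< j → f j ≡ 1ℤ) →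
               prod l f ≡ -1ℤ ℤ.^ q
prod-initial l       zero    f _          _  hi = trans (prod-cong {l} {f} (λ j 1≤j _ → hi j 1≤j)) (prod-one l)
prod-initial (suc l) (suc q) f (s≤s q≤l) lo hi = cong₂ _*_ (lo 1 (s≤s z≤n) (s≤s z≤n))
  (prod-initial l q (f ∘ suc) q≤l (λ j _ j≤q → lo (suc j) (s≤s z≤n) (s≤s j≤q)) (λ j q<j → hi (suc j) (s≤s q<j)))

module _ (h l : ℕ) where

  private
    n m : ℕ
    n = modulus h
    m = modulus l

  quotient-parity : ∀ {k} → 1 ℕ.≤ k → k ℕ.≤ h → -1ℤ ℤ.^ (m ℕ.* k / n) ≡ prod l (λ j → below (n ℕ.* j) (m ℕ.* k))
  quotient-parity {k} 1≤k k≤h = sym (prod-initial l (m ℕ.* k / n) (λ j → below (n ℕ.* j) (m ℕ.* k)) q≤l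
    (λ j _ j≤q → below-≤ (ℕₚ.≤-trans (ℕₚ.≤-reflexive (ℕₚ.*-comm n j))
      (ℕₚ.≤-trans (ℕₚ.*-monoˡ-≤ n j≤q) (ℕ÷.m/n*n≤m (m ℕ.* k) n))))
    (λ j q<j → below-> (ℕₚ.≰⇒> λ le → ℕₚ.<⇒≱ q<j
      (subst (ℕ._≤ m ℕ.* k / n) (ℕ÷.m*n/n≡m j n) (ℕ÷./-monoˡ-≤ n (subst (ℕ._≤ m ℕ.* k) (ℕₚ.*-comm n j) le))))))
    where
    q≤l : m ℕ.* k / n ℕ.≤ l
    q≤l = ℕₚ.≤-pred (ℕ÷.m<n*o⇒m/o<n {m ℕ.* k} {suc l} {n} (begin-strict
      m ℕ.* k                  ≤⟨ ℕₚ.*-monoʳ-≤ m k≤h ⟩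
      m ℕ.* h                  <⟨ s≤s (ℕₚ.m≤m+n _ (h ℕ.+ l)) ⟩
      suc (m ℕ.* h ℕ.+ (h ℕ.+ l)) ≡⟨ lemma l h ⟩
      suc l ℕ.* n              ∎))
      where
      open ℕₚ.≤-Reasoning
      lemma : ∀ l h → suc (suc (l ℕ.+ l) ℕ.* h ℕ.+ (h ℕ.+ l)) ≡ suc l ℕ.* suc (h ℕ.+ h)
      lemma = ℕ-Ring.solve-∀

  -- Eisenstein: (m / n) is the parity of Σ ⌊mk/n⌋.
  jacobi-eisenstein : Unit h (+ m) → jacobi h (+ m) ≡ prod h (λ k → prod l (λ j → below (n ℕ.* j) (m ℕ.* k)))
  jacobi-eisenstein u = begin
    jacobi h (+ m)              ≡⟨ sym (ℤₚ.*-identityʳ _) ⟩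
    jacobi h (+ m) * 1ℤ         ≡⟨ cong (jacobi h (+ m) *_) (sym (sign-square P-sign)) ⟩
    jacobi h (+ m) * (P * P)    ≡⟨ sym (ℤₚ.*-assoc (jacobi h (+ m)) P P) ⟩
    jacobi h (+ m) * P * P      ≡⟨ cong (_* P) (sym (prod-transfer h u (residueParity h) (residueParity-odd h))) ⟩
    prod h (λ k → residueParity h (+ m * + k)) * P
      ≡⟨ sym (prod-* h (λ k → residueParity h (+ m * + k)) (λ k → residueParity h (+ k))) ⟩
    prod h (λ k → residueParity h (+ m * + k) * residueParity h (+ k))
      ≡⟨ prod-cong {h} {λ k → residueParity h (+ m * + k) * residueParity h (+ k)} termwise ⟩
    prod h (λ k → prod l (λ j → below (n ℕ.* j) (m ℕ.* k))) ∎
    where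
    open ≡-Reasoning
    P : ℤ
    P = prod h (λ k → residueParity h (+ k))
    P-sign : IsSign P
    P-sign = prod-sign h (λ k → residueParity h (+ k)) (λ k → -1^-sign (+ k %ℕ n))
    termwise : ∀ k → 1 ℕ.≤ k → k ℕ.≤ h →
      residueParity h (+ m * + k) * residueParity h (+ k) ≡ prod l (λ j → below (n ℕ.* j) (m ℕ.* k))
    termwise k 1≤k k≤h = begin
      residueParity h (+ m * + k) * residueParity h (+ k)
        ≡⟨ cong₂ _*_ (cong (residueParity h) (sym (ℤₚ.pos-* m k)))
             (trans (residueParity-pos {h} k≤h) (sym (-1^-odd-* l k))) ⟩
      -1ℤ ℤ.^ (m ℕ.* k % n) * -1ℤ ℤ.^ (m ℕ.* k)
        ≡⟨ cong (λ e → -1ℤ ℤ.^ (m ℕ.* k % n) * -1ℤ ℤ.^ e)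
             (trans (ℕ÷.m≡m%n+[m/n]*n (m ℕ.* k) n) (cong (m ℕ.* k % n ℕ.+_) (ℕₚ.*-comm _ n))) ⟩
      -1ℤ ℤ.^ (m ℕ.* k % n) * -1ℤ ℤ.^ (m ℕ.* k % n ℕ.+ n ℕ.* (m ℕ.* k / n))
        ≡⟨ cong (-1ℤ ℤ.^ (m ℕ.* k % n) *_) (trans (ℤₚ.^-distribˡ-+-* -1ℤ (m ℕ.* k % n) (n ℕ.* (m ℕ.* k / n)))
             (cong (-1ℤ ℤ.^ (m ℕ.* k % n) *_) (-1^-odd-* h (m ℕ.* k / n)))) ⟩
      -1ℤ ℤ.^ (m ℕ.* k % n) * (-1ℤ ℤ.^ (m ℕ.* k % n) * -1ℤ ℤ.^ (m ℕ.* k / n))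
        ≡⟨ sym (ℤₚ.*-assoc (-1ℤ ℤ.^ (m ℕ.* k % n)) (-1ℤ ℤ.^ (m ℕ.* k % n)) _) ⟩
      -1ℤ ℤ.^ (m ℕ.* k % n) * -1ℤ ℤ.^ (m ℕ.* k % n) * -1ℤ ℤ.^ (m ℕ.* k / n)
        ≡⟨ cong (_* -1ℤ ℤ.^ (m ℕ.* k / n)) (sign-square (-1^-sign (m ℕ.* k % n))) ⟩
      1ℤ * -1ℤ ℤ.^ (m ℕ.* k / n)
        ≡⟨ trans (ℤₚ.*-identityˡ _) (quotient-parity 1≤k k≤h) ⟩
      prod l (λ j → below (n ℕ.* j) (m ℕ.* k)) ∎

jacobi-reciprocity : ∀ h l → Unit h (+ modulus l) → Unit l (+ modulus h) →
                     jacobi h (+ modulus l) * jacobi l (+ modulus h) ≡ (-1ℤ ℤ.^ l) ℤ.^ h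
jacobi-reciprocity h l u v = begin
  jacobi h (+ m) * jacobi l (+ n)
    ≡⟨ cong₂ _*_ (jacobi-eisenstein h l u) (trans (jacobi-eisenstein l h v)
         (prod-comm l h (λ j k → below (m ℕ.* k) (n ℕ.* j)))) ⟩
  prod h (λ k → prod l (λ j → below (n ℕ.* j) (m ℕ.* k))) * prod h (λ k → prod l (λ j → below (m ℕ.* k) (n ℕ.* j)))
    ≡⟨ sym (prod-* h (λ k → prod l (λ j → below (n ℕ.* j) (m ℕ.* k))) (λ k → prod l (λ j → below (m ℕ.* k) (n ℕ.* j)))) ⟩
  prod h (λ k → prod l (λ j → below (n ℕ.* j) (m ℕ.* k)) * prod l (λ j → below (m ℕ.* k) (n ℕ.* j)))
    ≡⟨ prod-cong {h} {λ k → prod l (λ j → below (n ℕ.* j) (m ℕ.* k)) * prod l (λ j → below (m ℕ.* k) (n ℕ.* j))}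
         (λ k 1≤k k≤h → trans (sym (prod-* l (λ j → below (n ℕ.* j) (m ℕ.* k)) (λ j → below (m ℕ.* k) (n ℕ.* j))))
           (trans (prod-cong {l} {λ j → below (n ℕ.* j) (m ℕ.* k) * below (m ℕ.* k) (n ℕ.* j)}
             (λ j _ _ → below-trichotomy (distinct k j 1≤k k≤h))) (prod-const l -1ℤ))) ⟩
  prod h (λ _ → -1ℤ ℤ.^ l)
    ≡⟨ prod-const h _ ⟩
  (-1ℤ ℤ.^ l) ℤ.^ h ∎
  where
  open ≡-Reasoning
  n m : ℕ
  n = modulus h
  m = modulus l
  distinct : ∀ k j → 1 ℕ.≤ k → k ℕ.≤ h → n ℕ.* j ≢ m ℕ.* k
  distinct k j 1≤k k≤h eq = ℕₚ.<-irrefl (sym (rem-unique (k<modulus {h} k≤h) (s≤s z≤n) k≈0)) 1≤k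
    where
    mk≈0 : + m * + k ≈ 0ℤ mod n
    mk≈0 = multiple (+ j) (begin
      + m * + k     ≡⟨ sym (ℤₚ.pos-* m k) ⟩
      + (m ℕ.* k)   ≡⟨ cong +_ (trans (sym eq) (ℕₚ.*-comm n j)) ⟩
      + (j ℕ.* n)   ≡⟨ ℤₚ.pos-* j n ⟩
      + j * + n     ≡⟨ sym (ℤₚ.+-identityˡ _) ⟩
      0ℤ + + j * + n ∎)
    k≈0 : + k ≈ 0ℤ mod n
    k≈0 = ≈-trans (≈-reflexive (sym (ℤₚ.*-identityˡ (+ k))))
      (≈-trans (≈-*ʳ (+ k) (≈-sym (inverseˡ u)))
        (≈-trans (≈-reflexive (ℤₚ.*-assoc (inverse u) (+ m) (+ k)))
          (≈-trans (≈-*ˡ (inverse u) mk≈0) (≈-reflexive (ℤₚ.*-zeroʳ (inverse u))))))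

-- Square roots modulo a prime

unit-* : ∀ {h a b} → Unit h a → Unit h b → Unit h (a * b)
unit-* {a = a} {b} (unit a⁻¹ p) (unit b⁻¹ q) = unit (a⁻¹ * b⁻¹)
  (≈-trans (≈-reflexive (lemma a b a⁻¹ b⁻¹)) (≈-* p q))
  where
  lemma : ∀ a b a⁻¹ b⁻¹ → a⁻¹ * b⁻¹ * (a * b) ≡ a⁻¹ * a * (b⁻¹ * b)
  lemma = solve-∀

coprime⇒inverse : ∀ {a n} → Coprime a n → ∃[ b ] b * + a ≈ 1ℤ mod n
coprime⇒inverse {a} {n} c with Coprimality.coprime-Bézout c
... | Bézout.+- x y eq = + x , multiple (+ y) (begin
  + x * + a         ≡⟨ sym (ℤₚ.pos-* x a) ⟩
  + (x ℕ.* a)       ≡⟨ cong +_ (sym eq) ⟩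
  1ℤ + + (y ℕ.* n)  ≡⟨ cong (λ z → 1ℤ + z) (ℤₚ.pos-* y n) ⟩
  1ℤ + + y * + n    ∎)
  where open ≡-Reasoning
... | Bézout.-+ x y eq = - + x , multiple (- + y) (begin
  - + x * + a                      ≡⟨ lemma (+ x) (+ a) (+ y) (+ n) ⟩
  1ℤ + - + y * + n + (+ y * + n - (1ℤ + + x * + a))
    ≡⟨ cong (λ z → 1ℤ + - + y * + n + z) (ℤₚ.i≡j⇒i-j≡0 (sym (trans
         (cong (λ z → 1ℤ + z) (sym (ℤₚ.pos-* x a))) (trans (cong +_ eq) (ℤₚ.pos-* y n))))) ⟩
  1ℤ + - + y * + n + 0ℤ            ≡⟨ ℤₚ.+-identityʳ _ ⟩
  1ℤ + - + y * + n                 ∎)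
  where
  open ≡-Reasoning
  lemma : ∀ x a y n → - x * a ≡ 1ℤ + - y * n + (y * n - (1ℤ + x * a))
  lemma = solve-∀

∣∣-multiple : ∀ {n} x → n ℕ∣.∣ ∣ x ∣ → x ≈ 0ℤ mod n
∣∣-multiple {n} x d with ℤ∣.∣ᵤ⇒∣ {+ n} {x} d
... | divides q eq = multiple q (trans eq (sym (ℤₚ.+-identityˡ _)))

multiple-∣∣ : ∀ {n} x → x ≈ 0ℤ mod n → n ℕ∣.∣ ∣ x ∣
multiple-∣∣ {n} x (multiple q eq) = ℤ∣.∣⇒∣ᵤ {+ n} {x} (divides q (trans eq (ℤₚ.+-identityˡ _)))

≈⇒-≈0 : ∀ {n} x y → x ≈ y mod n → x - y ≈ 0ℤ mod n
≈⇒-≈0 x y (multiple q eq) = multiple q (trans (x≡y+z⇒x-y≡z x y eq) (sym (ℤₚ.+-identityˡ _)))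

-≈0⇒≈ : ∀ {n} x y → x - y ≈ 0ℤ mod n → x ≈ y mod n
-≈0⇒≈ x y (multiple q eq) = multiple q (trans (lemma x y) (cong (λ z → y + z) (trans eq (ℤₚ.+-identityˡ _))))
  where
  lemma : ∀ x y → x ≡ y + (x - y)
  lemma = solve-∀

≈? : ∀ n x y → Dec (x ≈ y mod n)
≈? n x y = map′ (λ d → -≈0⇒≈ x y (∣∣-multiple (x - y) d)) (λ e → multiple-∣∣ (x - y) (≈⇒-≈0 x y e))
  (n ℕ∣.∣? ∣ x - y ∣)

prime-zero-product : ∀ {p} → Prime p → ∀ x y → x * y ≈ 0ℤ mod p → x ≈ 0ℤ mod p ⊎ y ≈ 0ℤ mod p
prime-zero-product {p} pr x y e with euclidsLemma ∣ x ∣ ∣ y ∣ pr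
  (subst (p ℕ∣.∣_) (ℤₚ.abs-* x y) (multiple-∣∣ (x * y) e))
... | inj₁ d = inj₁ (∣∣-multiple x d)
... | inj₂ d = inj₂ (∣∣-multiple y d)

-- The monic polynomial with lower coefficients cs, constant term first.
monic : ∀ {d} → Vec ℤ d → ℤ → ℤ
monic []       x = 1ℤ
monic (c ∷ cs) x = c + x * monic cs x

addScaled : ∀ {d} → Vec ℤ (suc d) → ℤ → Vec ℤ d → Vec ℤ (suc d)
addScaled (c ∷ [])          r []       = c + r ∷ []
addScaled (c ∷ cs@(_ ∷ _)) r (g ∷ gs) = c + r * g ∷ addScaled cs r gs

monic-addScaled : ∀ {d} (cs : Vec ℤ (suc d)) r gs x → monic (addScaled cs r gs) x ≡ monic cs x + r * monic gs x
monic-addScaled (c ∷ [])          r []       x = lemma c r x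
  where
  lemma : ∀ c r x → c + r + x * 1ℤ ≡ c + x * 1ℤ + r * 1ℤ
  lemma = solve-∀
monic-addScaled (c ∷ cs@(_ ∷ _)) r (g ∷ gs) x =
  trans (cong (λ z → c + r * g + x * z) (monic-addScaled cs r gs x)) (lemma c r g x (monic cs x) (monic gs x))
  where
  lemma : ∀ c r g x F G → c + r * g + x * (F + r * G) ≡ c + x * F + r * (g + x * G)
  lemma = solve-∀

deflate : ∀ {d} → Vec ℤ (suc d) → ℤ → Vec ℤ d
deflate (c ∷ [])          r = []
deflate (c ∷ cs@(_ ∷ _)) r = addScaled cs r (deflate cs r)

monic-deflate : ∀ {d} (cs : Vec ℤ (suc d)) r x → monic cs x - monic cs r ≡ (x - r) * monic (deflate cs r) x
monic-deflate (c ∷ [])          r x = lemma c r x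
  where
  lemma : ∀ c r x → c + x * 1ℤ - (c + r * 1ℤ) ≡ (x - r) * 1ℤ
  lemma = solve-∀
monic-deflate (c ∷ cs@(_ ∷ _)) r x = begin
  c + x * F x - (c + r * F r)           ≡⟨ lemma₁ c x r (F x) (F r) ⟩
  (x - r) * F x + r * (F x - F r)       ≡⟨ cong (λ z → (x - r) * F x + r * z) (monic-deflate cs r x) ⟩
  (x - r) * F x + r * ((x - r) * G)     ≡⟨ lemma₂ x r (F x) G ⟩
  (x - r) * (F x + r * G)               ≡⟨ cong ((x - r) *_) (sym (monic-addScaled cs r (deflate cs r) x)) ⟩
  (x - r) * monic (addScaled cs r (deflate cs r)) x ∎
  where
  open ≡-Reasoning
  F : ℤ → ℤ
  F = monic cs
  G : ℤ
  G = monic (deflate cs r) x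
  lemma₁ : ∀ c x r F F′ → c + x * F - (c + r * F′) ≡ (x - r) * F + r * (F - F′)
  lemma₁ = solve-∀
  lemma₂ : ∀ x r F G → (x - r) * F + r * ((x - r) * G) ≡ (x - r) * (F + r * G)
  lemma₂ = solve-∀

prime≥2 : ∀ {p} → Prime p → 2 ℕ.≤ p
prime≥2 {zero}        pr = ⊥-elim (Primality.¬prime[0] pr)
prime≥2 {suc zero}    pr = ⊥-elim (Primality.¬prime[1] pr)
prime≥2 {suc (suc p)} pr = s≤s (s≤s z≤n)

monic-roots : ∀ {p d} → Prime p → (cs : Vec ℤ d) (r : Fin (suc d) → ℤ) →
              (∀ i → monic cs (r i) ≈ 0ℤ mod p) → (∀ i j → r i ≈ r j mod p → i ≡ j) → ⊥
monic-roots pr [] r root distinct = ℕₚ.1+n≢0 (rem-unique (prime≥2 pr) (ℕₚ.<-trans (s≤s z≤n) (prime≥2 pr)) (root Fin.zero))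
monic-roots {p} pr cs@(_ ∷ _) r root distinct = monic-roots pr (deflate cs r₀) (r ∘ Fin.suc) root′
  (λ i j e → Finₚ.suc-injective (distinct (Fin.suc i) (Fin.suc j) e))
  where
  r₀ : ℤ
  r₀ = r Fin.zero
  root′ : ∀ i → monic (deflate cs r₀) (r (Fin.suc i)) ≈ 0ℤ mod p
  root′ i with prime-zero-product pr (r (Fin.suc i) - r₀) (monic (deflate cs r₀) (r (Fin.suc i)))
    (≈-trans (≈-reflexive (sym (monic-deflate cs r₀ (r (Fin.suc i)))))
      (≈⇒-≈0 _ _ (≈-trans (root (Fin.suc i)) (≈-sym (root Fin.zero)))))
  ... | inj₁ e = case distinct (Fin.suc i) Fin.zero (-≈0⇒≈ (r (Fin.suc i)) r₀ e) of λ ()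
  ... | inj₂ e = e

prod-≈ : ∀ {n} h {f g : ℕ → ℤ} → (∀ k → 1 ℕ.≤ k → k ℕ.≤ h → f k ≈ g k mod n) → prod h f ≈ prod h g mod n
prod-≈ zero    e = ≈-refl
prod-≈ (suc h) e = ≈-* (e 1 (s≤s z≤n) (s≤s z≤n)) (prod-≈ h (λ k 1≤k k≤h → e (suc k) (s≤s z≤n) (s≤s k≤h)))

module _ {h : ℕ} (pr : Prime (modulus h)) where

  private
    p : ℕ
    p = modulus h

  prime-unit : ∀ {k} → 1 ℕ.≤ k → k ℕ.≤ h → Unit h (+ k)
  prime-unit {k} 1≤k k≤h =
    let (b , e) = coprime⇒inverse (Coprimality.sym (Coprimality.prime⇒coprime pr {{ℕ.>-nonZero 1≤k}} (k<modulus {h} k≤h)))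
    in unit b e

  prod-nonzero : ∀ l → l ℕ.≤ h → (f : ℕ → ℕ) → (∀ k → 1 ℕ.≤ k → k ℕ.≤ l → 1 ℕ.≤ f k × f k ℕ.≤ h) →
                 ¬ (prod l (λ k → + f k) ≈ 0ℤ mod p)
  prod-nonzero zero    _   f _ e = ℕₚ.1+n≢0 (rem-unique (prime≥2 pr) (s≤s z≤n) e)
  prod-nonzero (suc l) l<h f b e with prime-zero-product pr (+ f 1) (prod l (λ k → + f (suc k))) e
  ... | inj₁ e₁ = let (lo , hi) = b 1 (s≤s z≤n) (s≤s z≤n) in
        ℕₚ.<-irrefl (sym (rem-unique (k<modulus {h} hi) (s≤s z≤n) e₁)) lo
  ... | inj₂ e₂ = prod-nonzero l (ℕₚ.<⇒≤ l<h) (f ∘ suc) (λ k 1≤k k≤l → b (suc k) (s≤s z≤n) (s≤s k≤l)) e₂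

  gauss-lemma : ∀ {a} → Unit h a → a ℤ.^ h ≈ jacobi h a mod p
  gauss-lemma {a} u = -≈0⇒≈ _ _ (cancel (prime-zero-product pr (a ℤ.^ h - jacobi h a) F
    (≈-trans (≈-reflexive (lemma (a ℤ.^ h) (jacobi h a) F)) (≈⇒-≈0 (a ℤ.^ h * F) (jacobi h a * F) products))))
    where
    F : ℤ
    F = prod h (λ k → + k)
    lemma : ∀ x y z → (x - y) * z ≡ x * z - y * z
    lemma = solve-∀
    cancel : a ℤ.^ h - jacobi h a ≈ 0ℤ mod p ⊎ F ≈ 0ℤ mod p → a ℤ.^ h - jacobi h a ≈ 0ℤ mod p
    cancel (inj₁ e) = e
    cancel (inj₂ e) = ⊥-elim (prod-nonzero h ℕₚ.≤-refl id (λ k 1≤k k≤h → 1≤k , k≤h) e)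
    products : a ℤ.^ h * F ≈ jacobi h a * F mod p
    products = ≈-trans (≈-reflexive (trans (cong (_* F) (sym (prod-const h a))) (sym (prod-* h (λ _ → a) (λ k → + k)))))
      (≈-trans (prod-≈ h {λ k → a * + k} {λ k → halfSign h (a * + k) * + halfAbs h (a * + k)} (λ k _ _ → half-split h (a * + k)))
        (≈-reflexive (trans (prod-* h (λ k → halfSign h (a * + k)) (λ k → + halfAbs h (a * + k)))
          (cong (jacobi h a *_) (prod-permute h (λ k → + k) (λ k → halfAbs h (a * + k)) (λ k → halfAbs h (inverse u * + k))
           (λ k 1≤k k≤h → halfAbs≥1 h u 1≤k k≤h , halfAbs≤h h (a * + k))
           (λ k 1≤k k≤h → halfAbs≥1 h (unit-inverse u) 1≤k k≤h , halfAbs≤h h (inverse u * + k))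
           (halfAbs-inverse h u) (halfAbs-inverse h (unit-inverse u)))))))

  -- Otherwise a and the squares 1², …, h² would be h + 1 roots of xʰ - 1.
  jacobi≡1⇒square : ∀ {a} → Unit h a → jacobi h a ≡ 1ℤ → ∃[ x ] x * x ≈ a mod p
  jacobi≡1⇒square {a} u j≡1 with Finₚ.any? {h} (λ i → ≈? p (+ suc (toℕ i) * + suc (toℕ i)) a)
  ... | yes (i , e) = + suc (toℕ i) , e
  ... | no  ¬square = ⊥-elim (contradiction h refl)
    where
    root : ∀ {n} → Fin (suc n) → ℤ
    root Fin.zero    = a
    root (Fin.suc i) = + suc (toℕ i) * + suc (toℕ i)

    bound : (i : Fin h) → suc (toℕ i) ℕ.≤ h
    bound = Finₚ.toℕ<n

    power≈1 : ∀ (i : Fin (suc h)) → root i ℤ.^ h ≈ 1ℤ mod p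
    power≈1 Fin.zero    = ≈-trans (gauss-lemma u) (≈-reflexive j≡1)
    power≈1 (Fin.suc i) = ≈-trans (gauss-lemma (unit-* v v)) (≈-reflexive (jacobi-square h v))
      where
      v : Unit h (+ suc (toℕ i))
      v = prime-unit (s≤s z≤n) (bound i)

    distinct-squares : ∀ k l → suc k ℕ.≤ h → suc l ℕ.≤ h → + suc k * + suc k ≈ + suc l * + suc l mod p → k ≡ l
    distinct-squares k l k<h l<h e = conclude (prime-zero-product pr (+ suc k - + suc l) (+ suc k + + suc l)
      (≈-trans (≈-reflexive (lemma (+ suc k) (+ suc l))) (≈⇒-≈0 (+ suc k * + suc k) (+ suc l * + suc l) e)))
      where
      lemma : ∀ x y → (x - y) * (x + y) ≡ x * x - y * y
      lemma = solve-∀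
      conclude : + suc k - + suc l ≈ 0ℤ mod p ⊎ + suc k + + suc l ≈ 0ℤ mod p → k ≡ l
      conclude (inj₁ e₁) = ℕₚ.suc-injective (rem-unique (k<modulus {h} k<h) (k<modulus {h} l<h) (-≈0⇒≈ (+ suc k) (+ suc l) e₁))
      conclude (inj₂ e₂) = ⊥-elim (ℕₚ.1+n≢0 (rem-unique (s≤s (ℕₚ.+-mono-≤ k<h l<h)) (s≤s z≤n) e₂))

    distinct : ∀ (i j : Fin (suc h)) → root i ≈ root j mod p → i ≡ j
    distinct Fin.zero    Fin.zero    _ = refl
    distinct Fin.zero    (Fin.suc j) e = ⊥-elim (¬square (j , ≈-sym e))
    distinct (Fin.suc i) Fin.zero    e = ⊥-elim (¬square (i , e))
    distinct (Fin.suc i) (Fin.suc j) e =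
      cong Fin.suc (Finₚ.toℕ-injective (distinct-squares (toℕ i) (toℕ j) (bound i) (bound j) e))

    monic-power : ∀ n x → monic (Vec.replicate n 0ℤ) x ≡ x ℤ.^ n
    monic-power zero    x = refl
    monic-power (suc n) x = trans (ℤₚ.+-identityˡ _) (cong (x *_) (monic-power n x))

    contradiction : ∀ n → n ≡ h → ⊥
    contradiction zero    refl = Primality.¬prime[1] pr
    contradiction (suc n) refl = monic-roots pr (-1ℤ ∷ Vec.replicate n 0ℤ) root
      (λ i → ≈-trans (≈-reflexive (trans (cong (λ z → -1ℤ + root i * z) (monic-power n (root i))) (ℤₚ.+-comm -1ℤ (root i ℤ.^ h))))
        (≈⇒-≈0 (root i ℤ.^ h) 1ℤ (power≈1 i))) distinct

-- Finite sums

∑ : ℕ → (ℕ → ℤ) → ℤ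
∑ zero    f = 0ℤ
∑ (suc n) f = ∑ n f + f n

∑-cong : ∀ n {f g : ℕ → ℤ} → (∀ i → i ℕ.< n → f i ≡ g i) → ∑ n f ≡ ∑ n g
∑-cong zero    e = refl
∑-cong (suc n) e = cong₂ _+_ (∑-cong n (λ i i<n → e i (ℕₚ.m≤n⇒m≤1+n i<n))) (e n ℕₚ.≤-refl)

∑-zero : ∀ n {f : ℕ → ℤ} → (∀ i → i ℕ.< n → f i ≡ 0ℤ) → ∑ n f ≡ 0ℤ
∑-zero zero    e = refl
∑-zero (suc n) e = cong₂ _+_ (∑-zero n (λ i i<n → e i (ℕₚ.m≤n⇒m≤1+n i<n))) (e n ℕₚ.≤-refl)

∑-+ : ∀ n f g → ∑ n (λ i → f i + g i) ≡ ∑ n f + ∑ n g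
∑-+ zero    f g = refl
∑-+ (suc n) f g = trans (cong (_+ (f n + g n)) (∑-+ n f g)) (lemma (∑ n f) (∑ n g) (f n) (g n))
  where
  lemma : ∀ a b c d → a + b + (c + d) ≡ a + c + (b + d)
  lemma = solve-∀

∑-* : ∀ n c f → ∑ n (λ i → c * f i) ≡ c * ∑ n f
∑-* zero    c f = sym (ℤₚ.*-zeroʳ c)
∑-* (suc n) c f = trans (cong (_+ c * f n) (∑-* n c f)) (sym (ℤₚ.*-distribˡ-+ c (∑ n f) (f n)))

∑-- : ∀ n f g → ∑ n (λ i → f i - g i) ≡ ∑ n f - ∑ n g
∑-- zero    f g = refl
∑-- (suc n) f g = trans (cong (_+ (f n - g n)) (∑-- n f g)) (lemma (∑ n f) (∑ n g) (f n) (g n))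
  where
  lemma : ∀ a b c d → a - b + (c - d) ≡ a + c - (b + d)
  lemma = solve-∀

∑-swap : ∀ m n (f : ℕ → ℕ → ℤ) → ∑ m (λ i → ∑ n (f i)) ≡ ∑ n (λ j → ∑ m (λ i → f i j))
∑-swap zero    n f = sym (∑-zero n (λ _ _ → refl))
∑-swap (suc m) n f = trans (cong (_+ ∑ n (f m)) (∑-swap m n f)) (sym (∑-+ n (λ j → ∑ m (λ i → f i j)) (f m)))

∑-append : ∀ m n f → ∑ (m ℕ.+ n) f ≡ ∑ m f + ∑ n (λ i → f (m ℕ.+ i))
∑-append m zero    f = trans (cong (λ k → ∑ k f) (ℕₚ.+-identityʳ m)) (sym (ℤₚ.+-identityʳ _))
∑-append m (suc n) f = trans (cong (λ k → ∑ k f) (ℕₚ.+-suc m n))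
  (trans (cong (_+ f (m ℕ.+ n)) (∑-append m n f)) (ℤₚ.+-assoc (∑ m f) _ _))

∑-nonneg : ∀ n {f} → (∀ i → i ℕ.< n → 0ℤ ≤ f i) → 0ℤ ≤ ∑ n f
∑-nonneg zero    h = ℤₚ.≤-refl
∑-nonneg (suc n) h = ℤₚ.+-mono-≤ (∑-nonneg n (λ i i<n → h i (ℕₚ.m≤n⇒m≤1+n i<n))) (h n ℕₚ.≤-refl)

∑-extend : ∀ {m n} f → m ℕ.≤ n → (∀ i → i ℕ.< n → 0ℤ ≤ f i) → ∑ m f ≤ ∑ n f
∑-extend {m} {n} f m≤n h = subst (∑ m f ≤_) eq (subst (_≤ ∑ m f + ∑ (n ℕ.∸ m) (λ i → f (m ℕ.+ i))) (ℤₚ.+-identityʳ (∑ m f))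
  (ℤₚ.+-monoʳ-≤ (∑ m f) (∑-nonneg (n ℕ.∸ m) (λ i i< → h (m ℕ.+ i) (ℕₚ.<-≤-trans (ℕₚ.+-monoʳ-< m i<) (ℕₚ.≤-reflexive (ℕₚ.m+[n∸m]≡n m≤n)))))))
  where
  eq : ∑ m f + ∑ (n ℕ.∸ m) (λ i → f (m ℕ.+ i)) ≡ ∑ n f
  eq = trans (sym (∑-append m (n ℕ.∸ m) f)) (cong (λ k → ∑ k f) (ℕₚ.m+[n∸m]≡n m≤n))

∑-subsequence : ∀ R X f (φ : ℕ → ℕ) → (∀ t → φ t ℕ.< φ (suc t)) → (∀ t → t ℕ.< R → φ t ℕ.< X) →
                (∀ i → i ℕ.< X → 0ℤ ≤ f i) → ∑ R (f ∘ φ) ≤ ∑ X f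
∑-subsequence zero    X f φ mono bound h = ∑-nonneg X h
∑-subsequence (suc R) X f φ mono bound h = ℤₚ.≤-trans
  (ℤₚ.+-monoˡ-≤ (f (φ R)) (∑-subsequence R (φ R) f φ mono below-φR (λ i i<φR → h i (ℕₚ.<-trans i<φR (bound R ℕₚ.≤-refl)))))
  (∑-extend f (bound R ℕₚ.≤-refl) h)
  where
  increasing : ∀ t d → φ t ℕ.< φ (suc (d ℕ.+ t))
  increasing t zero    = mono t
  increasing t (suc d) = ℕₚ.<-trans (increasing t d) (mono (suc (d ℕ.+ t)))
  below-φR : ∀ t → t ℕ.< R → φ t ℕ.< φ R
  below-φR t t<R = subst (λ r → φ t ℕ.< φ r) (trans (sym (ℕₚ.+-suc (R ℕ.∸ suc t) t)) (ℕₚ.m∸n+n≡m t<R)) (increasing t (R ℕ.∸ suc t))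

∑-nonzero-term : ∀ n f → ∑ n f ≢ 0ℤ → ∃[ i ] i ℕ.< n × f i ≢ 0ℤ
∑-nonzero-term zero    f ne = ⊥-elim (ne refl)
∑-nonzero-term (suc n) f ne with f n ℤₚ.≟ 0ℤ
... | no  fn≢0 = n , ℕₚ.≤-refl , fn≢0
... | yes fn≡0 = let (i , i<n , fi) = ∑-nonzero-term n f (λ e → ne (cong₂ _+_ e fn≡0)) in i , ℕₚ.m≤n⇒m≤1+n i<n , fi

∑-const : ∀ n c → ∑ n (λ _ → c) ≡ + n * c
∑-const zero    c = refl
∑-const (suc n) c = trans (cong (_+ c) (∑-const n c)) (trans (ℤₚ.+-comm _ c) (sym (ℤₚ.suc-* (+ n) c)))

∑ℕ : ℕ → (ℕ → ℕ) → ℕ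
∑ℕ zero    f = 0
∑ℕ (suc n) f = ∑ℕ n f ℕ.+ f n

∑ℕ-mono : ∀ n {f g : ℕ → ℕ} → (∀ i → f i ℕ.≤ g i) → ∑ℕ n f ℕ.≤ ∑ℕ n g
∑ℕ-mono zero    h = z≤n
∑ℕ-mono (suc n) h = ℕₚ.+-mono-≤ (∑ℕ-mono n h) (h n)

∑ℕ-extend : ∀ {m n} f → m ℕ.≤ n → ∑ℕ m f ℕ.≤ ∑ℕ n f
∑ℕ-extend {m} f m≤n = go (ℕₚ.≤⇒≤′ m≤n)
  where
  go : ∀ {n} → m ℕ.≤′ n → ∑ℕ m f ℕ.≤ ∑ℕ n f
  go ℕ.≤′-refl     = ℕₚ.≤-refl
  go (ℕ.≤′-step l) = ℕₚ.≤-trans (go l) (ℕₚ.m≤m+n _ _)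

∑ℕ-const : ∀ n c → ∑ℕ n (λ _ → c) ≡ n ℕ.* c
∑ℕ-const zero    c = refl
∑ℕ-const (suc n) c = trans (cong (ℕ._+ c) (∑ℕ-const n c)) (ℕₚ.+-comm _ c)

∑ℕ-+ : ∀ n f g → ∑ℕ n (λ i → f i ℕ.+ g i) ≡ ∑ℕ n f ℕ.+ ∑ℕ n g
∑ℕ-+ zero    f g = refl
∑ℕ-+ (suc n) f g = trans (cong (ℕ._+ (f n ℕ.+ g n)) (∑ℕ-+ n f g)) (lemma (∑ℕ n f) (∑ℕ n g) (f n) (g n))
  where
  lemma : ∀ a b c d → a ℕ.+ b ℕ.+ (c ℕ.+ d) ≡ a ℕ.+ c ℕ.+ (b ℕ.+ d)
  lemma = ℕ-Ring.solve-∀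

∑ℕ-* : ∀ n c f → ∑ℕ n (λ i → c ℕ.* f i) ≡ c ℕ.* ∑ℕ n f
∑ℕ-* zero    c f = sym (ℕₚ.*-zeroʳ c)
∑ℕ-* (suc n) c f = trans (cong (ℕ._+ c ℕ.* f n) (∑ℕ-* n c f)) (sym (ℕₚ.*-distribˡ-+ c (∑ℕ n f) (f n)))

∑ℕ-append : ∀ m n f → ∑ℕ (m ℕ.+ n) f ≡ ∑ℕ m f ℕ.+ ∑ℕ n (λ i → f (m ℕ.+ i))
∑ℕ-append m zero    f = trans (cong (λ k → ∑ℕ k f) (ℕₚ.+-identityʳ m)) (sym (ℕₚ.+-identityʳ _))
∑ℕ-append m (suc n) f = trans (cong (λ k → ∑ℕ k f) (ℕₚ.+-suc m n))
  (trans (cong (ℕ._+ f (m ℕ.+ n)) (∑ℕ-append m n f)) (ℕₚ.+-assoc (∑ℕ m f) _ _))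

∣∑∣≤ : ∀ n f g → (∀ i → ∣ f i ∣ ℕ.≤ g i) → ∣ ∑ n f ∣ ℕ.≤ ∑ℕ n g
∣∑∣≤ zero    f g h = z≤n
∣∑∣≤ (suc n) f g h = ℕₚ.≤-trans (ℤₚ.∣i+j∣≤∣i∣+∣j∣ (∑ n f) (f n)) (ℕₚ.+-mono-≤ (∣∑∣≤ n f g h) (h n))

abel : ∀ n (x w : ℕ → ℤ) →
       ∑ n (λ i → x i * w i) ≡ ∑ n (λ i → ∑ (suc i) x * (w i - w (suc i))) + ∑ n x * w n
abel zero    x w = refl
abel (suc n) x w = trans (cong (_+ x n * w n) (abel n x w))
  (lemma (∑ n (λ i → ∑ (suc i) x * (w i - w (suc i)))) (∑ n x) (x n) (w n) (w (suc n)))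
  where
  lemma : ∀ s X x w w′ → s + X * w + x * w ≡ s + (X + x) * (w - w′) + (X + x) * w′
  lemma = solve-∀

abel₂ : ∀ n (k w : ℕ → ℕ → ℤ) → (∀ i → w i n ≡ 0ℤ) → (∀ j → w n j ≡ 0ℤ) →
        ∑ n (λ i → ∑ n (λ j → k i j * w i j))
        ≡ ∑ n (λ j → ∑ n (λ i → ∑ (suc i) (λ i′ → ∑ (suc j) (k i′))
            * ((w i j - w i (suc j)) - (w (suc i) j - w (suc i) (suc j)))))
abel₂ n k w right bottom = begin
  ∑ n (λ i → ∑ n (λ j → k i j * w i j))
    ≡⟨ ∑-cong n (λ i _ → trans (abel n (k i) (w i))
         (trans (cong (λ z → ∑ n (λ j → ∑ (suc j) (k i) * (w i j - w i (suc j))) + ∑ n (k i) * z) (right i))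
                (drop (∑ n (λ j → ∑ (suc j) (k i) * (w i j - w i (suc j)))) (∑ n (k i))))) ⟩
  ∑ n (λ i → ∑ n (λ j → ∑ (suc j) (k i) * (w i j - w i (suc j))))
    ≡⟨ ∑-swap n n (λ i j → ∑ (suc j) (k i) * (w i j - w i (suc j))) ⟩
  ∑ n (λ j → ∑ n (λ i → ∑ (suc j) (k i) * (w i j - w i (suc j))))
    ≡⟨ ∑-cong n (λ j _ → trans (abel n (λ i → ∑ (suc j) (k i)) (λ i → w i j - w i (suc j)))
         (trans (cong (λ z → inner j + ∑ n (λ i → ∑ (suc j) (k i)) * z) (cong₂ _-_ (bottom j) (bottom (suc j))))
                (drop (inner j) (∑ n (λ i → ∑ (suc j) (k i)))))) ⟩
  ∑ n inner ∎
  where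
  open ≡-Reasoning
  inner : ℕ → ℤ
  inner j = ∑ n (λ i → ∑ (suc i) (λ i′ → ∑ (suc j) (k i′))
              * ((w i j - w i (suc j)) - (w (suc i) j - w (suc i) (suc j))))
  drop : ∀ a b → a + b * 0ℤ ≡ a
  drop = solve-∀

module Smoothing (X : ℕ) where

  hat : ℕ → ℕ
  hat t = X ℕ.∸ t

  weight : ℕ → ℕ → ℕ
  weight i j = hat (suc i ℕ.* suc j)

  drop : ℕ → ℕ → ℕ
  drop j i = weight i j ℕ.∸ weight i (suc j)

  inside : ℕ → ℕ → ℕ
  inside j i = if (suc i ℕ.* suc (suc j)) ℕ.≤ᵇ X then 1 else 0

  hat-anti : ∀ {s t} → s ℕ.≤ t → hat t ℕ.≤ hat s
  hat-anti = ℕₚ.∸-monoʳ-≤ X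

  hat-convex : ∀ A a b → hat (A ℕ.+ a) ℕ.+ hat (A ℕ.+ b) ℕ.≤ hat A ℕ.+ hat (A ℕ.+ (a ℕ.+ b))
  hat-convex A a b = subst₂ ℕ._≤_
    (cong₂ ℕ._+_ (ℕₚ.∸-+-assoc X A a) (ℕₚ.∸-+-assoc X A b))
    (cong (hat A ℕ.+_) (ℕₚ.∸-+-assoc X A (a ℕ.+ b)))
    (convex (X ℕ.∸ A))
    where
    convex : ∀ Y → (Y ℕ.∸ a) ℕ.+ (Y ℕ.∸ b) ℕ.≤ Y ℕ.+ (Y ℕ.∸ (a ℕ.+ b))
    convex Y with ℕₚ.≤-total Y a
    ... | inj₁ Y≤a = ℕₚ.≤-trans (ℕₚ.+-mono-≤ (ℕₚ.≤-reflexive (ℕₚ.m≤n⇒m∸n≡0 Y≤a)) (ℕₚ.m∸n≤m Y b)) (ℕₚ.m≤m+n Y _)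
    ... | inj₂ a≤Y = begin
      Z ℕ.+ (Y ℕ.∸ b)               ≤⟨ ℕₚ.+-monoʳ-≤ Z (ℕₚ.m≤n+o⇒m∸n≤o Y b (begin
          Y                         ≡⟨ ℕₚ.m+[n∸m]≡n a≤Y ⟨
          a ℕ.+ Z                   ≤⟨ ℕₚ.+-monoʳ-≤ a (ℕₚ.m≤n+m∸n Z b) ⟩
          a ℕ.+ (b ℕ.+ (Z ℕ.∸ b))   ≡⟨ lemma a b (Z ℕ.∸ b) ⟩
          b ℕ.+ (a ℕ.+ (Z ℕ.∸ b))   ∎)) ⟩
      Z ℕ.+ (a ℕ.+ (Z ℕ.∸ b))       ≡⟨ lemma′ Z a (Z ℕ.∸ b) ⟩
      a ℕ.+ Z ℕ.+ (Z ℕ.∸ b)         ≡⟨ cong₂ ℕ._+_ (ℕₚ.m+[n∸m]≡n a≤Y) (ℕₚ.∸-+-assoc Y a b) ⟩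
      Y ℕ.+ (Y ℕ.∸ (a ℕ.+ b))       ∎
      where
      open ℕₚ.≤-Reasoning
      Z : ℕ
      Z = Y ℕ.∸ a
      lemma : ∀ a b z → a ℕ.+ (b ℕ.+ z) ≡ b ℕ.+ (a ℕ.+ z)
      lemma = ℕ-Ring.solve-∀
      lemma′ : ∀ z a w → z ℕ.+ (a ℕ.+ w) ≡ a ℕ.+ z ℕ.+ w
      lemma′ = ℕ-Ring.solve-∀

  hat-step : ∀ t → hat t ℕ.≤ suc (hat (suc t))
  hat-step t = ℕₚ.m≤n+o⇒m∸n≤o X t (ℕₚ.≤-trans (ℕₚ.m≤n+m∸n X (suc t)) (ℕₚ.≤-reflexive (sym (ℕₚ.+-suc t _))))

  hat-last : ∀ j i → let t = suc i ℕ.* suc j ℕ.+ (suc i ℕ.+ suc j) in hat t ℕ.≤ hat (suc t) ℕ.+ inside j i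
  hat-last j i with (suc i ℕ.* suc (suc j)) ℕ.≤ᵇ X in eq
  ... | true  = ℕₚ.≤-trans (hat-step (suc i ℕ.* suc j ℕ.+ (suc i ℕ.+ suc j))) (ℕₚ.≤-reflexive (ℕₚ.+-comm 1 _))
  ... | false = ℕₚ.≤-trans (ℕₚ.≤-reflexive (ℕₚ.m≤n⇒m∸n≡0 {X} (ℕₚ.≤-trans (ℕₚ.<⇒≤ (ℕₚ.≰⇒> λ le → subst T eq (ℕₚ.≤⇒≤ᵇ le))) (begin
      suc i ℕ.* suc (suc j)                 ≡⟨ ℕₚ.*-suc (suc i) (suc j) ⟩
      suc i ℕ.+ suc i ℕ.* suc j             ≡⟨ ℕₚ.+-comm (suc i) _ ⟩
      suc i ℕ.* suc j ℕ.+ suc i             ≤⟨ ℕₚ.+-monoʳ-≤ (suc i ℕ.* suc j) (ℕₚ.m≤m+n (suc i) (suc j)) ⟩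
      suc i ℕ.* suc j ℕ.+ (suc i ℕ.+ suc j) ∎)))) z≤n
    where open ℕₚ.≤-Reasoning

  drop-rise : ∀ j i → drop j (suc i) ℕ.≤ drop j i ℕ.+ inside j i
  drop-rise j i = ℕₚ.m≤n+o⇒m∸n≤o (weight (suc i) j) (weight (suc i) (suc j)) (ℕₚ.+-cancelˡ-≤ (weight i (suc j)) _ _ (begin
    weight i (suc j) ℕ.+ weight (suc i) j
      ≡⟨ cong₂ (λ s t → hat s ℕ.+ hat t) (trans (ℕₚ.*-suc (suc i) (suc j)) (ℕₚ.+-comm (suc i) A)) (ℕₚ.+-comm (suc j) A) ⟩
    hat (A ℕ.+ suc i) ℕ.+ hat (A ℕ.+ suc j)
      ≤⟨ hat-convex A (suc i) (suc j) ⟩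
    hat A ℕ.+ hat (A ℕ.+ (suc i ℕ.+ suc j))
      ≤⟨ ℕₚ.+-monoʳ-≤ (hat A) (hat-last j i) ⟩
    hat A ℕ.+ (hat (suc (A ℕ.+ (suc i ℕ.+ suc j))) ℕ.+ inside j i)
      ≡⟨ cong₂ (λ s t → s ℕ.+ (hat t ℕ.+ inside j i)) (sym (ℕₚ.m+[n∸m]≡n (hat-anti (ℕₚ.*-monoʳ-≤ (suc i) (ℕₚ.n≤1+n (suc j)))))) (corner i j) ⟩
    weight i (suc j) ℕ.+ drop j i ℕ.+ (weight (suc i) (suc j) ℕ.+ inside j i)
      ≡⟨ lemma (weight i (suc j)) (drop j i) (weight (suc i) (suc j)) (inside j i) ⟩
    weight i (suc j) ℕ.+ (weight (suc i) (suc j) ℕ.+ (drop j i ℕ.+ inside j i)) ∎))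
    where
    open ℕₚ.≤-Reasoning
    A : ℕ
    A = suc i ℕ.* suc j
    corner : ∀ i j → suc (suc i ℕ.* suc j ℕ.+ (suc i ℕ.+ suc j)) ≡ suc (suc i) ℕ.* suc (suc j)
    corner = ℕ-Ring.solve-∀
    lemma : ∀ a b c d → a ℕ.+ b ℕ.+ (c ℕ.+ d) ≡ a ℕ.+ (c ℕ.+ (b ℕ.+ d))
    lemma = ℕ-Ring.solve-∀

  variation : ℕ → ℕ → ℕ
  variation j i = ∣ + drop j i - + drop j (suc i) ∣

  ∣-∣-rise : ∀ m n d → n ℕ.≤ m ℕ.+ d → ∣ + m - + n ∣ ℕ.+ n ℕ.≤ m ℕ.+ 2 ℕ.* d
  ∣-∣-rise m n d n≤m+d with ℕₚ.≤-total n m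
  ... | inj₁ n≤m = ℕₚ.≤-trans (ℕₚ.≤-reflexive (trans (cong (λ z → ∣ z ∣ ℕ.+ n) (trans (ℤₚ.m-n≡m⊖n m n) (ℤₚ.⊖-≥ n≤m)))
                     (ℕₚ.m∸n+n≡m n≤m))) (ℕₚ.m≤m+n m _)
  ... | inj₂ m≤n = begin
    ∣ + m - + n ∣ ℕ.+ n  ≡⟨ cong (ℕ._+ n) (trans (ℤₚ.∣i-j∣≡∣j-i∣ (+ m) (+ n)) (cong ∣_∣ (trans (ℤₚ.m-n≡m⊖n n m) (ℤₚ.⊖-≥ m≤n)))) ⟩
    (n ℕ.∸ m) ℕ.+ n      ≤⟨ ℕₚ.+-mono-≤ (ℕₚ.m≤n+o⇒m∸n≤o n m n≤m+d) n≤m+d ⟩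
    d ℕ.+ (m ℕ.+ d)      ≡⟨ lemma d m ⟩
    m ℕ.+ 2 ℕ.* d        ∎
    where
    open ℕₚ.≤-Reasoning
    lemma : ∀ d m → d ℕ.+ (m ℕ.+ d) ≡ m ℕ.+ 2 ℕ.* d
    lemma = ℕ-Ring.solve-∀

  count : ℕ → ℕ
  count j = ∑ℕ X (inside j)

  variation-sum : ∀ j → ∑ℕ X (variation j) ℕ.≤ 1 ℕ.+ 2 ℕ.* count j
  variation-sum j = ℕₚ.≤-trans (ℕₚ.m+n≤o⇒m≤o _ (telescope X)) (ℕₚ.+-monoˡ-≤ (2 ℕ.* count j) drop₀)
    where
    open ℕₚ.≤-Reasoning
    telescope : ∀ n → ∑ℕ n (variation j) ℕ.+ drop j n ℕ.≤ drop j 0 ℕ.+ 2 ℕ.* ∑ℕ n (inside j)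
    telescope zero    = ℕₚ.≤-reflexive (sym (ℕₚ.+-identityʳ (drop j 0)))
    telescope (suc n) = begin
      ∑ℕ n (variation j) ℕ.+ variation j n ℕ.+ drop j (suc n)   ≡⟨ ℕₚ.+-assoc (∑ℕ n (variation j)) _ _ ⟩
      ∑ℕ n (variation j) ℕ.+ (variation j n ℕ.+ drop j (suc n)) ≤⟨ ℕₚ.+-monoʳ-≤ (∑ℕ n (variation j)) (∣-∣-rise (drop j n) (drop j (suc n)) (inside j n) (drop-rise j n)) ⟩
      ∑ℕ n (variation j) ℕ.+ (drop j n ℕ.+ 2 ℕ.* inside j n)    ≡⟨ ℕₚ.+-assoc (∑ℕ n (variation j)) _ _ ⟨
      ∑ℕ n (variation j) ℕ.+ drop j n ℕ.+ 2 ℕ.* inside j n      ≤⟨ ℕₚ.+-monoˡ-≤ (2 ℕ.* inside j n) (telescope n) ⟩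
      drop j 0 ℕ.+ 2 ℕ.* ∑ℕ n (inside j) ℕ.+ 2 ℕ.* inside j n   ≡⟨ lemma (drop j 0) (∑ℕ n (inside j)) (inside j n) ⟩
      drop j 0 ℕ.+ 2 ℕ.* (∑ℕ n (inside j) ℕ.+ inside j n)       ∎
      where
      lemma : ∀ a b c → a ℕ.+ 2 ℕ.* b ℕ.+ 2 ℕ.* c ≡ a ℕ.+ 2 ℕ.* (b ℕ.+ c)
      lemma = ℕ-Ring.solve-∀
    drop₀ : drop j 0 ℕ.≤ 1
    drop₀ = ℕₚ.m≤n+o⇒m∸n≤o (weight 0 j) (weight 0 (suc j)) (begin
      hat (1 ℕ.* suc j)            ≡⟨ cong hat (ℕₚ.*-identityˡ (suc j)) ⟩
      hat (suc j)                  ≤⟨ hat-step (suc j) ⟩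
      suc (hat (suc (suc j)))      ≡⟨ cong (λ t → suc (hat t)) (ℕₚ.*-identityˡ (suc (suc j))) ⟨
      suc (hat (1 ℕ.* suc (suc j))) ≡⟨ ℕₚ.+-comm 1 _ ⟩
      hat (1 ℕ.* suc (suc j)) ℕ.+ 1 ∎)

  count-bound : ∀ j → count j ℕ.* suc j ℕ.≤ X
  count-bound j = ℕₚ.≤-trans (ℕₚ.*-monoʳ-≤ (count j) (ℕₚ.n≤1+n (suc j))) (proj₁ (go X))
    where
    go : ∀ n → ∑ℕ n (inside j) ℕ.* suc (suc j) ℕ.≤ X × ∑ℕ n (inside j) ℕ.≤ n
    go zero    = z≤n , z≤n
    go (suc n) with (suc n ℕ.* suc (suc j)) ℕ.≤ᵇ X in eq | go n
    ... | false | b , l = subst (λ c → c ℕ.* suc (suc j) ℕ.≤ X × c ℕ.≤ suc n) (sym (ℕₚ.+-identityʳ _)) (b , ℕₚ.m≤n⇒m≤1+n l)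
    ... | true  | b , l = ℕₚ.≤-trans (ℕₚ.*-monoˡ-≤ (suc (suc j)) l′) (ℕₚ.≤ᵇ⇒≤ _ _ (subst T (sym eq) tt)) , l′
      where
      l′ : ∑ℕ n (inside j) ℕ.+ 1 ℕ.≤ suc n
      l′ = ℕₚ.≤-trans (ℕₚ.≤-reflexive (ℕₚ.+-comm _ 1)) (s≤s l)

  count-dyadic : ∀ l → ∑ℕ (2 ℕ.^ l) count ℕ.≤ X ℕ.* suc l
  count-dyadic zero    = ℕₚ.≤-trans (ℕₚ.≤-reflexive (sym (ℕₚ.*-identityʳ (count 0))))
    (ℕₚ.≤-trans (count-bound 0) (ℕₚ.≤-reflexive (sym (ℕₚ.*-identityʳ X))))
  count-dyadic (suc l) = begin
    ∑ℕ (2 ℕ.* P) count                                    ≡⟨ cong (λ n → ∑ℕ (P ℕ.+ n) count) (ℕₚ.+-identityʳ P) ⟩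
    ∑ℕ (P ℕ.+ P) count                                    ≡⟨ ∑ℕ-append P P count ⟩
    ∑ℕ P count ℕ.+ ∑ℕ P (λ i → count (P ℕ.+ i))           ≤⟨ ℕₚ.+-mono-≤ (count-dyadic l) second ⟩
    X ℕ.* suc l ℕ.+ X                                     ≡⟨ trans (ℕₚ.+-comm _ X) (sym (ℕₚ.*-suc X (suc l))) ⟩
    X ℕ.* suc (suc l)                                     ∎
    where
    open ℕₚ.≤-Reasoning
    P : ℕ
    P = 2 ℕ.^ l
    second : ∑ℕ P (λ i → count (P ℕ.+ i)) ℕ.≤ X
    second = ℕₚ.*-cancelˡ-≤ P {{ℕₚ.m^n≢0 2 l}} (begin
      P ℕ.* ∑ℕ P (λ i → count (P ℕ.+ i))        ≡⟨ ∑ℕ-* P P _ ⟨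
      ∑ℕ P (λ i → P ℕ.* count (P ℕ.+ i))        ≤⟨ ∑ℕ-mono P (λ i → ℕₚ.≤-trans (ℕₚ.≤-trans (ℕₚ.≤-reflexive (ℕₚ.*-comm P _))
                                                     (ℕₚ.*-monoʳ-≤ (count (P ℕ.+ i)) (ℕₚ.m≤n⇒m≤1+n (ℕₚ.m≤m+n P i)))) (count-bound (P ℕ.+ i))) ⟩
      ∑ℕ P (λ _ → X)                            ≡⟨ ∑ℕ-const P X ⟩
      P ℕ.* X                                   ∎)

  total-variation : ∀ {L} → X ℕ.≤ 2 ℕ.^ L → ∑ℕ X (λ j → ∑ℕ X (variation j)) ℕ.≤ X ℕ.* (3 ℕ.+ 2 ℕ.* L)
  total-variation {L} X≤2^L = begin
    ∑ℕ X (λ j → ∑ℕ X (variation j))               ≤⟨ ∑ℕ-mono X variation-sum ⟩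
    ∑ℕ X (λ j → 1 ℕ.+ 2 ℕ.* count j)              ≡⟨ ∑ℕ-+ X (λ _ → 1) (λ j → 2 ℕ.* count j) ⟩
    ∑ℕ X (λ _ → 1) ℕ.+ ∑ℕ X (λ j → 2 ℕ.* count j) ≡⟨ cong₂ ℕ._+_ (∑ℕ-const X 1) (∑ℕ-* X 2 count) ⟩
    X ℕ.* 1 ℕ.+ 2 ℕ.* ∑ℕ X count                  ≤⟨ ℕₚ.+-monoʳ-≤ (X ℕ.* 1) (ℕₚ.*-monoʳ-≤ 2 (ℕₚ.≤-trans (∑ℕ-extend count X≤2^L) (count-dyadic L))) ⟩
    X ℕ.* 1 ℕ.+ 2 ℕ.* (X ℕ.* suc L)               ≡⟨ lemma X L ⟩
    X ℕ.* (3 ℕ.+ 2 ℕ.* L)                         ∎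
    where
    open ℕₚ.≤-Reasoning
    lemma : ∀ x l → x ℕ.* 1 ℕ.+ 2 ℕ.* (x ℕ.* suc l) ≡ x ℕ.* (3 ℕ.+ 2 ℕ.* l)
    lemma = ℕ-Ring.solve-∀

  smoothed-sum-bound : ∀ (k : ℕ → ℕ → ℤ) B L → X ℕ.≤ 2 ℕ.^ L → (∀ u v → ∣ ∑ u (λ i → ∑ v (k i)) ∣ ℕ.≤ B) →
    ∣ ∑ X (λ i → ∑ X (λ j → k i j * + weight i j)) ∣ ℕ.≤ B ℕ.* (X ℕ.* (3 ℕ.+ 2 ℕ.* L))
  smoothed-sum-bound k B L X≤2^L bounded = begin
    ∣ ∑ X (λ i → ∑ X (λ j → k i j * + weight i j)) ∣
      ≡⟨ cong ∣_∣ (abel₂ X k (λ i j → + weight i j)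
           (λ i → cong +_ (ℕₚ.m≤n⇒m∸n≡0 (ℕₚ.≤-trans (ℕₚ.n≤1+n X) (ℕₚ.m≤m+n (suc X) (i ℕ.* suc X)))))
           (λ j → cong +_ (ℕₚ.m≤n⇒m∸n≡0 (ℕₚ.≤-trans (ℕₚ.n≤1+n X) (ℕₚ.m≤m*n (suc X) (suc j)))))) ⟩
    ∣ ∑ X (λ j → ∑ X (λ i → ∑ (suc i) (λ i′ → ∑ (suc j) (k i′)) * D j i)) ∣
      ≤⟨ ∣∑∣≤ X _ _ (λ j → ℕₚ.≤-trans (∣∑∣≤ X _ _ (term j)) (ℕₚ.≤-reflexive (∑ℕ-* X B (variation j)))) ⟩
    ∑ℕ X (λ j → B ℕ.* ∑ℕ X (variation j))
      ≡⟨ ∑ℕ-* X B _ ⟩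
    B ℕ.* ∑ℕ X (λ j → ∑ℕ X (variation j))
      ≤⟨ ℕₚ.*-monoʳ-≤ B (total-variation {L} X≤2^L) ⟩
    B ℕ.* (X ℕ.* (3 ℕ.+ 2 ℕ.* L)) ∎
    where
    open ℕₚ.≤-Reasoning
    D : ℕ → ℕ → ℤ
    D j i = (+ weight i j - + weight i (suc j)) - (+ weight (suc i) j - + weight (suc i) (suc j))
    drop-ℤ : ∀ j i → + weight i j - + weight i (suc j) ≡ + drop j i
    drop-ℤ j i = trans (ℤₚ.m-n≡m⊖n (weight i j) (weight i (suc j)))
      (ℤₚ.⊖-≥ (hat-anti (ℕₚ.*-monoʳ-≤ (suc i) (ℕₚ.n≤1+n (suc j)))))
    term : ∀ j i → ∣ ∑ (suc i) (λ i′ → ∑ (suc j) (k i′)) * D j i ∣ ℕ.≤ B ℕ.* variation j i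
    term j i = ℕₚ.≤-trans (ℕₚ.≤-reflexive (ℤₚ.abs-* (∑ (suc i) (λ i′ → ∑ (suc j) (k i′))) (D j i)))
      (ℕₚ.*-mono-≤ (bounded (suc i) (suc j)) (ℕₚ.≤-reflexive (cong ∣_∣ (cong₂ _-_ (drop-ℤ j i) (drop-ℤ j (suc i))))))

-- Divisor sums of a character

ind : {P : Set} → Dec P → ℤ
ind (yes _) = 1ℤ
ind (no _)  = 0ℤ

ind-yes : {P : Set} (P? : Dec P) → P → ind P? ≡ 1ℤ
ind-yes (yes _) _ = refl
ind-yes (no ¬p) p = ⊥-elim (¬p p)

ind-no : {P : Set} (P? : Dec P) → ¬ P → ind P? ≡ 0ℤ
ind-no (yes p) ¬p = ⊥-elim (¬p p)
ind-no (no _)  _  = refl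

ind-cong : {P Q : Set} (P? : Dec P) (Q? : Dec Q) → (P → Q) → (Q → P) → ind P? ≡ ind Q?
ind-cong (yes p) Q? f _ = sym (ind-yes Q? (f p))
ind-cong (no ¬p) Q? _ g = sym (ind-no Q? (¬p ∘ g))

ind-nonneg : {P : Set} (P? : Dec P) → 0ℤ ≤ ind P?
ind-nonneg (yes _) = +≤+ z≤n
ind-nonneg (no _)  = +≤+ z≤n

∑-single : ∀ n {f : ℕ → ℤ} i₀ → i₀ ℕ.< n → (∀ i → i ≢ i₀ → f i ≡ 0ℤ) → ∑ n f ≡ f i₀
∑-single (suc n) {f} i₀ i₀<1+n h with i₀ ℕₚ.≟ n
... | yes refl = trans (cong (_+ f n) (∑-zero n (λ i i<n → h i (ℕₚ.<⇒≢ i<n)))) (ℤₚ.+-identityˡ (f n))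
... | no  i₀≢n = trans (cong₂ _+_ (∑-single n i₀ (ℕₚ.≤∧≢⇒< (ℕₚ.≤-pred i₀<1+n) i₀≢n) h) (h n (i₀≢n ∘ sym)))
                       (ℤₚ.+-identityʳ (f i₀))

∑-head : ∀ n f → ∑ (suc n) f ≡ f 0 + ∑ n (f ∘ suc)
∑-head zero    f = ℤₚ.+-comm 0ℤ (f 0)
∑-head (suc n) f = trans (cong (_+ f (suc n)) (∑-head n f)) (ℤₚ.+-assoc (f 0) _ _)

∑-multiples : ∀ p .{{_ : ℕ.NonZero p}} n (F : ℕ → ℤ) → ∑ (n ℕ.* p) (λ d → ind (p ℕ∣.∣? d) * F d) ≡ ∑ n (λ d → F (d ℕ.* p))
∑-multiples p zero    F = refl
∑-multiples p (suc n) F = begin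
  ∑ (p ℕ.+ n ℕ.* p) f                                  ≡⟨ cong (λ k → ∑ k f) (ℕₚ.+-comm p (n ℕ.* p)) ⟩
  ∑ (n ℕ.* p ℕ.+ p) f                                  ≡⟨ ∑-append (n ℕ.* p) p f ⟩
  ∑ (n ℕ.* p) f + ∑ p (λ i → f (n ℕ.* p ℕ.+ i))        ≡⟨ cong₂ _+_ (∑-multiples p n F) block ⟩
  ∑ n (λ d → F (d ℕ.* p)) + F (n ℕ.* p)                ∎
  where
  open ≡-Reasoning
  f : ℕ → ℤ
  f d = ind (p ℕ∣.∣? d) * F d
  truncate : ℕ → ℤ
  truncate i = ind (i ℕₚ.<? p) * f (n ℕ.* p ℕ.+ i)
  zero-off : ∀ i → i ≢ 0 → truncate i ≡ 0ℤ
  zero-off i i≢0 = by-cases (i ℕₚ.<? p)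
    where
    by-cases : (i<p? : Dec (i ℕ.< p)) → ind i<p? * f (n ℕ.* p ℕ.+ i) ≡ 0ℤ
    by-cases (no _)    = refl
    by-cases (yes i<p) = trans (ℤₚ.*-identityˡ (f (n ℕ.* p ℕ.+ i))) (cong (_* F (n ℕ.* p ℕ.+ i)) (ind-no (p ℕ∣.∣? (n ℕ.* p ℕ.+ i))
      (λ p∣ → ℕₚ.<⇒≱ i<p (ℕ∣.∣⇒≤ {{ℕ.≢-nonZero i≢0}} (ℕ∣.∣m+n∣m⇒∣n p∣ (ℕ∣.n∣m*n n))))))
  block : ∑ p (λ i → f (n ℕ.* p ℕ.+ i)) ≡ F (n ℕ.* p)
  block = begin
    ∑ p (λ i → f (n ℕ.* p ℕ.+ i)) ≡⟨ ∑-cong p (λ i i<p → sym (trans (cong (_* f (n ℕ.* p ℕ.+ i)) (ind-yes (i ℕₚ.<? p) i<p)) (ℤₚ.*-identityˡ _))) ⟩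
    ∑ p truncate                  ≡⟨ ∑-single p 0 (ℕ.>-nonZero⁻¹ p) zero-off ⟩
    truncate 0                    ≡⟨ trans (cong (_* f (n ℕ.* p ℕ.+ 0)) (ind-yes (0 ℕₚ.<? p) (ℕ.>-nonZero⁻¹ p))) (ℤₚ.*-identityˡ (f (n ℕ.* p ℕ.+ 0))) ⟩
    f (n ℕ.* p ℕ.+ 0)             ≡⟨ cong f (ℕₚ.+-identityʳ (n ℕ.* p)) ⟩
    f (n ℕ.* p)                   ≡⟨ trans (cong (_* F (n ℕ.* p)) (ind-yes (p ℕ∣.∣? (n ℕ.* p)) (ℕ∣.n∣m*n n))) (ℤₚ.*-identityˡ _) ⟩
    F (n ℕ.* p)                   ∎

remove-prime : ∀ p → Prime p → ∀ A → 1 ℕ.≤ A → ∃[ k ] ∃[ m ] A ≡ p ℕ.^ k ℕ.* m × ¬ (p ℕ∣.∣ m) × 1 ℕ.≤ m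
remove-prime p pr A 1≤A = go A A ℕₚ.≤-refl 1≤A
  where
  go : ∀ bound A → A ℕ.≤ bound → 1 ℕ.≤ A → ∃[ k ] ∃[ m ] A ≡ p ℕ.^ k ℕ.* m × ¬ (p ℕ∣.∣ m) × 1 ℕ.≤ m
  go zero        A A≤0 1≤A = ⊥-elim (ℕₚ.<⇒≱ 1≤A A≤0)
  go (suc bound) A A≤ 1≤A with p ℕ∣.∣? A
  ... | no  p∤A = 0 , A , sym (ℕₚ.+-identityʳ A) , p∤A , 1≤A
  ... | yes (ℕ∣.divides zero refl) = ⊥-elim (ℕₚ.<⇒≱ 1≤A z≤n)
  ... | yes (ℕ∣.divides q@(suc _) refl) =
    let (k , m , eq , p∤m , 1≤m) = go bound q (ℕₚ.≤-pred (ℕₚ.<-≤-trans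
            (ℕₚ.m<m*n q p (prime≥2 pr)) A≤)) (s≤s z≤n)
    in suc k , m , trans (ℕₚ.*-comm q p) (trans (cong (p ℕ.*_) eq) (sym (ℕₚ.*-assoc p (p ℕ.^ k) m))) , p∤m , 1≤m

prime-divisor : ∀ A → 2 ℕ.≤ A → ∃[ p ] Prime p × p ℕ∣.∣ A
prime-divisor A 2≤A with factorise A {{ℕ.>-nonZero (ℕₚ.<-trans (s≤s z≤n) 2≤A)}}
... | record { factors = []     ; isFactorisation = refl } = ⊥-elim (ℕₚ.<⇒≱ 2≤A ℕₚ.≤-refl)
... | record { factors = p ∷ ps ; isFactorisation = refl ; factorsPrime = pr ∷ _ } = p , pr , ℕ∣.m∣m*n _

prime-power-induction : (P : ℕ → Set) → P 1 →
  (∀ p k m → Prime p → ¬ (p ℕ∣.∣ m) → 1 ℕ.≤ m → P m → P (p ℕ.^ k ℕ.* m)) → ∀ A → 1 ℕ.≤ A → P A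
prime-power-induction P one step A 1≤A = go A A ℕₚ.≤-refl 1≤A
  where
  go : ∀ bound A → A ℕ.≤ bound → 1 ℕ.≤ A → P A
  go bound       1 _ _ = one
  go zero        (suc (suc A)) () _
  go (suc bound) A@(suc (suc _)) A≤ 1≤A with prime-divisor A (s≤s (s≤s z≤n))
  ... | p , pr , p∣A with remove-prime p pr A 1≤A
  ... | zero  , m , eq , p∤m , 1≤m = ⊥-elim (p∤m (subst (p ℕ∣.∣_) (trans eq (ℕₚ.+-identityʳ m)) p∣A))
  ... | suc k , m , eq , p∤m , 1≤m = subst P (sym eq) (step p (suc k) m pr p∤m 1≤m (go bound m (ℕₚ.≤-pred (begin-strict
    m                             <⟨ ℕₚ.m<m*n m p {{ℕ.>-nonZero 1≤m}} (prime≥2 pr) ⟩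
    m ℕ.* p                       ≡⟨ ℕₚ.*-comm m p ⟩
    p ℕ.* m                       ≤⟨ ℕₚ.*-monoˡ-≤ m (ℕₚ.m≤m*n p (p ℕ.^ k) {{ℕₚ.m^n≢0 p k {{Primality.prime⇒nonZero pr}}}}) ⟩
    p ℕ.^ suc k ℕ.* m             ≡⟨ eq ⟨
    A                             ≤⟨ A≤ ⟩
    suc bound                     ∎)) 1≤m))
    where open ℕₚ.≤-Reasoning

module DivisorSum (χ : ℕ → ℤ) (χ-* : ∀ a b → χ (a ℕ.* b) ≡ χ a * χ b) (χ-1 : χ 1 ≡ 1ℤ)
                  (χ-value : ∀ a → χ a ≡ 0ℤ ⊎ IsSign (χ a)) where

  restricted : (ℕ → ℤ) → ℕ → ℕ → ℤ
  restricted φ M A = ∑ M (λ d → χ d * (ind (d ℕ∣.∣? A) * φ d))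

  restricted-range : ∀ φ {M A} → 1 ℕ.≤ A → A ℕ.< M → restricted φ M A ≡ restricted φ (suc A) A
  restricted-range φ {M} {A} 1≤A A<M = begin
    restricted φ M A                       ≡⟨ cong (λ n → ∑ n f) (sym (ℕₚ.m+[n∸m]≡n A<M)) ⟩
    ∑ (suc A ℕ.+ (M ℕ.∸ suc A)) f          ≡⟨ ∑-append (suc A) (M ℕ.∸ suc A) f ⟩
    ∑ (suc A) f + ∑ (M ℕ.∸ suc A) (λ i → f (suc A ℕ.+ i)) ≡⟨ cong (λ z → ∑ (suc A) f + z) (∑-zero (M ℕ.∸ suc A) (λ i _ →
      trans (cong (λ z → χ (suc A ℕ.+ i) * (z * φ (suc A ℕ.+ i))) (ind-no ((suc A ℕ.+ i) ℕ∣.∣? A)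
        (λ d∣A → ℕₚ.<⇒≱ (s≤s (ℕₚ.m≤m+n A i)) (ℕ∣.∣⇒≤ {{ℕ.>-nonZero 1≤A}} d∣A)))) (ℤₚ.*-zeroʳ (χ (suc A ℕ.+ i))))) ⟩
    ∑ (suc A) f + 0ℤ                       ≡⟨ ℤₚ.+-identityʳ _ ⟩
    ∑ (suc A) f                            ∎
    where
    open ≡-Reasoning
    f : ℕ → ℤ
    f d = χ d * (ind (d ℕ∣.∣? A) * φ d)

  divisorSum : ℕ → ℤ
  divisorSum A = restricted (λ _ → 1ℤ) (suc A) A

  avoiding : ℕ → ℕ → ℤ
  avoiding p d = 1ℤ - ind (p ℕ∣.∣? d)

  avoiding-no : ∀ {p d} → ¬ (p ℕ∣.∣ d) → avoiding p d ≡ 1ℤ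
  avoiding-no {p} {d} p∤d = cong (λ z → 1ℤ - z) (ind-no (p ℕ∣.∣? d) p∤d)

  avoiding-yes : ∀ {p d} → p ℕ∣.∣ d → avoiding p d ≡ 0ℤ
  avoiding-yes {p} {d} p∣d = cong (λ z → 1ℤ - z) (ind-yes (p ℕ∣.∣? d) p∣d)

  coprimeDivisorSum : ℕ → ℕ → ℤ
  coprimeDivisorSum p A = restricted (avoiding p) (suc A) A

  module _ {p} (pr : Prime p) where

    private instance
      p≢0 : ℕ.NonZero p
      p≢0 = Primality.prime⇒nonZero pr

    coprime-divides : ∀ {d A} → ¬ (p ℕ∣.∣ d) → d ℕ∣.∣ A ℕ.* p → d ℕ∣.∣ A
    coprime-divides {d} {A} p∤d d∣ = Coprimality.coprime-divisor d⊥p (subst (d ℕ∣.∣_) (ℕₚ.*-comm A p) d∣)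
      where
      d⊥p : Coprime d p
      d⊥p {e} (e∣d , e∣p) with Primality.prime⇒irreducible pr e∣p
      ... | inj₁ e≡1 = e≡1
      ... | inj₂ refl = ⊥-elim (p∤d e∣d)

    coprimeDivisorSum-* : ∀ A → 1 ℕ.≤ A → restricted (avoiding p) (suc A ℕ.* p) (A ℕ.* p) ≡ coprimeDivisorSum p A
    coprimeDivisorSum-* A 1≤A = trans (∑-cong (suc A ℕ.* p) (λ d _ → cong (χ d *_) (same d)))
      (restricted-range (avoiding p) 1≤A (ℕₚ.m≤m*n (suc A) p))
      where
      same : ∀ d → ind (d ℕ∣.∣? (A ℕ.* p)) * avoiding p d ≡ ind (d ℕ∣.∣? A) * avoiding p d
      same d = by-cases (p ℕ∣.∣? d)
        where
        by-cases : Dec (p ℕ∣.∣ d) → ind (d ℕ∣.∣? (A ℕ.* p)) * avoiding p d ≡ ind (d ℕ∣.∣? A) * avoiding p d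
        by-cases (no p∤d)  = cong (_* avoiding p d) (ind-cong (d ℕ∣.∣? (A ℕ.* p)) (d ℕ∣.∣? A) (coprime-divides p∤d) (λ d∣A → ℕ∣.∣m⇒∣m*n p d∣A))
        by-cases (yes p∣d) = trans (trans (cong (ind (d ℕ∣.∣? (A ℕ.* p)) *_) (avoiding-yes p∣d)) (ℤₚ.*-zeroʳ (ind (d ℕ∣.∣? (A ℕ.* p)))))
          (sym (trans (cong (ind (d ℕ∣.∣? A) *_) (avoiding-yes p∣d)) (ℤₚ.*-zeroʳ (ind (d ℕ∣.∣? A)))))

    A*p<1+A*p : ∀ A → A ℕ.* p ℕ.< suc A ℕ.* p
    A*p<1+A*p A = ℕₚ.*-monoˡ-< p (ℕₚ.n<1+n A)

    divisorSum-* : ∀ A → 1 ℕ.≤ A → divisorSum (A ℕ.* p) ≡ χ p * divisorSum A + coprimeDivisorSum p A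
    divisorSum-* A 1≤A = begin
      divisorSum (A ℕ.* p)
        ≡⟨ restricted-range (λ _ → 1ℤ) (ℕₚ.*-mono-≤ 1≤A (ℕ.>-nonZero⁻¹ p)) (A*p<1+A*p A) ⟨
      ∑ M (λ d → χ d * (ind (d ℕ∣.∣? (A ℕ.* p)) * 1ℤ))
        ≡⟨ ∑-cong M (λ d _ → split (χ d) (ind (d ℕ∣.∣? (A ℕ.* p))) (ind (p ℕ∣.∣? d))) ⟩
      ∑ M (λ d → ind (p ℕ∣.∣? d) * F d + χ d * (ind (d ℕ∣.∣? (A ℕ.* p)) * avoiding p d))
        ≡⟨ ∑-+ M (λ d → ind (p ℕ∣.∣? d) * F d) (λ d → χ d * (ind (d ℕ∣.∣? (A ℕ.* p)) * avoiding p d)) ⟩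
      ∑ M (λ d → ind (p ℕ∣.∣? d) * F d) + restricted (avoiding p) M (A ℕ.* p)
        ≡⟨ cong₂ _+_ (trans (∑-multiples p (suc A) F) (trans (∑-cong (suc A) (λ d _ → multiple-term d))
             (∑-* (suc A) (χ p) (λ d → χ d * (ind (d ℕ∣.∣? A) * 1ℤ))))) (coprimeDivisorSum-* A 1≤A) ⟩
      χ p * divisorSum A + coprimeDivisorSum p A ∎
      where
      open ≡-Reasoning
      M : ℕ
      M = suc A ℕ.* p
      F : ℕ → ℤ
      F d = χ d * ind (d ℕ∣.∣? (A ℕ.* p))
      split : ∀ x i j → x * (i * 1ℤ) ≡ j * (x * i) + x * (i * (1ℤ - j))
      split = solve-∀
      multiple-term : ∀ d → F (d ℕ.* p) ≡ χ p * (χ d * (ind (d ℕ∣.∣? A) * 1ℤ))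
      multiple-term d = trans (cong₂ _*_ (χ-* d p) (ind-cong ((d ℕ.* p) ℕ∣.∣? (A ℕ.* p)) (d ℕ∣.∣? A)
        (ℕ∣.*-cancelʳ-∣ p) (ℕ∣.*-monoˡ-∣ p))) (lemma (χ d) (χ p) (ind (d ℕ∣.∣? A)))
        where
        lemma : ∀ x y i → x * y * i ≡ y * (x * (i * 1ℤ))
        lemma = solve-∀

    coprimeDivisorSum-power : ∀ k m → 1 ℕ.≤ m → coprimeDivisorSum p (p ℕ.^ k ℕ.* m) ≡ coprimeDivisorSum p m
    coprimeDivisorSum-power zero    m 1≤m = cong (coprimeDivisorSum p) (ℕₚ.+-identityʳ m)
    coprimeDivisorSum-power (suc k) m 1≤m = begin
      coprimeDivisorSum p (p ℕ.^ suc k ℕ.* m)  ≡⟨ cong (coprimeDivisorSum p) (shuffle p (p ℕ.^ k) m) ⟩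
      coprimeDivisorSum p (A ℕ.* p)            ≡⟨ restricted-range (avoiding p) (ℕₚ.*-mono-≤ 1≤A (ℕ.>-nonZero⁻¹ p)) (A*p<1+A*p A) ⟨
      restricted (avoiding p) (suc A ℕ.* p) (A ℕ.* p) ≡⟨ coprimeDivisorSum-* A 1≤A ⟩
      coprimeDivisorSum p A                    ≡⟨ coprimeDivisorSum-power k m 1≤m ⟩
      coprimeDivisorSum p m                    ∎
      where
      open ≡-Reasoning
      A : ℕ
      A = p ℕ.^ k ℕ.* m
      1≤A : 1 ℕ.≤ A
      1≤A = ℕₚ.*-mono-≤ (ℕₚ.m^n>0 p k) 1≤m
      shuffle : ∀ p q m → p ℕ.* q ℕ.* m ≡ q ℕ.* m ℕ.* p
      shuffle = ℕ-Ring.solve-∀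

    geometric : ℕ → ℤ
    geometric zero    = 1ℤ
    geometric (suc k) = χ p * geometric k + 1ℤ

    divisorSum-power : ∀ k m → 1 ℕ.≤ m → ¬ (p ℕ∣.∣ m) → divisorSum (p ℕ.^ k ℕ.* m) ≡ geometric k * divisorSum m
    divisorSum-power zero    m 1≤m p∤m = trans (cong divisorSum (ℕₚ.+-identityʳ m)) (sym (ℤₚ.*-identityˡ _))
    divisorSum-power (suc k) m 1≤m p∤m = begin
      divisorSum (p ℕ.^ suc k ℕ.* m)                     ≡⟨ cong divisorSum (shuffle p (p ℕ.^ k) m) ⟩
      divisorSum (A ℕ.* p)                               ≡⟨ divisorSum-* A (ℕₚ.*-mono-≤ (ℕₚ.m^n>0 p k) 1≤m) ⟩
      χ p * divisorSum A + coprimeDivisorSum p A         ≡⟨ cong₂ (λ x y → χ p * x + y) (divisorSum-power k m 1≤m p∤m)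
                                                             (trans (coprimeDivisorSum-power k m 1≤m) all-coprime) ⟩
      χ p * (geometric k * divisorSum m) + divisorSum m  ≡⟨ lemma (χ p) (geometric k) (divisorSum m) ⟩
      (χ p * geometric k + 1ℤ) * divisorSum m            ∎
      where
      open ≡-Reasoning
      A : ℕ
      A = p ℕ.^ k ℕ.* m
      shuffle : ∀ p q m → p ℕ.* q ℕ.* m ≡ q ℕ.* m ℕ.* p
      shuffle = ℕ-Ring.solve-∀
      lemma : ∀ x g s → x * (g * s) + s ≡ (x * g + 1ℤ) * s
      lemma = solve-∀
      all-coprime : coprimeDivisorSum p m ≡ divisorSum m
      all-coprime = ∑-cong (suc m) (λ d _ → cong (χ d *_) (term d))
        where
        term : ∀ d → ind (d ℕ∣.∣? m) * avoiding p d ≡ ind (d ℕ∣.∣? m) * 1ℤ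
        term d = by-cases (d ℕ∣.∣? m)
          where
          by-cases : (d∣m? : Dec (d ℕ∣.∣ m)) → ind d∣m? * avoiding p d ≡ ind d∣m? * 1ℤ
          by-cases (yes d∣m) = cong (1ℤ *_) (avoiding-no (λ p∣d → p∤m (ℕ∣.∣-trans p∣d d∣m)))
          by-cases (no _)    = refl

    geometric-nonneg : ∀ k → 0ℤ ≤ geometric k × 1ℤ ≤ geometric (k ℕ.+ k)
    geometric-nonneg k = by-value (χ-value p)
      where
      vanishing : χ p ≡ 0ℤ → ∀ k → geometric k ≡ 1ℤ
      vanishing e zero    = refl
      vanishing e (suc k) = cong (λ x → x * geometric k + 1ℤ) e
      positive : χ p ≡ 1ℤ → ∀ k → 1ℤ ≤ geometric k
      positive e zero    = ℤₚ.≤-refl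
      positive e (suc k) = subst (λ x → 1ℤ ≤ x * geometric k + 1ℤ) (sym e)
        (ℤₚ.≤-trans {j = 1ℤ + 1ℤ} (+≤+ (s≤s z≤n)) (ℤₚ.+-monoˡ-≤ 1ℤ (subst (1ℤ ≤_) (sym (ℤₚ.*-identityˡ (geometric k))) (positive e k))))
      alternating : χ p ≡ -1ℤ → ∀ k → (geometric (k ℕ.+ k) ≡ 1ℤ) × (geometric (suc (k ℕ.+ k)) ≡ 0ℤ)
      alternating e zero    = refl , cong (λ x → x * 1ℤ + 1ℤ) e
      alternating e (suc k) = subst (λ n → geometric n ≡ 1ℤ × geometric (suc n) ≡ 0ℤ) (cong suc (sym (ℕₚ.+-suc k k)))
        (even , trans (cong₂ (λ x y → x * y + 1ℤ) e even) refl)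
        where
        even : geometric (suc (suc (k ℕ.+ k))) ≡ 1ℤ
        even = cong₂ (λ x y → x * y + 1ℤ) e (proj₂ (alternating e k))
      by-value : χ p ≡ 0ℤ ⊎ IsSign (χ p) → 0ℤ ≤ geometric k × 1ℤ ≤ geometric (k ℕ.+ k)
      by-value (inj₁ e) = subst (0ℤ ≤_) (sym (vanishing e k)) (+≤+ z≤n) , ℤₚ.≤-reflexive (sym (vanishing e (k ℕ.+ k)))
      by-value (inj₂ (inj₁ e)) = ℤₚ.≤-trans (+≤+ z≤n) (positive e k) , positive e (k ℕ.+ k)
      by-value (inj₂ (inj₂ e)) = nonneg (half k) , ℤₚ.≤-reflexive (sym (proj₁ (alternating e k)))
        where
        nonneg : ∃[ j ] (k ≡ j ℕ.+ j ⊎ k ≡ suc (j ℕ.+ j)) → 0ℤ ≤ geometric k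
        nonneg (j , inj₁ refl) = subst (0ℤ ≤_) (sym (proj₁ (alternating e j))) (+≤+ z≤n)
        nonneg (j , inj₂ refl) = ℤₚ.≤-reflexive (sym (proj₂ (alternating e j)))

    geometric-odd : χ p ≡ -1ℤ → ∀ k → geometric (suc (k ℕ.+ k)) ≡ 0ℤ
    geometric-odd e zero    = cong (λ x → x * 1ℤ + 1ℤ) e
    geometric-odd e (suc k) = subst (λ n → geometric (suc n) ≡ 0ℤ) (cong suc (sym (ℕₚ.+-suc k k)))
      (trans (cong (λ x → x * (x * geometric (suc (k ℕ.+ k)) + 1ℤ) + 1ℤ) e) (cong (λ y → -1ℤ * (-1ℤ * y + 1ℤ) + 1ℤ) (geometric-odd e k)))

  divisorSum-1 : divisorSum 1 ≡ 1ℤ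
  divisorSum-1 = trans (lemma (χ 0) (χ 1)) χ-1
    where
    lemma : ∀ x y → 0ℤ + x * (0ℤ * 1ℤ) + y * (1ℤ * 1ℤ) ≡ y
    lemma = solve-∀

module DivisorSumPositivity (χ : ℕ → ℤ) (χ-* : ∀ a b → χ (a ℕ.* b) ≡ χ a * χ b) (χ-1 : χ 1 ≡ 1ℤ)
                            (χ-value : ∀ a → χ a ≡ 0ℤ ⊎ IsSign (χ a)) where
  open DivisorSum χ χ-* χ-1 χ-value public

  divisorSum-nonneg : ∀ A → 1 ℕ.≤ A → 0ℤ ≤ divisorSum A
  divisorSum-nonneg = prime-power-induction (λ A → 0ℤ ≤ divisorSum A) (subst (0ℤ ≤_) (sym divisorSum-1) (+≤+ z≤n))
    (λ p k m pr p∤m 1≤m ih → subst (0ℤ ≤_) (sym (divisorSum-power pr k m 1≤m p∤m)) (0≤* (proj₁ (geometric-nonneg pr k)) ih))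

  divisorSum-square : ∀ s → 1 ℕ.≤ s → 1ℤ ≤ divisorSum (s ℕ.* s)
  divisorSum-square = prime-power-induction (λ s → 1ℤ ≤ divisorSum (s ℕ.* s)) (ℤₚ.≤-reflexive (sym divisorSum-1)) step
    where
    1≤* : ∀ {x y} → 1ℤ ≤ x → 1ℤ ≤ y → 1ℤ ≤ x * y
    1≤* {x} {y} 1≤x 1≤y = ℤₚ.0≤i-j⇒j≤i (subst (0ℤ ≤_) (lemma x y) (0≤+ (0≤+ (0≤* x′ y′) x′) y′))
      where
      x′ : 0ℤ ≤ x - 1ℤ
      x′ = ℤₚ.i≤j⇒0≤j-i 1≤x
      y′ : 0ℤ ≤ y - 1ℤ
      y′ = ℤₚ.i≤j⇒0≤j-i 1≤y
      lemma : ∀ x y → (x - 1ℤ) * (y - 1ℤ) + (x - 1ℤ) + (y - 1ℤ) ≡ x * y - 1ℤ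
      lemma = solve-∀
    step : ∀ p k m → Prime p → ¬ (p ℕ∣.∣ m) → 1 ℕ.≤ m → 1ℤ ≤ divisorSum (m ℕ.* m) →
           1ℤ ≤ divisorSum (p ℕ.^ k ℕ.* m ℕ.* (p ℕ.^ k ℕ.* m))
    step p k m pr p∤m 1≤m ih = subst (1ℤ ≤_) (sym (trans (cong divisorSum shuffled)
        (divisorSum-power pr (k ℕ.+ k) (m ℕ.* m) (ℕₚ.*-mono-≤ 1≤m 1≤m) p∤m²)))
      (1≤* (proj₂ (geometric-nonneg pr k)) ih)
      where
      p∤m² : ¬ (p ℕ∣.∣ m ℕ.* m)
      p∤m² d = [ p∤m , p∤m ]′ (euclidsLemma m m pr d)
      shuffled : p ℕ.^ k ℕ.* m ℕ.* (p ℕ.^ k ℕ.* m) ≡ p ℕ.^ (k ℕ.+ k) ℕ.* (m ℕ.* m)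
      shuffled = trans (lemma (p ℕ.^ k) m) (cong (ℕ._* (m ℕ.* m)) (sym (ℕₚ.^-distribˡ-+-* p k k)))
        where
        lemma : ∀ q m → q ℕ.* m ℕ.* (q ℕ.* m) ≡ q ℕ.* q ℕ.* (m ℕ.* m)
        lemma = ℕ-Ring.solve-∀

  -- A nonzero divisor sum forces every prime with χ(p) = -1 to divide A to an even power,
  -- so up to a square A is a product of distinct primes with χ(p) = 1.
  divisorSum-kernel : (Q : ℕ → Set) → Q 1 → (∀ p m → Prime p → ¬ (p ℕ∣.∣ m) → χ p ≡ 1ℤ → Q m → Q (p ℕ.* m)) →
    ∀ A → 1 ℕ.≤ A → χ A ≢ 0ℤ → divisorSum A ≢ 0ℤ → ∃[ α ] ∃[ σ ] A ≡ α ℕ.* (σ ℕ.* σ) × Q α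
  divisorSum-kernel Q Q1 Qp A 1≤A = prime-power-induction
    (λ A → χ A ≢ 0ℤ → divisorSum A ≢ 0ℤ → ∃[ α ] ∃[ σ ] A ≡ α ℕ.* (σ ℕ.* σ) × Q α)
    (λ _ _ → 1 , 1 , refl , Q1) step A 1≤A
    where
    step : ∀ p k m → Prime p → ¬ (p ℕ∣.∣ m) → 1 ℕ.≤ m →
      (χ m ≢ 0ℤ → divisorSum m ≢ 0ℤ → ∃[ α ] ∃[ σ ] m ≡ α ℕ.* (σ ℕ.* σ) × Q α) →
      χ (p ℕ.^ k ℕ.* m) ≢ 0ℤ → divisorSum (p ℕ.^ k ℕ.* m) ≢ 0ℤ →
      ∃[ α ] ∃[ σ ] p ℕ.^ k ℕ.* m ≡ α ℕ.* (σ ℕ.* σ) × Q α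
    step p k m pr p∤m 1≤m ih χ≢0 s≢0 = by-parity (half k) (ih χm≢0 sm≢0)
      where
      s≡ : divisorSum (p ℕ.^ k ℕ.* m) ≡ geometric pr k * divisorSum m
      s≡ = divisorSum-power pr k m 1≤m p∤m
      χm≢0 : χ m ≢ 0ℤ
      χm≢0 e = χ≢0 (trans (χ-* (p ℕ.^ k) m) (trans (cong (χ (p ℕ.^ k) *_) e) (ℤₚ.*-zeroʳ (χ (p ℕ.^ k)))))
      sm≢0 : divisorSum m ≢ 0ℤ
      sm≢0 e = s≢0 (trans s≡ (trans (cong (geometric pr k *_) e) (ℤₚ.*-zeroʳ (geometric pr k))))
      by-parity : ∃[ j ] (k ≡ j ℕ.+ j ⊎ k ≡ suc (j ℕ.+ j)) → ∃[ α ] ∃[ σ ] m ≡ α ℕ.* (σ ℕ.* σ) × Q α →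
                  ∃[ α ] ∃[ σ ] p ℕ.^ k ℕ.* m ≡ α ℕ.* (σ ℕ.* σ) × Q α
      by-parity (j , inj₁ refl) (α , σ , eq , q) = α , p ℕ.^ j ℕ.* σ ,
        trans (cong₂ ℕ._*_ (ℕₚ.^-distribˡ-+-* p j j) eq) (lemma (p ℕ.^ j) α σ) , q
        where
        lemma : ∀ P α σ → P ℕ.* P ℕ.* (α ℕ.* (σ ℕ.* σ)) ≡ α ℕ.* (P ℕ.* σ ℕ.* (P ℕ.* σ))
        lemma = ℕ-Ring.solve-∀
      by-parity (j , inj₂ refl) (α , σ , eq , q) = p ℕ.* α , p ℕ.^ j ℕ.* σ ,
        trans (cong₂ (λ x y → p ℕ.* x ℕ.* y) (ℕₚ.^-distribˡ-+-* p j j) eq) (lemma p (p ℕ.^ j) α σ) ,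
        Qp p α pr (λ p∣α → p∤m (subst (p ℕ∣.∣_) (sym eq) (ℕ∣.∣m⇒∣m*n (σ ℕ.* σ) p∣α))) (χp≡1 (χ-value p)) q
        where
        lemma : ∀ p P α σ → p ℕ.* (P ℕ.* P) ℕ.* (α ℕ.* (σ ℕ.* σ)) ≡ p ℕ.* α ℕ.* (P ℕ.* σ ℕ.* (P ℕ.* σ))
        lemma = ℕ-Ring.solve-∀
        χp≡1 : χ p ≡ 0ℤ ⊎ IsSign (χ p) → χ p ≡ 1ℤ
        χp≡1 (inj₂ (inj₁ e)) = e
        χp≡1 (inj₂ (inj₂ e)) = ⊥-elim (s≢0 (trans s≡ (cong (_* divisorSum m) (geometric-odd pr e j))))
        χp≡1 (inj₁ e) = ⊥-elim (χ≢0 (trans (cong χ (ℕₚ.*-assoc p (p ℕ.^ (j ℕ.+ j)) m))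
          (trans (χ-* p (p ℕ.^ (j ℕ.+ j) ℕ.* m)) (cong (_* χ (p ℕ.^ (j ℕ.+ j) ℕ.* m)) e))))

-- A weak form of Dirichlet's theorem

∑-mono : ∀ n {f g : ℕ → ℤ} → (∀ i → i ℕ.< n → f i ≤ g i) → ∑ n f ≤ ∑ n g
∑-mono zero    h = ℤₚ.≤-refl
∑-mono (suc n) h = ℤₚ.+-mono-≤ (∑-mono n (λ i i<n → h i (ℕₚ.m≤n⇒m≤1+n i<n))) (h n ℕₚ.≤-refl)

+-cancelˡ : ∀ a {x y : ℤ} → a + x ≡ a + y → x ≡ y
+-cancelˡ a {x} {y} e = trans (lemma a x) (trans (cong (λ z → z - a) e) (sym (lemma a y)))
  where
  lemma : ∀ a x → x ≡ a + x - a
  lemma = solve-∀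

∑-shift : ∀ n f → f n ≡ f 0 → ∑ n (f ∘ suc) ≡ ∑ n f
∑-shift n f e = +-cancelˡ (f 0) (trans (sym (∑-head n f)) (trans (cong (λ z → ∑ n f + z) e) (ℤₚ.+-comm (∑ n f) (f 0))))

∑-periodic : ∀ N .{{_ : ℕ.NonZero N}} (f : ℕ → ℤ) → (∀ i → f (N ℕ.+ i) ≡ f i) → ∑ N f ≡ 0ℤ → ∀ v → ∑ v f ≡ ∑ (v % N) f
∑-periodic N f period zero-sum v = trans (cong (λ k → ∑ k f) (ℕ÷.m≡m%n+[m/n]*n v N)) (blocks (v % N) (v / N))
  where
  blocks : ∀ r q → ∑ (r ℕ.+ q ℕ.* N) f ≡ ∑ r f
  blocks r zero    = cong (λ k → ∑ k f) (ℕₚ.+-identityʳ r)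
  blocks r (suc q) = begin
    ∑ (r ℕ.+ (N ℕ.+ q ℕ.* N)) f                     ≡⟨ cong (λ k → ∑ k f) (lemma r N (q ℕ.* N)) ⟩
    ∑ (N ℕ.+ (r ℕ.+ q ℕ.* N)) f                     ≡⟨ ∑-append N (r ℕ.+ q ℕ.* N) f ⟩
    ∑ N f + ∑ (r ℕ.+ q ℕ.* N) (λ i → f (N ℕ.+ i))   ≡⟨ cong₂ _+_ zero-sum (∑-cong (r ℕ.+ q ℕ.* N) (λ i _ → period i)) ⟩
    0ℤ + ∑ (r ℕ.+ q ℕ.* N) f                        ≡⟨ trans (ℤₚ.+-identityˡ _) (blocks r q) ⟩
    ∑ r f                                           ∎
    where
    open ≡-Reasoning
    lemma : ∀ a b c → a ℕ.+ (b ℕ.+ c) ≡ b ℕ.+ (a ℕ.+ c)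
    lemma = ℕ-Ring.solve-∀

%-*-cong : ∀ {N} .{{_ : ℕ.NonZero N}} a a′ b b′ → a % N ≡ a′ % N → b % N ≡ b′ % N → (a ℕ.* b) % N ≡ (a′ ℕ.* b′) % N
%-*-cong {N} a a′ b b′ e f = trans (ℕ÷.%-distribˡ-* a b N)
  (trans (cong₂ (λ x y → (x ℕ.* y) % N) e f) (sym (ℕ÷.%-distribˡ-* a′ b′ N)))

n<2^n : ∀ n → n ℕ.< 2 ℕ.^ n
n<2^n zero    = s≤s z≤n
n<2^n (suc n) = ℕₚ.≤-trans (s≤s (n<2^n n)) (ℕₚ.≤-trans (ℕₚ.+-monoˡ-≤ (2 ℕ.^ n) (ℕₚ.m^n>0 2 n))
  (ℕₚ.≤-reflexive (cong (2 ℕ.^ n ℕ.+_) (sym (ℕₚ.+-identityʳ (2 ℕ.^ n))))))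

exponential-beats-linear : ∀ M → ∃[ K ] M ℕ.* suc K ℕ.< 2 ℕ.^ K
exponential-beats-linear M = j ℕ.+ j , (begin-strict
  M ℕ.* suc (j ℕ.+ j)                       <⟨ s≤s (ℕₚ.m≤m+n _ (M ℕ.+ M ℕ.+ M)) ⟩
  suc (M ℕ.* suc (j ℕ.+ j) ℕ.+ (M ℕ.+ M ℕ.+ M)) ≡⟨ lemma M ⟩
  suc j ℕ.* suc j                           ≤⟨ ℕₚ.*-mono-≤ (n<2^n j) (n<2^n j) ⟩
  2 ℕ.^ j ℕ.* 2 ℕ.^ j                       ≡⟨ ℕₚ.^-distribˡ-+-* 2 j j ⟨
  2 ℕ.^ (j ℕ.+ j)                           ∎)
  where
  open ℕₚ.≤-Reasoning
  j : ℕ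
  j = M ℕ.+ M
  lemma : ∀ M → suc (M ℕ.* suc (M ℕ.+ M ℕ.+ (M ℕ.+ M)) ℕ.+ (M ℕ.+ M ℕ.+ M)) ≡ suc (M ℕ.+ M) ℕ.* suc (M ℕ.+ M)
  lemma = ℕ-Ring.solve-∀

-- For a real character χ and a class c with χ(c) = 1, the sum Σ χ(d) (X - de)₊ over de ≡ c differs by
-- O(X log X) from the same sum over de ≡ 1, since the difference of the two indicator functions
-- sums to zero over a period in d and in e.  The sum for the class 1 is at least the contribution of
-- the squares, of order X^{3/2}.
module WeakDirichlet (N : ℕ) {{N≢0 : ℕ.NonZero N}} (χ : ℕ → ℤ) (χ-* : ∀ a b → χ (a ℕ.* b) ≡ χ a * χ b) (χ-1 : χ 1 ≡ 1ℤ)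
                     (χ-value : ∀ a → χ a ≡ 0ℤ ⊎ IsSign (χ a)) (χ-% : ∀ a → χ (a % N) ≡ χ a)
                     (χ-inverse : ∀ a → χ a ≢ 0ℤ → ∃[ b ] (b ℕ.* a) % N ≡ 1 % N) where
  open DivisorSumPositivity χ χ-* χ-1 χ-value public

  χ-cong : ∀ {a b} → a % N ≡ b % N → χ a ≡ χ b
  χ-cong {a} {b} e = trans (sym (χ-% a)) (trans (cong χ e) (χ-% b))

  kernel : ℕ → ℕ → ℕ → ℤ
  kernel c d e = χ d * ind ((d ℕ.* e) % N ℕₚ.≟ c % N)

  kernel-bound : ∀ c d e → ∣ kernel c d e ∣ ℕ.≤ 1
  kernel-bound c d e = ℕₚ.≤-trans (ℕₚ.≤-reflexive (ℤₚ.abs-* (χ d) (ind ((d ℕ.* e) % N ℕₚ.≟ c % N))))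
    (ℕₚ.*-mono-≤ (sign-bound (χ-value d)) (ind-bound ((d ℕ.* e) % N ℕₚ.≟ c % N)))
    where
    sign-bound : ∀ {x} → x ≡ 0ℤ ⊎ IsSign x → ∣ x ∣ ℕ.≤ 1
    sign-bound (inj₁ refl)        = z≤n
    sign-bound (inj₂ (inj₁ refl)) = ℕₚ.≤-refl
    sign-bound (inj₂ (inj₂ refl)) = ℕₚ.≤-refl
    ind-bound : {P : Set} (P? : Dec P) → ∣ ind P? ∣ ℕ.≤ 1
    ind-bound (yes _) = ℕₚ.≤-refl
    ind-bound (no _)  = z≤n

  unit-cancel : ∀ u u⁻¹ → (u⁻¹ ℕ.* u) % N ≡ 1 % N → ∀ x c → (x ℕ.* u) % N ≡ c % N → x % N ≡ (u⁻¹ ℕ.* c) % N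
  unit-cancel u u⁻¹ inv x c e = begin
    x % N                       ≡⟨ cong (_% N) (ℕₚ.*-identityʳ x) ⟨
    (x ℕ.* 1) % N               ≡⟨ %-*-cong x x 1 (u⁻¹ ℕ.* u) refl (sym inv) ⟩
    (x ℕ.* (u⁻¹ ℕ.* u)) % N     ≡⟨ cong (_% N) (lemma x u⁻¹ u) ⟩
    (u⁻¹ ℕ.* (x ℕ.* u)) % N     ≡⟨ %-*-cong u⁻¹ u⁻¹ (x ℕ.* u) c refl e ⟩
    (u⁻¹ ℕ.* c) % N             ∎
    where
    open ≡-Reasoning
    lemma : ∀ x v u → x ℕ.* (v ℕ.* u) ≡ v ℕ.* (x ℕ.* u)
    lemma = ℕ-Ring.solve-∀

  unit-restore : ∀ u u⁻¹ → (u⁻¹ ℕ.* u) % N ≡ 1 % N → ∀ x c → x % N ≡ (u⁻¹ ℕ.* c) % N → (x ℕ.* u) % N ≡ c % N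
  unit-restore u u⁻¹ inv x c e = begin
    (x ℕ.* u) % N               ≡⟨ %-*-cong x (u⁻¹ ℕ.* c) u u e refl ⟩
    (u⁻¹ ℕ.* c ℕ.* u) % N       ≡⟨ cong (_% N) (lemma u⁻¹ c u) ⟩
    (u⁻¹ ℕ.* u ℕ.* c) % N       ≡⟨ %-*-cong (u⁻¹ ℕ.* u) 1 c c inv refl ⟩
    (1 ℕ.* c) % N               ≡⟨ cong (_% N) (ℕₚ.*-identityˡ c) ⟩
    c % N                       ∎
    where
    open ≡-Reasoning
    lemma : ∀ v c u → v ℕ.* c ℕ.* u ≡ v ℕ.* u ℕ.* c
    lemma = ℕ-Ring.solve-∀

  ∑-unit : ∀ u u⁻¹ → (u⁻¹ ℕ.* u) % N ≡ 1 % N → ∀ c (F : ℕ → ℤ) →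
           ∑ N (λ x → F x * ind ((x ℕ.* u) % N ℕₚ.≟ c % N)) ≡ F ((u⁻¹ ℕ.* c) % N)
  ∑-unit u u⁻¹ inv c F = begin
    ∑ N (λ x → F x * ind ((x ℕ.* u) % N ℕₚ.≟ c % N)) ≡⟨ ∑-cong N (λ x x<N → cong (F x *_) (ind-cong ((x ℕ.* u) % N ℕₚ.≟ c % N) (x ℕₚ.≟ x₀)
        (λ e → trans (sym (ℕ÷.m<n⇒m%n≡m x<N)) (unit-cancel u u⁻¹ inv x c e))
        (λ e → unit-restore u u⁻¹ inv x c (trans (ℕ÷.m<n⇒m%n≡m x<N) e)))) ⟩
    ∑ N (λ x → F x * ind (x ℕₚ.≟ x₀)) ≡⟨ ∑-single N x₀ (ℕ÷.m%n<n (u⁻¹ ℕ.* c) N) (λ x x≢ → trans (cong (F x *_) (ind-no (x ℕₚ.≟ x₀) x≢)) (ℤₚ.*-zeroʳ (F x))) ⟩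
    F x₀ * ind (x₀ ℕₚ.≟ x₀)           ≡⟨ trans (cong (F x₀ *_) (ind-yes (x₀ ℕₚ.≟ x₀) refl)) (ℤₚ.*-identityʳ (F x₀)) ⟩
    F x₀                              ∎
    where
    open ≡-Reasoning
    x₀ : ℕ
    x₀ = (u⁻¹ ℕ.* c) % N

  kernel-row : ∀ c d → ∑ N (kernel c d) ≡ χ d
  kernel-row c d = by-cases (χ d ℤₚ.≟ 0ℤ)
    where
    by-cases : Dec (χ d ≡ 0ℤ) → ∑ N (kernel c d) ≡ χ d
    by-cases (yes e) = trans (∑-zero N (λ x _ → cong (_* ind ((d ℕ.* x) % N ℕₚ.≟ c % N)) e)) (sym e)
    by-cases (no ne) = trans (∑-cong N (λ x _ → cong (λ y → χ d * ind (y % N ℕₚ.≟ c % N)) (ℕₚ.*-comm d x)))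
      (∑-unit d (proj₁ (χ-inverse d ne)) (proj₂ (χ-inverse d ne)) c (λ _ → χ d))

  kernel-column : ∀ {c c′} e → χ c ≡ 1ℤ → χ c′ ≡ 1ℤ → ∑ N (λ d → kernel c d e) ≡ ∑ N (λ d → kernel c′ d e)
  kernel-column {c} {c′} e χc χc′ = by-cases (χ e ℤₚ.≟ 0ℤ)
    where
    vanish : χ e ≡ 0ℤ → ∀ {c} → χ c ≡ 1ℤ → ∑ N (λ d → kernel c d e) ≡ 0ℤ
    vanish χe {c} χc = ∑-zero N (λ d _ → trans (cong (χ d *_) (ind-no ((d ℕ.* e) % N ℕₚ.≟ c % N) (λ eq →
      0≢1 (trans (sym (trans (χ-* d e) (trans (cong (χ d *_) χe) (ℤₚ.*-zeroʳ (χ d))))) (trans (χ-cong eq) χc))))) (ℤₚ.*-zeroʳ (χ d)))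
      where
      0≢1 : 0ℤ ≢ 1ℤ
      0≢1 ()
    at-unit : (ne : χ e ≢ 0ℤ) → ∀ {c} → χ c ≡ 1ℤ → ∑ N (λ d → kernel c d e) ≡ χ (proj₁ (χ-inverse e ne))
    at-unit ne {c} χc = let (e⁻¹ , inv) = χ-inverse e ne in
      trans (∑-unit e e⁻¹ inv c χ) (trans (χ-% (e⁻¹ ℕ.* c)) (trans (χ-* e⁻¹ c) (trans (cong (χ e⁻¹ *_) χc) (ℤₚ.*-identityʳ (χ e⁻¹)))))
    by-cases : Dec (χ e ≡ 0ℤ) → ∑ N (λ d → kernel c d e) ≡ ∑ N (λ d → kernel c′ d e)
    by-cases (yes χe) = trans (vanish χe χc) (sym (vanish χe χc′))
    by-cases (no ne)  = trans (at-unit ne χc) (sym (at-unit ne χc′))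

  module _ {c c′} (χc : χ c ≡ 1ℤ) (χc′ : χ c′ ≡ 1ℤ) where

    difference : ℕ → ℕ → ℤ
    difference i j = kernel c (suc i) (suc j) - kernel c′ (suc i) (suc j)

    kernel-period-e : ∀ c d e → kernel c d (N ℕ.+ e) ≡ kernel c d e
    kernel-period-e c d e = cong (λ r → χ d * ind (r ℕₚ.≟ c % N)) (trans (cong (_% N) (lemma d N e)) (ℕ÷.[m+kn]%n≡m%n (d ℕ.* e) d N))
      where
      lemma : ∀ d n e → d ℕ.* (n ℕ.+ e) ≡ d ℕ.* e ℕ.+ d ℕ.* n
      lemma = ℕ-Ring.solve-∀

    kernel-period-d : ∀ c d e → kernel c (N ℕ.+ d) e ≡ kernel c d e
    kernel-period-d c d e = cong₂ (λ x r → x * ind (r ℕₚ.≟ c % N)) (χ-cong (trans (cong (_% N) (ℕₚ.+-comm N d)) (ℕ÷.[m+n]%n≡m%n d N)))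
      (trans (cong (_% N) (lemma d N e)) (ℕ÷.[m+kn]%n≡m%n (d ℕ.* e) e N))
      where
      lemma : ∀ d n e → (n ℕ.+ d) ℕ.* e ≡ d ℕ.* e ℕ.+ e ℕ.* n
      lemma = ℕ-Ring.solve-∀

    difference-row : ∀ i → ∑ N (difference i) ≡ 0ℤ
    difference-row i = trans (∑-- N (λ j → kernel c (suc i) (suc j)) (λ j → kernel c′ (suc i) (suc j)))
      (ℤₚ.i≡j⇒i-j≡0 (trans (row c) (sym (row c′))))
      where
      row : ∀ c → ∑ N (λ j → kernel c (suc i) (suc j)) ≡ χ (suc i)
      row c = trans (∑-shift N (kernel c (suc i)) (trans (cong (kernel c (suc i)) (sym (ℕₚ.+-identityʳ N))) (kernel-period-e c (suc i) 0)))
        (kernel-row c (suc i))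

    difference-column : ∀ j → ∑ N (λ i → difference i j) ≡ 0ℤ
    difference-column j = trans (∑-- N (λ i → kernel c (suc i) (suc j)) (λ i → kernel c′ (suc i) (suc j)))
      (ℤₚ.i≡j⇒i-j≡0 (trans (column c) (trans (kernel-column (suc j) χc χc′) (sym (column c′)))))
      where
      column : ∀ c → ∑ N (λ i → kernel c (suc i) (suc j)) ≡ ∑ N (λ d → kernel c d (suc j))
      column c = ∑-shift N (λ d → kernel c d (suc j))
        (trans (cong (λ d → kernel c d (suc j)) (sym (ℕₚ.+-identityʳ N))) (kernel-period-d c 0 (suc j)))

    difference-bounded : ∀ u v → ∣ ∑ u (λ i → ∑ v (difference i)) ∣ ℕ.≤ N ℕ.* (N ℕ.* 2)
    difference-bounded u v = begin
      ∣ ∑ u (λ i → ∑ v (difference i)) ∣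
        ≡⟨ cong ∣_∣ (trans (∑-cong u (λ i _ → ∑-periodic N (difference i) (period-e i) (difference-row i) v))
             (∑-swap u (v % N) difference)) ⟩
      ∣ ∑ (v % N) (λ j → ∑ u (λ i → difference i j)) ∣
        ≡⟨ cong ∣_∣ (∑-cong (v % N) (λ j _ → ∑-periodic N (λ i → difference i j) (period-d j) (difference-column j) u)) ⟩
      ∣ ∑ (v % N) (λ j → ∑ (u % N) (λ i → difference i j)) ∣
        ≤⟨ ∣∑∣≤ (v % N) _ (λ _ → N ℕ.* 2) (λ j → ℕₚ.≤-trans (∣∑∣≤ (u % N) _ (λ _ → 2) (λ i → entry i j))
             (ℕₚ.≤-trans (ℕₚ.≤-reflexive (∑ℕ-const (u % N) 2)) (ℕₚ.*-monoˡ-≤ 2 (ℕₚ.<⇒≤ (ℕ÷.m%n<n u N))))) ⟩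
      ∑ℕ (v % N) (λ _ → N ℕ.* 2)
        ≡⟨ ∑ℕ-const (v % N) (N ℕ.* 2) ⟩
      v % N ℕ.* (N ℕ.* 2)
        ≤⟨ ℕₚ.*-monoˡ-≤ (N ℕ.* 2) (ℕₚ.<⇒≤ (ℕ÷.m%n<n v N)) ⟩
      N ℕ.* (N ℕ.* 2) ∎
      where
      open ℕₚ.≤-Reasoning
      entry : ∀ i j → ∣ difference i j ∣ ℕ.≤ 2
      entry i j = ℕₚ.≤-trans (ℤₚ.∣i-j∣≤∣i∣+∣j∣ (kernel c (suc i) (suc j)) (kernel c′ (suc i) (suc j)))
        (ℕₚ.+-mono-≤ (kernel-bound c (suc i) (suc j)) (kernel-bound c′ (suc i) (suc j)))
      period-e : ∀ i j → difference i (N ℕ.+ j) ≡ difference i j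
      period-e i j = cong₂ _-_ (step c) (step c′)
        where
        step : ∀ c → kernel c (suc i) (suc (N ℕ.+ j)) ≡ kernel c (suc i) (suc j)
        step c = trans (cong (kernel c (suc i)) (sym (ℕₚ.+-suc N j))) (kernel-period-e c (suc i) (suc j))
      period-d : ∀ j i → difference (N ℕ.+ i) j ≡ difference i j
      period-d j i = cong₂ _-_ (step c) (step c′)
        where
        step : ∀ c → kernel c (suc (N ℕ.+ i)) (suc j) ≡ kernel c (suc i) (suc j)
        step c = trans (cong (λ d → kernel c d (suc j)) (sym (ℕₚ.+-suc N i))) (kernel-period-d c (suc i) (suc j))

module WeakDirichletConclusion (N : ℕ) {{N≢0 : ℕ.NonZero N}} (χ : ℕ → ℤ) (χ-* : ∀ a b → χ (a ℕ.* b) ≡ χ a * χ b) (χ-1 : χ 1 ≡ 1ℤ)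
                     (χ-value : ∀ a → χ a ≡ 0ℤ ⊎ IsSign (χ a)) (χ-% : ∀ a → χ (a % N) ≡ χ a)
                     (χ-inverse : ∀ a → χ a ≢ 0ℤ → ∃[ b ] (b ℕ.* a) % N ≡ 1 % N) where
  open WeakDirichlet N χ χ-* χ-1 χ-value χ-% χ-inverse public

  module _ (X : ℕ) where

    smoothed : ℕ → ℤ
    smoothed c = ∑ X (λ i → ∑ X (λ j → kernel c (suc i) (suc j) * + (X ℕ.∸ suc i ℕ.* suc j)))

    pairSum : ℕ → ℤ
    pairSum A = ∑ X (λ i → ∑ X (λ j → χ (suc i) * ind (suc i ℕ.* suc j ℕₚ.≟ A)))

    classWeight : ℕ → ℕ → ℤ
    classWeight c A = ind (A % N ℕₚ.≟ c % N) * + (X ℕ.∸ A)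

    smoothed-difference : ∀ {c c′} → χ c ≡ 1ℤ → χ c′ ≡ 1ℤ → ∀ L → X ℕ.≤ 2 ℕ.^ L →
      ∣ smoothed c - smoothed c′ ∣ ℕ.≤ N ℕ.* (N ℕ.* 2) ℕ.* (X ℕ.* (3 ℕ.+ 2 ℕ.* L))
    smoothed-difference {c} {c′} χc χc′ L X≤2^L = subst (λ z → ∣ z ∣ ℕ.≤ N ℕ.* (N ℕ.* 2) ℕ.* (X ℕ.* (3 ℕ.+ 2 ℕ.* L))) (sym eq)
      (Smoothing.smoothed-sum-bound X (difference χc χc′) (N ℕ.* (N ℕ.* 2)) L X≤2^L (difference-bounded χc χc′))
      where
      w : ℕ → ℕ → ℤ
      w i j = + (X ℕ.∸ suc i ℕ.* suc j)
      K : ℕ → ℕ → ℕ → ℤ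
      K c i j = kernel c (suc i) (suc j)
      distrib : ∀ x y z → x * z - y * z ≡ (x - y) * z
      distrib = solve-∀
      eq : smoothed c - smoothed c′ ≡ ∑ X (λ i → ∑ X (λ j → difference χc χc′ i j * w i j))
      eq = trans (sym (∑-- X (λ i → ∑ X (λ j → K c i j * w i j)) (λ i → ∑ X (λ j → K c′ i j * w i j))))
        (∑-cong X (λ i _ → trans (sym (∑-- X (λ j → K c i j * w i j) (λ j → K c′ i j * w i j)))
          (∑-cong X (λ j _ → distrib (K c i j) (K c′ i j) (w i j)))))

    select : ∀ (F : ℕ → ℤ) x m → (X ℕ.≤ m → F m ≡ 0ℤ) → ∑ X (λ A → F A * (x * ind (m ℕₚ.≟ A))) ≡ x * F m
    select F x m vanish = by-cases (m ℕₚ.<? X)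
      where
      off : ∀ A → A ≢ m → F A * (x * ind (m ℕₚ.≟ A)) ≡ 0ℤ
      off A A≢m = trans (cong (λ z → F A * (x * z)) (ind-no (m ℕₚ.≟ A) (A≢m ∘ sym))) (lemma (F A) x)
        where
        lemma : ∀ a x → a * (x * 0ℤ) ≡ 0ℤ
        lemma = solve-∀
      by-cases : Dec (m ℕ.< X) → ∑ X (λ A → F A * (x * ind (m ℕₚ.≟ A))) ≡ x * F m
      by-cases (yes m<X) = trans (∑-single X m m<X off)
        (trans (cong (λ z → F m * (x * z)) (ind-yes (m ℕₚ.≟ m) refl)) (lemma (F m) x))
        where
        lemma : ∀ a x → a * (x * 1ℤ) ≡ x * a
        lemma = solve-∀
      by-cases (no m≮X) = trans (∑-zero X (λ A A<X → off A (λ { refl → m≮X A<X })))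
        (sym (trans (cong (x *_) (vanish (ℕₚ.≮⇒≥ m≮X))) (ℤₚ.*-zeroʳ x)))

    smoothed-regroup : ∀ c → smoothed c ≡ ∑ X (λ A → classWeight c A * pairSum A)
    smoothed-regroup c = sym (begin
      ∑ X (λ A → F A * ∑ X (λ i → ∑ X (t A i)))
        ≡⟨ ∑-cong X (λ A _ → trans (sym (∑-* X (F A) (λ i → ∑ X (t A i)))) (∑-cong X (λ i _ → sym (∑-* X (F A) (t A i))))) ⟩
      ∑ X (λ A → ∑ X (λ i → ∑ X (λ j → F A * t A i j)))
        ≡⟨ ∑-swap X X (λ A i → ∑ X (λ j → F A * t A i j)) ⟩
      ∑ X (λ i → ∑ X (λ A → ∑ X (λ j → F A * t A i j)))
        ≡⟨ ∑-cong X (λ i _ → ∑-swap X X (λ A j → F A * t A i j)) ⟩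
      ∑ X (λ i → ∑ X (λ j → ∑ X (λ A → F A * t A i j)))
        ≡⟨ ∑-cong X (λ i _ → ∑-cong X (λ j _ → trans (select F (χ (suc i)) (suc i ℕ.* suc j) (vanish i j))
             (sym (ℤₚ.*-assoc (χ (suc i)) (ind ((suc i ℕ.* suc j) % N ℕₚ.≟ c % N)) (+ (X ℕ.∸ suc i ℕ.* suc j)))))) ⟩
      smoothed c ∎)
      where
      open ≡-Reasoning
      F : ℕ → ℤ
      F = classWeight c
      t : ℕ → ℕ → ℕ → ℤ
      t A i j = χ (suc i) * ind (suc i ℕ.* suc j ℕₚ.≟ A)
      vanish : ∀ i j → X ℕ.≤ suc i ℕ.* suc j → F (suc i ℕ.* suc j) ≡ 0ℤ
      vanish i j le = trans (cong (λ z → ind ((suc i ℕ.* suc j) % N ℕₚ.≟ c % N) * + z) (ℕₚ.m≤n⇒m∸n≡0 le))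
        (ℤₚ.*-zeroʳ (ind ((suc i ℕ.* suc j) % N ℕₚ.≟ c % N)))

    pairSum-0 : pairSum 0 ≡ 0ℤ
    pairSum-0 = ∑-zero X (λ i _ → ∑-zero X (λ j _ → trans
      (cong (χ (suc i) *_) (ind-no (suc i ℕ.* suc j ℕₚ.≟ 0) (λ ()))) (ℤₚ.*-zeroʳ (χ (suc i)))))

    pairSum≡divisorSum : ∀ {A} → 1 ℕ.≤ A → A ℕ.< X → pairSum A ≡ divisorSum A
    pairSum≡divisorSum {A} 1≤A A<X = begin
      pairSum A
        ≡⟨ ∑-cong X (λ i _ → trans (∑-* X (χ (suc i)) (λ j → ind (suc i ℕ.* suc j ℕₚ.≟ A)))
             (cong (χ (suc i) *_) (trans (cofactors i (suc i ℕ∣.∣? A)) (sym (ℤₚ.*-identityʳ _))))) ⟩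
      ∑ X (f ∘ suc)                     ≡⟨ sym (ℤₚ.+-identityˡ _) ⟩
      0ℤ + ∑ X (f ∘ suc)                ≡⟨ cong (_+ ∑ X (f ∘ suc)) (sym f0) ⟩
      f 0 + ∑ X (f ∘ suc)               ≡⟨ ∑-head X f ⟨
      ∑ (suc X) f                       ≡⟨ restricted-range (λ _ → 1ℤ) 1≤A (ℕₚ.m≤n⇒m≤1+n A<X) ⟩
      divisorSum A                      ∎
      where
      open ≡-Reasoning
      f : ℕ → ℤ
      f d = χ d * (ind (d ℕ∣.∣? A) * 1ℤ)
      f0 : f 0 ≡ 0ℤ
      f0 = trans (cong (λ z → χ 0 * (z * 1ℤ)) (ind-no (0 ℕ∣.∣? A) (λ 0∣A → ℕₚ.<⇒≢ 1≤A (sym (ℕ∣.0∣⇒≡0 0∣A))))) (ℤₚ.*-zeroʳ (χ 0))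
      cofactors : ∀ i (d∣A? : Dec (suc i ℕ∣.∣ A)) → ∑ X (λ j → ind (suc i ℕ.* suc j ℕₚ.≟ A)) ≡ ind d∣A?
      cofactors i (no d∤A) = ∑-zero X (λ j _ → ind-no (suc i ℕ.* suc j ℕₚ.≟ A) (λ eq →
        d∤A (ℕ∣.divides (suc j) (trans (sym eq) (ℕₚ.*-comm (suc i) (suc j))))))
      cofactors i (yes (ℕ∣.divides zero eq)) = ⊥-elim (ℕₚ.<⇒≢ 1≤A (sym eq))
      cofactors i (yes (ℕ∣.divides (suc q) eq)) = trans
        (∑-single X q (ℕₚ.<-trans (ℕₚ.≤-trans (ℕₚ.m≤m*n (suc q) (suc i)) (ℕₚ.≤-reflexive (sym eq))) A<X)
          (λ j j≢q → ind-no (suc i ℕ.* suc j ℕₚ.≟ A) (λ e → j≢q (ℕₚ.suc-injective (ℕₚ.*-cancelˡ-≡ (suc j) (suc q) (suc i)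
            (trans e (trans eq (ℕₚ.*-comm (suc q) (suc i)))))))))
        (ind-yes (suc i ℕ.* suc q ℕₚ.≟ A) (trans (ℕₚ.*-comm (suc i) (suc q)) (sym eq)))

    term-nonneg : ∀ A → A ℕ.< X → 0ℤ ≤ classWeight 1 A * pairSum A
    term-nonneg zero      A<X = ℤₚ.≤-reflexive (sym (trans (cong (classWeight 1 0 *_) pairSum-0) (ℤₚ.*-zeroʳ (classWeight 1 0))))
    term-nonneg A@(suc _) A<X = 0≤* (0≤* (ind-nonneg (A % N ℕₚ.≟ 1 % N)) (+≤+ z≤n))
      (subst (0ℤ ≤_) (sym (pairSum≡divisorSum (s≤s z≤n) A<X)) (divisorSum-nonneg A (s≤s z≤n)))

    smoothed-lower : ∀ R Y → (∀ t → t ℕ.< R → suc (t ℕ.* N) ℕ.* suc (t ℕ.* N) ℕ.≤ Y) → X ≡ Y ℕ.+ Y → + R * + Y ≤ smoothed 1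
    smoothed-lower R zero    _     refl = ℤₚ.≤-reflexive (ℤₚ.*-zeroʳ (+ R))
    smoothed-lower R Y@(suc _) bound refl = subst₂ _≤_ (∑-const R (+ Y)) (sym (smoothed-regroup 1))
      (ℤₚ.≤-trans (∑-mono R term) (∑-subsequence R X (λ A → classWeight 1 A * pairSum A) φ φ-mono φ<X term-nonneg))
      where
      φ : ℕ → ℕ
      φ t = suc (t ℕ.* N) ℕ.* suc (t ℕ.* N)
      φ-mono : ∀ t → φ t ℕ.< φ (suc t)
      φ-mono t = ℕₚ.*-mono-< smaller smaller
        where
        smaller : suc (t ℕ.* N) ℕ.< suc (suc t ℕ.* N)
        smaller = s≤s (ℕₚ.*-monoˡ-< N (ℕₚ.n<1+n t))
      φ<X : ∀ t → t ℕ.< R → φ t ℕ.< X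
      φ<X t t<R = ℕₚ.≤-<-trans (bound t t<R) (ℕₚ.m<m+n Y (s≤s z≤n))
      class : ∀ t → φ t % N ≡ 1 % N
      class t = trans (%-*-cong (suc (t ℕ.* N)) 1 (suc (t ℕ.* N)) 1 (ℕ÷.[m+kn]%n≡m%n 1 t N) (ℕ÷.[m+kn]%n≡m%n 1 t N)) refl
      term : ∀ t → t ℕ.< R → + Y ≤ classWeight 1 (φ t) * pairSum (φ t)
      term t t<R = subst₂ (λ x y → + Y ≤ x * y)
        (sym (trans (cong (_* + (X ℕ.∸ φ t)) (ind-yes (φ t % N ℕₚ.≟ 1 % N) (class t))) (ℤₚ.*-identityˡ _)))
        (sym (pairSum≡divisorSum (s≤s z≤n) (φ<X t t<R)))
        (ℤₚ.≤-trans (+≤+ (ℕₚ.m+n≤o⇒m≤o∸n Y (ℕₚ.+-monoʳ-≤ Y (bound t t<R))))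
          (ℤₚ.0≤i-j⇒j≤i (subst (0ℤ ≤_) (lemma (+ (X ℕ.∸ φ t)) (divisorSum (φ t)))
            (0≤* {+ (X ℕ.∸ φ t)} (+≤+ z≤n) (ℤₚ.i≤j⇒0≤j-i (divisorSum-square (suc (t ℕ.* N)) (s≤s z≤n)))))))
        where
        lemma : ∀ x g → x * (g - 1ℤ) ≡ x * g - x
        lemma = solve-∀

  weak-dirichlet : ∀ c → χ c ≡ 1ℤ → ∃[ A ] A % N ≡ c % N × 1 ℕ.≤ A × divisorSum A ≢ 0ℤ
  weak-dirichlet c χc = conclude (∑-nonzero-term X (λ A → classWeight X c A * pairSum X A)
    (λ e → smoothed≢0 (trans (smoothed-regroup X c) e)))
    where
    M : ℕ
    M = 4 ℕ.* (N ℕ.* N) ℕ.* (5 ℕ.+ 4 ℕ.* N)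
    K : ℕ
    K = proj₁ (exponential-beats-linear M)
    R : ℕ
    R = 2 ℕ.^ K
    Y : ℕ
    Y = R ℕ.* N ℕ.* (R ℕ.* N)
    X : ℕ
    X = Y ℕ.+ Y
    L : ℕ
    L = suc (N ℕ.+ N ℕ.+ (K ℕ.+ K))
    X≤2^L : X ℕ.≤ 2 ℕ.^ L
    X≤2^L = ℕₚ.≤-trans (ℕₚ.+-mono-≤ Y≤ Y≤) (ℕₚ.≤-reflexive (cong (2 ℕ.^ (N ℕ.+ N ℕ.+ (K ℕ.+ K)) ℕ.+_) (sym (ℕₚ.+-identityʳ _))))
      where
      open ℕₚ.≤-Reasoning
      shuffle : ∀ r n → r ℕ.* n ℕ.* (r ℕ.* n) ≡ n ℕ.* n ℕ.* (r ℕ.* r)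
      shuffle = ℕ-Ring.solve-∀
      Y≤ : Y ℕ.≤ 2 ℕ.^ (N ℕ.+ N ℕ.+ (K ℕ.+ K))
      Y≤ = begin
        R ℕ.* N ℕ.* (R ℕ.* N)                               ≡⟨ shuffle R N ⟩
        N ℕ.* N ℕ.* (R ℕ.* R)                               ≤⟨ ℕₚ.*-monoˡ-≤ (R ℕ.* R) (ℕₚ.*-mono-≤ (ℕₚ.<⇒≤ (n<2^n N)) (ℕₚ.<⇒≤ (n<2^n N))) ⟩
        2 ℕ.^ N ℕ.* 2 ℕ.^ N ℕ.* (R ℕ.* R)                   ≡⟨ cong₂ ℕ._*_ (ℕₚ.^-distribˡ-+-* 2 N N) (ℕₚ.^-distribˡ-+-* 2 K K) ⟨
        2 ℕ.^ (N ℕ.+ N) ℕ.* 2 ℕ.^ (K ℕ.+ K)                 ≡⟨ ℕₚ.^-distribˡ-+-* 2 (N ℕ.+ N) (K ℕ.+ K) ⟨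
        2 ℕ.^ (N ℕ.+ N ℕ.+ (K ℕ.+ K))                       ∎
    square-bound : ∀ t → t ℕ.< R → suc (t ℕ.* N) ℕ.* suc (t ℕ.* N) ℕ.≤ Y
    square-bound t t<R = ℕₚ.*-mono-≤ le le
      where
      le : suc (t ℕ.* N) ℕ.≤ R ℕ.* N
      le = ℕₚ.≤-trans (ℕₚ.+-monoˡ-≤ (t ℕ.* N) (ℕ.>-nonZero⁻¹ N)) (ℕₚ.*-monoˡ-≤ N t<R)
    small : N ℕ.* (N ℕ.* 2) ℕ.* (X ℕ.* (3 ℕ.+ 2 ℕ.* L)) ℕ.< R ℕ.* Y
    small = begin-strict
      N ℕ.* (N ℕ.* 2) ℕ.* (X ℕ.* (3 ℕ.+ 2 ℕ.* L))                         ≡⟨ regroup N Y K ⟩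
      4 ℕ.* (N ℕ.* N) ℕ.* (5 ℕ.+ 4 ℕ.* N ℕ.+ 4 ℕ.* K) ℕ.* Y               ≤⟨ ℕₚ.*-monoˡ-≤ Y (ℕₚ.*-monoʳ-≤ (4 ℕ.* (N ℕ.* N)) (ℕₚ.m≤m+n _ (K ℕ.+ 4 ℕ.* N ℕ.* K))) ⟩
      4 ℕ.* (N ℕ.* N) ℕ.* (5 ℕ.+ 4 ℕ.* N ℕ.+ 4 ℕ.* K ℕ.+ (K ℕ.+ 4 ℕ.* N ℕ.* K)) ℕ.* Y ≡⟨ cong (ℕ._* Y) (factor N K) ⟩
      M ℕ.* suc K ℕ.* Y                                                   <⟨ ℕₚ.*-monoˡ-< Y {{Y≢0}} (proj₂ (exponential-beats-linear M)) ⟩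
      R ℕ.* Y                                                             ∎
      where
      open ℕₚ.≤-Reasoning
      Y≢0 : ℕ.NonZero Y
      Y≢0 = ℕₚ.m*n≢0 (R ℕ.* N) (R ℕ.* N) {{RN≢0}} {{RN≢0}}
        where
        RN≢0 : ℕ.NonZero (R ℕ.* N)
        RN≢0 = ℕₚ.m*n≢0 R N {{ℕₚ.m^n≢0 2 K}}
      regroup : ∀ N Y K → N ℕ.* (N ℕ.* 2) ℕ.* ((Y ℕ.+ Y) ℕ.* (3 ℕ.+ 2 ℕ.* suc (N ℕ.+ N ℕ.+ (K ℕ.+ K))))
        ≡ 4 ℕ.* (N ℕ.* N) ℕ.* (5 ℕ.+ 4 ℕ.* N ℕ.+ 4 ℕ.* K) ℕ.* Y
      regroup = ℕ-Ring.solve-∀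
      factor : ∀ N K → 4 ℕ.* (N ℕ.* N) ℕ.* (5 ℕ.+ 4 ℕ.* N ℕ.+ 4 ℕ.* K ℕ.+ (K ℕ.+ 4 ℕ.* N ℕ.* K))
        ≡ 4 ℕ.* (N ℕ.* N) ℕ.* (5 ℕ.+ 4 ℕ.* N) ℕ.* suc K
      factor = ℕ-Ring.solve-∀
    smoothed≢0 : smoothed X c ≢ 0ℤ
    smoothed≢0 e = ℕₚ.<⇒≱ small (ℕₚ.≤-trans RY≤ (smoothed-difference X χ-1 χc L X≤2^L))
      where
      RY≤S : + (R ℕ.* Y) ≤ smoothed X 1
      RY≤S = subst (_≤ smoothed X 1) (sym (ℤₚ.pos-* R Y)) (smoothed-lower X R Y square-bound refl)
      ≤∣∣ : ∀ {m x} → + m ≤ x → m ℕ.≤ ∣ x ∣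
      ≤∣∣ (+≤+ le) = le
      RY≤ : R ℕ.* Y ℕ.≤ ∣ smoothed X 1 - smoothed X c ∣
      RY≤ = ≤∣∣ (subst (+ (R ℕ.* Y) ≤_) (sym (trans (cong (λ z → smoothed X 1 - z) e) (ℤₚ.+-identityʳ _))) RY≤S)
    conclude : ∃[ A ] A ℕ.< X × classWeight X c A * pairSum X A ≢ 0ℤ → ∃[ A ] A % N ≡ c % N × 1 ℕ.≤ A × divisorSum A ≢ 0ℤ
    conclude (zero , _ , ne) = ⊥-elim (ne (trans (cong (classWeight X c 0 *_) (pairSum-0 X)) (ℤₚ.*-zeroʳ (classWeight X c 0))))
    conclude (A@(suc _) , A<X , ne) = A , in-class (A % N ℕₚ.≟ c % N) refl , s≤s z≤n , λ e → ne
      (trans (cong (classWeight X c A *_) (trans (pairSum≡divisorSum X (s≤s z≤n) A<X) e)) (ℤₚ.*-zeroʳ (classWeight X c A)))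
      where
      in-class : (A≡c? : Dec (A % N ≡ c % N)) → A≡c? ≡ (A % N ℕₚ.≟ c % N) → A % N ≡ c % N
      in-class (yes e)  _ = e
      in-class (no A≢c) _ = ⊥-elim (ne (cong (λ z → z * + (X ℕ.∸ A) * pairSum X A) (ind-no (A % N ℕₚ.≟ c % N) A≢c)))

-- Supplementary laws and the character (κ / ·)

coprime⇒unit : ∀ {a h} → Coprime a (modulus h) → Unit h (+ a)
coprime⇒unit c = let (b , e) = coprime⇒inverse c in unit b e

unit-neg1 : ∀ {h} → Unit h -1ℤ
unit-neg1 = unit -1ℤ ≈-refl

unit-2 : ∀ h → Unit h (+ 2)
unit-2 h = unit (+ suc h) (multiple 1ℤ (trans (sym (ℤₚ.pos-* (suc h) 2))
  (trans (cong +_ (lemma h)) (cong (λ z → 1ℤ + z) (sym (ℤₚ.*-identityˡ (+ modulus h)))))))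
  where
  lemma : ∀ h → suc h ℕ.* 2 ≡ suc (suc (h ℕ.+ h))
  lemma = ℕ-Ring.solve-∀

triangular-even : ∀ l → (-1ℤ ℤ.^ suc l) ℤ.^ l ≡ 1ℤ
triangular-even l = trans (ℤₚ.^-*-assoc -1ℤ (suc l) l) (go l)
  where
  go : ∀ l → -1ℤ ℤ.^ (suc l ℕ.* l) ≡ 1ℤ
  go zero    = refl
  go (suc l) = trans (cong (-1ℤ ℤ.^_) (lemma l)) (trans (ℤₚ.^-distribˡ-+-* -1ℤ (suc l ℕ.* l) (suc l ℕ.+ suc l))
    (cong₂ _*_ (go l) (-1^-double (suc l))))
    where
    lemma : ∀ l → suc (suc l) ℕ.* suc l ≡ suc l ℕ.* l ℕ.+ (suc l ℕ.+ suc l)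
    lemma = ℕ-Ring.solve-∀

-- Since n + 2 ≡ 2 modulo n and n ≡ -2 modulo n + 2, reciprocity for n and n + 2 relates (2 / n) to (2 / n + 2).
jacobi-2-suc : ∀ l → jacobi (suc l) (+ 2) ≡ -1ℤ ℤ.^ suc l * jacobi l (+ 2)
jacobi-2-suc l = solve-sign (jacobi-sign l (+ 2)) (-1^-sign (suc l)) (begin
  jacobi l (+ 2) * (-1ℤ ℤ.^ suc l * jacobi (suc l) (+ 2))
    ≡⟨ cong₂ _*_ (sym (jacobi-≈ l u up)) (sym (trans (jacobi-≈ (suc l) v down)
         (trans (jacobi-* (suc l) unit-neg1 (unit-2 (suc l))) (cong (_* jacobi (suc l) (+ 2)) (jacobi-neg1 (suc l)))))) ⟩
  jacobi l (+ modulus (suc l)) * jacobi (suc l) (+ modulus l)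
    ≡⟨ jacobi-reciprocity l (suc l) u v ⟩
  (-1ℤ ℤ.^ suc l) ℤ.^ l
    ≡⟨ triangular-even l ⟩
  1ℤ ∎)
  where
  open ≡-Reasoning
  n+2 : modulus (suc l) ≡ 2 ℕ.+ modulus l
  n+2 = cong (λ m → suc (suc m)) (ℕₚ.+-suc l l)
  up : + modulus (suc l) ≈ + 2 mod modulus l
  up = multiple 1ℤ (trans (cong +_ n+2) (cong (λ z → + 2 + z) (sym (ℤₚ.*-identityˡ (+ modulus l)))))
  down : + modulus l ≈ -1ℤ * + 2 mod modulus (suc l)
  down = multiple 1ℤ (trans (lemma (+ modulus l)) (cong (λ z → -1ℤ * + 2 + z)
    (trans (cong +_ (sym n+2)) (sym (ℤₚ.*-identityˡ (+ modulus (suc l)))))))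
    where
    lemma : ∀ m → m ≡ -1ℤ * + 2 + (+ 2 + m)
    lemma = solve-∀
  u : Unit l (+ modulus (suc l))
  u = unit-≈ (≈-sym up) (unit-2 l)
  v : Unit (suc l) (+ modulus l)
  v = unit-≈ (≈-sym down) (unit-* unit-neg1 (unit-2 (suc l)))
  solve-sign : ∀ {x y z} → IsSign x → IsSign y → x * (y * z) ≡ 1ℤ → z ≡ y * x
  solve-sign {z = z} (inj₁ refl) (inj₁ refl) e = trans (sym (trans (ℤₚ.*-identityˡ (1ℤ * z)) (ℤₚ.*-identityˡ z))) e
  solve-sign {z = z} (inj₁ refl) (inj₂ refl) e = trans (lemma z) (cong -_ e)
    where
    lemma : ∀ z → z ≡ - (1ℤ * (-1ℤ * z))
    lemma = solve-∀
  solve-sign {z = z} (inj₂ refl) (inj₁ refl) e = trans (lemma z) (cong -_ e)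
    where
    lemma : ∀ z → z ≡ - (-1ℤ * (1ℤ * z))
    lemma = solve-∀
  solve-sign {z = z} (inj₂ refl) (inj₂ refl) e = trans (lemma z) e
    where
    lemma : ∀ z → z ≡ -1ℤ * (-1ℤ * z)
    lemma = solve-∀

-- The characters (-1 / r) and (2 / r) modulo 8.
ω η : ℕ → ℤ
ω 1 = 1ℤ
ω 3 = -1ℤ
ω 5 = 1ℤ
ω 7 = -1ℤ
ω _ = 0ℤ
η 1 = 1ℤ
η 3 = -1ℤ
η 5 = -1ℤ
η 7 = 1ℤ
η _ = 0ℤ

residues₈ : ∀ (f : ℕ → ℤ) → (∀ (i j : Fin 8) → f ((toℕ i ℕ.* toℕ j) % 8) ≡ f (toℕ i) * f (toℕ j)) →
            ∀ a b → f ((a ℕ.* b) % 8) ≡ f (a % 8) * f (b % 8)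
residues₈ f check a b = begin
  f ((a ℕ.* b) % 8)                   ≡⟨ cong f (ℕ÷.%-distribˡ-* a b 8) ⟩
  f (((a % 8) ℕ.* (b % 8)) % 8)       ≡⟨ cong₂ (λ x y → f ((x ℕ.* y) % 8)) (sym (Finₚ.toℕ-fromℕ< a<8)) (sym (Finₚ.toℕ-fromℕ< b<8)) ⟩
  f ((toℕ (fromℕ< a<8) ℕ.* toℕ (fromℕ< b<8)) % 8) ≡⟨ check (fromℕ< a<8) (fromℕ< b<8) ⟩
  f (toℕ (fromℕ< a<8)) * f (toℕ (fromℕ< b<8)) ≡⟨ cong₂ (λ x y → f x * f y) (Finₚ.toℕ-fromℕ< a<8) (Finₚ.toℕ-fromℕ< b<8) ⟩
  f (a % 8) * f (b % 8)               ∎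
  where
  open ≡-Reasoning
  a<8 : a % 8 ℕ.< 8
  a<8 = ℕ÷.m%n<n a 8
  b<8 : b % 8 ℕ.< 8
  b<8 = ℕ÷.m%n<n b 8

ω-* : ∀ a b → ω ((a ℕ.* b) % 8) ≡ ω (a % 8) * ω (b % 8)
ω-* = residues₈ ω (toWitness {a? = Finₚ.all? (λ i → Finₚ.all? (λ j → ω ((toℕ i ℕ.* toℕ j) % 8) ℤₚ.≟ ω (toℕ i) * ω (toℕ j)))} tt)

η-* : ∀ a b → η ((a ℕ.* b) % 8) ≡ η (a % 8) * η (b % 8)
η-* = residues₈ η (toWitness {a? = Finₚ.all? (λ i → Finₚ.all? (λ j → η ((toℕ i ℕ.* toℕ j) % 8) ℤₚ.≟ η (toℕ i) * η (toℕ j)))} tt)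

modulus-+4 : ∀ l → modulus (4 ℕ.+ l) % 8 ≡ modulus l % 8
modulus-+4 l = trans (cong (_% 8) (lemma l)) (ℕ÷.[m+n]%n≡m%n (modulus l) 8)
  where
  lemma : ∀ l → suc (4 ℕ.+ l ℕ.+ (4 ℕ.+ l)) ≡ suc (l ℕ.+ l) ℕ.+ 8
  lemma = ℕ-Ring.solve-∀

-1^≡ω : ∀ l → -1ℤ ℤ.^ l ≡ ω (modulus l % 8)
-1^≡ω 0 = refl
-1^≡ω 1 = refl
-1^≡ω 2 = refl
-1^≡ω 3 = refl
-1^≡ω (suc (suc (suc (suc l)))) = trans (lemma (-1ℤ ℤ.^ l)) (trans (-1^≡ω l) (cong ω (sym (modulus-+4 l))))
  where
  lemma : ∀ x → -1ℤ * (-1ℤ * (-1ℤ * (-1ℤ * x))) ≡ x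
  lemma = solve-∀

jacobi-2 : ∀ l → jacobi l (+ 2) ≡ η (modulus l % 8)
jacobi-2 0 = refl
jacobi-2 1 = trans (jacobi-2-suc 0) (cong (-1ℤ *_) (jacobi-2 0))
jacobi-2 2 = trans (jacobi-2-suc 1) (cong (1ℤ *_) (jacobi-2 1))
jacobi-2 3 = trans (jacobi-2-suc 2) (cong (-1ℤ *_) (jacobi-2 2))
jacobi-2 (suc (suc (suc (suc l)))) = begin
  jacobi (4 ℕ.+ l) (+ 2)
    ≡⟨ trans (jacobi-2-suc (3 ℕ.+ l)) (cong (-1ℤ ℤ.^ (4 ℕ.+ l) *_) (trans (jacobi-2-suc (2 ℕ.+ l)) (cong (-1ℤ ℤ.^ (3 ℕ.+ l) *_)
         (trans (jacobi-2-suc (1 ℕ.+ l)) (cong (-1ℤ ℤ.^ (2 ℕ.+ l) *_) (jacobi-2-suc l)))))) ⟩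
  -1ℤ ℤ.^ (4 ℕ.+ l) * (-1ℤ ℤ.^ (3 ℕ.+ l) * (-1ℤ ℤ.^ (2 ℕ.+ l) * (-1ℤ ℤ.^ (1 ℕ.+ l) * jacobi l (+ 2))))
    ≡⟨ lemma (-1ℤ ℤ.^ l) (jacobi l (+ 2)) ⟩
  (-1ℤ ℤ.^ l * -1ℤ ℤ.^ l) * ((-1ℤ ℤ.^ l * -1ℤ ℤ.^ l) * jacobi l (+ 2))
    ≡⟨ cong₂ (λ x y → x * (y * jacobi l (+ 2))) (sign-square (-1^-sign l)) (sign-square (-1^-sign l)) ⟩
  1ℤ * (1ℤ * jacobi l (+ 2))
    ≡⟨ trans (ℤₚ.*-identityˡ _) (ℤₚ.*-identityˡ _) ⟩
  jacobi l (+ 2)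
    ≡⟨ trans (jacobi-2 l) (cong η (sym (modulus-+4 l))) ⟩
  η (modulus (4 ℕ.+ l) % 8) ∎
  where
  open ≡-Reasoning
  lemma : ∀ x j → -1ℤ * (-1ℤ * (-1ℤ * (-1ℤ * x))) * (-1ℤ * (-1ℤ * (-1ℤ * x)) * (-1ℤ * (-1ℤ * x) * (-1ℤ * x * j)))
    ≡ x * x * (x * x * j)
  lemma = solve-∀

record Invertible (n a : ℕ) : Set where
  constructor invertible
  field
    inv  : ℤ
    invˡ : inv * + a ≈ 1ℤ mod n

≈-% : ∀ {n} .{{_ : ℕ.NonZero n}} x y → + x ≈ + y mod n → x % n ≡ y % n
≈-% {n} x y e = rem-unique (ℕ÷.m%n<n x n) (ℕ÷.m%n<n y n) (≈-trans (≈-sym (%-≈ x)) (≈-trans e (%-≈ y)))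
  where
  %-≈ : ∀ x → + x ≈ + (x % n) mod n
  %-≈ x = multiple (+ (x / n)) (trans (cong +_ (ℕ÷.m≡m%n+[m/n]*n x n))
    (cong (λ z → + (x % n) + z) (ℤₚ.pos-* (x / n) n)))

%-≈ : ∀ {n} .{{_ : ℕ.NonZero n}} x y → x % n ≡ y % n → + x ≈ + y mod n
%-≈ {n} x y e = ≈-trans (%ℕ-≈ (+ x) n) (≈-trans (≈-reflexive (cong +_ e)) (≈-sym (%ℕ-≈ (+ y) n)))

≈-weaken : ∀ {m x y} n → x ≈ y mod (m ℕ.* n) → x ≈ y mod n
≈-weaken {m} {y = y} n (multiple q refl) = multiple (q * + m) (cong (λ z → y + z)
  (trans (cong (q *_) (ℤₚ.pos-* m n)) (sym (ℤₚ.*-assoc q (+ m) (+ n)))))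

coprime⇒invertible : ∀ {n a} → Coprime a n → Invertible n a
coprime⇒invertible c = let (b , e) = coprime⇒inverse c in invertible b e

invertible⇒coprime : ∀ {n a} → Invertible n a → Coprime a n
invertible⇒coprime {n} {a} (invertible b (multiple q eq)) {d} (d∣a , d∣n) = ℕ∣.∣1⇒≡1 (ℤ∣.∣⇒∣ᵤ {+ d} {1ℤ}
  (subst (+ d ℤ∣.∣_) (sym (x≡y+z⇒z≡x-y eq))
    (ℤ∣.∣m∣n⇒∣m-n (ℤ∣.∣n⇒∣m*n b (ℤ∣.∣ᵤ⇒∣ {+ d} {+ a} d∣a)) (ℤ∣.∣n⇒∣m*n q (ℤ∣.∣ᵤ⇒∣ {+ d} {+ n} d∣n)))))
  where
  x≡y+z⇒z≡x-y : ∀ {x y} → x ≡ 1ℤ + y → 1ℤ ≡ x - y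
  x≡y+z⇒z≡x-y {y = y} refl = lemma y
    where
    lemma : ∀ y → 1ℤ ≡ 1ℤ + y - y
    lemma = solve-∀

invertible-* : ∀ {m n a} → Invertible m a → Invertible n a → Invertible (m ℕ.* n) a
invertible-* {m} {n} {a} (invertible b (multiple q e)) (invertible c (multiple r f)) =
  invertible (b + c - b * c * + a) (multiple (- (q * r)) (begin
    (b + c - b * c * + a) * + a                              ≡⟨ lemma b c (+ a) ⟩
    1ℤ - (b * + a - 1ℤ) * (c * + a - 1ℤ)                     ≡⟨ cong₂ (λ x y → 1ℤ - (x - 1ℤ) * (y - 1ℤ)) e f ⟩
    1ℤ - (1ℤ + q * + m - 1ℤ) * (1ℤ + r * + n - 1ℤ)           ≡⟨ lemma′ q r (+ m) (+ n) ⟩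
    1ℤ + - (q * r) * (+ m * + n)                             ≡⟨ cong (λ z → 1ℤ + - (q * r) * z) (sym (ℤₚ.pos-* m n)) ⟩
    1ℤ + - (q * r) * + (m ℕ.* n)                             ∎))
  where
  open ≡-Reasoning
  lemma : ∀ b c a → (b + c - b * c * a) * a ≡ 1ℤ - (b * a - 1ℤ) * (c * a - 1ℤ)
  lemma = solve-∀
  lemma′ : ∀ q r m n → 1ℤ - (1ℤ + q * m - 1ℤ) * (1ℤ + r * n - 1ℤ) ≡ 1ℤ + - (q * r) * (m * n)
  lemma′ = solve-∀

invertible-factor : ∀ {n} a b → Invertible n (a ℕ.* b) → Invertible n a
invertible-factor a b (invertible c e) = invertible (c * + b)
  (≈-trans (≈-reflexive (trans (lemma c (+ a) (+ b)) (cong (c *_) (sym (ℤₚ.pos-* a b))))) e)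
  where
  lemma : ∀ c a b → c * b * a ≡ c * (a * b)
  lemma = solve-∀

invertible-product : ∀ {n a b} → Invertible n a → Invertible n b → Invertible n (a ℕ.* b)
invertible-product {n} {a} {b} (invertible c e) (invertible d f) = invertible (c * d)
  (≈-trans (≈-reflexive (trans (cong (c * d *_) (ℤₚ.pos-* a b)) (lemma c d (+ a) (+ b)))) (≈-* e f))
  where
  lemma : ∀ c d a b → c * d * (a * b) ≡ c * a * (d * b)
  lemma = solve-∀

invertible-≈ : ∀ {n a b} → + a ≈ + b mod n → Invertible n a → Invertible n b
invertible-≈ e (invertible c f) = invertible c (≈-trans (≈-*ˡ c (≈-sym e)) f)

invertible? : ∀ n a → Dec (Invertible n a)
invertible? n a = map′ coprime⇒invertible invertible⇒coprime (Coprimality.coprime? a n)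

-- κ = - m k with k = 2h + 1 and m ∈ {1, 2}; the character a ↦ (κ / a) modulo 8k, computed by reciprocity.
data Twist : Set where
  one two : Twist

twist : Twist → ℕ
twist one = 1
twist two = 2

module JacobiCharacter (h : ℕ) (m : Twist) where

  k N : ℕ
  k = modulus h
  N = 8 ℕ.* k

  κ : ℤ
  κ = - + (twist m ℕ.* k)

  θ-twist : Twist → ℕ → ℤ
  θ-twist one r = ω r ℤ.^ suc h
  θ-twist two r = η r * ω r ℤ.^ suc h

  θ : ℕ → ℤ
  θ = θ-twist m

  θ-* : ∀ a b → θ ((a ℕ.* b) % 8) ≡ θ (a % 8) * θ (b % 8)
  θ-* a b = go m
    where
    power : ω ((a ℕ.* b) % 8) ℤ.^ suc h ≡ ω (a % 8) ℤ.^ suc h * ω (b % 8) ℤ.^ suc h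
    power = trans (cong (ℤ._^ suc h) (ω-* a b)) (^-distrib-* (ω (a % 8)) (ω (b % 8)) (suc h))
      where
      ^-distrib-* : ∀ x y n → (x * y) ℤ.^ n ≡ x ℤ.^ n * y ℤ.^ n
      ^-distrib-* x y zero    = refl
      ^-distrib-* x y (suc n) = trans (cong (x * y *_) (^-distrib-* x y n)) (lemma x y (x ℤ.^ n) (y ℤ.^ n))
        where
        lemma : ∀ x y p q → x * y * (p * q) ≡ x * p * (y * q)
        lemma = solve-∀
    go : ∀ m → θ-twist m ((a ℕ.* b) % 8) ≡ θ-twist m (a % 8) * θ-twist m (b % 8)
    go one = power
    go two = trans (cong₂ _*_ (η-* a b) power)
      (lemma (η (a % 8)) (η (b % 8)) (ω (a % 8) ℤ.^ suc h) (ω (b % 8) ℤ.^ suc h))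
      where
      lemma : ∀ x y p q → x * y * (p * q) ≡ x * p * (y * q)
      lemma = solve-∀

  value-at : ℕ → ℤ
  value-at a = θ (a % 8) * jacobi h (+ a)

  χ : ℕ → ℤ
  χ a = ind (invertible? N a) * value-at a

  χ-yes : ∀ {a} → Invertible N a → χ a ≡ value-at a
  χ-yes {a} i = trans (cong (_* value-at a) (ind-yes (invertible? N a) i)) (ℤₚ.*-identityˡ _)

  χ-no : ∀ {a} → ¬ Invertible N a → χ a ≡ 0ℤ
  χ-no {a} ¬i = cong (_* value-at a) (ind-no (invertible? N a) ¬i)

  invertible-k : ∀ {a} → Invertible N a → Unit h (+ a)
  invertible-k (invertible b e) = unit b (≈-weaken {8} k e)

  invertible-8 : ∀ {a} → Invertible N a → Invertible 8 a
  invertible-8 {a} (invertible b e) = invertible b (≈-weaken {k} 8 (subst (λ n → b * + a ≈ 1ℤ mod n) (ℕₚ.*-comm 8 k) e))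

  χ-* : ∀ a b → χ (a ℕ.* b) ≡ χ a * χ b
  χ-* a b = by-cases (invertible? N a) (invertible? N b)
    where
    by-cases : Dec (Invertible N a) → Dec (Invertible N b) → χ (a ℕ.* b) ≡ χ a * χ b
    by-cases (yes i) (yes j) = trans (χ-yes (invertible-product i j)) (trans
      (cong₂ _*_ (θ-* a b) (trans (cong (jacobi h) (ℤₚ.pos-* a b)) (jacobi-* h (invertible-k i) (invertible-k j))))
      (trans (lemma (θ (a % 8)) (θ (b % 8)) (jacobi h (+ a)) (jacobi h (+ b))) (sym (cong₂ _*_ (χ-yes i) (χ-yes j)))))
      where
      lemma : ∀ x y p q → x * y * (p * q) ≡ x * p * (y * q)
      lemma = solve-∀
    by-cases (no ¬i) _ = trans (χ-no (¬i ∘ invertible-factor a b)) (sym (cong (_* χ b) (χ-no ¬i)))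
    by-cases _ (no ¬j) = trans (χ-no (λ i → ¬j (invertible-factor b a (subst (Invertible N) (ℕₚ.*-comm a b) i))))
      (sym (trans (cong (χ a *_) (χ-no ¬j)) (ℤₚ.*-zeroʳ (χ a))))

  invertible-1 : Invertible N 1
  invertible-1 = invertible 1ℤ ≈-refl

  χ-1 : χ 1 ≡ 1ℤ
  χ-1 = trans (χ-yes invertible-1) (cong₂ _*_ (go m) (jacobi-1 h))
    where
    go : ∀ m → θ-twist m 1 ≡ 1ℤ
    go one = ℤₚ.^-zeroˡ (suc h)
    go two = trans (ℤₚ.*-identityˡ _) (ℤₚ.^-zeroˡ (suc h))

  χ-% : ∀ a → χ (a % N) ≡ χ a
  χ-% a = by-cases (invertible? N a)
    where
    e : + (a % N) ≈ + a mod N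
    e = %-≈ (a % N) a (ℕ÷.m%n%n≡m%n a N)
    by-cases : Dec (Invertible N a) → χ (a % N) ≡ χ a
    by-cases (yes i) = trans (χ-yes (invertible-≈ (≈-sym e) i)) (trans
      (cong₂ (λ r j → θ r * j) (≈-% {8} (a % N) a (≈-weaken {k} 8 (subst (λ n → + (a % N) ≈ + a mod n) (ℕₚ.*-comm 8 k) e)))
        (sym (jacobi-≈ h (invertible-k i) (≈-weaken {8} k (≈-sym e))))) (sym (χ-yes i)))
    by-cases (no ¬i) = trans (χ-no (¬i ∘ invertible-≈ e)) (sym (χ-no ¬i))

  odd-half : ∀ a → Invertible 8 a → ∃[ l ] a ≡ modulus l
  odd-half a (invertible b e) = by-parity (half a)
    where
    by-parity : ∃[ l ] (a ≡ l ℕ.+ l ⊎ a ≡ modulus l) → ∃[ l ] a ≡ modulus l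
    by-parity (l , inj₂ eq)   = l , eq
    by-parity (l , inj₁ refl) = ⊥-elim (0≢1 (≈-% {2} 0 1 (≈-trans (multiple (- (b * + l)) (lemma b (+ l))) (≈-weaken {4} 2 e))))
      where
      lemma : ∀ b l → 0ℤ ≡ b * (l + l) + - (b * l) * + 2
      lemma = solve-∀
      0≢1 : 0 ≢ 1
      0≢1 ()

  χ≡jacobi : ∀ l → Invertible N (modulus l) → χ (modulus l) ≡ jacobi l κ × Unit l κ
  χ≡jacobi l i = trans (χ-yes i) (go m) , unit-κ m
    where
    open ≡-Reasoning
    a : ℕ
    a = modulus l
    v : Unit h (+ a)
    v = invertible-k i
    u : Unit l (+ k)
    u = coprime⇒unit (Coprimality.sym (invertible⇒coprime (invertible (inverse v) (inverseˡ v))))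
    neg : ∀ x → - x ≡ -1ℤ * x
    neg = solve-∀
    unit-neg : ∀ {x} → Unit l x → Unit l (- x)
    unit-neg {x} w = unit-≈ (≈-reflexive (sym (neg x))) (unit-* unit-neg1 w)
    2k : + (2 ℕ.* k) ≡ + 2 * + k
    2k = ℤₚ.pos-* 2 k
    unit-κ : ∀ m → Unit l (- + (twist m ℕ.* k))
    unit-κ one = unit-neg (subst (λ x → Unit l (+ x)) (sym (ℕₚ.+-identityʳ k)) u)
    unit-κ two = unit-neg (unit-≈ (≈-reflexive (sym 2k)) (unit-* (unit-2 l) u))
    jacobi-neg : ∀ {x} → Unit l x → jacobi l (- x) ≡ ω (a % 8) * jacobi l x
    jacobi-neg {x} w = trans (cong (jacobi l) (neg x)) (trans (jacobi-* l unit-neg1 w)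
      (cong (_* jacobi l x) (trans (jacobi-neg1 l) (-1^≡ω l))))
    reciprocal : jacobi l (+ k) ≡ ω (a % 8) ℤ.^ h * jacobi h (+ a)
    reciprocal = begin
      jacobi l (+ k)                                       ≡⟨ sym (ℤₚ.*-identityʳ _) ⟩
      jacobi l (+ k) * 1ℤ                                  ≡⟨ cong (jacobi l (+ k) *_) (sym (sign-square (jacobi-sign h (+ a)))) ⟩
      jacobi l (+ k) * (jacobi h (+ a) * jacobi h (+ a))   ≡⟨ lemma (jacobi l (+ k)) (jacobi h (+ a)) ⟩
      jacobi h (+ a) * jacobi l (+ k) * jacobi h (+ a)     ≡⟨ cong (_* jacobi h (+ a)) (jacobi-reciprocity h l v u) ⟩
      (-1ℤ ℤ.^ l) ℤ.^ h * jacobi h (+ a)                   ≡⟨ cong (λ x → x ℤ.^ h * jacobi h (+ a)) (-1^≡ω l) ⟩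
      ω (a % 8) ℤ.^ h * jacobi h (+ a)                     ∎
      where
      lemma : ∀ x y → x * (y * y) ≡ y * x * y
      lemma = solve-∀
    -k : jacobi l (- + k) ≡ ω (a % 8) ℤ.^ suc h * jacobi h (+ a)
    -k = trans (jacobi-neg u) (trans (cong (ω (a % 8) *_) reciprocal) (sym (ℤₚ.*-assoc (ω (a % 8)) (ω (a % 8) ℤ.^ h) (jacobi h (+ a)))))
    go : ∀ m → θ-twist m (a % 8) * jacobi h (+ a) ≡ jacobi l (- + (twist m ℕ.* k))
    go one = trans (sym -k) (cong (λ x → jacobi l (- + x)) (sym (ℕₚ.+-identityʳ k)))
    go two = sym (begin
      jacobi l (- + (2 ℕ.* k))                 ≡⟨ cong (jacobi l) (trans (cong -_ 2k) (lemma (+ 2) (+ k))) ⟩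
      jacobi l (+ 2 * - + k)                   ≡⟨ jacobi-* l (unit-2 l) (unit-neg u) ⟩
      jacobi l (+ 2) * jacobi l (- + k)        ≡⟨ cong₂ _*_ (jacobi-2 l) -k ⟩
      η (a % 8) * (ω (a % 8) ℤ.^ suc h * jacobi h (+ a)) ≡⟨ sym (ℤₚ.*-assoc (η (a % 8)) (ω (a % 8) ℤ.^ suc h) (jacobi h (+ a))) ⟩
      η (a % 8) * ω (a % 8) ℤ.^ suc h * jacobi h (+ a) ∎)
      where
      lemma : ∀ x y → - (x * y) ≡ x * - y
      lemma = solve-∀

  χ-value : ∀ a → χ a ≡ 0ℤ ⊎ IsSign (χ a)
  χ-value a = by-cases (invertible? N a)
    where
    by-cases : Dec (Invertible N a) → χ a ≡ 0ℤ ⊎ IsSign (χ a)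
    by-cases (no ¬i) = inj₁ (χ-no ¬i)
    by-cases (yes i) = let (l , eq) = odd-half a (invertible-8 i) in
      inj₂ (subst (IsSign ∘ χ) (sym eq) (subst IsSign (sym (proj₁ (χ≡jacobi l (subst (Invertible N) eq i)))) (jacobi-sign l κ)))

  χ≢0⇒invertible : ∀ {a} → χ a ≢ 0ℤ → Invertible N a
  χ≢0⇒invertible {a} ne = by-cases (invertible? N a)
    where
    by-cases : Dec (Invertible N a) → Invertible N a
    by-cases (yes i) = i
    by-cases (no ¬i) = ⊥-elim (ne (χ-no ¬i))

  χ-inverse : ∀ a → χ a ≢ 0ℤ → ∃[ b ] (b ℕ.* a) % N ≡ 1 % N
  χ-inverse a ne with χ≢0⇒invertible ne
  ... | invertible b e = b %ℕ N , ≈-% (b %ℕ N ℕ.* a) 1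
    (≈-trans (≈-reflexive (ℤₚ.pos-* (b %ℕ N) a)) (≈-trans (≈-*ʳ (+ a) (≈-sym (%ℕ-≈ b N))) e))

module CharacterPrimes (h : ℕ) (m : Twist) where
  open JacobiCharacter h m public
  open WeakDirichletConclusion N χ χ-* χ-1 χ-value χ-% χ-inverse using (χ-cong; divisorSum; divisorSum-kernel; weak-dirichlet)

  HasRoot : ℕ → Set
  HasRoot α = ∃[ β ] β * β ≈ κ mod α

  root-1 : HasRoot 1
  root-1 = 0ℤ , multiple (- κ) (lemma κ)
    where
    lemma : ∀ κ → 0ℤ * 0ℤ ≡ κ + - κ * 1ℤ
    lemma = solve-∀

  -- Chinese remainder theorem for the square root of κ.
  root-* : ∀ {a b} → Coprime a b → HasRoot a → HasRoot b → HasRoot (a ℕ.* b)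
  root-* {a} {b} a⊥b (x , multiple q e) (y , multiple r f) = combine (coprime⇒inverse a⊥b)
    where
    open ≡-Reasoning
    A B : ℤ
    A = + a
    B = + b
    combine : ∃[ u ] u * + a ≈ 1ℤ mod b → HasRoot (a ℕ.* b)
    combine (u , multiple w g) = z , multiple Z (begin
      z * z
        ≡⟨ expand x y A B u w ⟩
      y * y * (u * A * (u * A)) + x * x * (w * B * (w * B)) - + 2 * (x * y * u * w) * (A * B)
        ≡⟨ cong₂ (λ s t → t * (u * A * (u * A)) + s * (w * B * (w * B)) - + 2 * (x * y * u * w) * (A * B)) e f ⟩
      (κ + r * B) * (u * A * (u * A)) + (κ + q * A) * (w * B * (w * B)) - + 2 * (x * y * u * w) * (A * B)
        ≡⟨ collect x y A B u w κ q r ⟩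
      κ * ((u * A - w * B) * (u * A - w * B)) + Z * (A * B)
        ≡⟨ cong₂ (λ s t → κ * (s * s) + Z * t) (trans (cong (_- w * B) g) (cancel (w * B))) (sym (ℤₚ.pos-* a b)) ⟩
      κ * (1ℤ * 1ℤ) + Z * + (a ℕ.* b)
        ≡⟨ cong (_+ Z * + (a ℕ.* b)) (ℤₚ.*-identityʳ κ) ⟩
      κ + Z * + (a ℕ.* b) ∎)
      where
      z Z : ℤ
      z = y * (u * A) - x * (w * B)
      Z = + 2 * κ * u * w + r * u * u * A + q * w * w * B - + 2 * (x * y * u * w)
      expand : ∀ x y A B u w → (y * (u * A) - x * (w * B)) * (y * (u * A) - x * (w * B))
        ≡ y * y * (u * A * (u * A)) + x * x * (w * B * (w * B)) - + 2 * (x * y * u * w) * (A * B)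
      expand = solve-∀
      collect : ∀ x y A B u w κ q r →
        (κ + r * B) * (u * A * (u * A)) + (κ + q * A) * (w * B * (w * B)) - + 2 * (x * y * u * w) * (A * B)
        ≡ κ * ((u * A - w * B) * (u * A - w * B))
          + (+ 2 * κ * u * w + r * u * u * A + q * w * w * B - + 2 * (x * y * u * w)) * (A * B)
      collect = solve-∀
      cancel : ∀ v → 1ℤ + v - v ≡ 1ℤ
      cancel = solve-∀

  root-prime : ∀ p α → Prime p → ¬ (p ℕ∣.∣ α) → χ p ≡ 1ℤ → HasRoot α → HasRoot (p ℕ.* α)
  root-prime p α pr p∤α χp≡1 rα = root-* p⊥α (root-p (odd-half p (invertible-8 i))) rα
    where
    1≢0 : 1ℤ ≢ 0ℤ
    1≢0 ()
    i : Invertible N p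
    i = χ≢0⇒invertible (λ e → 1≢0 (trans (sym χp≡1) e))
    p⊥α : Coprime p α
    p⊥α {d} (d∣p , d∣α) with Primality.prime⇒irreducible pr d∣p
    ... | inj₁ d≡1  = d≡1
    ... | inj₂ refl = ⊥-elim (p∤α d∣α)
    root-p : ∃[ l ] p ≡ modulus l → HasRoot p
    root-p (l , refl) = jacobi≡1⇒square {l} pr (proj₂ (χ≡jacobi l i)) (trans (sym (proj₁ (χ≡jacobi l i))) χp≡1)

  record Root (c : ℕ) : Set where
    field
      α     : ℕ
      τ β   : ℤ
      1≤α   : 1 ℕ.≤ α
      unitα : Invertible N α
      class : + α ≈ + c * (τ * τ) mod N
      root  : β * β ≈ κ mod α

  find-root : ∀ l → Invertible N (modulus l) → jacobi l κ ≡ 1ℤ → Root (modulus l)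
  find-root l i j≡1 = build (weak-dirichlet c χc≡1)
    where
    c : ℕ
    c = modulus l
    χc≡1 : χ c ≡ 1ℤ
    χc≡1 = trans (proj₁ (χ≡jacobi l i)) j≡1
    1≢0 : 1ℤ ≢ 0ℤ
    1≢0 ()
    build : ∃[ A ] A % N ≡ c % N × 1 ℕ.≤ A × divisorSum A ≢ 0ℤ → Root c
    build (A , A≡c , 1≤A , s≢0) = finish (divisorSum-kernel HasRoot root-1 root-prime A 1≤A χA≢0 s≢0)
      where
      χA≢0 : χ A ≢ 0ℤ
      χA≢0 e = 1≢0 (trans (sym (trans (χ-cong {A} {c} A≡c) χc≡1)) e)
      finish : ∃[ α ] ∃[ σ ] A ≡ α ℕ.* (σ ℕ.* σ) × HasRoot α → Root c
      finish (zero , σ , eq , _) = ⊥-elim (ℕₚ.<⇒≢ 1≤A (sym eq))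
      finish (α@(suc _) , σ , eq , β , root) = record
        { α = α ; τ = τ ; β = β ; 1≤α = s≤s z≤n ; unitα = invertible-factor α (σ ℕ.* σ) iA
        ; class = ≈-trans (≈-reflexive (sym (ℤₚ.*-identityʳ (+ α))))
            (≈-trans (≈-*ˡ (+ α) (≈-sym (≈-* τσ≈1 τσ≈1)))
              (≈-trans (≈-reflexive (trans (lemma (+ α) τ (+ σ)) (cong (_* (τ * τ)) A≡ασσ)))
                (≈-*ʳ (τ * τ) (%-≈ A c A≡c))))
        ; root = root }
        where
        iA : Invertible N (α ℕ.* (σ ℕ.* σ))
        iA = subst (Invertible N) eq (χ≢0⇒invertible χA≢0)
        iσ : Invertible N σ
        iσ = invertible-factor σ σ (invertible-factor (σ ℕ.* σ) α (subst (Invertible N) (ℕₚ.*-comm α (σ ℕ.* σ)) iA))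
        τ : ℤ
        τ = Invertible.inv iσ
        τσ≈1 : τ * + σ ≈ 1ℤ mod N
        τσ≈1 = Invertible.invˡ iσ
        lemma : ∀ a t s → a * (t * s * (t * s)) ≡ a * (s * s) * (t * t)
        lemma = solve-∀
        A≡ασσ : + α * (+ σ * + σ) ≡ + A
        A≡ασσ = trans (cong (+ α *_) (sym (ℤₚ.pos-* σ σ))) (trans (sym (ℤₚ.pos-* α (σ ℕ.* σ))) (cong +_ (sym eq)))

  -- A square root of κ = - q c modulo α, for a unit c, gives b α = c t² + q.
  norm-equation : ∀ {c₀} (R : Root c₀) q c → κ ≡ - (q * + c) → c ℕ∣.∣ N → let open Root R in
                  ∃[ t ] ∃[ b ] b * + α ≡ + c * (t * t) + q
  norm-equation R q c κ≡ c∣N = build (coprime⇒invertible c⊥α)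
    where
    open Root R
    c⊥α : Coprime c α
    c⊥α {d} (d∣c , d∣α) = invertible⇒coprime unitα (d∣α , ℕ∣.∣-trans d∣c c∣N)
    build : Invertible α c → ∃[ t ] ∃[ b ] b * + α ≡ + c * (t * t) + q
    build (invertible i e) = i * β , quotient ≈q , lemma (+ c * (i * β * (i * β))) q (quotient ≈q * + α) (equation ≈q)
      where
      ≈q : + c * (i * β * (i * β)) ≈ - q mod α
      ≈q = ≈-trans (≈-reflexive (shuffle (+ c) i β))
        (≈-trans (≈-*ʳ (i * (β * β)) e) (≈-trans (≈-reflexive (ℤₚ.*-identityˡ (i * (β * β))))
          (≈-trans (≈-*ˡ i (≈-trans root (≈-reflexive κ≡)))
            (≈-trans (≈-reflexive (shuffle′ i q (+ c))) (≈-trans (≈-*ˡ (- q) e) (≈-reflexive (ℤₚ.*-identityʳ (- q))))))))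
        where
        shuffle : ∀ c i β → c * (i * β * (i * β)) ≡ i * c * (i * (β * β))
        shuffle = solve-∀
        shuffle′ : ∀ i q c → i * - (q * c) ≡ - q * (i * c)
        shuffle′ = solve-∀
      lemma : ∀ x q y → x ≡ - q + y → y ≡ x + q
      lemma x q y refl = sym (cancel q y)
        where
        cancel : ∀ q y → - q + y + q ≡ y
        cancel = solve-∀

module _ {l : ℕ} {x : ℤ} (u : Unit l x) where

  private
    r : ℕ
    r = modulus l % 8

  jacobi-neg : jacobi l (- x) ≡ ω r * jacobi l x
  jacobi-neg = trans (cong (jacobi l) (lemma x)) (trans (jacobi-* l unit-neg1 u)
    (cong (_* jacobi l x) (trans (jacobi-neg1 l) (-1^≡ω l))))
    where
    lemma : ∀ x → - x ≡ -1ℤ * x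
    lemma = solve-∀

  jacobi-double : jacobi l (+ 2 * x) ≡ η r * jacobi l x
  jacobi-double = trans (jacobi-* l (unit-2 l) u) (cong (_* jacobi l x) (jacobi-2 l))

unit-factor : ∀ {l} x y → Unit l (x * y) → Unit l y
unit-factor x y (unit c e) = unit (c * x) (≈-trans (≈-reflexive (ℤₚ.*-assoc c x y)) e)

jacobi-quarter : ∀ {l x y} → Unit l y → + 4 * x ≈ y mod modulus l → Unit l x × jacobi l x ≡ jacobi l y
jacobi-quarter {l} {x} {y} uy e = ux , (begin
  jacobi l x                              ≡⟨ sym (ℤₚ.*-identityˡ _) ⟩
  1ℤ * jacobi l x                         ≡⟨ cong (_* jacobi l x) (sym (jacobi-square l (unit-2 l))) ⟩
  jacobi l (+ 2 * + 2) * jacobi l x       ≡⟨ sym (jacobi-* l (unit-* (unit-2 l) (unit-2 l)) ux) ⟩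
  jacobi l (+ 4 * x)                      ≡⟨ jacobi-≈ l u4x e ⟩
  jacobi l y                              ∎)
  where
  open ≡-Reasoning
  u4x : Unit l (+ 4 * x)
  u4x = unit-≈ (≈-sym e) uy
  ux : Unit l x
  ux = unit-factor (+ 4) x u4x

jacobi-eighth : ∀ {l x y} → Unit l y → + 8 * x ≈ y mod modulus l → Unit l x × jacobi l x ≡ η (modulus l % 8) * jacobi l y
jacobi-eighth {l} {x} {y} uy e = ux , (begin
  jacobi l x                    ≡⟨ sym (ℤₚ.*-identityˡ _) ⟩
  1ℤ * jacobi l x               ≡⟨ cong (_* jacobi l x) (sym (sign-square η-sign)) ⟩
  η r * η r * jacobi l x        ≡⟨ ℤₚ.*-assoc (η r) (η r) (jacobi l x) ⟩
  η r * (η r * jacobi l x)      ≡⟨ cong (η r *_) (trans (sym (jacobi-double ux)) (proj₂ quarter)) ⟩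
  η r * jacobi l y              ∎)
  where
  open ≡-Reasoning
  r : ℕ
  r = modulus l % 8
  η-sign : IsSign (η r)
  η-sign = subst IsSign (jacobi-2 l) (jacobi-sign l (+ 2))
  lemma : ∀ x → + 8 * x ≡ + 4 * (+ 2 * x)
  lemma = solve-∀
  quarter : Unit l (+ 2 * x) × jacobi l (+ 2 * x) ≡ jacobi l y
  quarter = jacobi-quarter uy (≈-trans (≈-reflexive (sym (lemma x))) e)
  ux : Unit l x
  ux = unit-factor (+ 2) x (proj₁ quarter)

jacobi-3 : ∀ l → + modulus l ≈ 1ℤ mod 3 → Unit l (+ 3) × jacobi l (+ 3) ≡ ω (modulus l % 8)
jacobi-3 l e = u , (begin
  jacobi l (+ 3)                              ≡⟨ sym (ℤₚ.*-identityˡ _) ⟩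
  1ℤ * jacobi l (+ 3)                         ≡⟨ cong (_* jacobi l (+ 3)) (sym (trans (jacobi-≈ 1 v e) (jacobi-1 1))) ⟩
  jacobi 1 (+ modulus l) * jacobi l (+ 3)     ≡⟨ jacobi-reciprocity 1 l v u ⟩
  -1ℤ ℤ.^ l * 1ℤ                              ≡⟨ trans (ℤₚ.*-identityʳ _) (-1^≡ω l) ⟩
  ω (modulus l % 8)                           ∎)
  where
  open ≡-Reasoning
  v : Unit 1 (+ modulus l)
  v = unit 1ℤ (≈-trans (≈-reflexive (ℤₚ.*-identityˡ _)) e)
  u : Unit l (+ 3)
  u = coprime⇒unit (Coprimality.sym (invertible⇒coprime (invertible 1ℤ (inverseˡ v))))

jacobi-5 : ∀ l → + modulus l ≈ + 3 mod 5 → Unit l (+ 5) × jacobi l (+ 5) ≡ -1ℤ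
jacobi-5 l e = u , (begin
  jacobi l (+ 5)                              ≡⟨ lemma (jacobi l (+ 5)) ⟩
  -1ℤ * (-1ℤ * jacobi l (+ 5))                ≡⟨ cong (λ j → -1ℤ * (j * jacobi l (+ 5))) (sym (trans (jacobi-≈ 2 v e) nonresidue)) ⟩
  -1ℤ * (jacobi 2 (+ modulus l) * jacobi l (+ 5)) ≡⟨ cong (-1ℤ *_) (jacobi-reciprocity 2 l v u) ⟩
  -1ℤ * (-1ℤ ℤ.^ l * (-1ℤ ℤ.^ l * 1ℤ))        ≡⟨ cong (-1ℤ *_) (trans (cong (-1ℤ ℤ.^ l *_) (ℤₚ.*-identityʳ _)) (sign-square (-1^-sign l))) ⟩
  -1ℤ                                         ∎)
  where
  open ≡-Reasoning
  lemma : ∀ j → j ≡ -1ℤ * (-1ℤ * j)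
  lemma = solve-∀
  nonresidue : jacobi 2 (+ 3) ≡ -1ℤ
  nonresidue = cong₂ (λ x y → x * (y * 1ℤ))
    (proj₁ (half-unique 2 {+ 3} { -1ℤ} {2} (inj₂ refl) (s≤s z≤n) ℕₚ.≤-refl (multiple 1ℤ refl)))
    (proj₁ (half-unique 2 {+ 6} {1ℤ} {1} (inj₁ refl) (s≤s z≤n) (s≤s z≤n) (multiple 1ℤ refl)))
  v : Unit 2 (+ modulus l)
  v = unit (+ 2) (≈-trans (≈-*ˡ (+ 2) e) (multiple 1ℤ refl))
  u : Unit l (+ 5)
  u = coprime⇒unit (Coprimality.sym (invertible⇒coprime (invertible (+ 2) (inverseˡ v))))

residue : ∀ {m} {{_ : ℕ.NonZero m}} {a} r q → a ≡ r ℕ.+ q ℕ.* m → a % m ≡ r % m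
residue {m} r q refl = ℕ÷.[m+kn]%n≡m%n r q m

invertible-residue : ∀ m {{_ : ℕ.NonZero m}} {a} r q → a ≡ r ℕ.+ q ℕ.* m → Invertible m r → Invertible m a
invertible-residue m {a} r q eq = invertible-≈ (%-≈ r a (sym (residue r q eq)))

-- Positive definite ternary forms

-- (a, b, c, r, s, t) stands for a x² + b y² + c z² + r yz + s xz + t xy.
record Form : Set where
  constructor form
  field a b c r s t : ℤ

eval : Form → ℤ → ℤ → ℤ → ℤ
eval (form a b c r s t) x y z =
  a * (x * x) + b * (y * y) + c * (z * z) + r * (y * z) + s * (x * z) + t * (x * y)

-- Half the determinant of the Gram matrix with even diagonal.
disc : Form → ℤ
disc (form a b c r s t) = + 4 * a * b * c + r * s * t - a * (r * r) - b * (s * s) - c * (t * t)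

Represents : Form → ℤ → Set
Represents Q n = ∃[ x ] ∃[ y ] ∃[ z ] eval Q x y z ≡ n

PosDef : Form → Set
PosDef Q = ∀ x y z → eval Q x y z ≤ 0ℤ → x ≡ 0ℤ × y ≡ 0ℤ × z ≡ 0ℤ

record _⊑_ (Q Q′ : Form) : Set where
  field
    disc≡  : disc Q′ ≡ disc Q
    pos    : PosDef Q → PosDef Q′
    repr   : ∀ {n} → Represents Q n → Represents Q′ n

open _⊑_ public

⊑-refl : ∀ {Q} → Q ⊑ Q
⊑-refl = record { disc≡ = refl ; pos = id ; repr = id }

⊑-trans : ∀ {P Q R} → P ⊑ Q → Q ⊑ R → P ⊑ R
⊑-trans p q = record
  { disc≡ = trans (disc≡ q) (disc≡ p) ; pos = pos q ∘ pos p ; repr = repr q ∘ repr p }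

rotate : Form → Form
rotate (form a b c r s t) = form b c a s t r

rotate-⊑ : ∀ Q → Q ⊑ rotate Q
rotate-⊑ Q@(form a b c r s t) = record
  { disc≡ = d a b c r s t
  ; pos   = λ p x y z le →
      let (x≡0 , y≡0 , z≡0) = p z x y (subst (_≤ 0ℤ) (e a b c r s t z x y) le)
      in y≡0 , z≡0 , x≡0
  ; repr  = λ (x , y , z , eq) → y , z , x , trans (e a b c r s t x y z) eq
  }
  where
  d : ∀ a b c r s t → disc (form b c a s t r) ≡ disc (form a b c r s t)
  d a b c r s t = lemma a b c r s t
    where
    lemma : ∀ a b c r s t → + 4 * b * c * a + s * t * r - b * (s * s) - c * (t * t) - a * (r * r)
                          ≡ + 4 * a * b * c + r * s * t - a * (r * r) - b * (s * s) - c * (t * t)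
    lemma = solve-∀
  e : ∀ a b c r s t x y z → eval (form b c a s t r) y z x ≡ eval (form a b c r s t) x y z
  e = lemma
    where
    lemma : ∀ a b c r s t x y z →
      b * (y * y) + c * (z * z) + a * (x * x) + s * (z * x) + t * (y * x) + r * (y * z)
      ≡ a * (x * x) + b * (y * y) + c * (z * z) + r * (y * z) + s * (x * z) + t * (x * y)
    lemma = solve-∀

-- The new basis replaces the first vector by itself plus m times the second and n times the third.
shear : ℤ → ℤ → Form → Form
shear m n (form a b c r s t) =
  form (a + b * (m * m) + c * (n * n) + r * (m * n) + s * n + t * m) b c r
       (s + + 2 * c * n + r * m) (t + + 2 * b * m + r * n)

shear-⊑ : ∀ m n Q → Q ⊑ shear m n Q
shear-⊑ m n (form a b c r s t) = record
  { disc≡ = d m n a b c r s t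
  ; pos   = λ p x y z le →
      let (x≡0 , y≡0 , z≡0) = p x (y + m * x) (z + n * x) (subst (_≤ 0ℤ) (e m n a b c r s t x y z) le)
      in x≡0 , back m x≡0 y≡0 , back n x≡0 z≡0
  ; repr  = λ (x , y , z , eq) → x , y - m * x , z - n * x ,
      trans (e′ m n a b c r s t x y z) eq
  }
  where
  back : ∀ m {x y} → x ≡ 0ℤ → y + m * x ≡ 0ℤ → y ≡ 0ℤ
  back m {y = y} refl eq = trans (lemma m y) eq
    where
    lemma : ∀ m y → y ≡ y + m * 0ℤ
    lemma = solve-∀
  d : ∀ m n a b c r s t → disc (shear m n (form a b c r s t)) ≡ disc (form a b c r s t)
  d = lemma
    where
    lemma : ∀ m n a b c r s t →
      + 4 * (a + b * (m * m) + c * (n * n) + r * (m * n) + s * n + t * m) * b * c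
      + r * (s + + 2 * c * n + r * m) * (t + + 2 * b * m + r * n)
      - (a + b * (m * m) + c * (n * n) + r * (m * n) + s * n + t * m) * (r * r)
      - b * ((s + + 2 * c * n + r * m) * (s + + 2 * c * n + r * m))
      - c * ((t + + 2 * b * m + r * n) * (t + + 2 * b * m + r * n))
      ≡ + 4 * a * b * c + r * s * t - a * (r * r) - b * (s * s) - c * (t * t)
    lemma = solve-∀
  e : ∀ m n a b c r s t x y z → eval (shear m n (form a b c r s t)) x y z
                              ≡ eval (form a b c r s t) x (y + m * x) (z + n * x)
  e = lemma
    where
    lemma : ∀ m n a b c r s t x y z →
      (a + b * (m * m) + c * (n * n) + r * (m * n) + s * n + t * m) * (x * x) + b * (y * y) + c * (z * z)
      + r * (y * z) + (s + + 2 * c * n + r * m) * (x * z) + (t + + 2 * b * m + r * n) * (x * y)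
      ≡ a * (x * x) + b * ((y + m * x) * (y + m * x)) + c * ((z + n * x) * (z + n * x))
        + r * ((y + m * x) * (z + n * x)) + s * (x * (z + n * x)) + t * (x * (y + m * x))
    lemma = solve-∀
  e′ : ∀ m n a b c r s t x y z → eval (shear m n (form a b c r s t)) x (y - m * x) (z - n * x)
                               ≡ eval (form a b c r s t) x y z
  e′ m n a b c r s t x y z = trans (e m n a b c r s t x (y - m * x) (z - n * x))
    (cong₂ (eval (form a b c r s t) x) (lemma y (m * x)) (lemma z (n * x)))
    where
    lemma : ∀ y k → y - k + k ≡ y
    lemma = solve-∀


gain : Form → ℤ × ℤ → ℤ
gain (form a b c r s t) (m , n) = b * (m * m) + c * (n * n) + r * (m * n) + s * n + t * m

shifts : List (ℤ × ℤ)
shifts = (1ℤ , 0ℤ) ∷ (-1ℤ , 0ℤ) ∷ (0ℤ , 1ℤ) ∷ (0ℤ , -1ℤ)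
       ∷ (1ℤ , 1ℤ) ∷ (1ℤ , -1ℤ) ∷ (-1ℤ , 1ℤ) ∷ (-1ℤ , -1ℤ) ∷ []

Minimal : Form → Set
Minimal Q = All (λ v → 0ℤ ≤ gain Q v) shifts

Reduced : Form → Set
Reduced Q = Minimal Q × Minimal (rotate Q) × Minimal (rotate (rotate Q))

size : Form → ℕ
size (form a b c _ _ _) = ∣ a ∣ ℕ.+ ∣ b ∣ ℕ.+ ∣ c ∣

size-rotate : ∀ Q → size (rotate Q) ≡ size Q
size-rotate (form a b c _ _ _) =
  trans (ℕₚ.+-comm (∣ b ∣ ℕ.+ ∣ c ∣) ∣ a ∣) (sym (ℕₚ.+-assoc (∣ a ∣) (∣ b ∣) (∣ c ∣)))

posDef-a : ∀ Q → PosDef Q → 0ℤ < Form.a Q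
posDef-a (form a b c r s t) pd = ℤₚ.≰⇒> λ a≤0 →
  1≢0 (proj₁ (pd 1ℤ 0ℤ 0ℤ (subst (_≤ 0ℤ) (lemma a b c r s t) a≤0)))
  where
  1≢0 : 1ℤ ≢ 0ℤ
  1≢0 ()
  lemma : ∀ a b c r s t →
    a ≡ a * (1ℤ * 1ℤ) + b * (0ℤ * 0ℤ) + c * (0ℤ * 0ℤ) + r * (0ℤ * 0ℤ) + s * (1ℤ * 0ℤ) + t * (1ℤ * 0ℤ)
  lemma = solve-∀

∣∣-mono-< : ∀ {i j} → 0ℤ < i → i < j → ∣ i ∣ ℕ.< ∣ j ∣
∣∣-mono-< {+ _} {+ _} _ (+<+ lt) = lt

Smaller : Form → Set
Smaller Q = ∃[ Q′ ] Q ⊑ Q′ × size Q′ ℕ.< size Q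

shear-smaller : ∀ Q → PosDef Q → ∀ v → ¬ (0ℤ ≤ gain Q v) → Smaller Q
shear-smaller Q@(form a b c r s t) pd (m , n) neg = Q′ , Q⊑Q′ ,
  ℕₚ.+-monoˡ-< ∣ c ∣ (ℕₚ.+-monoˡ-< ∣ b ∣ (∣∣-mono-< (posDef-a Q′ (pos Q⊑Q′ pd)) less))
  where
  Q′ : Form
  Q′ = shear m n Q
  Q⊑Q′ : Q ⊑ Q′
  Q⊑Q′ = shear-⊑ m n Q
  assoc : ∀ a b c r s t m n → a + (b * (m * m) + c * (n * n) + r * (m * n) + s * n + t * m)
    ≡ a + b * (m * m) + c * (n * n) + r * (m * n) + s * n + t * m
  assoc = solve-∀
  less : a + b * (m * m) + c * (n * n) + r * (m * n) + s * n + t * m < a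
  less = subst₂ _<_ (assoc a b c r s t m n) (ℤₚ.+-identityʳ a) (ℤₚ.+-monoʳ-< a (ℤₚ.≰⇒> neg))

minimal⊎smaller : ∀ Q → PosDef Q → Minimal Q ⊎ Smaller Q
minimal⊎smaller Q pd = go shifts
  where
  go : ∀ vs → All (λ v → 0ℤ ≤ gain Q v) vs ⊎ Smaller Q
  go []       = inj₁ []
  go (v ∷ vs) with 0ℤ ℤₚ.≤? gain Q v | go vs
  ... | no neg | _         = inj₂ (shear-smaller Q pd v neg)
  ... | yes _  | inj₂ less = inj₂ less
  ... | yes p  | inj₁ ps   = inj₁ (p ∷ ps)

smaller-rotate : ∀ Q → Smaller (rotate Q) → Smaller Q
smaller-rotate Q (Q′ , le , lt) =
  Q′ , ⊑-trans (rotate-⊑ Q) le , subst (size Q′ ℕ.<_) (size-rotate Q) lt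

reduced⊎smaller : ∀ Q → PosDef Q → Reduced Q ⊎ Smaller Q
reduced⊎smaller Q pd = combine (minimal⊎smaller Q pd) (minimal⊎smaller (rotate Q) pd₁)
                               (minimal⊎smaller (rotate (rotate Q)) (pos (rotate-⊑ (rotate Q)) pd₁))
  where
  pd₁ : PosDef (rotate Q)
  pd₁ = pos (rotate-⊑ Q) pd
  combine : Minimal Q ⊎ Smaller Q → Minimal (rotate Q) ⊎ Smaller (rotate Q) →
            Minimal (rotate (rotate Q)) ⊎ Smaller (rotate (rotate Q)) → Reduced Q ⊎ Smaller Q
  combine (inj₁ p) (inj₁ q) (inj₁ r) = inj₁ (p , q , r)
  combine (inj₂ l) _        _        = inj₂ l
  combine _        (inj₂ l) _        = inj₂ (smaller-rotate Q l)
  combine _        _        (inj₂ l) = inj₂ (smaller-rotate Q (smaller-rotate (rotate Q) l))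

reduce : ∀ Q → PosDef Q → ∃[ Q′ ] Q ⊑ Q′ × Reduced Q′
reduce Q pd = go (size Q) Q ℕₚ.≤-refl pd
  where
  go : ∀ k Q → size Q ℕ.≤ k → PosDef Q → ∃[ Q′ ] Q ⊑ Q′ × Reduced Q′
  descend : ∀ k Q → size Q ℕ.≤ k → PosDef Q → Reduced Q ⊎ Smaller Q → ∃[ Q′ ] Q ⊑ Q′ × Reduced Q′
  go k Q le pd = descend k Q le pd (reduced⊎smaller Q pd)
  descend k       Q le pd (inj₁ red) = Q , ⊑-refl , red
  descend zero    Q le pd (inj₂ (Q′ , _ , lt)) = ⊥-elim (ℕₚ.n≮0 (ℕₚ.<-≤-trans lt le))
  descend (suc k) Q le pd (inj₂ (Q′ , Q⊑Q′ , lt)) =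
    let (Q″ , Q′⊑Q″ , red) = go k Q′ (ℕₚ.≤-pred (ℕₚ.<-≤-trans lt le)) (pos Q⊑Q′ pd)
    in Q″ , ⊑-trans Q⊑Q′ Q′⊑Q″ , red

record Bounded (Q : Form) : Set where
  open Form Q
  field
    b+t : 0ℤ ≤ b + t
    b-t : 0ℤ ≤ b - t
    c+s : 0ℤ ≤ c + s
    c-s : 0ℤ ≤ c - s
    c+r : 0ℤ ≤ c + r
    c-r : 0ℤ ≤ c - r
    a+t : 0ℤ ≤ a + t
    a-t : 0ℤ ≤ a - t
    a+s : 0ℤ ≤ a + s
    a-s : 0ℤ ≤ a - s
    b+r : 0ℤ ≤ b + r
    b-r : 0ℤ ≤ b - r

reduced⇒bounded : ∀ Q → Reduced Q → Bounded Q
reduced⇒bounded (form a b c r s t)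
  ( (p₁ ∷ p₂ ∷ p₃ ∷ p₄ ∷ _) , (q₁ ∷ q₂ ∷ q₃ ∷ q₄ ∷ _) , (r₁ ∷ r₂ ∷ r₃ ∷ r₄ ∷ _)) = record
  { b+t = at (e₁ b c r s t) p₁ ; b-t = at (e₂ b c r s t) p₂
  ; c+s = at (e₃ b c r s t) p₃ ; c-s = at (e₄ b c r s t) p₄
  ; c+r = at (e₁ c a s t r) q₁ ; c-r = at (e₂ c a s t r) q₂
  ; a+t = at (e₃ c a s t r) q₃ ; a-t = at (e₄ c a s t r) q₄
  ; a+s = at (e₁ a b t r s) r₁ ; a-s = at (e₂ a b t r s) r₂
  ; b+r = at (e₃ a b t r s) r₃ ; b-r = at (e₄ a b t r s) r₄
  }
  where
  at : ∀ {x y} → x ≡ y → 0ℤ ≤ x → 0ℤ ≤ y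
  at = subst (0ℤ ≤_)
  e₁ : ∀ b c r s t → b * (1ℤ * 1ℤ) + c * (0ℤ * 0ℤ) + r * (1ℤ * 0ℤ) + s * 0ℤ + t * 1ℤ ≡ b + t
  e₁ = solve-∀
  e₂ : ∀ b c r s t → b * (-1ℤ * -1ℤ) + c * (0ℤ * 0ℤ) + r * (-1ℤ * 0ℤ) + s * 0ℤ + t * -1ℤ ≡ b - t
  e₂ = solve-∀
  e₃ : ∀ b c r s t → b * (0ℤ * 0ℤ) + c * (1ℤ * 1ℤ) + r * (0ℤ * 1ℤ) + s * 1ℤ + t * 0ℤ ≡ c + s
  e₃ = solve-∀
  e₄ : ∀ b c r s t → b * (0ℤ * 0ℤ) + c * (-1ℤ * -1ℤ) + r * (0ℤ * -1ℤ) + s * -1ℤ + t * 0ℤ ≡ c - s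
  e₄ = solve-∀

0≤2i⇒0≤i : ∀ {i} → 0ℤ ≤ + 2 * i → 0ℤ ≤ i
0≤2i⇒0≤i {i} le = ℤₚ.*-cancelˡ-≤-pos 0ℤ i (+ 2) le

module _ {a b c r s t : ℤ} (bd : Bounded (form a b c r s t))
         (0≤a : 0ℤ ≤ a) (0≤b : 0ℤ ≤ b) (0≤c : 0ℤ ≤ c) where
  open Bounded bd

  abc≤disc-same : 0ℤ ≤ r * s * t → a * b * c ≤ disc (form a b c r s t)
  abc≤disc-same 0≤rst = ℤₚ.0≤i-j⇒j≤i (0≤2i⇒0≤i (subst (0ℤ ≤_) (sym (lemma a b c r s t))
    (0≤+ (0≤+ (0≤+ (0≤* 0≤a (0≤+ (0≤* b-r c+r) (0≤* b+r c-r)))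
                   (0≤* 0≤b (0≤+ (0≤* a-s c+s) (0≤* a+s c-s))))
              (0≤* 0≤c (0≤+ (0≤* a-t b+t) (0≤* a+t b-t))))
         (0≤* {+ 2} (+≤+ z≤n) 0≤rst))))
    where
    lemma : ∀ a b c r s t →
      + 2 * (+ 4 * a * b * c + r * s * t - a * (r * r) - b * (s * s) - c * (t * t) - a * b * c)
      ≡ a * ((b - r) * (c + r) + (b + r) * (c - r)) + b * ((a - s) * (c + s) + (a + s) * (c - s))
        + c * ((a - t) * (b + t) + (a + t) * (b - t)) + + 2 * (r * s * t)
    lemma = solve-∀

-- With R, S, T ≥ 0 the only inequality needed beyond the bounds on R, S, T is R + S + T ≤ a + b:
-- it makes a c (b - R) + b c (a - S) at least c min(a, b) T ≥ R S T.
abc≤disc-opposite : ∀ {a b c R S T} → 0ℤ ≤ a → 0ℤ ≤ b → 0ℤ ≤ c → 0ℤ ≤ R → 0ℤ ≤ S → 0ℤ ≤ T →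
  0ℤ ≤ b - R → 0ℤ ≤ c - R → 0ℤ ≤ a - S → 0ℤ ≤ c - S → 0ℤ ≤ a - T → 0ℤ ≤ b - T →
  0ℤ ≤ a + b - R - S - T → a * b * c ≤ disc (form a b c (- R) (- S) (- T))
abc≤disc-opposite {a} {b} {c} {R} {S} {T} 0≤a 0≤b 0≤c 0≤R 0≤S 0≤T bR cR aS cS aT bT y =
  ℤₚ.0≤i-j⇒j≤i ([ by-a≤b , by-b≤a ]′ (ℤₚ.≤-total a b))
  where
  lemma₁ : ∀ a b c R S T →
    + 4 * a * b * c + (- R) * (- S) * (- T) - a * ((- R) * (- R)) - b * ((- S) * (- S)) - c * ((- T) * (- T)) - a * b * c
    ≡ a * R * (c - R) + b * S * (c - S) + c * a * (b - T) + c * T * (a - T)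
      + a * c * (a + b - R - S - T) + c * (b - a) * (a - S) + T * a * (c - R) + T * R * (a - S)
  lemma₁ = solve-∀
  lemma₂ : ∀ a b c R S T →
    + 4 * a * b * c + (- R) * (- S) * (- T) - a * ((- R) * (- R)) - b * ((- S) * (- S)) - c * ((- T) * (- T)) - a * b * c
    ≡ a * R * (c - R) + b * S * (c - S) + c * a * (b - T) + c * T * (a - T)
      + b * c * (a + b - R - S - T) + c * (a - b) * (b - R) + T * b * (c - S) + T * S * (b - R)
  lemma₂ = solve-∀
  common : 0ℤ ≤ a * R * (c - R) + b * S * (c - S) + c * a * (b - T) + c * T * (a - T)
  common = 0≤+ (0≤+ (0≤+ (0≤* (0≤* 0≤a 0≤R) cR) (0≤* (0≤* 0≤b 0≤S) cS))
                    (0≤* (0≤* 0≤c 0≤a) bT)) (0≤* (0≤* 0≤c 0≤T) aT)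
  by-a≤b : a ≤ b → 0ℤ ≤ disc (form a b c (- R) (- S) (- T)) - a * b * c
  by-a≤b a≤b = subst (0ℤ ≤_) (sym (lemma₁ a b c R S T))
    (0≤+ (0≤+ (0≤+ (0≤+ common (0≤* (0≤* 0≤a 0≤c) y)) (0≤* (0≤* 0≤c (ℤₚ.i≤j⇒0≤j-i a≤b)) aS))
              (0≤* (0≤* 0≤T 0≤a) cR)) (0≤* (0≤* 0≤T 0≤R) aS))
  by-b≤a : b ≤ a → 0ℤ ≤ disc (form a b c (- R) (- S) (- T)) - a * b * c
  by-b≤a b≤a = subst (0ℤ ≤_) (sym (lemma₂ a b c R S T))
    (0≤+ (0≤+ (0≤+ (0≤+ common (0≤* (0≤* 0≤b 0≤c) y)) (0≤* (0≤* 0≤c (ℤₚ.i≤j⇒0≤j-i b≤a)) bR))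
              (0≤* (0≤* 0≤T 0≤b) cS)) (0≤* (0≤* 0≤T 0≤S) bR))

abc≤disc : ∀ Q → PosDef Q → Reduced Q → let open Form Q in a * b * c ≤ disc Q
abc≤disc Q@(form a b c r s t) pd red@(_ , _ , (_ ∷ _ ∷ _ ∷ _ ∷ m₁ ∷ m₂ ∷ m₃ ∷ m₄ ∷ [])) = by-signs (nonneg? r) (nonneg? s) (nonneg? t)
  where
  bd : Bounded Q
  bd = reduced⇒bounded Q red
  open Bounded bd
  pd₁ : PosDef (rotate Q)
  pd₁ = pos (rotate-⊑ Q) pd
  0≤a : 0ℤ ≤ a
  0≤a = ℤₚ.<⇒≤ (posDef-a Q pd)
  0≤b : 0ℤ ≤ b
  0≤b = ℤₚ.<⇒≤ (posDef-a (rotate Q) pd₁)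
  0≤c : 0ℤ ≤ c
  0≤c = ℤₚ.<⇒≤ (posDef-a (rotate (rotate Q)) (pos (rotate-⊑ (rotate Q)) pd₁))
  nonneg? : ∀ i → 0ℤ ≤ i ⊎ 0ℤ ≤ - i
  nonneg? (+ _)    = inj₁ (+≤+ z≤n)
  nonneg? -[1+ _ ] = inj₂ (+≤+ z≤n)
  at : ∀ {x y} → x ≡ y → 0ℤ ≤ x → 0ℤ ≤ y
  at = subst (0ℤ ≤_)
  same : 0ℤ ≤ r * s * t → a * b * c ≤ disc Q
  same = abc≤disc-same bd 0≤a 0≤b 0≤c
  neg : ∀ x y → 0ℤ ≤ x + y → 0ℤ ≤ x - - y
  neg x y = at (cong (λ z → x + z) (sym (ℤₚ.neg-involutive y)))
  s₁ : ∀ r s t → r * (- s) * (- t) ≡ r * s * t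
  s₁ = solve-∀
  s₂ : ∀ r s t → - r * s * (- t) ≡ r * s * t
  s₂ = solve-∀
  s₃ : ∀ r s t → - r * (- s) * t ≡ r * s * t
  s₃ = solve-∀
  d₁ : ∀ a b c r s t → + 4 * a * b * c + - - r * - s * - t - a * (- - r * - - r) - b * (- s * - s) - c * (- t * - t)
       ≡ + 4 * a * b * c + r * s * t - a * (r * r) - b * (s * s) - c * (t * t)
  d₁ = solve-∀
  d₂ : ∀ a b c r s t → + 4 * a * b * c + - r * - - s * - t - a * (- r * - r) - b * (- - s * - - s) - c * (- t * - t)
       ≡ + 4 * a * b * c + r * s * t - a * (r * r) - b * (s * s) - c * (t * t)
  d₂ = solve-∀
  d₃ : ∀ a b c r s t → + 4 * a * b * c + - r * - s * - - t - a * (- r * - r) - b * (- s * - s) - c * (- - t * - - t)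
       ≡ + 4 * a * b * c + r * s * t - a * (r * r) - b * (s * s) - c * (t * t)
  d₃ = solve-∀
  d₀ : ∀ a b c r s t → + 4 * a * b * c + - - r * - - s * - - t - a * (- - r * - - r) - b * (- - s * - - s) - c * (- - t * - - t)
       ≡ + 4 * a * b * c + r * s * t - a * (r * r) - b * (s * s) - c * (t * t)
  d₀ = solve-∀
  y₀ : ∀ a b r s t → a * (1ℤ * 1ℤ) + b * (1ℤ * 1ℤ) + t * (1ℤ * 1ℤ) + r * 1ℤ + s * 1ℤ ≡ a + b - - r - - s - - t
  y₀ = solve-∀
  y₁ : ∀ a b r s t → a * (-1ℤ * -1ℤ) + b * (1ℤ * 1ℤ) + t * (-1ℤ * 1ℤ) + r * 1ℤ + s * -1ℤ ≡ a + b - - r - s - t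
  y₁ = solve-∀
  y₂ : ∀ a b r s t → a * (1ℤ * 1ℤ) + b * (-1ℤ * -1ℤ) + t * (1ℤ * -1ℤ) + r * -1ℤ + s * 1ℤ ≡ a + b - r - - s - t
  y₂ = solve-∀
  y₃ : ∀ a b r s t → a * (-1ℤ * -1ℤ) + b * (-1ℤ * -1ℤ) + t * (-1ℤ * -1ℤ) + r * -1ℤ + s * -1ℤ ≡ a + b - r - s - - t
  y₃ = solve-∀
  by-signs : 0ℤ ≤ r ⊎ 0ℤ ≤ - r → 0ℤ ≤ s ⊎ 0ℤ ≤ - s → 0ℤ ≤ t ⊎ 0ℤ ≤ - t → a * b * c ≤ disc Q
  by-signs (inj₁ r₊) (inj₁ s₊) (inj₁ t₊) = same (0≤* (0≤* r₊ s₊) t₊)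
  by-signs (inj₁ r₊) (inj₂ s₋) (inj₂ t₋) = same (at (s₁ r s t) (0≤* (0≤* r₊ s₋) t₋))
  by-signs (inj₂ r₋) (inj₁ s₊) (inj₂ t₋) = same (at (s₂ r s t) (0≤* (0≤* r₋ s₊) t₋))
  by-signs (inj₂ r₋) (inj₂ s₋) (inj₁ t₊) = same (at (s₃ r s t) (0≤* (0≤* r₋ s₋) t₊))
  by-signs (inj₂ r₋) (inj₂ s₋) (inj₂ t₋) = subst (a * b * c ≤_) (d₀ a b c r s t)
    (abc≤disc-opposite 0≤a 0≤b 0≤c r₋ s₋ t₋ (neg b r b+r) (neg c r c+r) (neg a s a+s) (neg c s c+s) (neg a t a+t) (neg b t b+t) (at (y₀ a b r s t) m₁))
  by-signs (inj₂ r₋) (inj₁ s₊) (inj₁ t₊) = subst (a * b * c ≤_) (d₁ a b c r s t)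
    (abc≤disc-opposite 0≤a 0≤b 0≤c r₋ s₊ t₊ (neg b r b+r) (neg c r c+r) a-s c-s a-t b-t (at (y₁ a b r s t) m₃))
  by-signs (inj₁ r₊) (inj₂ s₋) (inj₁ t₊) = subst (a * b * c ≤_) (d₂ a b c r s t)
    (abc≤disc-opposite 0≤a 0≤b 0≤c r₊ s₋ t₊ b-r c-r (neg a s a+s) (neg c s c+s) a-t b-t (at (y₂ a b r s t) m₂))
  by-signs (inj₁ r₊) (inj₁ s₊) (inj₂ t₋) = subst (a * b * c ≤_) (d₃ a b c r s t)
    (abc≤disc-opposite 0≤a 0≤b 0≤c r₊ s₊ t₋ b-r c-r a-s c-s (neg a t a+t) (neg b t b+t) (at (y₃ a b r s t) m₄))

Vector₃ : Set
Vector₃ = ℤ × ℤ × ℤ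

value : Form → Vector₃ → ℤ
value Q (x , y , z) = eval Q x y z

polar : Form → Vector₃ → Vector₃ → ℤ
polar (form a b c r s t) (x , y , z) (x′ , y′ , z′) =
  + 2 * a * (x * x′) + + 2 * b * (y * y′) + + 2 * c * (z * z′)
  + r * (y * z′ + y′ * z) + s * (x * z′ + x′ * z) + t * (x * y′ + x′ * y)

pullback : Form → Vector₃ → Vector₃ → Vector₃ → Form
pullback f u v w = form (value f u) (value f v) (value f w) (polar f v w) (polar f u w) (polar f u v)

pullback-represents : ∀ f u v w {n} → Represents (pullback f u v w) n → Represents f n
pullback-represents f@(form a b c r s t) u@(u₁ , u₂ , u₃) v@(v₁ , v₂ , v₃) w@(w₁ , w₂ , w₃) (x , y , z , eq) =
  x * u₁ + y * v₁ + z * w₁ , x * u₂ + y * v₂ + z * w₂ , x * u₃ + y * v₃ + z * w₃ ,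
  trans (lemma a b c r s t u₁ u₂ u₃ v₁ v₂ v₃ w₁ w₂ w₃ x y z) eq
  where
  lemma : ∀ a b c r s t u₁ u₂ u₃ v₁ v₂ v₃ w₁ w₂ w₃ x y z →
      a * ((x * u₁ + y * v₁ + z * w₁) * (x * u₁ + y * v₁ + z * w₁))
    + b * ((x * u₂ + y * v₂ + z * w₂) * (x * u₂ + y * v₂ + z * w₂))
    + c * ((x * u₃ + y * v₃ + z * w₃) * (x * u₃ + y * v₃ + z * w₃))
    + r * ((x * u₂ + y * v₂ + z * w₂) * (x * u₃ + y * v₃ + z * w₃))
    + s * ((x * u₁ + y * v₁ + z * w₁) * (x * u₃ + y * v₃ + z * w₃))
    + t * ((x * u₁ + y * v₁ + z * w₁) * (x * u₂ + y * v₂ + z * w₂))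
    ≡ (a * (u₁ * u₁) + b * (u₂ * u₂) + c * (u₃ * u₃) + r * (u₂ * u₃) + s * (u₁ * u₃) + t * (u₁ * u₂)) * (x * x)
    + (a * (v₁ * v₁) + b * (v₂ * v₂) + c * (v₃ * v₃) + r * (v₂ * v₃) + s * (v₁ * v₃) + t * (v₁ * v₂)) * (y * y)
    + (a * (w₁ * w₁) + b * (w₂ * w₂) + c * (w₃ * w₃) + r * (w₂ * w₃) + s * (w₁ * w₃) + t * (w₁ * w₂)) * (z * z)
    + (+ 2 * a * (v₁ * w₁) + + 2 * b * (v₂ * w₂) + + 2 * c * (v₃ * w₃)
       + r * (v₂ * w₃ + w₂ * v₃) + s * (v₁ * w₃ + w₁ * v₃) + t * (v₁ * w₂ + w₁ * v₂)) * (y * z)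
    + (+ 2 * a * (u₁ * w₁) + + 2 * b * (u₂ * w₂) + + 2 * c * (u₃ * w₃)
       + r * (u₂ * w₃ + w₂ * u₃) + s * (u₁ * w₃ + w₁ * u₃) + t * (u₁ * w₂ + w₁ * u₂)) * (x * z)
    + (+ 2 * a * (u₁ * v₁) + + 2 * b * (u₂ * v₂) + + 2 * c * (u₃ * v₃)
       + r * (u₂ * v₃ + v₂ * u₃) + s * (u₁ * v₃ + v₁ * u₃) + t * (u₁ * v₂ + v₁ * u₂)) * (x * y)
  lemma = solve-∀

module _ {A : Set} where

  exists : (A → Bool) → List A → Bool
  exists p []       = false
  exists p (x ∷ xs) = if p x then true else exists p xs

  exists-sound : ∀ p xs → T (exists p xs) → ∃[ x ] T (p x)
  exists-sound p (x ∷ xs) h with p x in eq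
  ... | true  = x , subst T (sym eq) tt
  ... | false = exists-sound p xs h

  forAll : (A → Bool) → List A → Bool
  forAll p []       = true
  forAll p (x ∷ xs) = if p x then forAll p xs else false

  forAll-sound : ∀ p {xs} → T (forAll p xs) → ∀ {x} → x ∈ xs → T (p x)
  forAll-sound p {y ∷ ys} h x∈ with p y in eq
  forAll-sound p {y ∷ ys} h (here refl) | true = subst T (sym eq) tt
  forAll-sound p {y ∷ ys} h (there x∈)  | true = forAll-sound p h x∈

given : {P : Set} → Dec P → Bool → Bool
given (yes _) b = b
given (no _)  _ = true

given-sound : {P : Set} (P? : Dec P) {b : Bool} → T (given P? b) → P → T b
given-sound (yes _) h _ = h
given-sound (no ¬p) _ p = ⊥-elim (¬p p)

both : {P : Set} → Dec P → Bool → Bool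
both (yes _) b = b
both (no _)  _ = false

both-sound : {P : Set} (P? : Dec P) {b : Bool} → T (both P? b) → P × T b
both-sound (yes p) h = p , h

box : List Vector₃
box = cartesianProduct unit-range (cartesianProduct unit-range unit-range)
  where
  unit-range : List ℤ
  unit-range = -1ℤ ∷ 0ℤ ∷ 1ℤ ∷ []

-- Opacity keeps the type checker from unfolding these finite searches when it compares types.
module _ (f : Form) where

  opaque
    pullback-w : Form → Vector₃ → Vector₃ → Vector₃ → Bool
    pullback-w (form a b c r s t) u v w =
      both (value f w ℤₚ.≟ c) (both (polar f u w ℤₚ.≟ s) (both (polar f v w ℤₚ.≟ r) true))

    pullback-w-sound : ∀ {a b c r s t u v w} → T (pullback-w (form a b c r s t) u v w) →
                       value f w ≡ c × polar f u w ≡ s × polar f v w ≡ r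
    pullback-w-sound {c = c} {r} {s} {u = u} {v} {w} h =
      let (e₁ , h₁) = both-sound (value f w ℤₚ.≟ c) h
          (e₂ , h₂) = both-sound (polar f u w ℤₚ.≟ s) h₁
          (e₃ , _)  = both-sound (polar f v w ℤₚ.≟ r) h₂
      in e₁ , e₂ , e₃

  opaque
    pullback-v : Form → Vector₃ → Vector₃ → Bool
    pullback-v Q@(form a b c r s t) u v =
      both (value f v ℤₚ.≟ b) (both (polar f u v ℤₚ.≟ t) (exists (pullback-w Q u v) box))

    pullback-v-sound : ∀ {a b c r s t u v} → let Q = form a b c r s t in T (pullback-v Q u v) →
                       value f v ≡ b × polar f u v ≡ t × ∃[ w ] T (pullback-w Q u v w)
    pullback-v-sound {a} {b} {c} {r} {s} {t} {u} {v} h =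
      let (e₁ , h₁) = both-sound (value f v ℤₚ.≟ b) h
          (e₂ , h₂) = both-sound (polar f u v ℤₚ.≟ t) h₁
      in e₁ , e₂ , exists-sound (pullback-w (form a b c r s t) u v) box h₂

  opaque
    pullback-u : Form → Vector₃ → Bool
    pullback-u Q@(form a b c r s t) u = both (value f u ℤₚ.≟ a) (exists (pullback-v Q u) box)

    pullback-u-sound : ∀ {a b c r s t u} → let Q = form a b c r s t in T (pullback-u Q u) →
                       value f u ≡ a × ∃[ v ] T (pullback-v Q u v)
    pullback-u-sound {a} {b} {c} {r} {s} {t} {u} h =
      let (e₁ , h₁) = both-sound (value f u ℤₚ.≟ a) h
      in e₁ , exists-sound (pullback-v (form a b c r s t) u) box h₁

  opaque
    isPullback : Form → Bool
    isPullback Q = exists (pullback-u Q) box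

    isPullback-sound : ∀ Q → T (isPullback Q) → ∃[ u ] ∃[ v ] ∃[ w ] pullback f u v w ≡ Q
    isPullback-sound Q@(form a b c r s t) h =
      let (u , hu) = exists-sound (pullback-u Q) box h
          (ea , v , hv) = pullback-u-sound hu
          (eb , et , w , hw) = pullback-v-sound hv
          (ec , es , er) = pullback-w-sound hw
      in u , v , w , eq ea eb ec er es et
      where
      eq : ∀ {a a′ b b′ c c′ r r′ s s′ t t′} → a ≡ a′ → b ≡ b′ → c ≡ c′ → r ≡ r′ → s ≡ s′ → t ≡ t′ →
           form a b c r s t ≡ form a′ b′ c′ r′ s′ t′
      eq refl refl refl refl refl refl = refl

isPullback-represents : ∀ f Q → T (isPullback f Q) → ∀ {n} → Represents Q n → Represents f n
isPullback-represents f Q h rep =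
  let (u , v , w , eq) = isPullback-sound f Q h
  in pullback-represents f u v w (subst (λ Q → Represents Q _) (sym eq) rep)

diagonals offDiagonals : List ℤ
diagonals    = + 1 ∷ + 2 ∷ + 3 ∷ + 4 ∷ + 5 ∷ []
offDiagonals = 0ℤ ∷ + 1 ∷ + 2 ∷ + 3 ∷ + 4 ∷ + 5 ∷ - + 1 ∷ - + 2 ∷ - + 3 ∷ - + 4 ∷ - + 5 ∷ []

WithinRange : ℤ → ℤ → ℤ → Set
WithinRange m n r = (0ℤ ≤ m - r × 0ℤ ≤ m + r) × (0ℤ ≤ n - r × 0ℤ ≤ n + r)

withinRange? : ∀ m n r → Dec (WithinRange m n r)
withinRange? m n r = ((0ℤ ℤₚ.≤? m - r) ×-dec (0ℤ ℤₚ.≤? m + r)) ×-dec ((0ℤ ℤₚ.≤? n - r) ×-dec (0ℤ ℤₚ.≤? n + r))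

module _ (p : ℤ) (f : Form) where

  opaque
    unique-t : ℤ → ℤ → ℤ → ℤ → ℤ → ℤ → Bool
    unique-t a b c r s t = given (withinRange? a b t)
      (given (disc (form a b c r s t) ℤₚ.≟ p) (isPullback f (form a b c r s t)))

    unique-t-sound : ∀ {a b c r s t} → T (unique-t a b c r s t) → WithinRange a b t →
                     disc (form a b c r s t) ≡ p → T (isPullback f (form a b c r s t))
    unique-t-sound {a} {b} {c} {r} {s} {t} h w e =
      given-sound (disc (form a b c r s t) ℤₚ.≟ p) (given-sound (withinRange? a b t) h w) e

  opaque
    unique-s : ℤ → ℤ → ℤ → ℤ → ℤ → Bool
    unique-s a b c r s = given (withinRange? a c s) (forAll (unique-t a b c r s) offDiagonals)

    unique-s-sound : ∀ {a b c r s t} → T (unique-s a b c r s) → WithinRange a c s → t ∈ offDiagonals →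
                     T (unique-t a b c r s t)
    unique-s-sound {a} {b} {c} {r} {s} h w = forAll-sound (unique-t a b c r s) (given-sound (withinRange? a c s) h w)

  opaque
    unique-r : ℤ → ℤ → ℤ → ℤ → Bool
    unique-r a b c r = given (withinRange? b c r) (forAll (unique-s a b c r) offDiagonals)

    unique-r-sound : ∀ {a b c r s} → T (unique-r a b c r) → WithinRange b c r → s ∈ offDiagonals →
                     T (unique-s a b c r s)
    unique-r-sound {a} {b} {c} {r} h w = forAll-sound (unique-s a b c r) (given-sound (withinRange? b c r) h w)

  opaque
    unique-c : ℤ → ℤ → ℤ → Bool
    unique-c a b c = given (a * b * c ℤₚ.≤? p) (forAll (unique-r a b c) offDiagonals)

    unique-c-sound : ∀ {a b c r} → T (unique-c a b c) → a * b * c ≤ p → r ∈ offDiagonals → T (unique-r a b c r)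
    unique-c-sound {a} {b} {c} h le = forAll-sound (unique-r a b c) (given-sound (a * b * c ℤₚ.≤? p) h le)

  opaque
    uniqueClass : Bool
    uniqueClass = forAll (λ a → forAll (λ b → forAll (unique-c a b) diagonals) diagonals) diagonals

    uniqueClass-sound : ∀ {a b c} → T uniqueClass → a ∈ diagonals → b ∈ diagonals → c ∈ diagonals → T (unique-c a b c)
    uniqueClass-sound {a} {b} h a∈ b∈ c∈ = forAll-sound (unique-c a b)
      (forAll-sound (λ b → forAll (unique-c a b) diagonals)
        (forAll-sound (λ a → forAll (λ b → forAll (unique-c a b) diagonals) diagonals) h a∈) b∈) c∈

f₂ f₃ f₅ : Form
f₂ = form 1ℤ 1ℤ 1ℤ 1ℤ 1ℤ 1ℤ
f₃ = form 1ℤ 1ℤ 1ℤ 0ℤ 0ℤ 1ℤ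
f₅ = form 1ℤ 1ℤ (+ 2) 1ℤ 1ℤ 1ℤ

opaque
  unfolding uniqueClass unique-c unique-r unique-s unique-t isPullback pullback-u pullback-v pullback-w

  unique₂ : T (uniqueClass (+ 2) f₂)
  unique₂ = tt

  unique₃ : T (uniqueClass (+ 3) f₃)
  unique₃ = tt

  unique₅ : T (uniqueClass (+ 5) f₅)
  unique₅ = tt

diagonal∈ : ∀ {a} → 0ℤ < a → a ≤ + 5 → a ∈ diagonals
diagonal∈ {+ 0} (+<+ ())
diagonal∈ {+ 1} _ _ = here refl
diagonal∈ {+ 2} _ _ = there (here refl)
diagonal∈ {+ 3} _ _ = there (there (here refl))
diagonal∈ {+ 4} _ _ = there (there (there (here refl)))
diagonal∈ {+ 5} _ _ = there (there (there (there (here refl))))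
diagonal∈ {+ suc (suc (suc (suc (suc (suc _)))))} _ (+≤+ (s≤s (s≤s (s≤s (s≤s (s≤s ()))))))

offDiagonal∈ : ∀ {r} → r ≤ + 5 → - r ≤ + 5 → r ∈ offDiagonals
offDiagonal∈ {+ 0} _ _ = here refl
offDiagonal∈ {+ 1} _ _ = there (here refl)
offDiagonal∈ {+ 2} _ _ = there (there (here refl))
offDiagonal∈ {+ 3} _ _ = there (there (there (here refl)))
offDiagonal∈ {+ 4} _ _ = there (there (there (there (here refl))))
offDiagonal∈ {+ 5} _ _ = there (there (there (there (there (here refl)))))
offDiagonal∈ {+ suc (suc (suc (suc (suc (suc _)))))} (+≤+ (s≤s (s≤s (s≤s (s≤s (s≤s ())))))) _
offDiagonal∈ { -[1+ 0 ]} _ _ = there (there (there (there (there (there (here refl))))))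
offDiagonal∈ { -[1+ 1 ]} _ _ = there (there (there (there (there (there (there (here refl)))))))
offDiagonal∈ { -[1+ 2 ]} _ _ = there (there (there (there (there (there (there (there (here refl))))))))
offDiagonal∈ { -[1+ 3 ]} _ _ = there (there (there (there (there (there (there (there (there (here refl)))))))))
offDiagonal∈ { -[1+ 4 ]} _ _ = there (there (there (there (there (there (there (there (there (there (here refl))))))))))
offDiagonal∈ { -[1+ suc (suc (suc (suc (suc _)))) ]} _ (+≤+ (s≤s (s≤s (s≤s (s≤s (s≤s ()))))))

represents-unique : ∀ p f → p ≤ + 5 → T (uniqueClass p f) → ∀ Q → PosDef Q → disc Q ≡ p →
                    ∀ {n} → Represents Q n → Represents f n
represents-unique p f p≤5 uniq Q pd dQ rep = conclude Q′ (pos Q⊑Q′ pd) red (trans (disc≡ Q⊑Q′) dQ) (repr Q⊑Q′ rep)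
  where
  reduced : ∃[ Q′ ] Q ⊑ Q′ × Reduced Q′
  reduced = reduce Q pd
  Q′ : Form
  Q′ = proj₁ reduced
  Q⊑Q′ : Q ⊑ Q′
  Q⊑Q′ = proj₁ (proj₂ reduced)
  red : Reduced Q′
  red = proj₂ (proj₂ reduced)

  conclude : ∀ Q → PosDef Q → Reduced Q → disc Q ≡ p → ∀ {n} → Represents Q n → Represents f n
  conclude Q@(form a b c r s t) pd red dQ rep = isPullback-represents f Q found rep
    where
    open Bounded (reduced⇒bounded Q red)
    pd₁ : PosDef (rotate Q)
    pd₁ = pos (rotate-⊑ Q) pd
    0<a : 0ℤ < a
    0<a = posDef-a Q pd
    0<b : 0ℤ < b
    0<b = posDef-a (rotate Q) pd₁
    0<c : 0ℤ < c
    0<c = posDef-a (rotate (rotate Q)) (pos (rotate-⊑ (rotate Q)) pd₁)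
    abc≤p : a * b * c ≤ p
    abc≤p = subst (a * b * c ≤_) dQ (abc≤disc Q pd red)
    ≤product : ∀ {x y z} → 0ℤ < x → 0ℤ < y → 0ℤ < z → x ≤ x * y * z
    ≤product {x} {y} {z} 0<x 0<y 0<z = ℤₚ.0≤i-j⇒j≤i (subst (0ℤ ≤_) (lemma x y z)
      (0≤+ (0≤* (ℤₚ.<⇒≤ 0<x) (ℤₚ.i≤j⇒0≤j-i (ℤₚ.i<j⇒suc[i]≤j 0<y)))
           (0≤* (0≤* (ℤₚ.<⇒≤ 0<x) (ℤₚ.<⇒≤ 0<y)) (ℤₚ.i≤j⇒0≤j-i (ℤₚ.i<j⇒suc[i]≤j 0<z)))))
      where
      lemma : ∀ x y z → x * (y - 1ℤ) + x * y * (z - 1ℤ) ≡ x * y * z - x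
      lemma = solve-∀
    a≤5 : a ≤ + 5
    a≤5 = ℤₚ.≤-trans (≤product 0<a 0<b 0<c) (ℤₚ.≤-trans abc≤p p≤5)
    b≤5 : b ≤ + 5
    b≤5 = ℤₚ.≤-trans (≤product 0<b 0<a 0<c) (ℤₚ.≤-trans (ℤₚ.≤-reflexive (cong (_* c) (ℤₚ.*-comm b a))) (ℤₚ.≤-trans abc≤p p≤5))
    c≤5 : c ≤ + 5
    c≤5 = ℤₚ.≤-trans (≤product 0<c 0<a 0<b) (ℤₚ.≤-trans (ℤₚ.≤-reflexive (lemma a b c)) (ℤₚ.≤-trans abc≤p p≤5))
      where
      lemma : ∀ a b c → c * a * b ≡ a * b * c
      lemma = solve-∀
    off : ∀ m r → m ≤ + 5 → 0ℤ ≤ m - r → 0ℤ ≤ m + r → r ∈ offDiagonals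
    off m r m≤5 lo hi = offDiagonal∈ (ℤₚ.≤-trans (ℤₚ.0≤i-j⇒j≤i lo) m≤5)
      (ℤₚ.≤-trans (ℤₚ.0≤i-j⇒j≤i (subst (0ℤ ≤_) (cong (λ z → m + z) (sym (ℤₚ.neg-involutive r))) hi)) m≤5)
    found : T (isPullback f Q)
    found = unique-t-sound p f (unique-s-sound p f (unique-r-sound p f (unique-c-sound p f (uniqueClass-sound p f uniq
      (diagonal∈ 0<a a≤5) (diagonal∈ 0<b b≤5) (diagonal∈ 0<c c≤5)) abc≤p
      (off b r b≤5 b-r b+r)) ((b-r , b+r) , (c-r , c+r))
      (off a s a≤5 a-s a+s)) ((a-s , a+s) , (c-s , c+s))
      (off a t a≤5 a-t a+t)) ((a-t , a+t) , (b-t , b+t)) dQ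

square-nonneg : ∀ i → 0ℤ ≤ i * i
square-nonneg (+ n)    = 0≤* {+ n} {+ n} (+≤+ z≤n) (+≤+ z≤n)
square-nonneg -[1+ n ] = +≤+ z≤n

0<* : ∀ {i j} → 0ℤ < i → 0ℤ < j → 0ℤ < i * j
0<* {+ suc m} {+ suc n} (+<+ _) (+<+ _) = +<+ (s≤s z≤n)

nonneg-sum-zero : ∀ {i j} → 0ℤ ≤ i → 0ℤ ≤ j → i + j ≤ 0ℤ → i ≡ 0ℤ × j ≡ 0ℤ
nonneg-sum-zero {i} {j} 0≤i 0≤j le =
  ℤₚ.≤-antisym (ℤₚ.≤-trans (subst (_≤ i + j) (ℤₚ.+-identityʳ i) (ℤₚ.+-monoʳ-≤ i 0≤j)) le) 0≤i ,
  ℤₚ.≤-antisym (ℤₚ.≤-trans (subst (_≤ i + j) (ℤₚ.+-identityˡ j) (ℤₚ.+-monoˡ-≤ j 0≤i)) le) 0≤j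

product-zero : ∀ {m x} → 0ℤ < m → m * x ≡ 0ℤ → x ≡ 0ℤ
product-zero {m} {x} 0<m e with ℤₚ.i*j≡0⇒i≡0∨j≡0 m e
... | inj₁ m≡0 = ⊥-elim (ℤₚ.<-irrefl (sym m≡0) 0<m)
... | inj₂ x≡0 = x≡0

square-zero : ∀ {x} → x * x ≡ 0ℤ → x ≡ 0ℤ
square-zero {x} e = [ id , id ]′ (ℤₚ.i*j≡0⇒i≡0∨j≡0 x e)

module _ {a b c s t p : ℤ} (0<c : 0ℤ < c) (0<α : 0ℤ < + 4 * a * c - s * s)
         (0<p : 0ℤ < p) (det : b * (+ 4 * a * c - s * s) - c * (t * t) ≡ p) where

  private
    α : ℤ
    α = + 4 * a * c - s * s

    Q : Form
    Q = form a b c 0ℤ s t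

    identity : ∀ x y z → + 4 * c * α * eval Q x y z
      ≡ α * ((+ 2 * c * z + s * x) * (+ 2 * c * z + s * x)) + (α * x + + 2 * c * t * y) * (α * x + + 2 * c * t * y)
        + + 4 * c * p * (y * y)
    identity x y z = trans (lemma a b c s t x y z)
      (cong (λ d → α * ((+ 2 * c * z + s * x) * (+ 2 * c * z + s * x)) + (α * x + + 2 * c * t * y) * (α * x + + 2 * c * t * y)
        + + 4 * c * d * (y * y)) det)
      where
      lemma : ∀ a b c s t x y z →
        + 4 * c * (+ 4 * a * c - s * s) * (a * (x * x) + b * (y * y) + c * (z * z) + 0ℤ * (y * z) + s * (x * z) + t * (x * y))
        ≡ (+ 4 * a * c - s * s) * ((+ 2 * c * z + s * x) * (+ 2 * c * z + s * x))
          + ((+ 4 * a * c - s * s) * x + + 2 * c * t * y) * ((+ 4 * a * c - s * s) * x + + 2 * c * t * y)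
          + + 4 * c * (b * (+ 4 * a * c - s * s) - c * (t * t)) * (y * y)
      lemma = solve-∀

  ternary-posDef : PosDef Q
  ternary-posDef x y z le = x≡0 , y≡0 , z≡0
    where
    0<4c : 0ℤ < + 4 * c
    0<4c = 0<* {+ 4} (+<+ (s≤s z≤n)) 0<c
    u v : ℤ
    u = + 2 * c * z + s * x
    v = α * x + + 2 * c * t * y
    total≤0 : α * (u * u) + v * v + + 4 * c * p * (y * y) ≤ 0ℤ
    total≤0 = subst (_≤ 0ℤ) (identity x y z) (subst (+ 4 * c * α * eval Q x y z ≤_) (ℤₚ.*-zeroʳ (+ 4 * c * α))
      (ℤₚ.*-monoˡ-≤-nonNeg (+ 4 * c * α) {{ℤ.nonNegative (ℤₚ.<⇒≤ (0<* 0<4c 0<α))}} le))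
    split₁ : α * (u * u) + v * v ≡ 0ℤ × + 4 * c * p * (y * y) ≡ 0ℤ
    split₁ = nonneg-sum-zero (0≤+ (0≤* (ℤₚ.<⇒≤ 0<α) (square-nonneg u)) (square-nonneg v))
      (0≤* (ℤₚ.<⇒≤ (0<* 0<4c 0<p)) (square-nonneg y)) total≤0
    split₂ : α * (u * u) ≡ 0ℤ × v * v ≡ 0ℤ
    split₂ = nonneg-sum-zero (0≤* (ℤₚ.<⇒≤ 0<α) (square-nonneg u)) (square-nonneg v) (ℤₚ.≤-reflexive (proj₁ split₁))
    y≡0 : y ≡ 0ℤ
    y≡0 = square-zero (product-zero (0<* 0<4c 0<p) (proj₂ split₁))
    x≡0 : x ≡ 0ℤ
    x≡0 = product-zero 0<α (trans (sym (lemma α x (+ 2 * c * t))) (trans (cong (λ y → α * x + + 2 * c * t * y) (sym y≡0)) (square-zero (proj₂ split₂))))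
      where
      lemma : ∀ α x w → α * x + w * 0ℤ ≡ α * x
      lemma = solve-∀
    z≡0 : z ≡ 0ℤ
    z≡0 = product-zero (0<* {+ 2} (+<+ (s≤s z≤n)) 0<c) (trans (sym (lemma (+ 2 * c) z s))
      (trans (cong (λ x → + 2 * c * z + s * x) (sym x≡0)) (square-zero (product-zero 0<α (proj₁ split₂)))))
      where
      lemma : ∀ w z s → w * z + s * 0ℤ ≡ w * z
      lemma = solve-∀

  ternary-represents : ∀ f → p ≤ + 5 → T (uniqueClass p f) → Represents f c
  ternary-represents f p≤5 uniq = represents-unique p f p≤5 uniq Q ternary-posDef (trans (disc-Q a b c s t) det)
    (0ℤ , 0ℤ , 1ℤ , value-c a b c s t)
    where
    disc-Q : ∀ a b c s t → + 4 * a * b * c + 0ℤ * s * t - a * (0ℤ * 0ℤ) - b * (s * s) - c * (t * t)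
      ≡ b * (+ 4 * a * c - s * s) - c * (t * t)
    disc-Q = solve-∀
    value-c : ∀ a b c s t → a * (0ℤ * 0ℤ) + b * (0ℤ * 0ℤ) + c * (1ℤ * 1ℤ) + 0ℤ * (0ℤ * 1ℤ) + s * (0ℤ * 1ℤ) + t * (0ℤ * 0ℤ) ≡ c
    value-c = solve-∀

represents₂ : ∀ {a b c s t α} → 0ℤ < c → 0ℤ < α → α ≡ + 4 * a * c - s * s → b * α - c * (t * t) ≡ + 2 → Represents f₂ c
represents₂ {a} {b} {c} {s} {t} 0<c 0<α refl det =
  ternary-represents {a} {b} {c} {s} {t} 0<c 0<α (+<+ (s≤s z≤n)) det f₂ (+≤+ (s≤s (s≤s z≤n))) unique₂

represents₃ : ∀ {a b c s t α} → 0ℤ < c → 0ℤ < α → α ≡ + 4 * a * c - s * s → b * α - c * (t * t) ≡ + 3 → Represents f₃ c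
represents₃ {a} {b} {c} {s} {t} 0<c 0<α refl det =
  ternary-represents {a} {b} {c} {s} {t} 0<c 0<α (+<+ (s≤s z≤n)) det f₃ (+≤+ (s≤s (s≤s (s≤s z≤n)))) unique₃

represents₅ : ∀ {a b c s t α} → 0ℤ < c → 0ℤ < α → α ≡ + 4 * a * c - s * s → b * α - c * (t * t) ≡ + 5 → Represents f₅ c
represents₅ {a} {b} {c} {s} {t} 0<c 0<α refl det =
  ternary-represents {a} {b} {c} {s} {t} 0<c 0<α (+<+ (s≤s z≤n)) det f₅ ℤₚ.≤-refl unique₅

-- Numbers represented by the three forms

jacobi-κ₁ : ∀ {l k} → Unit l (+ k) → jacobi l (- + (1 ℕ.* k)) ≡ ω (modulus l % 8) * jacobi l (+ k)
jacobi-κ₁ {l} {k} u = trans (cong (λ x → jacobi l (- + x)) (ℕₚ.*-identityˡ k)) (jacobi-neg u)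

jacobi-κ₂ : ∀ {l k} → Unit l (+ k) → jacobi l (- + (2 ℕ.* k)) ≡ ω (modulus l % 8) * (η (modulus l % 8) * jacobi l (+ k))
jacobi-κ₂ {l} {k} u = trans (cong (λ x → jacobi l (- x)) (ℤₚ.pos-* 2 k))
  (trans (jacobi-neg (unit-* (unit-2 l) u)) (cong (ω (modulus l % 8) *_) (jacobi-double u)))

≈-from-ℕ : ∀ m x y q n → m ℕ.* x ≡ y ℕ.+ q ℕ.* n → + m * + x ≈ + y mod n
≈-from-ℕ m x y q n eq = multiple (+ q) (trans (sym (ℤₚ.pos-* m x)) (trans (cong +_ eq) (cong (λ z → + y + z) (ℤₚ.pos-* q n))))

invertible-from-ℕ : ∀ m x q n → m ℕ.* x ≡ 1 ℕ.+ q ℕ.* n → Invertible n x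
invertible-from-ℕ m x q n eq = invertible (+ m) (≈-from-ℕ m x 1 q n eq)

invertible-from-ℕ⁻ : ∀ m x q n → m ℕ.* x ℕ.+ 1 ≡ q ℕ.* n → Invertible n x
invertible-from-ℕ⁻ m x q n eq = invertible (- + m) (multiple (- + q) (trans (lemma (+ m) (+ x))
  (trans (cong (λ z → 1ℤ - z) (trans (cong (_+ 1ℤ) (sym (ℤₚ.pos-* m x))) (trans (cong +_ eq) (ℤₚ.pos-* q n)))) (lemma′ (+ q) (+ n)))))
  where
  lemma : ∀ m x → - m * x ≡ 1ℤ - (m * x + 1ℤ)
  lemma = solve-∀
  lemma′ : ∀ q n → 1ℤ - q * n ≡ 1ℤ + - q * n
  lemma′ = solve-∀

+-linear : ∀ a b n → + (a ℕ.* n ℕ.+ b) ≡ + a * + n + + b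
+-linear a b n = cong (_+ + b) (ℤₚ.pos-* a n)

+-linear-≡ : ∀ {x} a b n → x ≡ a ℕ.* n ℕ.+ b → + x ≡ + a * + n + + b
+-linear-≡ a b n refl = +-linear a b n

move-norm : ∀ b α c q → b * α ≡ c + q → b * α - c ≡ q
move-norm b α c q e = x≡y+z⇒x-y≡z (b * α) c e

unit-1 : ∀ {l} → Unit l 1ℤ
unit-1 = unit 1ℤ ≈-refl

-- For odd α the solution of b α = k t² + 1 can be chosen with t odd.
odd-solution : ∀ {j k b t} → b * (1ℤ + (j + j)) ≡ k * (t * t) + 1ℤ →
               ∃[ b′ ] ∃[ w ] b′ * (1ℤ + (j + j)) ≡ k * ((1ℤ + (w + w)) * (1ℤ + (w + w))) + 1ℤ
odd-solution {j} {k} {b} {t} e = by-parity (t %ℕ 2) (n%ℕd<d t 2) (a≡a%ℕn+[a/ℕn]*n t 2)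
  where
  q : ℤ
  q = t /ℕ 2
  by-parity : ∀ r → r ℕ.< 2 → t ≡ + r + q * + 2 →
              ∃[ b′ ] ∃[ w ] b′ * (1ℤ + (j + j)) ≡ k * ((1ℤ + (w + w)) * (1ℤ + (w + w))) + 1ℤ
  by-parity 0 _ t≡ = b + + 2 * k * t + k * (1ℤ + (j + j)) , j + q ,
    trans (expand b k t j) (trans (cong (_+ (+ 2 * k * t + k * (1ℤ + (j + j))) * (1ℤ + (j + j))) e)
      (trans (collect k t j) (cong (λ t → k * ((t + (1ℤ + (j + j))) * (t + (1ℤ + (j + j)))) + 1ℤ) t≡) ■ shift k j q))
    where
    infixr 2 _■_
    _■_ : ∀ {x y z : ℤ} → x ≡ y → y ≡ z → x ≡ z
    _■_ = trans
    expand : ∀ b k t j → (b + + 2 * k * t + k * (1ℤ + (j + j))) * (1ℤ + (j + j))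
      ≡ b * (1ℤ + (j + j)) + (+ 2 * k * t + k * (1ℤ + (j + j))) * (1ℤ + (j + j))
    expand = solve-∀
    collect : ∀ k t j → k * (t * t) + 1ℤ + (+ 2 * k * t + k * (1ℤ + (j + j))) * (1ℤ + (j + j))
      ≡ k * ((t + (1ℤ + (j + j))) * (t + (1ℤ + (j + j)))) + 1ℤ
    collect = solve-∀
    shift : ∀ k j q → k * ((0ℤ + q * + 2 + (1ℤ + (j + j))) * (0ℤ + q * + 2 + (1ℤ + (j + j)))) + 1ℤ
      ≡ k * ((1ℤ + (j + q + (j + q))) * (1ℤ + (j + q + (j + q)))) + 1ℤ
    shift = solve-∀
  by-parity 1 _ t≡ = b , q , trans e (trans (cong (λ t → k * (t * t) + 1ℤ) t≡) (shift k q))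
    where
    shift : ∀ k q → k * ((1ℤ + q * + 2) * (1ℤ + q * + 2)) + 1ℤ ≡ k * ((1ℤ + (q + q)) * (1ℤ + (q + q))) + 1ℤ
    shift = solve-∀
  by-parity (suc (suc _)) (s≤s (s≤s ())) _

module RootFor (h : ℕ) (m : Twist) (l : ℕ) where
  open CharacterPrimes h m public

  root-for : ∀ r q → modulus l ≡ r ℕ.+ q ℕ.* 8 → Invertible 8 r → Invertible k (modulus l) → jacobi l κ ≡ 1ℤ → Root (modulus l)
  root-for r q eq i8 ik j = find-root l (invertible-* {8} {k} (invertible-residue 8 r q eq i8) ik) j

  N-ℤ : + N ≡ + 8 * + k
  N-ℤ = ℤₚ.pos-* 8 k

  class-equation : ∀ (R : Root (modulus l)) x → + modulus l ≡ x → let open Root R in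
                   + α ≡ x * (τ * τ) + quotient class * (+ 8 * + k)
  class-equation R x e = trans (equation class) (cong₂ (λ x y → x * (τ * τ) + quotient class * y) e N-ℤ)
    where open Root R

  odd-α : ∀ (R : Root (modulus l)) → ∃[ j ] + Root.α R ≡ 1ℤ + (j + j)
  odd-α R = let (j , eq) = odd-half (Root.α R) (invertible-8 (Root.unitα R)) in + j , cong +_ eq

represents₂-8n+3 : ∀ n → Represents f₂ (+ (8 ℕ.* n ℕ.+ 3))
represents₂-8n+3 n = from-root (root-for 3 (4 ℕ.* n ℕ.+ 1) (e₁ n) (toWitness {a? = invertible? 8 3} tt)
    (invertible-from-ℕ⁻ 1 a 4 k (e₂ n)) j≡1)
  where
  h l a : ℕ
  h = 4 ℕ.* n ℕ.+ 1
  l = 16 ℕ.* n ℕ.+ 5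
  a = modulus l
  open RootFor h two l
  e₁ : ∀ n → suc (16 ℕ.* n ℕ.+ 5 ℕ.+ (16 ℕ.* n ℕ.+ 5)) ≡ 3 ℕ.+ (4 ℕ.* n ℕ.+ 1) ℕ.* 8
  e₁ = ℕ-Ring.solve-∀
  e₂ : ∀ n → 1 ℕ.* suc (16 ℕ.* n ℕ.+ 5 ℕ.+ (16 ℕ.* n ℕ.+ 5)) ℕ.+ 1 ≡ 4 ℕ.* suc (4 ℕ.* n ℕ.+ 1 ℕ.+ (4 ℕ.* n ℕ.+ 1))
  e₂ = ℕ-Ring.solve-∀
  e₃ : ∀ n → 4 ℕ.* suc (4 ℕ.* n ℕ.+ 1 ℕ.+ (4 ℕ.* n ℕ.+ 1)) ≡ 1 ℕ.+ 1 ℕ.* suc (16 ℕ.* n ℕ.+ 5 ℕ.+ (16 ℕ.* n ℕ.+ 5))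
  e₃ = ℕ-Ring.solve-∀
  e₄ : ∀ n → suc (4 ℕ.* n ℕ.+ 1 ℕ.+ (4 ℕ.* n ℕ.+ 1)) ≡ 8 ℕ.* n ℕ.+ 3
  e₄ = ℕ-Ring.solve-∀
  r≡ : a % 8 ≡ 3
  r≡ = residue 3 (4 ℕ.* n ℕ.+ 1) (e₁ n)
  jk : Unit l (+ k) × jacobi l (+ k) ≡ jacobi l 1ℤ
  jk = jacobi-quarter unit-1 (≈-from-ℕ 4 k 1 1 a (e₃ n))
  j≡1 : jacobi l κ ≡ 1ℤ
  j≡1 = trans (jacobi-κ₂ (proj₁ jk)) (cong₂ (λ r j → ω r * (η r * j)) r≡ (trans (proj₂ jk) (jacobi-1 l)))
  a≡ : + a ≡ + 4 * + k - 1ℤ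
  a≡ = trans (lemma (+ a)) (cong (_- 1ℤ) (sym (trans (sym (ℤₚ.pos-* 4 k)) (cong +_ (trans (e₃ n) (cong suc (ℕₚ.*-identityˡ a)))))))
    where
    lemma : ∀ a → a ≡ 1ℤ + a - 1ℤ
    lemma = solve-∀
  from-root : Root a → Represents f₂ (+ (8 ℕ.* n ℕ.+ 3))
  from-root R = subst (λ c → Represents f₂ (+ c)) (e₄ n)
    (let (t , b , norm) = norm-equation R (+ 2) k (cong -_ (ℤₚ.pos-* 2 k)) (ℕ∣.n∣m*n 8)
     in represents₂ {τ * τ + + 2 * q} {b} {+ k} {τ} {t} {+ α} (+<+ (s≤s z≤n)) (+<+ 1≤α)
       (trans (class-equation R _ a≡) (shape (+ k) τ q)) (move-norm b (+ α) (+ k * (t * t)) (+ 2) norm))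
    where
    open Root R
    q : ℤ
    q = quotient class
    shape : ∀ k τ q → (+ 4 * k - 1ℤ) * (τ * τ) + q * (+ 8 * k) ≡ + 4 * (τ * τ + + 2 * q) * k - τ * τ
    shape = solve-∀

represents₂-2[8n+3] : ∀ n → Represents f₂ (+ 2 * + (8 ℕ.* n ℕ.+ 3))
represents₂-2[8n+3] n = from-root (root-for 1 n (e₁ n) (toWitness {a? = invertible? 8 1} tt)
    (invertible-from-ℕ h a h′ k (e₂ n)) j≡1)
  where
  h h′ l a : ℕ
  h = 4 ℕ.* n ℕ.+ 1
  h′ = 4 ℕ.* n
  l = 4 ℕ.* n
  a = modulus l
  open RootFor h one l
  e₁ : ∀ n → suc (4 ℕ.* n ℕ.+ 4 ℕ.* n) ≡ 1 ℕ.+ n ℕ.* 8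
  e₁ = ℕ-Ring.solve-∀
  e₂ : ∀ n → (4 ℕ.* n ℕ.+ 1) ℕ.* suc (4 ℕ.* n ℕ.+ 4 ℕ.* n) ≡ 1 ℕ.+ 4 ℕ.* n ℕ.* suc (4 ℕ.* n ℕ.+ 1 ℕ.+ (4 ℕ.* n ℕ.+ 1))
  e₂ = ℕ-Ring.solve-∀
  e₃ : ∀ n → suc (4 ℕ.* n ℕ.+ 1 ℕ.+ (4 ℕ.* n ℕ.+ 1)) ≡ 2 ℕ.+ 1 ℕ.* suc (4 ℕ.* n ℕ.+ 4 ℕ.* n)
  e₃ = ℕ-Ring.solve-∀
  e₄ : ∀ n → suc (4 ℕ.* n ℕ.+ 1 ℕ.+ (4 ℕ.* n ℕ.+ 1)) ≡ 8 ℕ.* n ℕ.+ 3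
  e₄ = ℕ-Ring.solve-∀
  r≡ : a % 8 ≡ 1
  r≡ = residue 1 n (e₁ n)
  k≈2 : + k ≈ + 2 mod a
  k≈2 = ≈-trans (≈-reflexive (sym (ℤₚ.*-identityˡ (+ k)))) (≈-from-ℕ 1 k 2 1 a (trans (ℕₚ.*-identityˡ k) (e₃ n)))
  uk : Unit l (+ k)
  uk = unit-≈ (≈-sym k≈2) (unit-2 l)
  j≡1 : jacobi l κ ≡ 1ℤ
  j≡1 = trans (jacobi-κ₁ uk) (cong₂ _*_ (cong ω r≡) (trans (jacobi-≈ l uk k≈2) (trans (jacobi-2 l) (cong η r≡))))
  a≡ : + a ≡ + k - + 2
  a≡ = trans (lemma (+ a)) (cong (_- + 2) (sym (cong +_ (trans (e₃ n) (cong (2 ℕ.+_) (ℕₚ.*-identityˡ a))))))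
    where
    lemma : ∀ a → a ≡ + 2 + a - + 2
    lemma = solve-∀
  k≡ : + k ≡ + 8 * + n + + 3
  k≡ = +-linear-≡ 8 3 n (e₄ n)
  from-root : Root a → Represents f₂ (+ 2 * + (8 ℕ.* n ℕ.+ 3))
  from-root R = subst (λ c → Represents f₂ (+ 2 * + c)) (e₄ n) (build (norm-equation R 1ℤ k (cong -_ (ℤₚ.pos-* 1 k)) (ℕ∣.n∣m*n 8)))
    where
    open Root R
    q : ℤ
    q = quotient class
    j : ℤ
    j = proj₁ (odd-α R)
    α≡ : + α ≡ 1ℤ + (j + j)
    α≡ = proj₂ (odd-α R)
    build : ∃[ t ] ∃[ b ] b * + α ≡ + k * (t * t) + 1ℤ → Represents f₂ (+ 2 * + k)
    build (t , b , norm) = finish (odd-solution {j} {+ k} {b} {t} (subst (λ x → b * x ≡ + k * (t * t) + 1ℤ) α≡ norm))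
      where
      finish : ∃[ b ] ∃[ w ] b * (1ℤ + (j + j)) ≡ + k * ((1ℤ + (w + w)) * (1ℤ + (w + w))) + 1ℤ → Represents f₂ (+ 2 * + k)
      finish (b , w , e) = represents₂ {τ * τ + + 8 * q} {b′} {+ 2 * + k} {+ 4 * τ} {v} {+ 8 * + α}
          (0<* {+ 2} (+<+ (s≤s z≤n)) (+<+ (s≤s z≤n))) (0<* {+ 8} (+<+ (s≤s z≤n)) (+<+ 1≤α))
          (trans (cong (+ 8 *_) (class-equation R _ a≡)) (shape (+ k) τ q)) det
        where
        v E b′ : ℤ
        v = 1ℤ + (w + w)
        E = (+ 8 * + n + + 3) * (w * w + w) + + 2 * + n + 1ℤ
        b′ = (1ℤ + (j + j)) * E - b * (j * j + j)
        shape : ∀ k τ q → + 8 * ((k - + 2) * (τ * τ) + q * (+ 8 * k))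
          ≡ + 4 * (τ * τ + + 8 * q) * (+ 2 * k) - + 4 * τ * (+ 4 * τ)
        shape = solve-∀
        four-E : + 4 * E ≡ b * (1ℤ + (j + j))
        four-E = sym (trans e (trans (cong (λ k → k * (v * v) + 1ℤ) k≡) (lemma (+ n) w)))
          where
          lemma : ∀ n w → (+ 8 * n + + 3) * ((1ℤ + (w + w)) * (1ℤ + (w + w))) + 1ℤ
            ≡ + 4 * ((+ 8 * n + + 3) * (w * w + w) + + 2 * n + 1ℤ)
          lemma = solve-∀
        four-b′ : + 4 * b′ ≡ b
        four-b′ = trans (lemma₁ j E b) (trans (cong (λ x → (1ℤ + (j + j)) * x - + 4 * b * (j * j + j)) four-E) (lemma₂ j b))
          where
          lemma₁ : ∀ j E b → + 4 * ((1ℤ + (j + j)) * E - b * (j * j + j)) ≡ (1ℤ + (j + j)) * (+ 4 * E) - + 4 * b * (j * j + j)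
          lemma₁ = solve-∀
          lemma₂ : ∀ j b → (1ℤ + (j + j)) * (b * (1ℤ + (j + j))) - + 4 * b * (j * j + j) ≡ b
          lemma₂ = solve-∀
        det : b′ * (+ 8 * + α) - + 2 * + k * (v * v) ≡ + 2
        det = trans (cong (λ x → b′ * (+ 8 * x) - + 2 * + k * (v * v)) α≡) (trans (lemma₁ b′ (1ℤ + (j + j)) (+ k) (v * v))
          (trans (cong (λ x → + 2 * (x * (1ℤ + (j + j))) - + 2 * (+ k * (v * v))) four-b′)
            (trans (cong (λ x → + 2 * x - + 2 * (+ k * (v * v))) e) (lemma₂ (+ k * (v * v))))))
          where
          lemma₁ : ∀ b α k u → b * (+ 8 * α) - + 2 * k * u ≡ + 2 * (+ 4 * b * α) - + 2 * (k * u)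
          lemma₁ = solve-∀
          lemma₂ : ∀ x → + 2 * (x + 1ℤ) - + 2 * x ≡ + 2
          lemma₂ = solve-∀

represents₂-2[8n+5] : ∀ n → Represents f₂ (+ 2 * + (8 ℕ.* n ℕ.+ 5))
represents₂-2[8n+5] n = from-root (root-for 1 (2 ℕ.* n ℕ.+ 1) (e₁ n) (toWitness {a? = invertible? 8 1} tt)
    (invertible-from-ℕ⁻ 1 a 2 k (e₂ n)) j≡1)
  where
  h l a : ℕ
  h = 4 ℕ.* n ℕ.+ 2
  l = 8 ℕ.* n ℕ.+ 4
  a = modulus l
  open RootFor h one l
  e₁ : ∀ n → suc (8 ℕ.* n ℕ.+ 4 ℕ.+ (8 ℕ.* n ℕ.+ 4)) ≡ 1 ℕ.+ (2 ℕ.* n ℕ.+ 1) ℕ.* 8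
  e₁ = ℕ-Ring.solve-∀
  e₂ : ∀ n → 1 ℕ.* suc (8 ℕ.* n ℕ.+ 4 ℕ.+ (8 ℕ.* n ℕ.+ 4)) ℕ.+ 1 ≡ 2 ℕ.* suc (4 ℕ.* n ℕ.+ 2 ℕ.+ (4 ℕ.* n ℕ.+ 2))
  e₂ = ℕ-Ring.solve-∀
  e₃ : ∀ n → 4 ℕ.* suc (4 ℕ.* n ℕ.+ 2 ℕ.+ (4 ℕ.* n ℕ.+ 2)) ≡ 2 ℕ.+ 2 ℕ.* suc (8 ℕ.* n ℕ.+ 4 ℕ.+ (8 ℕ.* n ℕ.+ 4))
  e₃ = ℕ-Ring.solve-∀
  e₄ : ∀ n → suc (4 ℕ.* n ℕ.+ 2 ℕ.+ (4 ℕ.* n ℕ.+ 2)) ≡ 8 ℕ.* n ℕ.+ 5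
  e₄ = ℕ-Ring.solve-∀
  e₅ : ∀ n → 2 ℕ.* suc (4 ℕ.* n ℕ.+ 2 ℕ.+ (4 ℕ.* n ℕ.+ 2)) ≡ suc (suc (8 ℕ.* n ℕ.+ 4 ℕ.+ (8 ℕ.* n ℕ.+ 4)))
  e₅ = ℕ-Ring.solve-∀
  r≡ : a % 8 ≡ 1
  r≡ = residue 1 (2 ℕ.* n ℕ.+ 1) (e₁ n)
  jk : Unit l (+ k) × jacobi l (+ k) ≡ jacobi l (+ 2)
  jk = jacobi-quarter (unit-2 l) (≈-from-ℕ 4 k 2 2 a (e₃ n))
  j≡1 : jacobi l κ ≡ 1ℤ
  j≡1 = trans (jacobi-κ₁ (proj₁ jk)) (cong₂ _*_ (cong ω r≡) (trans (proj₂ jk) (trans (jacobi-2 l) (cong η r≡))))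
  a≡ : + a ≡ + 2 * + k - 1ℤ
  a≡ = trans (lemma (+ a)) (cong (_- 1ℤ) (sym (trans (sym (ℤₚ.pos-* 2 k)) (cong +_ (e₅ n)))))
    where
    lemma : ∀ a → a ≡ 1ℤ + a - 1ℤ
    lemma = solve-∀
  k≡ : + k ≡ + 8 * + n + + 5
  k≡ = +-linear-≡ 8 5 n (e₄ n)
  from-root : Root a → Represents f₂ (+ 2 * + (8 ℕ.* n ℕ.+ 5))
  from-root R = subst (λ c → Represents f₂ (+ 2 * + c)) (e₄ n) (build (norm-equation R 1ℤ k (cong -_ (ℤₚ.pos-* 1 k)) (ℕ∣.n∣m*n 8)))
    where
    open Root R
    q : ℤ
    q = quotient class
    j : ℤ
    j = proj₁ (odd-α R)
    α≡ : + α ≡ 1ℤ + (j + j)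
    α≡ = proj₂ (odd-α R)
    build : ∃[ t ] ∃[ b ] b * + α ≡ + k * (t * t) + 1ℤ → Represents f₂ (+ 2 * + k)
    build (t , b , norm) = finish (odd-solution {j} {+ k} {b} {t} (subst (λ x → b * x ≡ + k * (t * t) + 1ℤ) α≡ norm))
      where
      finish : ∃[ b ] ∃[ w ] b * (1ℤ + (j + j)) ≡ + k * ((1ℤ + (w + w)) * (1ℤ + (w + w))) + 1ℤ → Represents f₂ (+ 2 * + k)
      finish (b , w , e) = represents₂ {τ * τ + + 4 * q} {b′} {+ 2 * + k} {+ 2 * τ} {v} {+ 4 * + α}
          (0<* {+ 2} (+<+ (s≤s z≤n)) (+<+ (s≤s z≤n))) (0<* {+ 4} (+<+ (s≤s z≤n)) (+<+ 1≤α))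
          (trans (cong (+ 4 *_) (class-equation R _ a≡)) (shape (+ k) τ q)) det
        where
        v E b′ : ℤ
        v = 1ℤ + (w + w)
        E = (+ 8 * + n + + 5) * (+ 2 * (w * w + w)) + + 4 * + n + + 3
        b′ = E - j * b
        shape : ∀ k τ q → + 4 * ((+ 2 * k - 1ℤ) * (τ * τ) + q * (+ 8 * k))
          ≡ + 4 * (τ * τ + + 4 * q) * (+ 2 * k) - + 2 * τ * (+ 2 * τ)
        shape = solve-∀
        two-E : + 2 * E ≡ b * (1ℤ + (j + j))
        two-E = sym (trans e (trans (cong (λ k → k * (v * v) + 1ℤ) k≡) (lemma (+ n) w)))
          where
          lemma : ∀ n w → (+ 8 * n + + 5) * ((1ℤ + (w + w)) * (1ℤ + (w + w))) + 1ℤ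
            ≡ + 2 * ((+ 8 * n + + 5) * (+ 2 * (w * w + w)) + + 4 * n + + 3)
          lemma = solve-∀
        two-b′ : + 2 * b′ ≡ b
        two-b′ = trans (lemma₁ j E b) (trans (cong (λ x → x - + 2 * j * b) two-E) (lemma₂ j b))
          where
          lemma₁ : ∀ j E b → + 2 * (E - j * b) ≡ + 2 * E - + 2 * j * b
          lemma₁ = solve-∀
          lemma₂ : ∀ j b → b * (1ℤ + (j + j)) - + 2 * j * b ≡ b
          lemma₂ = solve-∀
        det : b′ * (+ 4 * + α) - + 2 * + k * (v * v) ≡ + 2
        det = trans (cong (λ x → b′ * (+ 4 * x) - + 2 * + k * (v * v)) α≡) (trans (lemma₁ b′ (1ℤ + (j + j)) (+ k) (v * v))
          (trans (cong (λ x → + 2 * (x * (1ℤ + (j + j))) - + 2 * (+ k * (v * v))) two-b′)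
            (trans (cong (λ x → + 2 * x - + 2 * (+ k * (v * v))) e) (lemma₂ (+ k * (v * v))))))
          where
          lemma₁ : ∀ b α k u → b * (+ 4 * α) - + 2 * k * u ≡ + 2 * (+ 2 * b * α) - + 2 * (k * u)
          lemma₁ = solve-∀
          lemma₂ : ∀ x → + 2 * (x + 1ℤ) - + 2 * x ≡ + 2
          lemma₂ = solve-∀

represents₃-6n+1 : ∀ n → Represents f₃ (+ (6 ℕ.* n ℕ.+ 1))
represents₃-6n+1 n = from-root (root-for 7 (6 ℕ.* n) (e₁ n) (toWitness {a? = invertible? 8 7} tt)
    (subst (λ k → Invertible k a) (sym (e₀ n)) (invertible-* {3} {c} (invertible-residue 3 1 (16 ℕ.* n ℕ.+ 2) (e₅ n) (toWitness {a? = invertible? 3 1} tt))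
      (invertible-from-ℕ⁻ 1 a 8 c (e₂ n)))) j≡1)
  where
  h l a c : ℕ
  h = 9 ℕ.* n ℕ.+ 1
  l = 24 ℕ.* n ℕ.+ 3
  a = modulus l
  c = 6 ℕ.* n ℕ.+ 1
  open RootFor h one l
  e₀ : ∀ n → suc (9 ℕ.* n ℕ.+ 1 ℕ.+ (9 ℕ.* n ℕ.+ 1)) ≡ 3 ℕ.* (6 ℕ.* n ℕ.+ 1)
  e₀ = ℕ-Ring.solve-∀
  e₁ : ∀ n → suc (24 ℕ.* n ℕ.+ 3 ℕ.+ (24 ℕ.* n ℕ.+ 3)) ≡ 7 ℕ.+ 6 ℕ.* n ℕ.* 8
  e₁ = ℕ-Ring.solve-∀
  e₂ : ∀ n → 1 ℕ.* suc (24 ℕ.* n ℕ.+ 3 ℕ.+ (24 ℕ.* n ℕ.+ 3)) ℕ.+ 1 ≡ 8 ℕ.* (6 ℕ.* n ℕ.+ 1)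
  e₂ = ℕ-Ring.solve-∀
  e₃ : ∀ n → 8 ℕ.* suc (9 ℕ.* n ℕ.+ 1 ℕ.+ (9 ℕ.* n ℕ.+ 1)) ≡ 3 ℕ.+ 3 ℕ.* suc (24 ℕ.* n ℕ.+ 3 ℕ.+ (24 ℕ.* n ℕ.+ 3))
  e₃ = ℕ-Ring.solve-∀
  e₅ : ∀ n → suc (24 ℕ.* n ℕ.+ 3 ℕ.+ (24 ℕ.* n ℕ.+ 3)) ≡ 1 ℕ.+ (16 ℕ.* n ℕ.+ 2) ℕ.* 3
  e₅ = ℕ-Ring.solve-∀
  r≡ : a % 8 ≡ 7
  r≡ = residue 7 (6 ℕ.* n) (e₁ n)
  j3 : Unit l (+ 3) × jacobi l (+ 3) ≡ ω (a % 8)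
  j3 = jacobi-3 l (%-≈ a 1 (residue 1 (16 ℕ.* n ℕ.+ 2) (e₅ n)))
  jk : Unit l (+ k) × jacobi l (+ k) ≡ η (a % 8) * jacobi l (+ 3)
  jk = jacobi-eighth (proj₁ j3) (≈-from-ℕ 8 k 3 3 a (e₃ n))
  j≡1 : jacobi l κ ≡ 1ℤ
  j≡1 = trans (jacobi-κ₁ (proj₁ jk)) (trans (cong (ω (a % 8) *_) (trans (proj₂ jk) (cong (η (a % 8) *_) (proj₂ j3))))
    (cong (λ r → ω r * (η r * ω r)) r≡))
  k≡ : + k ≡ + 3 * + c
  k≡ = trans (cong +_ (e₀ n)) (ℤₚ.pos-* 3 c)
  a≡ : + a ≡ + 8 * + c - 1ℤ
  a≡ = trans (lemma (+ a)) (cong (_- 1ℤ) (trans (cong +_ (trans (sym (cong (ℕ._+ 1) (ℕₚ.*-identityˡ a))) (e₂ n))) (ℤₚ.pos-* 8 c)))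
    where
    lemma : ∀ a → a ≡ a + 1ℤ - 1ℤ
    lemma = solve-∀
  from-root : Root a → Represents f₃ (+ c)
  from-root R =
    let (t , b , norm) = norm-equation R (+ 3) c (cong -_ (trans (cong +_ (ℕₚ.*-identityˡ k)) k≡)) (ℕ∣.divides 24 (trans (cong (8 ℕ.*_) (e₀ n)) (lemma c)))
    in represents₃ {+ 2 * (τ * τ) + + 6 * q} {b} {+ c} {τ} {t} {+ α} 0<c (+<+ 1≤α)
       (trans (class-equation R _ a≡) (trans (cong (λ k → (+ 8 * + c - 1ℤ) * (τ * τ) + q * (+ 8 * k)) k≡) (shape (+ c) τ q)))
       (move-norm b (+ α) (+ c * (t * t)) (+ 3) norm)
    where
    open Root R
    q : ℤ
    q = quotient class
    0<c : 0ℤ < + c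
    0<c = +<+ (ℕₚ.m≤n+m 1 (6 ℕ.* n))
    lemma : ∀ c → 8 ℕ.* (3 ℕ.* c) ≡ 24 ℕ.* c
    lemma = ℕ-Ring.solve-∀
    shape : ∀ c τ q → (+ 8 * c - 1ℤ) * (τ * τ) + q * (+ 8 * (+ 3 * c)) ≡ + 4 * (+ 2 * (τ * τ) + + 6 * q) * c - τ * τ
    shape = solve-∀

represents₃-6n+5 : ∀ n → Represents f₃ (+ (6 ℕ.* n ℕ.+ 5))
represents₃-6n+5 n = from-root (root-for 3 (3 ℕ.* n ℕ.+ 2) (e₁ n) (toWitness {a? = invertible? 8 3} tt)
    (subst (λ k → Invertible k a) (sym (e₀ n)) (invertible-* {3} {c} (invertible-residue 3 1 (8 ℕ.* n ℕ.+ 6) (e₅ n) (toWitness {a? = invertible? 3 1} tt))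
      (invertible-from-ℕ⁻ 1 a 4 c (e₂ n)))) j≡1)
  where
  h l a c : ℕ
  h = 9 ℕ.* n ℕ.+ 7
  l = 12 ℕ.* n ℕ.+ 9
  a = modulus l
  c = 6 ℕ.* n ℕ.+ 5
  open RootFor h one l
  e₀ : ∀ n → suc (9 ℕ.* n ℕ.+ 7 ℕ.+ (9 ℕ.* n ℕ.+ 7)) ≡ 3 ℕ.* (6 ℕ.* n ℕ.+ 5)
  e₀ = ℕ-Ring.solve-∀
  e₁ : ∀ n → suc (12 ℕ.* n ℕ.+ 9 ℕ.+ (12 ℕ.* n ℕ.+ 9)) ≡ 3 ℕ.+ (3 ℕ.* n ℕ.+ 2) ℕ.* 8
  e₁ = ℕ-Ring.solve-∀
  e₂ : ∀ n → 1 ℕ.* suc (12 ℕ.* n ℕ.+ 9 ℕ.+ (12 ℕ.* n ℕ.+ 9)) ℕ.+ 1 ≡ 4 ℕ.* (6 ℕ.* n ℕ.+ 5)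
  e₂ = ℕ-Ring.solve-∀
  e₃ : ∀ n → 4 ℕ.* suc (9 ℕ.* n ℕ.+ 7 ℕ.+ (9 ℕ.* n ℕ.+ 7)) ≡ 3 ℕ.+ 3 ℕ.* suc (12 ℕ.* n ℕ.+ 9 ℕ.+ (12 ℕ.* n ℕ.+ 9))
  e₃ = ℕ-Ring.solve-∀
  e₅ : ∀ n → suc (12 ℕ.* n ℕ.+ 9 ℕ.+ (12 ℕ.* n ℕ.+ 9)) ≡ 1 ℕ.+ (8 ℕ.* n ℕ.+ 6) ℕ.* 3
  e₅ = ℕ-Ring.solve-∀
  r≡ : a % 8 ≡ 3
  r≡ = residue 3 (3 ℕ.* n ℕ.+ 2) (e₁ n)
  j3 : Unit l (+ 3) × jacobi l (+ 3) ≡ ω (a % 8)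
  j3 = jacobi-3 l (%-≈ a 1 (residue 1 (8 ℕ.* n ℕ.+ 6) (e₅ n)))
  jk : Unit l (+ k) × jacobi l (+ k) ≡ jacobi l (+ 3)
  jk = jacobi-quarter (proj₁ j3) (≈-from-ℕ 4 k 3 3 a (e₃ n))
  j≡1 : jacobi l κ ≡ 1ℤ
  j≡1 = trans (jacobi-κ₁ (proj₁ jk)) (trans (cong (ω (a % 8) *_) (trans (proj₂ jk) (proj₂ j3))) (cong (λ r → ω r * ω r) r≡))
  k≡ : + k ≡ + 3 * + c
  k≡ = trans (cong +_ (e₀ n)) (ℤₚ.pos-* 3 c)
  a≡ : + a ≡ + 4 * + c - 1ℤ
  a≡ = trans (lemma (+ a)) (cong (_- 1ℤ) (trans (cong +_ (trans (sym (cong (ℕ._+ 1) (ℕₚ.*-identityˡ a))) (e₂ n))) (ℤₚ.pos-* 4 c)))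
    where
    lemma : ∀ a → a ≡ a + 1ℤ - 1ℤ
    lemma = solve-∀
  from-root : Root a → Represents f₃ (+ c)
  from-root R =
    let (t , b , norm) = norm-equation R (+ 3) c (cong -_ (trans (cong +_ (ℕₚ.*-identityˡ k)) k≡)) (ℕ∣.divides 24 (trans (cong (8 ℕ.*_) (e₀ n)) (lemma c)))
    in represents₃ {τ * τ + + 6 * q} {b} {+ c} {τ} {t} {+ α} 0<c (+<+ 1≤α)
       (trans (class-equation R _ a≡) (trans (cong (λ k → (+ 4 * + c - 1ℤ) * (τ * τ) + q * (+ 8 * k)) k≡) (shape (+ c) τ q)))
       (move-norm b (+ α) (+ c * (t * t)) (+ 3) norm)
    where
    open Root R
    q : ℤ
    q = quotient class
    0<c : 0ℤ < + c
    0<c = +<+ (ℕₚ.≤-trans (s≤s z≤n) (ℕₚ.m≤n+m 5 (6 ℕ.* n)))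
    lemma : ∀ c → 8 ℕ.* (3 ℕ.* c) ≡ 24 ℕ.* c
    lemma = ℕ-Ring.solve-∀
    shape : ∀ c τ q → (+ 4 * c - 1ℤ) * (τ * τ) + q * (+ 8 * (+ 3 * c)) ≡ + 4 * (τ * τ + + 6 * q) * c - τ * τ
    shape = solve-∀

represents₃-2[6n+1] : ∀ n → Represents f₃ (+ 2 * + (6 ℕ.* n ℕ.+ 1))
represents₃-2[6n+1] n = from-root (root-for 7 (6 ℕ.* n) (e₁ n) (toWitness {a? = invertible? 8 7} tt)
    (subst (λ k → Invertible k a) (sym (e₀ n)) (invertible-* {3} {c} (invertible-residue 3 1 (16 ℕ.* n ℕ.+ 2) (e₅ n) (toWitness {a? = invertible? 3 1} tt))
      (invertible-from-ℕ⁻ 1 a 8 c (e₂ n)))) j≡1)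
  where
  h l a c : ℕ
  h = 9 ℕ.* n ℕ.+ 1
  l = 24 ℕ.* n ℕ.+ 3
  a = modulus l
  c = 6 ℕ.* n ℕ.+ 1
  open RootFor h two l
  e₀ : ∀ n → suc (9 ℕ.* n ℕ.+ 1 ℕ.+ (9 ℕ.* n ℕ.+ 1)) ≡ 3 ℕ.* (6 ℕ.* n ℕ.+ 1)
  e₀ = ℕ-Ring.solve-∀
  e₁ : ∀ n → suc (24 ℕ.* n ℕ.+ 3 ℕ.+ (24 ℕ.* n ℕ.+ 3)) ≡ 7 ℕ.+ 6 ℕ.* n ℕ.* 8
  e₁ = ℕ-Ring.solve-∀
  e₂ : ∀ n → 1 ℕ.* suc (24 ℕ.* n ℕ.+ 3 ℕ.+ (24 ℕ.* n ℕ.+ 3)) ℕ.+ 1 ≡ 8 ℕ.* (6 ℕ.* n ℕ.+ 1)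
  e₂ = ℕ-Ring.solve-∀
  e₃ : ∀ n → 8 ℕ.* suc (9 ℕ.* n ℕ.+ 1 ℕ.+ (9 ℕ.* n ℕ.+ 1)) ≡ 3 ℕ.+ 3 ℕ.* suc (24 ℕ.* n ℕ.+ 3 ℕ.+ (24 ℕ.* n ℕ.+ 3))
  e₃ = ℕ-Ring.solve-∀
  e₅ : ∀ n → suc (24 ℕ.* n ℕ.+ 3 ℕ.+ (24 ℕ.* n ℕ.+ 3)) ≡ 1 ℕ.+ (16 ℕ.* n ℕ.+ 2) ℕ.* 3
  e₅ = ℕ-Ring.solve-∀
  r≡ : a % 8 ≡ 7
  r≡ = residue 7 (6 ℕ.* n) (e₁ n)
  j3 : Unit l (+ 3) × jacobi l (+ 3) ≡ ω (a % 8)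
  j3 = jacobi-3 l (%-≈ a 1 (residue 1 (16 ℕ.* n ℕ.+ 2) (e₅ n)))
  jk : Unit l (+ k) × jacobi l (+ k) ≡ η (a % 8) * jacobi l (+ 3)
  jk = jacobi-eighth (proj₁ j3) (≈-from-ℕ 8 k 3 3 a (e₃ n))
  j≡1 : jacobi l κ ≡ 1ℤ
  j≡1 = trans (jacobi-κ₂ (proj₁ jk)) (trans (cong (λ j → ω (a % 8) * (η (a % 8) * j)) (trans (proj₂ jk) (cong (η (a % 8) *_) (proj₂ j3))))
    (cong (λ r → ω r * (η r * (η r * ω r))) r≡))
  k≡ : + k ≡ + 3 * + c
  k≡ = trans (cong +_ (e₀ n)) (ℤₚ.pos-* 3 c)
  a≡ : + a ≡ + 8 * + c - 1ℤ
  a≡ = trans (lemma (+ a)) (cong (_- 1ℤ) (trans (cong +_ (trans (sym (cong (ℕ._+ 1) (ℕₚ.*-identityˡ a))) (e₂ n))) (ℤₚ.pos-* 8 c)))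
    where
    lemma : ∀ a → a ≡ a + 1ℤ - 1ℤ
    lemma = solve-∀
  from-root : Root a → Represents f₃ (+ 2 * + c)
  from-root R =
    let (t , b , norm) = norm-equation R (+ 3) (2 ℕ.* c) κ≡ (ℕ∣.divides 12 (trans (cong (8 ℕ.*_) (e₀ n)) (lemma c)))
    in represents₃ {τ * τ + + 3 * q} {b} {+ 2 * + c} {τ} {t} {+ α} (0<* {+ 2} (+<+ (s≤s z≤n)) 0<c) (+<+ 1≤α)
       (trans (class-equation R _ a≡) (trans (cong (λ k → (+ 8 * + c - 1ℤ) * (τ * τ) + q * (+ 8 * k)) k≡) (shape (+ c) τ q)))
       (move-norm b (+ α) (+ 2 * + c * (t * t)) (+ 3) (trans norm (cong (λ x → x * (t * t) + + 3) (ℤₚ.pos-* 2 c))))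
    where
    open Root R
    q : ℤ
    q = quotient class
    0<c : 0ℤ < + c
    0<c = +<+ (ℕₚ.m≤n+m 1 (6 ℕ.* n))
    κ≡ : κ ≡ - (+ 3 * + (2 ℕ.* c))
    κ≡ = cong -_ (trans (cong +_ (trans (cong (2 ℕ.*_) (e₀ n)) (lemma′ c))) (ℤₚ.pos-* 3 (2 ℕ.* c)))
      where
      lemma′ : ∀ c → 2 ℕ.* (3 ℕ.* c) ≡ 3 ℕ.* (2 ℕ.* c)
      lemma′ = ℕ-Ring.solve-∀
    lemma : ∀ c → 8 ℕ.* (3 ℕ.* c) ≡ 12 ℕ.* (2 ℕ.* c)
    lemma = ℕ-Ring.solve-∀
    shape : ∀ c τ q → (+ 8 * c - 1ℤ) * (τ * τ) + q * (+ 8 * (+ 3 * c)) ≡ + 4 * (τ * τ + + 3 * q) * (+ 2 * c) - τ * τ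
    shape = solve-∀

represents₃-6[6n+5] : ∀ n → Represents f₃ (+ 6 * + (6 ℕ.* n ℕ.+ 5))
represents₃-6[6n+5] n = from-root (root-for 5 (6 ℕ.* n ℕ.+ 4) (e₁ n) (toWitness {a? = invertible? 8 5} tt)
    (invertible-from-ℕ⁻ (2 ℕ.* n ℕ.+ 2) a (16 ℕ.* n ℕ.+ 15) k (e₂ n)) j≡1)
  where
  h l a : ℕ
  h = 3 ℕ.* n ℕ.+ 2
  l = 24 ℕ.* n ℕ.+ 18
  a = modulus l
  open RootFor h two l
  e₁ : ∀ n → suc (24 ℕ.* n ℕ.+ 18 ℕ.+ (24 ℕ.* n ℕ.+ 18)) ≡ 5 ℕ.+ (6 ℕ.* n ℕ.+ 4) ℕ.* 8
  e₁ = ℕ-Ring.solve-∀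
  e₂ : ∀ n → (2 ℕ.* n ℕ.+ 2) ℕ.* suc (24 ℕ.* n ℕ.+ 18 ℕ.+ (24 ℕ.* n ℕ.+ 18)) ℕ.+ 1
    ≡ (16 ℕ.* n ℕ.+ 15) ℕ.* suc (3 ℕ.* n ℕ.+ 2 ℕ.+ (3 ℕ.* n ℕ.+ 2))
  e₂ = ℕ-Ring.solve-∀
  e₃ : ∀ n → 8 ℕ.* suc (3 ℕ.* n ℕ.+ 2 ℕ.+ (3 ℕ.* n ℕ.+ 2)) ≡ 3 ℕ.+ 1 ℕ.* suc (24 ℕ.* n ℕ.+ 18 ℕ.+ (24 ℕ.* n ℕ.+ 18))
  e₃ = ℕ-Ring.solve-∀
  e₄ : ∀ n → suc (3 ℕ.* n ℕ.+ 2 ℕ.+ (3 ℕ.* n ℕ.+ 2)) ≡ 6 ℕ.* n ℕ.+ 5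
  e₄ = ℕ-Ring.solve-∀
  e₅ : ∀ n → suc (24 ℕ.* n ℕ.+ 18 ℕ.+ (24 ℕ.* n ℕ.+ 18)) ≡ 1 ℕ.+ (16 ℕ.* n ℕ.+ 12) ℕ.* 3
  e₅ = ℕ-Ring.solve-∀
  r≡ : a % 8 ≡ 5
  r≡ = residue 5 (6 ℕ.* n ℕ.+ 4) (e₁ n)
  j3 : Unit l (+ 3) × jacobi l (+ 3) ≡ ω (a % 8)
  j3 = jacobi-3 l (%-≈ a 1 (residue 1 (16 ℕ.* n ℕ.+ 12) (e₅ n)))
  jk : Unit l (+ k) × jacobi l (+ k) ≡ η (a % 8) * jacobi l (+ 3)
  jk = jacobi-eighth (proj₁ j3) (≈-from-ℕ 8 k 3 1 a (e₃ n))
  j≡1 : jacobi l κ ≡ 1ℤ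
  j≡1 = trans (jacobi-κ₂ (proj₁ jk)) (trans (cong (λ j → ω (a % 8) * (η (a % 8) * j)) (trans (proj₂ jk) (cong (η (a % 8) *_) (proj₂ j3))))
    (cong (λ r → ω r * (η r * (η r * ω r))) r≡))
  a≡ : + a ≡ + 8 * + k - + 3
  a≡ = trans (lemma (+ a)) (cong (_- + 3) (sym (trans (sym (ℤₚ.pos-* 8 k)) (cong +_ (trans (e₃ n) (cong (3 ℕ.+_) (ℕₚ.*-identityˡ a)))))))
    where
    lemma : ∀ a → a ≡ + 3 + a - + 3
    lemma = solve-∀
  from-root : Root a → Represents f₃ (+ 6 * + (6 ℕ.* n ℕ.+ 5))
  from-root R = subst (λ c → Represents f₃ (+ 6 * + c)) (e₄ n)
    (let (t , b , norm) = norm-equation R 1ℤ (2 ℕ.* k) (cong -_ (sym (ℤₚ.*-identityˡ (+ (2 ℕ.* k))))) (ℕ∣.divides 4 (lemma k))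
     in represents₃ {τ * τ + q} {b} {+ 6 * + k} {+ 3 * τ} {t} {+ 3 * + α} (0<* {+ 6} (+<+ (s≤s z≤n)) (+<+ (s≤s z≤n)))
       (0<* {+ 3} (+<+ (s≤s z≤n)) (+<+ 1≤α))
       (trans (cong (+ 3 *_) (class-equation R _ a≡)) (shape (+ k) τ q))
       (trans (scale b (+ α) (+ k) (t * t)) (cong (+ 3 *_) (move-norm b (+ α) (+ 2 * + k * (t * t)) 1ℤ
         (trans norm (cong (λ x → x * (t * t) + 1ℤ) (ℤₚ.pos-* 2 k)))))))
    where
    open Root R
    q : ℤ
    q = quotient class
    lemma : ∀ k → 8 ℕ.* k ≡ 4 ℕ.* (2 ℕ.* k)
    lemma = ℕ-Ring.solve-∀
    shape : ∀ k τ q → + 3 * ((+ 8 * k - + 3) * (τ * τ) + q * (+ 8 * k)) ≡ + 4 * (τ * τ + q) * (+ 6 * k) - + 3 * τ * (+ 3 * τ)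
    shape = solve-∀
    scale : ∀ b α k u → b * (+ 3 * α) - + 6 * k * u ≡ + 3 * (b * α - + 2 * k * u)
    scale = solve-∀

represents₅-5[40n+17] : ∀ n → Represents f₅ (+ 5 * + (40 ℕ.* n ℕ.+ 17))
represents₅-5[40n+17] n = from-root (root-for 7 (20 ℕ.* n ℕ.+ 7) (e₁ n) (toWitness {a? = invertible? 8 7} tt)
    (invertible-from-ℕ⁻ (16 ℕ.* n ℕ.+ 7) a (64 ℕ.* n ℕ.+ 26) k (e₂ n)) j≡1)
  where
  h l a : ℕ
  h = 20 ℕ.* n ℕ.+ 8
  l = 80 ℕ.* n ℕ.+ 31
  a = modulus l
  open RootFor h one l
  e₁ : ∀ n → suc (80 ℕ.* n ℕ.+ 31 ℕ.+ (80 ℕ.* n ℕ.+ 31)) ≡ 7 ℕ.+ (20 ℕ.* n ℕ.+ 7) ℕ.* 8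
  e₁ = ℕ-Ring.solve-∀
  e₂ : ∀ n → (16 ℕ.* n ℕ.+ 7) ℕ.* suc (80 ℕ.* n ℕ.+ 31 ℕ.+ (80 ℕ.* n ℕ.+ 31)) ℕ.+ 1
    ≡ (64 ℕ.* n ℕ.+ 26) ℕ.* suc (20 ℕ.* n ℕ.+ 8 ℕ.+ (20 ℕ.* n ℕ.+ 8))
  e₂ = ℕ-Ring.solve-∀
  e₃ : ∀ n → 4 ℕ.* suc (20 ℕ.* n ℕ.+ 8 ℕ.+ (20 ℕ.* n ℕ.+ 8)) ≡ 5 ℕ.+ 1 ℕ.* suc (80 ℕ.* n ℕ.+ 31 ℕ.+ (80 ℕ.* n ℕ.+ 31))
  e₃ = ℕ-Ring.solve-∀
  e₄ : ∀ n → suc (20 ℕ.* n ℕ.+ 8 ℕ.+ (20 ℕ.* n ℕ.+ 8)) ≡ 40 ℕ.* n ℕ.+ 17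
  e₄ = ℕ-Ring.solve-∀
  e₅ : ∀ n → suc (80 ℕ.* n ℕ.+ 31 ℕ.+ (80 ℕ.* n ℕ.+ 31)) ≡ 3 ℕ.+ (32 ℕ.* n ℕ.+ 12) ℕ.* 5
  e₅ = ℕ-Ring.solve-∀
  r≡ : a % 8 ≡ 7
  r≡ = residue 7 (20 ℕ.* n ℕ.+ 7) (e₁ n)
  j5 : Unit l (+ 5) × jacobi l (+ 5) ≡ -1ℤ
  j5 = jacobi-5 l (%-≈ a 3 (residue 3 (32 ℕ.* n ℕ.+ 12) (e₅ n)))
  jk : Unit l (+ k) × jacobi l (+ k) ≡ jacobi l (+ 5)
  jk = jacobi-quarter (proj₁ j5) (≈-from-ℕ 4 k 5 1 a (e₃ n))
  j≡1 : jacobi l κ ≡ 1ℤ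
  j≡1 = trans (jacobi-κ₁ (proj₁ jk)) (cong₂ _*_ (cong ω r≡) (trans (proj₂ jk) (proj₂ j5)))
  a≡ : + a ≡ + 4 * + k - + 5
  a≡ = trans (lemma (+ a)) (cong (_- + 5) (sym (trans (sym (ℤₚ.pos-* 4 k)) (cong +_ (trans (e₃ n) (cong (5 ℕ.+_) (ℕₚ.*-identityˡ a)))))))
    where
    lemma : ∀ a → a ≡ + 5 + a - + 5
    lemma = solve-∀
  from-root : Root a → Represents f₅ (+ 5 * + (40 ℕ.* n ℕ.+ 17))
  from-root R = subst (λ c → Represents f₅ (+ 5 * + c)) (e₄ n)
    (let (t , b , norm) = norm-equation R 1ℤ k (cong -_ (ℤₚ.pos-* 1 k)) (ℕ∣.n∣m*n 8)
     in represents₅ {τ * τ + + 2 * q} {b} {+ 5 * + k} {+ 5 * τ} {t} {+ 5 * + α} (0<* {+ 5} (+<+ (s≤s z≤n)) (+<+ (s≤s z≤n)))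
       (0<* {+ 5} (+<+ (s≤s z≤n)) (+<+ 1≤α))
       (trans (cong (+ 5 *_) (class-equation R _ a≡)) (shape (+ k) τ q))
       (trans (scale b (+ α) (+ k) (t * t)) (cong (+ 5 *_) (move-norm b (+ α) (+ k * (t * t)) 1ℤ norm))))
    where
    open Root R
    q : ℤ
    q = quotient class
    shape : ∀ k τ q → + 5 * ((+ 4 * k - + 5) * (τ * τ) + q * (+ 8 * k)) ≡ + 4 * (τ * τ + + 2 * q) * (+ 5 * k) - + 5 * τ * (+ 5 * τ)
    shape = solve-∀
    scale : ∀ b α k u → b * (+ 5 * α) - + 5 * k * u ≡ + 5 * (b * α - k * u)
    scale = solve-∀

-- Polygonal sums

Even Odd : ℤ → Set
Even x = ∃[ h ] x ≡ + 2 * h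
Odd  x = ∃[ h ] x ≡ 1ℤ + + 2 * h

division : ∀ n .{{_ : ℕ.NonZero n}} x → ∃[ r ] ∃[ q ] r ℕ.< n × x ≡ + r + q * + n
division n x = x %ℕ n , x /ℕ n , n%ℕd<d x n , a≡a%ℕn+[a/ℕn]*n x n

parity : ∀ x → Even x ⊎ Odd x
parity x = by-residue (division 2 x)
  where
  by-residue : ∃[ r ] ∃[ q ] r ℕ.< 2 × x ≡ + r + q * + 2 → Even x ⊎ Odd x
  by-residue (0 , q , _ , e) = inj₁ (q , trans e (lemma q))
    where
    lemma : ∀ q → 0ℤ + q * + 2 ≡ + 2 * q
    lemma = solve-∀
  by-residue (1 , q , _ , e) = inj₂ (q , trans e (cong (λ z → 1ℤ + z) (ℤₚ.*-comm q (+ 2))))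
  by-residue (suc (suc _) , _ , s≤s (s≤s ()) , _)

absurd-mod : ∀ n r {T A B : ℤ} → 1 ℕ.≤ r → r ℕ.< n → A ≡ B → + n * T ≡ A - B + + r → ⊥
absurd-mod n r {T} {A} {B} 1≤r r<n A≡B e = ℕₚ.<⇒≢ 1≤r (sym (rem-unique r<n (ℕₚ.≤-<-trans z≤n r<n)
  (multiple T (trans (sym (trans e (trans (cong (_+ + r) (ℤₚ.i≡j⇒i-j≡0 A≡B)) (ℤₚ.+-identityˡ (+ r)))))
    (trans (ℤₚ.*-comm (+ n) T) (sym (ℤₚ.+-identityˡ (T * + n))))))))

pronic : ℤ → ℤ
pronic u = u * u + u

pronic-even : ∀ u → ∃[ y ] pronic u ≡ y * (+ 4 * y + + 2)
pronic-even u = by-parity (parity u)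
  where
  by-parity : Even u ⊎ Odd u → ∃[ y ] pronic u ≡ y * (+ 4 * y + + 2)
  by-parity (inj₁ (h , refl)) = h , lemma h
    where
    lemma : ∀ h → + 2 * h * (+ 2 * h) + + 2 * h ≡ h * (+ 4 * h + + 2)
    lemma = solve-∀
  by-parity (inj₂ (h , refl)) = - (h + 1ℤ) , lemma h
    where
    lemma : ∀ h → (1ℤ + + 2 * h) * (1ℤ + + 2 * h) + (1ℤ + + 2 * h) ≡ - (h + 1ℤ) * (+ 4 * - (h + 1ℤ) + + 2)
    lemma = solve-∀

-- Triangular numbers are T₈,₂ = x (8x + 2) / 2 and T₈,₆ + 1 according to their parity.
pronic-mod-4 : ∀ u → (∃[ x ] pronic u ≡ + 2 * (x * (+ 8 * x + + 2))) ⊎ (∃[ x ] pronic u ≡ + 2 * (x * (+ 8 * x + + 6)) + + 2)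
pronic-mod-4 u = by-residue (division 4 u)
  where
  l₀ : ∀ q → (0ℤ + q * + 4) * (0ℤ + q * + 4) + (0ℤ + q * + 4) ≡ + 2 * (q * (+ 8 * q + + 2))
  l₀ = solve-∀
  l₁ : ∀ q → (1ℤ + q * + 4) * (1ℤ + q * + 4) + (1ℤ + q * + 4) ≡ + 2 * (q * (+ 8 * q + + 6)) + + 2
  l₁ = solve-∀
  l₂ : ∀ q → (+ 2 + q * + 4) * (+ 2 + q * + 4) + (+ 2 + q * + 4) ≡ + 2 * (- (q + 1ℤ) * (+ 8 * - (q + 1ℤ) + + 6)) + + 2
  l₂ = solve-∀
  l₃ : ∀ q → (+ 3 + q * + 4) * (+ 3 + q * + 4) + (+ 3 + q * + 4) ≡ + 2 * (- (q + 1ℤ) * (+ 8 * - (q + 1ℤ) + + 2))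
  l₃ = solve-∀
  by-residue : ∃[ r ] ∃[ q ] r ℕ.< 4 × u ≡ + r + q * + 4 →
    (∃[ x ] pronic u ≡ + 2 * (x * (+ 8 * x + + 2))) ⊎ (∃[ x ] pronic u ≡ + 2 * (x * (+ 8 * x + + 6)) + + 2)
  by-residue (0 , q , _ , e) = inj₁ (q , trans (cong pronic e) (l₀ q))
  by-residue (1 , q , _ , e) = inj₂ (q , trans (cong pronic e) (l₁ q))
  by-residue (2 , q , _ , e) = inj₂ (- (q + 1ℤ) , trans (cong pronic e) (l₂ q))
  by-residue (3 , q , _ , e) = inj₁ (- (q + 1ℤ) , trans (cong pronic e) (l₃ q))
  by-residue (suc (suc (suc (suc _))) , _ , s≤s (s≤s (s≤s (s≤s ()))) , _)

pronic≡4w : ∀ u w → pronic u ≡ + 4 * w → ∃[ x ] pronic u ≡ + 2 * (x * (+ 8 * x + + 2))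
pronic≡4w u w e = choose (pronic-mod-4 u)
  where
  lemma : ∀ x w → + 4 * (+ 4 * (x * x) + + 3 * x - w + 1ℤ) ≡ + 2 * (x * (+ 8 * x + + 6)) + + 2 - + 4 * w + + 2
  lemma = solve-∀
  choose : (∃[ x ] pronic u ≡ + 2 * (x * (+ 8 * x + + 2))) ⊎ (∃[ x ] pronic u ≡ + 2 * (x * (+ 8 * x + + 6)) + + 2) →
           ∃[ x ] pronic u ≡ + 2 * (x * (+ 8 * x + + 2))
  choose (inj₁ p)        = p
  choose (inj₂ (x , e′)) = ⊥-elim (absurd-mod 4 2 (s≤s z≤n) (s≤s (s≤s (s≤s z≤n))) (trans (sym e′) e) (lemma x w))

pronic≡4w+2 : ∀ u w → pronic u ≡ + 4 * w + + 2 → ∃[ x ] pronic u ≡ + 2 * (x * (+ 8 * x + + 6)) + + 2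
pronic≡4w+2 u w e = choose (pronic-mod-4 u)
  where
  lemma : ∀ x w → + 4 * (+ 4 * (x * x) + x - w) ≡ + 2 * (x * (+ 8 * x + + 2)) - (+ 4 * w + + 2) + + 2
  lemma = solve-∀
  choose : (∃[ x ] pronic u ≡ + 2 * (x * (+ 8 * x + + 2))) ⊎ (∃[ x ] pronic u ≡ + 2 * (x * (+ 8 * x + + 6)) + + 2) →
           ∃[ x ] pronic u ≡ + 2 * (x * (+ 8 * x + + 6)) + + 2
  choose (inj₂ p)        = p
  choose (inj₁ (x , e′)) = ⊥-elim (absurd-mod 4 2 (s≤s z≤n) (s≤s (s≤s (s≤s z≤n))) (trans (sym e′) e) (lemma x w))

mod-3 : ∀ v → (∃[ w ] v ≡ + 3 * w) ⊎ (∃[ y ] v * v ≡ 1ℤ + + 3 * (y * (+ 3 * y + + 2)))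
mod-3 v = by-residue (division 3 v)
  where
  l₀ : ∀ q → 0ℤ + q * + 3 ≡ + 3 * q
  l₀ = solve-∀
  l₁ : ∀ q → (1ℤ + q * + 3) * (1ℤ + q * + 3) ≡ 1ℤ + + 3 * (q * (+ 3 * q + + 2))
  l₁ = solve-∀
  l₂ : ∀ q → (+ 2 + q * + 3) * (+ 2 + q * + 3) ≡ 1ℤ + + 3 * (- (q + 1ℤ) * (+ 3 * - (q + 1ℤ) + + 2))
  l₂ = solve-∀
  by-residue : ∃[ r ] ∃[ q ] r ℕ.< 3 × v ≡ + r + q * + 3 →
    (∃[ w ] v ≡ + 3 * w) ⊎ (∃[ y ] v * v ≡ 1ℤ + + 3 * (y * (+ 3 * y + + 2)))
  by-residue (0 , q , _ , e) = inj₁ (q , trans e (l₀ q))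
  by-residue (1 , q , _ , e) = inj₂ (q , trans (cong (λ v → v * v) e) (l₁ q))
  by-residue (2 , q , _ , e) = inj₂ (- (q + 1ℤ) , trans (cong (λ v → v * v) e) (l₂ q))
  by-residue (suc (suc (suc _)) , _ , s≤s (s≤s (s≤s ())) , _)

mod-3-odd : ∀ v → Odd v → (∃[ w ] v ≡ + 3 * w) ⊎ (∃[ y ] v * v ≡ 1ℤ + + 12 * (y * (+ 3 * y + 1ℤ)))
mod-3-odd v (h , refl) = by-residue (division 3 h)
  where
  l₀ : ∀ q → (1ℤ + + 2 * (0ℤ + q * + 3)) * (1ℤ + + 2 * (0ℤ + q * + 3)) ≡ 1ℤ + + 12 * (q * (+ 3 * q + 1ℤ))
  l₀ = solve-∀
  l₁ : ∀ q → 1ℤ + + 2 * (1ℤ + q * + 3) ≡ + 3 * (1ℤ + + 2 * q)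
  l₁ = solve-∀
  l₂ : ∀ q → (1ℤ + + 2 * (+ 2 + q * + 3)) * (1ℤ + + 2 * (+ 2 + q * + 3)) ≡ 1ℤ + + 12 * (- (q + 1ℤ) * (+ 3 * - (q + 1ℤ) + 1ℤ))
  l₂ = solve-∀
  by-residue : ∃[ r ] ∃[ q ] r ℕ.< 3 × h ≡ + r + q * + 3 →
    (∃[ w ] v ≡ + 3 * w) ⊎ (∃[ y ] v * v ≡ 1ℤ + + 12 * (y * (+ 3 * y + 1ℤ)))
  by-residue (0 , q , _ , refl) = inj₂ (q , l₀ q)
  by-residue (1 , q , _ , refl) = inj₁ (1ℤ + + 2 * q , l₁ q)
  by-residue (2 , q , _ , refl) = inj₂ (- (q + 1ℤ) , l₂ q)
  by-residue (suc (suc (suc _)) , _ , s≤s (s≤s (s≤s ())) , _)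

data Mod5 (v : ℤ) : Set where
  zero₅ : ∀ w → v ≡ + 5 * w → Mod5 v
  one₅  : ∀ y → v * v ≡ 1ℤ + + 20 * (y * (+ 5 * y + 1ℤ)) → Mod5 v
  four₅ : ∀ y → v * v ≡ + 9 + + 20 * (y * (+ 5 * y + + 3)) → Mod5 v

mod-5-odd : ∀ v → Odd v → Mod5 v
mod-5-odd v (h , refl) = by-residue (division 5 h)
  where
  l₀ : ∀ q → (1ℤ + + 2 * (0ℤ + q * + 5)) * (1ℤ + + 2 * (0ℤ + q * + 5)) ≡ 1ℤ + + 20 * (q * (+ 5 * q + 1ℤ))
  l₀ = solve-∀
  l₁ : ∀ q → (1ℤ + + 2 * (1ℤ + q * + 5)) * (1ℤ + + 2 * (1ℤ + q * + 5)) ≡ + 9 + + 20 * (q * (+ 5 * q + + 3))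
  l₁ = solve-∀
  l₂ : ∀ q → 1ℤ + + 2 * (+ 2 + q * + 5) ≡ + 5 * (1ℤ + + 2 * q)
  l₂ = solve-∀
  l₃ : ∀ q → (1ℤ + + 2 * (+ 3 + q * + 5)) * (1ℤ + + 2 * (+ 3 + q * + 5)) ≡ + 9 + + 20 * (- (q + 1ℤ) * (+ 5 * - (q + 1ℤ) + + 3))
  l₃ = solve-∀
  l₄ : ∀ q → (1ℤ + + 2 * (+ 4 + q * + 5)) * (1ℤ + + 2 * (+ 4 + q * + 5)) ≡ 1ℤ + + 20 * (- (q + 1ℤ) * (+ 5 * - (q + 1ℤ) + 1ℤ))
  l₄ = solve-∀
  by-residue : ∃[ r ] ∃[ q ] r ℕ.< 5 × h ≡ + r + q * + 5 → Mod5 v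
  by-residue (0 , q , _ , refl) = one₅ q (l₀ q)
  by-residue (1 , q , _ , refl) = four₅ q (l₁ q)
  by-residue (2 , q , _ , refl) = zero₅ (1ℤ + + 2 * q) (l₂ q)
  by-residue (3 , q , _ , refl) = four₅ (- (q + 1ℤ)) (l₃ q)
  by-residue (4 , q , _ , refl) = one₅ (- (q + 1ℤ)) (l₄ q)
  by-residue (suc (suc (suc (suc (suc _)))) , _ , s≤s (s≤s (s≤s (s≤s (s≤s ())))) , _)

cancel-* : ∀ n {x y} .{{_ : ℤ.NonZero (+ n)}} → + n * x ≡ + n * y → x ≡ y
cancel-* n {x} {y} = ℤₚ.*-cancelˡ-≡ (+ n) x y

pronic-align : ∀ p q → ∃[ q′ ] pronic q′ ≡ pronic q × Even (p - q′)
pronic-align p q = by-parity (parity (p - q))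
  where
  by-parity : Even (p - q) ⊎ Odd (p - q) → ∃[ q′ ] pronic q′ ≡ pronic q × Even (p - q′)
  by-parity (inj₁ ev)       = q , refl , ev
  by-parity (inj₂ (h , h≡)) = - (q + 1ℤ) , reflect q , q + 1ℤ + h , trans (shift p q) (trans (cong (λ d → d + + 2 * q + 1ℤ) h≡) (collect q h))
    where
    reflect : ∀ q → - (q + 1ℤ) * - (q + 1ℤ) + - (q + 1ℤ) ≡ q * q + q
    reflect = solve-∀
    shift : ∀ p q → p - - (q + 1ℤ) ≡ p - q + + 2 * q + 1ℤ
    shift = solve-∀
    collect : ∀ q h → 1ℤ + + 2 * h + + 2 * q + 1ℤ ≡ + 2 * (q + 1ℤ + h)
    collect = solve-∀

bit : ∀ {x} → Even x ⊎ Odd x → ℕ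
bit (inj₁ _) = 0
bit (inj₂ _) = 1

bit≤1 : ∀ {x} (p : Even x ⊎ Odd x) → bit p ℕ.≤ 1
bit≤1 (inj₁ _) = z≤n
bit≤1 (inj₂ _) = s≤s z≤n

square-bit : ∀ {x} (p : Even x ⊎ Odd x) → x * x ≈ + bit p mod 4
square-bit (inj₁ (h , refl)) = multiple (h * h) (lemma h)
  where
  lemma : ∀ h → + 2 * h * (+ 2 * h) ≡ 0ℤ + h * h * + 4
  lemma = solve-∀
square-bit (inj₂ (h , refl)) = multiple (h * h + h) (lemma h)
  where
  lemma : ∀ h → (1ℤ + + 2 * h) * (1ℤ + + 2 * h) ≡ 1ℤ + (h * h + h) * + 4
  lemma = solve-∀

count-odd : ∀ {A B C M} r → r ℕ.< 4 → A * A + B * B + C * C ≡ + r + + 4 * M →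
            (p : Even A ⊎ Odd A) (q : Even B ⊎ Odd B) (s : Even C ⊎ Odd C) → bit p ℕ.+ bit q ℕ.+ bit s ≡ r
count-odd {M = M} r r<4 e p q s = rem-unique (s≤s (ℕₚ.+-mono-≤ (ℕₚ.+-mono-≤ (bit≤1 p) (bit≤1 q)) (bit≤1 s))) r<4
  (≈-trans (≈-sym (≈-+ (≈-+ (square-bit p) (square-bit q)) (square-bit s))) (multiple M (trans e (cong (λ z → + r + z) (ℤₚ.*-comm (+ 4) M)))))

SumOf₃ : ℤ → Set
SumOf₃ m = ∃[ A ] ∃[ B ] ∃[ C ] A * A + B * B + C * C ≡ m

all-even : ∀ {m} → SumOf₃ (+ 4 * m) → SumOf₃ m
all-even {m} (A , B , C , e) = choose (parity A) (parity B) (parity C) (count-odd {A} {B} {C} {m} 0 (s≤s z≤n) (trans e (sym (ℤₚ.+-identityˡ (+ 4 * m)))) (parity A) (parity B) (parity C))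
  where
  choose : (p : Even A ⊎ Odd A) (q : Even B ⊎ Odd B) (s : Even C ⊎ Odd C) → bit p ℕ.+ bit q ℕ.+ bit s ≡ 0 → SumOf₃ m
  choose (inj₁ (a , a≡)) (inj₁ (b , b≡)) (inj₁ (c , c≡)) _ = a , b , c , cancel-* 4 (trans (lemma a b c)
    (trans (cong₂ _+_ (cong₂ _+_ (cong (λ x → x * x) (sym a≡)) (cong (λ x → x * x) (sym b≡))) (cong (λ x → x * x) (sym c≡))) e))
    where
    lemma : ∀ a b c → + 4 * (a * a + b * b + c * c) ≡ + 2 * a * (+ 2 * a) + + 2 * b * (+ 2 * b) + + 2 * c * (+ 2 * c)
    lemma = solve-∀
  choose (inj₂ _) _        _        ()
  choose (inj₁ _) (inj₂ _) _        ()
  choose (inj₁ _) (inj₁ _) (inj₂ _) ()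

three-odd : ∀ {M} → SumOf₃ (+ 3 + + 4 * M) → ∃[ p ] ∃[ q ] ∃[ r ] pronic p + pronic q + pronic r ≡ M
three-odd {M} (A , B , C , e) = choose (parity A) (parity B) (parity C) (count-odd {A} {B} {C} {M} 3 ℕₚ.≤-refl e (parity A) (parity B) (parity C))
  where
  choose : (p : Even A ⊎ Odd A) (q : Even B ⊎ Odd B) (s : Even C ⊎ Odd C) → bit p ℕ.+ bit q ℕ.+ bit s ≡ 3 →
           ∃[ p ] ∃[ q ] ∃[ r ] pronic p + pronic q + pronic r ≡ M
  choose (inj₂ (p , p≡)) (inj₂ (q , q≡)) (inj₂ (r , r≡)) _ = p , q , r , cancel-* 4 (+-cancelˡ (+ 3) (trans (lemma p q r)
    (trans (cong₂ _+_ (cong₂ _+_ (cong (λ x → x * x) (sym p≡)) (cong (λ x → x * x) (sym q≡))) (cong (λ x → x * x) (sym r≡))) e)))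
    where
    lemma : ∀ p q r → + 3 + + 4 * (p * p + p + (q * q + q) + (r * r + r))
      ≡ (1ℤ + + 2 * p) * (1ℤ + + 2 * p) + (1ℤ + + 2 * q) * (1ℤ + + 2 * q) + (1ℤ + + 2 * r) * (1ℤ + + 2 * r)
    lemma = solve-∀
  choose (inj₁ _) (inj₁ _) (inj₁ _) ()
  choose (inj₁ _) (inj₁ _) (inj₂ _) ()
  choose (inj₁ _) (inj₂ _) (inj₁ _) ()
  choose (inj₁ _) (inj₂ _) (inj₂ _) ()
  choose (inj₂ _) (inj₁ _) (inj₁ _) ()
  choose (inj₂ _) (inj₁ _) (inj₂ _) ()
  choose (inj₂ _) (inj₂ _) (inj₁ _) ()

one-odd : ∀ {M} → SumOf₃ (1ℤ + + 4 * M) → ∃[ p ] ∃[ b ] ∃[ c ] pronic p + b * b + c * c ≡ M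
one-odd {M} (A , B , C , e) = choose (parity A) (parity B) (parity C) (count-odd {A} {B} {C} {M} 1 (s≤s (s≤s z≤n)) e (parity A) (parity B) (parity C))
  where
  lemma : ∀ p b c → 1ℤ + + 4 * (p * p + p + b * b + c * c) ≡ (1ℤ + + 2 * p) * (1ℤ + + 2 * p) + + 2 * b * (+ 2 * b) + + 2 * c * (+ 2 * c)
  lemma = solve-∀
  rotated : ∀ x y z → x + y + z ≡ y + z + x
  rotated = solve-∀
  build : ∀ {A B C} → A * A + B * B + C * C ≡ 1ℤ + + 4 * M → Odd A → Even B → Even C → ∃[ p ] ∃[ b ] ∃[ c ] pronic p + b * b + c * c ≡ M
  build e (p , p≡) (b , b≡) (c , c≡) = p , b , c , cancel-* 4 (+-cancelˡ 1ℤ (trans (lemma p b c)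
    (trans (cong₂ _+_ (cong₂ _+_ (cong (λ x → x * x) (sym p≡)) (cong (λ x → x * x) (sym b≡))) (cong (λ x → x * x) (sym c≡))) e)))
  choose : (p : Even A ⊎ Odd A) (q : Even B ⊎ Odd B) (s : Even C ⊎ Odd C) → bit p ℕ.+ bit q ℕ.+ bit s ≡ 1 →
           ∃[ p ] ∃[ b ] ∃[ c ] pronic p + b * b + c * c ≡ M
  choose (inj₂ p) (inj₁ q) (inj₁ s) _ = build {A} {B} {C} e p q s
  choose (inj₁ p) (inj₂ q) (inj₁ s) _ = build {B} {C} {A} (trans (sym (rotated (A * A) (B * B) (C * C))) e) q s p
  choose (inj₁ p) (inj₁ q) (inj₂ s) _ = build {C} {A} {B} (trans (rotated (C * C) (A * A) (B * B)) e) s p q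
  choose (inj₁ _) (inj₁ _) (inj₁ _) ()
  choose (inj₁ _) (inj₂ _) (inj₂ _) ()
  choose (inj₂ _) (inj₁ _) (inj₂ _) ()
  choose (inj₂ _) (inj₂ _) (inj₁ _) ()
  choose (inj₂ _) (inj₂ _) (inj₂ _) ()

two-odd : ∀ {M} → SumOf₃ (+ 2 + + 4 * M) → ∃[ p ] ∃[ q ] ∃[ c ] pronic p + pronic q + c * c ≡ M
two-odd {M} (A , B , C , e) = choose (parity A) (parity B) (parity C) (count-odd {A} {B} {C} {M} 2 (s≤s (s≤s (s≤s z≤n))) e (parity A) (parity B) (parity C))
  where
  lemma : ∀ p q c → + 2 + + 4 * (p * p + p + (q * q + q) + c * c)
    ≡ (1ℤ + + 2 * p) * (1ℤ + + 2 * p) + (1ℤ + + 2 * q) * (1ℤ + + 2 * q) + + 2 * c * (+ 2 * c)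
  lemma = solve-∀
  rotated : ∀ x y z → x + y + z ≡ y + z + x
  rotated = solve-∀
  build : ∀ {A B C} → A * A + B * B + C * C ≡ + 2 + + 4 * M → Odd A → Odd B → Even C → ∃[ p ] ∃[ q ] ∃[ c ] pronic p + pronic q + c * c ≡ M
  build e (p , p≡) (q , q≡) (c , c≡) = p , q , c , cancel-* 4 (+-cancelˡ (+ 2) (trans (lemma p q c)
    (trans (cong₂ _+_ (cong₂ _+_ (cong (λ x → x * x) (sym p≡)) (cong (λ x → x * x) (sym q≡))) (cong (λ x → x * x) (sym c≡))) e)))
  choose : (p : Even A ⊎ Odd A) (q : Even B ⊎ Odd B) (s : Even C ⊎ Odd C) → bit p ℕ.+ bit q ℕ.+ bit s ≡ 2 →
           ∃[ p ] ∃[ q ] ∃[ c ] pronic p + pronic q + c * c ≡ M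
  choose (inj₂ p) (inj₂ q) (inj₁ s) _ = build {A} {B} {C} e p q s
  choose (inj₁ p) (inj₂ q) (inj₂ s) _ = build {B} {C} {A} (trans (sym (rotated (A * A) (B * B) (C * C))) e) q s p
  choose (inj₂ p) (inj₁ q) (inj₂ s) _ = build {C} {A} {B} (trans (rotated (C * C) (A * A) (B * B)) e) s p q
  choose (inj₁ _) (inj₁ _) (inj₁ _) ()
  choose (inj₁ _) (inj₁ _) (inj₂ _) ()
  choose (inj₁ _) (inj₂ _) (inj₁ _) ()
  choose (inj₂ _) (inj₁ _) (inj₁ _) ()
  choose (inj₂ _) (inj₂ _) (inj₂ _) ()

f₂⇒sum₃ : ∀ {m} → Represents f₂ m → SumOf₃ (+ 2 * m)
f₂⇒sum₃ (x , y , z , refl) = x + y , y + z , x + z , lemma x y z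
  where
  lemma : ∀ x y z → (x + y) * (x + y) + (y + z) * (y + z) + (x + z) * (x + z)
    ≡ + 2 * (1ℤ * (x * x) + 1ℤ * (y * y) + 1ℤ * (z * z) + 1ℤ * (y * z) + 1ℤ * (x * z) + 1ℤ * (x * y))
  lemma = solve-∀

-- Opaque, so that no witness is computed when types are compared.
opaque
  sum₃-2[8n+3] : ∀ n → ∃[ p ] ∃[ q ] ∃[ c ] pronic p + pronic q + c * c ≡ + 4 * + n + 1ℤ
  sum₃-2[8n+3] n = two-odd (subst SumOf₃ (trans (cong (+ 2 *_) (+-linear 8 3 n)) (lemma (+ n))) (f₂⇒sum₃ (represents₂-8n+3 n)))
    where
    lemma : ∀ n → + 2 * (+ 8 * n + + 3) ≡ + 2 + + 4 * (+ 4 * n + 1ℤ)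
    lemma = solve-∀

  sum₃-8n+3 : ∀ n → ∃[ p ] ∃[ q ] ∃[ r ] pronic p + pronic q + pronic r ≡ + 2 * + n
  sum₃-8n+3 n = three-odd (subst SumOf₃ (trans (+-linear 8 3 n) (lemma (+ n))) (all-even (subst SumOf₃ (regroup (+ (8 ℕ.* n ℕ.+ 3))) (f₂⇒sum₃ (represents₂-2[8n+3] n)))))
    where
    regroup : ∀ m → + 2 * (+ 2 * m) ≡ + 4 * m
    regroup = solve-∀
    lemma : ∀ n → + 8 * n + + 3 ≡ + 3 + + 4 * (+ 2 * n)
    lemma = solve-∀

  -- 8n + 5 = (2p + 1)² + 2 (2v + 1)² + 2 (2w + 1)²
  sum₃-8n+5 : ∀ n → ∃[ p ] ∃[ v ] ∃[ w ] pronic p + + 2 * pronic v + + 2 * pronic w ≡ + 2 * + n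
  sum₃-8n+5 n = split (one-odd (subst SumOf₃ (trans (+-linear 8 5 n) (lemma (+ n))) (all-even (subst SumOf₃ (regroup (+ (8 ℕ.* n ℕ.+ 5))) (f₂⇒sum₃ (represents₂-2[8n+5] n))))))
    where
    regroup : ∀ m → + 2 * (+ 2 * m) ≡ + 4 * m
    regroup = solve-∀
    lemma : ∀ n → + 8 * n + + 5 ≡ 1ℤ + + 4 * (+ 2 * n + 1ℤ)
    lemma = solve-∀
    split : ∃[ p ] ∃[ b ] ∃[ c ] pronic p + b * b + c * c ≡ + 2 * + n + 1ℤ → ∃[ p ] ∃[ v ] ∃[ w ] pronic p + + 2 * pronic v + + 2 * pronic w ≡ + 2 * + n
    split (p , b , c , e) = by-parity (parity (b + c)) (pronic-even p)
      where
      by-parity : Even (b + c) ⊎ Odd (b + c) → ∃[ y ] pronic p ≡ y * (+ 4 * y + + 2) → ∃[ p ] ∃[ v ] ∃[ w ] pronic p + + 2 * pronic v + + 2 * pronic w ≡ + 2 * + n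
      by-parity (inj₁ (h , h≡)) (y , y≡) = ⊥-elim (absurd-mod 2 1 {T = y * (+ 2 * y + 1ℤ) + + 2 * (h * h) - b * c - + n}
        (s≤s z≤n) ℕₚ.≤-refl (trans (cong₂ (λ s t → s + t * t - + 2 * (b * c)) (sym y≡) (sym h≡)) (trans (square p b c) e)) (even y h b c (+ n)))
        where
        square : ∀ p b c → p * p + p + (b + c) * (b + c) - + 2 * (b * c) ≡ p * p + p + b * b + c * c
        square = solve-∀
        even : ∀ y h b c n → + 2 * (y * (+ 2 * y + 1ℤ) + + 2 * (h * h) - b * c - n)
          ≡ y * (+ 4 * y + + 2) + + 2 * h * (+ 2 * h) - + 2 * (b * c) - (+ 2 * n + 1ℤ) + 1ℤ
        even = solve-∀
      by-parity (inj₂ (v , v≡)) _ = p , v , b - 1ℤ - v , +-cancelˡ 1ℤ (trans (halves p v b)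
        (trans (cong (λ s → pronic p + b * b + (s - b) * (s - b)) (sym v≡)) (trans (back p b c) (trans e (ℤₚ.+-comm (+ 2 * + n) 1ℤ)))))
        where
        halves : ∀ p v b → 1ℤ + (p * p + p + + 2 * (v * v + v) + + 2 * ((b - 1ℤ - v) * (b - 1ℤ - v) + (b - 1ℤ - v)))
          ≡ p * p + p + b * b + (1ℤ + + 2 * v - b) * (1ℤ + + 2 * v - b)
        halves = solve-∀
        back : ∀ p b c → p * p + p + b * b + (b + c - b) * (b + c - b) ≡ p * p + p + b * b + c * c
        back = solve-∀

universal-8-2-4-2-2-0 : Universal (+ 8) (+ 2) (+ 4) (+ 2) (+ 2) (+ 0)
universal-8-2-4-2-2-0 n = start (sum₃-2[8n+3] (n ℕ.+ n))
  where
  N : ℤ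
  N = + n + + n
  Goal : Set
  Goal = ∃[ x ] ∃[ y ] ∃[ z ] + 2 * + n ≡ x * (+ 8 * x + + 2) + y * (+ 4 * y + + 2) + z * (+ 2 * z + + 0)
  finish : ∀ f z d → pronic f + + 2 * z * (+ 2 * z) + + 2 * pronic d ≡ + 2 * N → Goal
  finish f z d e = let (Y , Y≡) = pronic-even d
                       (x , x≡) = pronic≡4w f (+ n - z * z - Y * (+ 2 * Y + 1ℤ)) (isolate f z d Y e Y≡)
                   in x , Y , z , cancel-* 2 (trans (double (+ n)) (trans (sym e) (trans (cong₂ (λ s t → s + + 2 * z * (+ 2 * z) + + 2 * t) x≡ Y≡) (collect x Y z))))
    where
    double : ∀ n → + 2 * (+ 2 * n) ≡ + 2 * (n + n)
    double = solve-∀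
    collect : ∀ x Y z → + 2 * (x * (+ 8 * x + + 2)) + + 2 * z * (+ 2 * z) + + 2 * (Y * (+ 4 * Y + + 2))
      ≡ + 2 * (x * (+ 8 * x + + 2) + Y * (+ 4 * Y + + 2) + z * (+ 2 * z + + 0))
    collect = solve-∀
    isolate : ∀ f z d Y → pronic f + + 2 * z * (+ 2 * z) + + 2 * pronic d ≡ + 2 * N → pronic d ≡ Y * (+ 4 * Y + + 2) →
              pronic f ≡ + 4 * (+ n - z * z - Y * (+ 2 * Y + 1ℤ))
    isolate f z d Y e Y≡ = trans (lemma₁ (pronic f) z (pronic d)) (trans (cong₂ (λ s t → s - + 4 * (z * z) - + 2 * t) e Y≡) (lemma₂ (+ n) z Y))
      where
      lemma₁ : ∀ P z Q → P ≡ P + + 2 * z * (+ 2 * z) + + 2 * Q - + 4 * (z * z) - + 2 * Q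
      lemma₁ = solve-∀
      lemma₂ : ∀ n z Y → + 2 * (n + n) - + 4 * (z * z) - + 2 * (Y * (+ 4 * Y + + 2)) ≡ + 4 * (n - z * z - Y * (+ 2 * Y + 1ℤ))
      lemma₂ = solve-∀
  halve : ∀ f e d → pronic f + e * e + + 2 * pronic d ≡ + 2 * N → Goal
  halve f e d eq = by-parity (parity e) (pronic-even f)
    where
    by-parity : Even e ⊎ Odd e → ∃[ y ] pronic f ≡ y * (+ 4 * y + + 2) → Goal
    by-parity (inj₁ (z , refl)) _ = finish f z d eq
    by-parity (inj₂ (h , refl)) (y , y≡) = ⊥-elim (absurd-mod 2 1 {T = y * (+ 2 * y + 1ℤ) + + 2 * (h * h + h) + pronic d - N + 1ℤ} (s≤s z≤n) ℕₚ.≤-refl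
      (trans (cong (λ s → s + (1ℤ + + 2 * h) * (1ℤ + + 2 * h) + + 2 * pronic d) (sym y≡)) eq) (lemma y h (pronic d) N))
      where
      lemma : ∀ y h D N → + 2 * (y * (+ 2 * y + 1ℤ) + + 2 * (h * h + h) + D - N + 1ℤ)
        ≡ y * (+ 4 * y + + 2) + (1ℤ + + 2 * h) * (1ℤ + + 2 * h) + + 2 * D - + 2 * N + 1ℤ
      lemma = solve-∀
  combine : ∀ p q d → pronic p + pronic q + + 4 * pronic d ≡ + 4 * N → Goal
  combine p q d eq = let (q′ , q′≡ , e , e≡) = pronic-align p q in halve (q′ + e) e d (cancel-* 2 (trans (expand q′ e (pronic d))
    (trans (cong₂ (λ s t → s * s + s + t + + 4 * pronic d) (trans (cong (λ t → q′ + t) (sym e≡)) (back p q′)) q′≡) (trans eq (regroup N)))))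
    where
    expand : ∀ q e D → + 2 * ((q + e) * (q + e) + (q + e) + e * e + + 2 * D) ≡ (q + + 2 * e) * (q + + 2 * e) + (q + + 2 * e) + (q * q + q) + + 4 * D
    expand = solve-∀
    back : ∀ p q → q + (p - q) ≡ p
    back = solve-∀
    regroup : ∀ N → + 4 * N ≡ + 2 * (+ 2 * N)
    regroup = solve-∀
  start : ∃[ p ] ∃[ q ] ∃[ c ] pronic p + pronic q + c * c ≡ + 4 * N + 1ℤ → Goal
  start (p , q , c , eq) = by-parity (parity c) (pronic-even p) (pronic-even q)
    where
    by-parity : Even c ⊎ Odd c → ∃[ y ] pronic p ≡ y * (+ 4 * y + + 2) → ∃[ y ] pronic q ≡ y * (+ 4 * y + + 2) → Goal
    by-parity (inj₂ (d , refl)) _ _ = combine p q d (+-cancelˡ 1ℤ (trans (lemma (pronic p) (pronic q) d) (trans eq (ℤₚ.+-comm (+ 4 * N) 1ℤ))))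
      where
      lemma : ∀ P Q d → 1ℤ + (P + Q + + 4 * (d * d + d)) ≡ P + Q + (1ℤ + + 2 * d) * (1ℤ + + 2 * d)
      lemma = solve-∀
    by-parity (inj₁ (h , refl)) (y , y≡) (z , z≡) = ⊥-elim (absurd-mod 2 1 {T = y * (+ 2 * y + 1ℤ) + z * (+ 2 * z + 1ℤ) + + 2 * (h * h) - + 2 * N}
      (s≤s z≤n) ℕₚ.≤-refl (trans (cong₂ (λ s t → s + t + + 2 * h * (+ 2 * h)) (sym y≡) (sym z≡)) eq) (lemma y z h N))
      where
      lemma : ∀ y z h N → + 2 * (y * (+ 2 * y + 1ℤ) + z * (+ 2 * z + 1ℤ) + + 2 * (h * h) - + 2 * N)
        ≡ y * (+ 4 * y + + 2) + z * (+ 4 * z + + 2) + + 2 * h * (+ 2 * h) - (+ 4 * N + 1ℤ) + 1ℤ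
      lemma = solve-∀

-- Among three odd squares two are congruent modulo 16.
congruent-pair : ∀ p q r → ∃[ p′ ] ∃[ y ] ∃[ s ] pronic p + pronic q + pronic r ≡ pronic p′ + + 2 * (y * (+ 4 * y + + 2)) + + 8 * (s * s)
congruent-pair p q r = choose (pronic-mod-4 p) (pronic-mod-4 q) (pronic-mod-4 r)
  where
  Class : ℤ → Set
  Class u = (∃[ x ] pronic u ≡ + 2 * (x * (+ 8 * x + + 2))) ⊎ (∃[ x ] pronic u ≡ + 2 * (x * (+ 8 * x + + 6)) + + 2)
  Goal : Set
  Goal = ∃[ p′ ] ∃[ y ] ∃[ s ] pronic p + pronic q + pronic r ≡ pronic p′ + + 2 * (y * (+ 4 * y + + 2)) + + 8 * (s * s)
  pair₀ : ∀ {q r} x x′ → pronic q ≡ + 2 * (x * (+ 8 * x + + 2)) → pronic r ≡ + 2 * (x′ * (+ 8 * x′ + + 2)) →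
          ∃[ y ] ∃[ s ] pronic q + pronic r ≡ + 2 * (y * (+ 4 * y + + 2)) + + 8 * (s * s)
  pair₀ x x′ e e′ = x + x′ , x - x′ , trans (cong₂ _+_ e e′) (lemma x x′)
    where
    lemma : ∀ x x′ → + 2 * (x * (+ 8 * x + + 2)) + + 2 * (x′ * (+ 8 * x′ + + 2))
      ≡ + 2 * ((x + x′) * (+ 4 * (x + x′) + + 2)) + + 8 * ((x - x′) * (x - x′))
    lemma = solve-∀
  pair₁ : ∀ {q r} x x′ → pronic q ≡ + 2 * (x * (+ 8 * x + + 6)) + + 2 → pronic r ≡ + 2 * (x′ * (+ 8 * x′ + + 6)) + + 2 →
          ∃[ y ] ∃[ s ] pronic q + pronic r ≡ + 2 * (y * (+ 4 * y + + 2)) + + 8 * (s * s)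
  pair₁ x x′ e e′ = - (x + x′ + 1ℤ) , x - x′ , trans (cong₂ _+_ e e′) (lemma x x′)
    where
    lemma : ∀ x x′ → + 2 * (x * (+ 8 * x + + 6)) + + 2 + (+ 2 * (x′ * (+ 8 * x′ + + 6)) + + 2)
      ≡ + 2 * (- (x + x′ + 1ℤ) * (+ 4 * - (x + x′ + 1ℤ) + + 2)) + + 8 * ((x - x′) * (x - x′))
    lemma = solve-∀
  swap₁ : ∀ x y z → x + y + z ≡ x + (y + z)
  swap₁ = solve-∀
  swap₂ : ∀ x y z → x + y + z ≡ y + (x + z)
  swap₂ = solve-∀
  swap₃ : ∀ x y z → x + y + z ≡ z + (x + y)
  swap₃ = solve-∀
  place : ∀ {p′ w} → pronic p + pronic q + pronic r ≡ pronic p′ + w → (∃[ y ] ∃[ s ] w ≡ + 2 * (y * (+ 4 * y + + 2)) + + 8 * (s * s)) → Goal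
  place {p′} e (y , s , w≡) = p′ , y , s , trans e (trans (cong (λ w → pronic p′ + w) w≡) (sym (ℤₚ.+-assoc (pronic p′) _ _)))
  choose : Class p → Class q → Class r → Goal
  choose _ (inj₁ (x , e)) (inj₁ (x′ , e′)) = place {p} (swap₁ (pronic p) (pronic q) (pronic r)) (pair₀ {q} {r} x x′ e e′)
  choose _ (inj₂ (x , e)) (inj₂ (x′ , e′)) = place {p} (swap₁ (pronic p) (pronic q) (pronic r)) (pair₁ {q} {r} x x′ e e′)
  choose (inj₁ (x , e)) _ (inj₁ (x′ , e′)) = place {q} (swap₂ (pronic p) (pronic q) (pronic r)) (pair₀ {p} {r} x x′ e e′)
  choose (inj₂ (x , e)) _ (inj₂ (x′ , e′)) = place {q} (swap₂ (pronic p) (pronic q) (pronic r)) (pair₁ {p} {r} x x′ e e′)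
  choose (inj₁ (x , e)) (inj₁ (x′ , e′)) _ = place {r} (swap₃ (pronic p) (pronic q) (pronic r)) (pair₀ {p} {q} x x′ e e′)
  choose (inj₂ (x , e)) (inj₂ (x′ , e′)) _ = place {r} (swap₃ (pronic p) (pronic q) (pronic r)) (pair₁ {p} {q} x x′ e e′)

opaque
  sum₃-congruent : ∀ n → ∃[ p ] ∃[ y ] ∃[ s ] pronic p + + 2 * (y * (+ 4 * y + + 2)) + + 8 * (s * s) ≡ + 2 * + n
  sum₃-congruent n = let (p , q , r , e) = sum₃-8n+3 n
                         (p′ , y , s , e′) = congruent-pair p q r
                     in p′ , y , s , trans (sym e′) e

universal-8-2-4-2-4-0 : Universal (+ 8) (+ 2) (+ 4) (+ 2) (+ 4) (+ 0)
universal-8-2-4-2-4-0 n =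
  let (p , y , s , e) = sum₃-congruent (n ℕ.+ n)
      (x , x≡) = pronic≡4w p (+ n - y * (+ 2 * y + 1ℤ) - + 2 * (s * s)) (trans (lemma₁ (pronic p) y s)
        (trans (cong (λ t → t - + 2 * (y * (+ 4 * y + + 2)) - + 8 * (s * s)) e) (lemma₂ (+ n) y s)))
  in x , y , s , cancel-* 2 (trans (lemma₃ (+ n)) (trans (sym e) (trans (cong (λ t → t + + 2 * (y * (+ 4 * y + + 2)) + + 8 * (s * s)) x≡) (lemma₄ x y s))))
  where
  lemma₁ : ∀ P y s → P ≡ P + + 2 * (y * (+ 4 * y + + 2)) + + 8 * (s * s) - + 2 * (y * (+ 4 * y + + 2)) - + 8 * (s * s)
  lemma₁ = solve-∀
  lemma₂ : ∀ n y s → + 2 * (n + n) - + 2 * (y * (+ 4 * y + + 2)) - + 8 * (s * s) ≡ + 4 * (n - y * (+ 2 * y + 1ℤ) - + 2 * (s * s))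
  lemma₂ = solve-∀
  lemma₃ : ∀ n → + 2 * (+ 2 * n) ≡ + 2 * (n + n)
  lemma₃ = solve-∀
  lemma₄ : ∀ x y s → + 2 * (x * (+ 8 * x + + 2)) + + 2 * (y * (+ 4 * y + + 2)) + + 8 * (s * s)
    ≡ + 2 * (x * (+ 8 * x + + 2) + y * (+ 4 * y + + 2) + s * (+ 4 * s + + 0))
  lemma₄ = solve-∀

universal-8-6-4-2-4-0 : Universal (+ 8) (+ 6) (+ 4) (+ 2) (+ 4) (+ 0)
universal-8-6-4-2-4-0 n =
  let (p , y , s , e) = sum₃-congruent (suc (n ℕ.+ n))
      (x , x≡) = pronic≡4w+2 p (+ n - y * (+ 2 * y + 1ℤ) - + 2 * (s * s)) (trans (lemma₁ (pronic p) y s)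
        (trans (cong (λ t → t - + 2 * (y * (+ 4 * y + + 2)) - + 8 * (s * s)) e) (lemma₂ (+ n) y s)))
  in x , y , s , cancel-* 2 (+-cancelˡ (+ 2) (trans (lemma₃ (+ n)) (trans (sym e) (trans (cong (λ t → t + + 2 * (y * (+ 4 * y + + 2)) + + 8 * (s * s)) x≡) (lemma₄ x y s)))))
  where
  lemma₁ : ∀ P y s → P ≡ P + + 2 * (y * (+ 4 * y + + 2)) + + 8 * (s * s) - + 2 * (y * (+ 4 * y + + 2)) - + 8 * (s * s)
  lemma₁ = solve-∀
  lemma₂ : ∀ n y s → + 2 * (1ℤ + (n + n)) - + 2 * (y * (+ 4 * y + + 2)) - + 8 * (s * s) ≡ + 4 * (n - y * (+ 2 * y + 1ℤ) - + 2 * (s * s)) + + 2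
  lemma₂ = solve-∀
  lemma₃ : ∀ n → + 2 + + 2 * (+ 2 * n) ≡ + 2 * (1ℤ + (n + n))
  lemma₃ = solve-∀
  lemma₄ : ∀ x y s → + 2 * (x * (+ 8 * x + + 6)) + + 2 + + 2 * (y * (+ 4 * y + + 2)) + + 8 * (s * s)
    ≡ + 2 + + 2 * (x * (+ 8 * x + + 6) + y * (+ 4 * y + + 2) + s * (+ 4 * s + + 0))
  lemma₄ = solve-∀

universal-8-6-4-2-4-2 : Universal (+ 8) (+ 6) (+ 4) (+ 2) (+ 4) (+ 2)
universal-8-6-4-2-4-2 n =
  let (p , v , w , e) = sum₃-8n+5 (suc (n ℕ.+ n))
      (y , y≡) = pronic-even v
      (z , z≡) = pronic-even w
      (x , x≡) = pronic≡4w+2 p (+ n - y * (+ 2 * y + 1ℤ) - z * (+ 2 * z + 1ℤ)) (trans (lemma₁ (pronic p) (pronic v) (pronic w))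
        (trans (cong₂ (λ t s → t - s) e (cong₂ (λ a b → + 2 * a + + 2 * b) y≡ z≡)) (lemma₂ (+ n) y z)))
  in x , y , z , cancel-* 2 (+-cancelˡ (+ 2) (trans (lemma₃ (+ n)) (trans (sym e)
       (trans (cong₂ _+_ (cong₂ (λ a b → a + + 2 * b) x≡ y≡) (cong (+ 2 *_) z≡)) (lemma₄ x y z)))))
  where
  lemma₁ : ∀ P V W → P ≡ P + + 2 * V + + 2 * W - (+ 2 * V + + 2 * W)
  lemma₁ = solve-∀
  lemma₂ : ∀ n y z → + 2 * (1ℤ + (n + n)) - (+ 2 * (y * (+ 4 * y + + 2)) + + 2 * (z * (+ 4 * z + + 2)))
    ≡ + 4 * (n - y * (+ 2 * y + 1ℤ) - z * (+ 2 * z + 1ℤ)) + + 2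
  lemma₂ = solve-∀
  lemma₃ : ∀ n → + 2 + + 2 * (+ 2 * n) ≡ + 2 * (1ℤ + (n + n))
  lemma₃ = solve-∀
  lemma₄ : ∀ x y z → + 2 * (x * (+ 8 * x + + 6)) + + 2 + + 2 * (y * (+ 4 * y + + 2)) + + 2 * (z * (+ 4 * z + + 2))
    ≡ + 2 + + 2 * (x * (+ 8 * x + + 6) + y * (+ 4 * y + + 2) + z * (+ 4 * z + + 2))
  lemma₄ = solve-∀

Div5 : ℤ → Set
Div5 v = ∃[ w ] v ≡ + 5 * w

-- If 5 divides y and z then (y² + z²) / 25 is rotated by one of the Gaussian integers 3 ± 4i.
not-both-div5 : ∀ k y z → ∣ y ∣ ℕ.≤ k → Odd y → Odd z →
  ∃[ y′ ] ∃[ z′ ] Odd y′ × Odd z′ × y′ * y′ + z′ * z′ ≡ y * y + z * z × ¬ (Div5 y′ × Div5 z′)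
not-both-div5 k y z le oy oz = by-class (div5? y oy) (div5? z oz)
  where
  Goal : Set
  Goal = ∃[ y′ ] ∃[ z′ ] Odd y′ × Odd z′ × y′ * y′ + z′ * z′ ≡ y * y + z * z × ¬ (Div5 y′ × Div5 z′)
  div5? : ∀ v → Odd v → Dec (Div5 v)
  div5? v ov = from-class (mod-5-odd v ov)
    where
    not-one : ∀ y w → + 5 * (+ 5 * (w * w) - + 4 * (y * (+ 5 * y + 1ℤ))) ≡ + 5 * w * (+ 5 * w) - (1ℤ + + 20 * (y * (+ 5 * y + 1ℤ))) + 1ℤ
    not-one = solve-∀
    not-four : ∀ y w → + 5 * (+ 5 * (w * w) - + 4 * (y * (+ 5 * y + + 3)) - 1ℤ) ≡ + 5 * w * (+ 5 * w) - (+ 9 + + 20 * (y * (+ 5 * y + + 3))) + + 4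
    not-four = solve-∀
    from-class : Mod5 v → Dec (Div5 v)
    from-class (zero₅ w e) = yes (w , e)
    from-class (one₅ y e)  = no λ (w , w≡) → absurd-mod 5 1 (s≤s z≤n) (s≤s (s≤s z≤n)) (trans (cong (λ v → v * v) (sym w≡)) e) (not-one y w)
    from-class (four₅ y e) = no λ (w , w≡) → absurd-mod 5 4 (s≤s z≤n) (s≤s (s≤s (s≤s (s≤s (s≤s z≤n))))) (trans (cong (λ v → v * v) (sym w≡)) e) (not-four y w)
  odd-factor : ∀ {v} w → Odd v → v ≡ + 5 * w → Odd w
  odd-factor w (h , h≡) w≡ = by-parity (parity w)
    where
    lemma : ∀ g h → + 2 * (+ 5 * g - h) ≡ + 5 * (+ 2 * g) - (1ℤ + + 2 * h) + 1ℤ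
    lemma = solve-∀
    by-parity : Even w ⊎ Odd w → Odd w
    by-parity (inj₂ o)       = o
    by-parity (inj₁ (g , g≡)) = ⊥-elim (absurd-mod 2 1 (s≤s z≤n) ℕₚ.≤-refl (trans (cong (+ 5 *_) (sym g≡)) (trans (sym w≡) h≡)) (lemma g h))
  combine-odd : ∀ {a b} m n → Odd a → (m ≡ + 3 ⊎ m ≡ - + 3) → + 4 * n ≡ b → Odd (m * a + b)
  combine-odd {b = b} m n (h , refl) (inj₁ refl) refl = 1ℤ + + 3 * h + + 2 * n , lemma h n
    where
    lemma : ∀ h n → + 3 * (1ℤ + + 2 * h) + + 4 * n ≡ 1ℤ + + 2 * (1ℤ + + 3 * h + + 2 * n)
    lemma = solve-∀
  combine-odd {b = b} m n (h , refl) (inj₂ refl) refl = - + 2 - + 3 * h + + 2 * n , lemma h n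
    where
    lemma : ∀ h n → - + 3 * (1ℤ + + 2 * h) + + 4 * n ≡ 1ℤ + + 2 * (- + 2 - + 3 * h + + 2 * n)
    lemma = solve-∀
  by-class : Dec (Div5 y) → Dec (Div5 z) → Goal
  by-class (no y≢) _       = y , z , oy , oz , refl , λ (dy , _) → y≢ dy
  by-class _       (no z≢) = y , z , oy , oz , refl , λ (_ , dz) → z≢ dz
  by-class (yes (y₁ , y≡)) (yes (z₁ , z≡)) = descend k le
    where
    oy₁ : Odd y₁
    oy₁ = odd-factor y₁ oy y≡
    nonzero : ∣ y₁ ∣ ≢ 0
    nonzero e = absurd-mod 2 1 {T = - proj₁ oy₁} (s≤s z≤n) ℕₚ.≤-refl (trans (sym (ℤₚ.∣i∣≡0⇒i≡0 {y₁} e)) (proj₂ oy₁)) (lemma (proj₁ oy₁))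
      where
      lemma : ∀ h → + 2 * - h ≡ 0ℤ - (1ℤ + + 2 * h) + 1ℤ
      lemma = solve-∀
    smaller : ∣ y₁ ∣ ℕ.< ∣ y ∣
    smaller = subst (∣ y₁ ∣ ℕ.<_) (sym (trans (cong ∣_∣ y≡) (trans (ℤₚ.abs-* (+ 5) y₁) (ℕₚ.*-comm 5 ∣ y₁ ∣))))
      (ℕₚ.m<m*n ∣ y₁ ∣ 5 {{ℕ.≢-nonZero nonzero}} (s≤s (s≤s z≤n)))
    descend : ∀ k → ∣ y ∣ ℕ.≤ k → Goal
    descend zero    le = ⊥-elim (ℕₚ.n≮0 (ℕₚ.<-≤-trans smaller le))
    descend (suc k) le = rotate-by (not-both-div5 k y₁ z₁ (ℕₚ.≤-pred (ℕₚ.<-≤-trans smaller le)) oy₁ (odd-factor z₁ oz z≡))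
      where
      rotate-by : ∃[ u ] ∃[ v ] Odd u × Odd v × u * u + v * v ≡ y₁ * y₁ + z₁ * z₁ × ¬ (Div5 u × Div5 v) → Goal
      rotate-by (u , v , ou , ov , norm , ndiv) = choose (div5? a oa) (div5? b ob) (div5? c oc) (div5? d od)
        where
        a b c d : ℤ
        a = + 3 * u + + 4 * v
        b = - + 3 * v + + 4 * u
        c = + 3 * u + + 4 * - v
        d = + 3 * v + + 4 * u
        oa : Odd a
        oa = combine-odd (+ 3) v ou (inj₁ refl) refl
        ob : Odd b
        ob = combine-odd (- + 3) u ov (inj₂ refl) refl
        oc : Odd c
        oc = combine-odd (+ 3) (- v) ou (inj₁ refl) refl
        od : Odd d
        od = combine-odd (+ 3) u ov (inj₁ refl) refl
        norm′ : + 25 * (u * u + v * v) ≡ y * y + z * z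
        norm′ = trans (cong (+ 25 *_) norm) (trans (lemma y₁ z₁) (cong₂ (λ s t → s * s + t * t) (sym y≡) (sym z≡)))
          where
          lemma : ∀ y z → + 25 * (y * y + z * z) ≡ + 5 * y * (+ 5 * y) + + 5 * z * (+ 5 * z)
          lemma = solve-∀
        norm-ab : ∀ u v → (+ 3 * u + + 4 * v) * (+ 3 * u + + 4 * v) + (- + 3 * v + + 4 * u) * (- + 3 * v + + 4 * u) ≡ + 25 * (u * u + v * v)
        norm-ab = solve-∀
        norm-cd : ∀ u v → (+ 3 * u + + 4 * - v) * (+ 3 * u + + 4 * - v) + (+ 3 * v + + 4 * u) * (+ 3 * v + + 4 * u) ≡ + 25 * (u * u + v * v)
        norm-cd = solve-∀
        choose : Dec (Div5 a) → Dec (Div5 b) → Dec (Div5 c) → Dec (Div5 d) → Goal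
        choose (no na) _ _ _ = a , b , oa , ob , trans (norm-ab u v) norm′ , λ (da , _) → na da
        choose _ (no nb) _ _ = a , b , oa , ob , trans (norm-ab u v) norm′ , λ (_ , db) → nb db
        choose _ _ (no nc) _ = c , d , oc , od , trans (norm-cd u v) norm′ , λ (dc , _) → nc dc
        choose _ _ _ (no nd) = c , d , oc , od , trans (norm-cd u v) norm′ , λ (_ , dd) → nd dd
        choose (yes (a′ , a≡)) (yes (b′ , b≡)) (yes (c′ , c≡)) (yes (d′ , d≡)) = ⊥-elim (ndiv
          ( (a′ + c′ - u , trans (lemma₁ u v) (trans (cong₂ (λ s t → s + t - + 5 * u) a≡ c≡) (lemma₂ a′ c′ u)))
          , (d′ - b′ - v , trans (lemma₃ u v) (trans (cong₂ (λ s t → s - t - + 5 * v) d≡ b≡) (lemma₄ d′ b′ v)))))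
          where
          lemma₁ : ∀ u v → u ≡ + 3 * u + + 4 * v + (+ 3 * u + + 4 * - v) - + 5 * u
          lemma₁ = solve-∀
          lemma₂ : ∀ a c u → + 5 * a + + 5 * c - + 5 * u ≡ + 5 * (a + c - u)
          lemma₂ = solve-∀
          lemma₃ : ∀ u v → v ≡ + 3 * v + + 4 * u - (- + 3 * v + + 4 * u) - + 5 * v
          lemma₃ = solve-∀
          lemma₄ : ∀ d b v → + 5 * d - + 5 * b - + 5 * v ≡ + 5 * (d - b - v)
          lemma₄ = solve-∀

opaque
  -- 5 ((2v + 1)² + (2w + 1)²) = (10y + 3)² + (10z + 1)²
  pronic-sum-5 : ∀ v w → ∃[ y ] ∃[ z ] pronic v + pronic w ≡ y * (+ 5 * y + + 3) + z * (+ 5 * z + 1ℤ)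
  pronic-sum-5 v w = build (not-both-div5 ∣ Y ∣ Y Z ℕₚ.≤-refl (1ℤ + + 2 * v + w , oddY v w) (v - 1ℤ - + 2 * w , oddZ v w))
    where
    Y Z : ℤ
    Y = + 2 * (1ℤ + + 2 * v) + (1ℤ + + 2 * w)
    Z = (1ℤ + + 2 * v) - + 2 * (1ℤ + + 2 * w)
    oddY : ∀ v w → + 2 * (1ℤ + + 2 * v) + (1ℤ + + 2 * w) ≡ 1ℤ + + 2 * (1ℤ + + 2 * v + w)
    oddY = solve-∀
    oddZ : ∀ v w → (1ℤ + + 2 * v) - + 2 * (1ℤ + + 2 * w) ≡ 1ℤ + + 2 * (v - 1ℤ - + 2 * w)
    oddZ = solve-∀
    Goal : Set
    Goal = ∃[ y ] ∃[ z ] pronic v + pronic w ≡ y * (+ 5 * y + + 3) + z * (+ 5 * z + 1ℤ)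
    expand : ∀ v w → (+ 2 * (1ℤ + + 2 * v) + (1ℤ + + 2 * w)) * (+ 2 * (1ℤ + + 2 * v) + (1ℤ + + 2 * w))
      + ((1ℤ + + 2 * v) - + 2 * (1ℤ + + 2 * w)) * ((1ℤ + + 2 * v) - + 2 * (1ℤ + + 2 * w)) ≡ + 10 + + 20 * (v * v + v + (w * w + w))
    expand = solve-∀
    conclude : ∀ {s t} y z → s ≡ + 9 + + 20 * (y * (+ 5 * y + + 3)) → t ≡ 1ℤ + + 20 * (z * (+ 5 * z + 1ℤ)) → s + t ≡ + 10 + + 20 * (pronic v + pronic w) → Goal
    conclude y z refl refl e = y , z , cancel-* 20 (+-cancelˡ (+ 10) (trans (sym e) (lemma (y * (+ 5 * y + + 3)) (z * (+ 5 * z + 1ℤ)))))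
      where
      lemma : ∀ a b → + 9 + + 20 * a + (1ℤ + + 20 * b) ≡ + 10 + + 20 * (a + b)
      lemma = solve-∀
    build : ∃[ y′ ] ∃[ z′ ] Odd y′ × Odd z′ × y′ * y′ + z′ * z′ ≡ Y * Y + Z * Z × ¬ (Div5 y′ × Div5 z′) → Goal
    build (y , z , oy , oz , norm , ndiv) = choose (mod-5-odd y oy) (mod-5-odd z oz)
      where
      total : y * y + z * z ≡ + 10 + + 20 * (pronic v + pronic w)
      total = trans norm (expand v w)
      wrong : ∀ r {s t T} → 1 ℕ.≤ r → r ℕ.< 5 → y * y ≡ s → z * z ≡ t → + 5 * T ≡ s + t - (+ 10 + + 20 * (pronic v + pronic w)) + + r → Goal
      wrong r 1≤r r<5 ey ez e = ⊥-elim (absurd-mod 5 r 1≤r r<5 (trans (cong₂ _+_ (sym ey) (sym ez)) total) e)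
      choose : Mod5 y → Mod5 z → Goal
      choose (four₅ a ea) (one₅ b eb)  = conclude a b ea eb total
      choose (one₅ a ea)  (four₅ b eb) = conclude b a eb ea (trans (ℤₚ.+-comm (z * z) (y * y)) total)
      choose (zero₅ a ea) (zero₅ b eb) = ⊥-elim (ndiv ((a , ea) , (b , eb)))
      choose (zero₅ a ea) (one₅ b eb)  = wrong 4 {T = + 5 * (a * a) + + 4 * B - 1ℤ - + 4 * P} (s≤s z≤n) (s≤s (s≤s (s≤s (s≤s (s≤s z≤n))))) (cong (λ v → v * v) ea) eb (lemma a B P)
        where
        B P : ℤ
        B = b * (+ 5 * b + 1ℤ)
        P = pronic v + pronic w
        lemma : ∀ a B P → + 5 * (+ 5 * (a * a) + + 4 * B - 1ℤ - + 4 * P) ≡ + 5 * a * (+ 5 * a) + (1ℤ + + 20 * B) - (+ 10 + + 20 * P) + + 4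
        lemma = solve-∀
      choose (zero₅ a ea) (four₅ b eb) = wrong 1 {T = + 5 * (a * a) + + 4 * B - + 4 * P} (s≤s z≤n) (s≤s (s≤s z≤n)) (cong (λ v → v * v) ea) eb (lemma a B P)
        where
        B P : ℤ
        B = b * (+ 5 * b + + 3)
        P = pronic v + pronic w
        lemma : ∀ a B P → + 5 * (+ 5 * (a * a) + + 4 * B - + 4 * P) ≡ + 5 * a * (+ 5 * a) + (+ 9 + + 20 * B) - (+ 10 + + 20 * P) + 1ℤ
        lemma = solve-∀
      choose (one₅ a ea)  (zero₅ b eb) = wrong 4 {T = + 5 * (b * b) + + 4 * B - 1ℤ - + 4 * P} (s≤s z≤n) (s≤s (s≤s (s≤s (s≤s (s≤s z≤n))))) ea (cong (λ v → v * v) eb) (lemma b B P)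
        where
        B P : ℤ
        B = a * (+ 5 * a + 1ℤ)
        P = pronic v + pronic w
        lemma : ∀ b B P → + 5 * (+ 5 * (b * b) + + 4 * B - 1ℤ - + 4 * P) ≡ 1ℤ + + 20 * B + + 5 * b * (+ 5 * b) - (+ 10 + + 20 * P) + + 4
        lemma = solve-∀
      choose (four₅ a ea) (zero₅ b eb) = wrong 1 {T = + 5 * (b * b) + + 4 * B - + 4 * P} (s≤s z≤n) (s≤s (s≤s z≤n)) ea (cong (λ v → v * v) eb) (lemma b B P)
        where
        B P : ℤ
        B = a * (+ 5 * a + + 3)
        P = pronic v + pronic w
        lemma : ∀ b B P → + 5 * (+ 5 * (b * b) + + 4 * B - + 4 * P) ≡ + 9 + + 20 * B + + 5 * b * (+ 5 * b) - (+ 10 + + 20 * P) + 1ℤ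
        lemma = solve-∀
      choose (one₅ a ea)  (one₅ b eb)  = wrong 3 {T = + 4 * A + + 4 * B - 1ℤ - + 4 * P} (s≤s z≤n) (s≤s (s≤s (s≤s (s≤s z≤n)))) ea eb (lemma A B P)
        where
        A B P : ℤ
        A = a * (+ 5 * a + 1ℤ)
        B = b * (+ 5 * b + 1ℤ)
        P = pronic v + pronic w
        lemma : ∀ A B P → + 5 * (+ 4 * A + + 4 * B - 1ℤ - + 4 * P) ≡ 1ℤ + + 20 * A + (1ℤ + + 20 * B) - (+ 10 + + 20 * P) + + 3
        lemma = solve-∀
      choose (four₅ a ea) (four₅ b eb) = wrong 2 {T = + 4 * A + + 4 * B + + 2 - + 4 * P} (s≤s z≤n) (s≤s (s≤s (s≤s z≤n))) ea eb (lemma A B P)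
        where
        A B P : ℤ
        A = a * (+ 5 * a + + 3)
        B = b * (+ 5 * b + + 3)
        P = pronic v + pronic w
        lemma : ∀ A B P → + 5 * (+ 4 * A + + 4 * B + + 2 - + 4 * P) ≡ + 9 + + 20 * A + (+ 9 + + 20 * B) - (+ 10 + + 20 * P) + + 2
        lemma = solve-∀

universal-8-2-5-3-5-1 : Universal (+ 8) (+ 2) (+ 5) (+ 3) (+ 5) (+ 1)
universal-8-2-5-3-5-1 n =
  let (p , v , w , e) = sum₃-8n+5 (n ℕ.+ n)
      (i , i≡) = pronic-even v
      (j , j≡) = pronic-even w
      (x , x≡) = pronic≡4w p (+ n - i * (+ 2 * i + 1ℤ) - j * (+ 2 * j + 1ℤ)) (trans (lemma₁ (pronic p) (pronic v) (pronic w))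
        (trans (cong₂ (λ t s → t - s) e (cong₂ (λ a b → + 2 * a + + 2 * b) i≡ j≡)) (lemma₂ (+ n) i j)))
      (y , z , yz≡) = pronic-sum-5 v w
  in x , y , z , cancel-* 2 (trans (lemma₃ (+ n)) (trans (sym e) (trans (regroup (pronic p) (pronic v) (pronic w))
       (trans (cong₂ (λ a b → a + + 2 * b) x≡ yz≡) (lemma₄ (x * (+ 8 * x + + 2)) (y * (+ 5 * y + + 3)) (z * (+ 5 * z + 1ℤ)))))))
  where
  lemma₁ : ∀ P V W → P ≡ P + + 2 * V + + 2 * W - (+ 2 * V + + 2 * W)
  lemma₁ = solve-∀
  lemma₂ : ∀ n y z → + 2 * (n + n) - (+ 2 * (y * (+ 4 * y + + 2)) + + 2 * (z * (+ 4 * z + + 2)))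
    ≡ + 4 * (n - y * (+ 2 * y + 1ℤ) - z * (+ 2 * z + 1ℤ))
  lemma₂ = solve-∀
  lemma₃ : ∀ n → + 2 * (+ 2 * n) ≡ + 2 * (n + n)
  lemma₃ = solve-∀
  regroup : ∀ P V W → P + + 2 * V + + 2 * W ≡ P + + 2 * (V + W)
  regroup = solve-∀
  lemma₄ : ∀ a b c → + 2 * a + + 2 * (b + c) ≡ + 2 * (a + b + c)
  lemma₄ = solve-∀

eisenstein-norm : ∀ x y → ∃[ A ] ∃[ B ] x * x + y * y + x * y ≡ A * A + + 3 * (B * B)
eisenstein-norm x y = by-parity (parity x) (parity y)
  where
  by-parity : Even x ⊎ Odd x → Even y ⊎ Odd y → ∃[ A ] ∃[ B ] x * x + y * y + x * y ≡ A * A + + 3 * (B * B)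
  by-parity (inj₁ (h , refl)) _ = y + h , h , lemma h y
    where
    lemma : ∀ h y → + 2 * h * (+ 2 * h) + y * y + + 2 * h * y ≡ (y + h) * (y + h) + + 3 * (h * h)
    lemma = solve-∀
  by-parity _ (inj₁ (h , refl)) = x + h , h , lemma h x
    where
    lemma : ∀ h x → x * x + + 2 * h * (+ 2 * h) + x * (+ 2 * h) ≡ (x + h) * (x + h) + + 3 * (h * h)
    lemma = solve-∀
  by-parity (inj₂ (g , refl)) (inj₂ (h , refl)) = h - g , 1ℤ + g + h , lemma g h
    where
    lemma : ∀ g h → (1ℤ + + 2 * g) * (1ℤ + + 2 * g) + (1ℤ + + 2 * h) * (1ℤ + + 2 * h) + (1ℤ + + 2 * g) * (1ℤ + + 2 * h)
      ≡ (h - g) * (h - g) + + 3 * ((1ℤ + g + h) * (1ℤ + g + h))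
    lemma = solve-∀

f₃⇒diagonal : ∀ {m} → Represents f₃ m → ∃[ A ] ∃[ B ] ∃[ C ] A * A + + 3 * (B * B) + C * C ≡ m
f₃⇒diagonal (x , y , z , refl) = let (A , B , e) = eisenstein-norm x y in A , B , z , trans (cong (_+ z * z) (sym e)) (lemma x y z)
  where
  lemma : ∀ x y z → x * x + y * y + x * y + z * z
    ≡ 1ℤ * (x * x) + 1ℤ * (y * y) + 1ℤ * (z * z) + 0ℤ * (y * z) + 0ℤ * (x * z) + 1ℤ * (x * y)
  lemma = solve-∀

bits-mod-4 : ∀ {A B C m n} r → A * A + + m * (B * B) + + n * (C * C) ≈ + r mod 4 →
             (p : Even A ⊎ Odd A) (q : Even B ⊎ Odd B) (s : Even C ⊎ Odd C) →
             (bit p ℕ.+ m ℕ.* bit q ℕ.+ n ℕ.* bit s) % 4 ≡ r % 4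
bits-mod-4 {m = m} {n} r e p q s = ≈-% (bit p ℕ.+ m ℕ.* bit q ℕ.+ n ℕ.* bit s) r
  (≈-trans (≈-reflexive (cong₂ (λ x y → + bit p + x + y) (ℤₚ.pos-* m (bit q)) (ℤₚ.pos-* n (bit s))))
    (≈-trans (≈-sym (≈-+ (≈-+ (square-bit p) (≈-*ˡ (+ m) (square-bit q))) (≈-*ˡ (+ n) (square-bit s)))) e))

opaque
  -- 2 (6n + 5) = 3 (2g + 1)² + 3 (2h + 1)² + (2b)²
  f₃-6n+5 : ∀ n → ∃[ g ] ∃[ h ] ∃[ b ] + 3 * pronic g + + 3 * pronic h + b * b ≡ + 3 * + n + 1ℤ
  f₃-6n+5 n = divide (f₃⇒diagonal (represents₃-6[6n+5] n))
    where
    N : ℤ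
    N = + n
    Goal : Set
    Goal = ∃[ g ] ∃[ h ] ∃[ b ] + 3 * pronic g + + 3 * pronic h + b * b ≡ + 3 * N + 1ℤ
    parities : ∀ a B c → + 3 * (a * a) + + 3 * (c * c) + B * B ≡ + 2 * (+ 6 * N + + 5) → Goal
    parities a B c e = choose (parity a) (parity B) (parity c)
      (bits-mod-4 {B} {a} {c} {3} {3} 2 (multiple (+ 3 * N + + 2) (trans (swap (a * a) (B * B) (c * c)) (trans e (split N)))) (parity B) (parity a) (parity c))
      where
      swap : ∀ x y z → y + + 3 * x + + 3 * z ≡ + 3 * x + + 3 * z + y
      swap = solve-∀
      split : ∀ N → + 2 * (+ 6 * N + + 5) ≡ + 2 + (+ 3 * N + + 2) * + 4
      split = solve-∀
      choose : (p : Even a ⊎ Odd a) (q : Even B ⊎ Odd B) (s : Even c ⊎ Odd c) → (bit q ℕ.+ 3 ℕ.* bit p ℕ.+ 3 ℕ.* bit s) % 4 ≡ 2 → Goal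
      choose (inj₂ (g , refl)) (inj₁ (b , refl)) (inj₂ (h , refl)) _ = g , h , b , cancel-* 4 (+-cancelˡ (+ 6) (trans (lemma g h b) (trans e (regroup N))))
        where
        lemma : ∀ g h b → + 6 + + 4 * (+ 3 * (g * g + g) + + 3 * (h * h + h) + b * b)
          ≡ + 3 * ((1ℤ + + 2 * g) * (1ℤ + + 2 * g)) + + 3 * ((1ℤ + + 2 * h) * (1ℤ + + 2 * h)) + + 2 * b * (+ 2 * b)
        lemma = solve-∀
        regroup : ∀ N → + 2 * (+ 6 * N + + 5) ≡ + 6 + + 4 * (+ 3 * N + 1ℤ)
        regroup = solve-∀
      choose (inj₁ _) (inj₁ _) (inj₁ _) ()
      choose (inj₁ _) (inj₁ _) (inj₂ _) ()
      choose (inj₁ _) (inj₂ _) (inj₁ _) ()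
      choose (inj₁ _) (inj₂ _) (inj₂ _) ()
      choose (inj₂ _) (inj₁ _) (inj₁ _) ()
      choose (inj₂ _) (inj₂ _) (inj₁ _) ()
      choose (inj₂ _) (inj₂ _) (inj₂ _) ()
    divide : ∃[ A ] ∃[ B ] ∃[ C ] A * A + + 3 * (B * B) + C * C ≡ + 6 * + (6 ℕ.* n ℕ.+ 5) → Goal
    divide (A , B , C , e) = choose (mod-3 A) (mod-3 C)
      where
      e′ : A * A + + 3 * (B * B) + C * C ≡ + 6 * (+ 6 * N + + 5)
      e′ = trans e (cong (+ 6 *_) (+-linear 6 5 n))
      wrong : ∀ r {s t T} → 1 ℕ.≤ r → r ℕ.< 3 → A * A ≡ s → C * C ≡ t → + 3 * T ≡ s + + 3 * (B * B) + t - + 6 * (+ 6 * N + + 5) + + r → Goal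
      wrong r 1≤r r<3 eA eC eq = ⊥-elim (absurd-mod 3 r 1≤r r<3 (trans (cong₂ (λ s t → s + + 3 * (B * B) + t) (sym eA) (sym eC)) e′) eq)
      choose : (∃[ w ] A ≡ + 3 * w) ⊎ (∃[ y ] A * A ≡ 1ℤ + + 3 * (y * (+ 3 * y + + 2))) →
               (∃[ w ] C ≡ + 3 * w) ⊎ (∃[ y ] C * C ≡ 1ℤ + + 3 * (y * (+ 3 * y + + 2))) → Goal
      choose (inj₁ (a , refl)) (inj₁ (c , refl)) = parities a B c (cancel-* 3 (trans (lemma a B c) (trans e′ (regroup N))))
        where
        lemma : ∀ a B c → + 3 * (+ 3 * (a * a) + + 3 * (c * c) + B * B) ≡ + 3 * a * (+ 3 * a) + + 3 * (B * B) + + 3 * c * (+ 3 * c)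
        lemma = solve-∀
        regroup : ∀ N → + 6 * (+ 6 * N + + 5) ≡ + 3 * (+ 2 * (+ 6 * N + + 5))
        regroup = solve-∀
      choose (inj₁ (a , a≡)) (inj₂ (y , y≡)) = wrong 2 {T = + 3 * (a * a) + B * B + y * (+ 3 * y + + 2) - + 2 * (+ 6 * N + + 5) + 1ℤ}
        (s≤s z≤n) ℕₚ.≤-refl (cong (λ v → v * v) a≡) y≡ (lemma a B (y * (+ 3 * y + + 2)) N)
        where
        lemma : ∀ a B Y N → + 3 * (+ 3 * (a * a) + B * B + Y - + 2 * (+ 6 * N + + 5) + 1ℤ)
          ≡ + 3 * a * (+ 3 * a) + + 3 * (B * B) + (1ℤ + + 3 * Y) - + 6 * (+ 6 * N + + 5) + + 2
        lemma = solve-∀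
      choose (inj₂ (y , y≡)) (inj₁ (a , a≡)) = wrong 2 {T = + 3 * (a * a) + B * B + y * (+ 3 * y + + 2) - + 2 * (+ 6 * N + + 5) + 1ℤ}
        (s≤s z≤n) ℕₚ.≤-refl y≡ (cong (λ v → v * v) a≡) (lemma a B (y * (+ 3 * y + + 2)) N)
        where
        lemma : ∀ a B Y N → + 3 * (+ 3 * (a * a) + B * B + Y - + 2 * (+ 6 * N + + 5) + 1ℤ)
          ≡ 1ℤ + + 3 * Y + + 3 * (B * B) + + 3 * a * (+ 3 * a) - + 6 * (+ 6 * N + + 5) + + 2
        lemma = solve-∀
      choose (inj₂ (x , x≡)) (inj₂ (y , y≡)) = wrong 1 {T = x * (+ 3 * x + + 2) + B * B + y * (+ 3 * y + + 2) - + 2 * (+ 6 * N + + 5) + 1ℤ}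
        (s≤s z≤n) (s≤s (s≤s z≤n)) x≡ y≡ (lemma (x * (+ 3 * x + + 2)) B (y * (+ 3 * y + + 2)) N)
        where
        lemma : ∀ X B Y N → + 3 * (X + B * B + Y - + 2 * (+ 6 * N + + 5) + 1ℤ)
          ≡ 1ℤ + + 3 * X + + 3 * (B * B) + (1ℤ + + 3 * Y) - + 6 * (+ 6 * N + + 5) + 1ℤ
        lemma = solve-∀

  -- 6n + 5 = 3 (2f + 1)² + 3 (2e)² + 2 v²
  f₃-6n+5′ : ∀ n → ∃[ f ] ∃[ e ] ∃[ v ] + 6 * pronic f + + 6 * (e * e) + v * v ≡ + 3 * + n + 1ℤ
  f₃-6n+5′ n = build (f₃-6n+5 n)
    where
    build : ∃[ g ] ∃[ h ] ∃[ b ] + 3 * pronic g + + 3 * pronic h + b * b ≡ + 3 * + n + 1ℤ →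
            ∃[ f ] ∃[ e ] ∃[ v ] + 6 * pronic f + + 6 * (e * e) + v * v ≡ + 3 * + n + 1ℤ
    build (g , h , b , eq) = aligned (pronic-align g h)
      where
      aligned : ∃[ q ] pronic q ≡ pronic h × Even (g - q) → ∃[ f ] ∃[ e ] ∃[ v ] + 6 * pronic f + + 6 * (e * e) + v * v ≡ + 3 * + n + 1ℤ
      aligned (q , q≡ , e , e≡) = q + e , e , b , trans (expand q e b)
        (trans (cong₂ (λ s t → + 3 * (s * s + s) + + 3 * t + b * b) (trans (cong (λ t → q + t) (sym e≡)) (back g q)) q≡) eq)
        where
        expand : ∀ q e b → + 6 * ((q + e) * (q + e) + (q + e)) + + 6 * (e * e) + b * b
          ≡ + 3 * ((q + + 2 * e) * (q + + 2 * e) + (q + + 2 * e)) + + 3 * (q * q + q) + b * b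
        expand = solve-∀
        back : ∀ p q → q + (p - q) ≡ p
        back = solve-∀

pentagonal-even : ∀ y → ∃[ k ] y * (+ 3 * y + 1ℤ) ≡ + 2 * k
pentagonal-even y = by-parity (parity y)
  where
  by-parity : Even y ⊎ Odd y → ∃[ k ] y * (+ 3 * y + 1ℤ) ≡ + 2 * k
  by-parity (inj₁ (h , refl)) = h * (+ 6 * h + 1ℤ) , lemma h
    where
    lemma : ∀ h → + 2 * h * (+ 3 * (+ 2 * h) + 1ℤ) ≡ + 2 * (h * (+ 6 * h + 1ℤ))
    lemma = solve-∀
  by-parity (inj₂ (h , refl)) = (1ℤ + + 2 * h) * (+ 3 * h + + 2) , lemma h
    where
    lemma : ∀ h → (1ℤ + + 2 * h) * (+ 3 * (1ℤ + + 2 * h) + 1ℤ) ≡ + 2 * ((1ℤ + + 2 * h) * (+ 3 * h + + 2))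
    lemma = solve-∀

-- (6y + 1)² = 1 + 12 y (3y + 1), and the sign of v is free.
pentagonal-root : ∀ v w → v * v ≡ 1ℤ + + 6 * w → ∃[ y ] v * v ≡ 1ℤ + + 12 * (y * (+ 3 * y + 1ℤ))
pentagonal-root v w e = by-parity (parity v)
  where
  nonzero : (∃[ u ] v ≡ + 3 * u) ⊎ (∃[ y ] v * v ≡ 1ℤ + + 12 * (y * (+ 3 * y + 1ℤ))) → ∃[ y ] v * v ≡ 1ℤ + + 12 * (y * (+ 3 * y + 1ℤ))
  nonzero (inj₂ p)        = p
  nonzero (inj₁ (u , u≡)) = ⊥-elim (absurd-mod 3 1 (s≤s z≤n) (s≤s (s≤s z≤n)) (trans (cong (λ v → v * v) (sym u≡)) e) (lemma u w))
    where
    lemma : ∀ u w → + 3 * (+ 3 * (u * u) - + 2 * w) ≡ + 3 * u * (+ 3 * u) - (1ℤ + + 6 * w) + 1ℤ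
    lemma = solve-∀
  by-parity : Even v ⊎ Odd v → ∃[ y ] v * v ≡ 1ℤ + + 12 * (y * (+ 3 * y + 1ℤ))
  by-parity (inj₂ o)        = nonzero (mod-3-odd v o)
  by-parity (inj₁ (h , h≡)) = ⊥-elim (absurd-mod 2 1 (s≤s z≤n) ℕₚ.≤-refl (trans (cong (λ v → v * v) (sym h≡)) e) (lemma h w))
    where
    lemma : ∀ h w → + 2 * (+ 2 * (h * h) - + 3 * w) ≡ + 2 * h * (+ 2 * h) - (1ℤ + + 6 * w) + 1ℤ
    lemma = solve-∀

universal-8-4-8-4-6-4 : Universal (+ 8) (+ 4) (+ 8) (+ 4) (+ 6) (+ 4)
universal-8-4-8-4-6-4 n = build (f₃-6n+5 n)
  where
  Goal : Set
  Goal = ∃[ x ] ∃[ y ] ∃[ z ] + 2 * + n ≡ x * (+ 8 * x + + 4) + y * (+ 8 * y + + 4) + z * (+ 6 * z + + 4)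
  build : ∃[ g ] ∃[ h ] ∃[ b ] + 3 * pronic g + + 3 * pronic h + b * b ≡ + 3 * + n + 1ℤ → Goal
  build (g , h , b , e) = choose (mod-3 b) (pronic-even g) (pronic-even h)
    where
    choose : (∃[ w ] b ≡ + 3 * w) ⊎ (∃[ y ] b * b ≡ 1ℤ + + 3 * (y * (+ 3 * y + + 2))) →
             ∃[ y ] pronic g ≡ y * (+ 4 * y + + 2) → ∃[ y ] pronic h ≡ y * (+ 4 * y + + 2) → Goal
    choose (inj₁ (w , w≡)) _ _ = ⊥-elim (absurd-mod 3 1 {T = pronic g + pronic h + + 3 * (w * w) - + n} (s≤s z≤n) (s≤s (s≤s z≤n))
      (trans (cong (λ v → + 3 * pronic g + + 3 * pronic h + v * v) (sym w≡)) e) (lemma (pronic g) (pronic h) w (+ n)))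
      where
      lemma : ∀ G H w N → + 3 * (G + H + + 3 * (w * w) - N) ≡ + 3 * G + + 3 * H + + 3 * w * (+ 3 * w) - (+ 3 * N + 1ℤ) + 1ℤ
      lemma = solve-∀
    choose (inj₂ (z , z≡)) (x , x≡) (y , y≡) = x , y , z , cancel-* 3 (+-cancelˡ (+ 2) (trans (double (+ n)) (trans (cong (+ 2 *_) (sym e))
      (trans (cong₂ (λ s t → + 2 * (s + t)) (cong₂ (λ s t → + 3 * s + + 3 * t) x≡ y≡) z≡) (lemma x y z)))))
      where
      double : ∀ n → + 2 + + 3 * (+ 2 * n) ≡ + 2 * (+ 3 * n + 1ℤ)
      double = solve-∀
      lemma : ∀ x y z → + 2 * (+ 3 * (x * (+ 4 * x + + 2)) + + 3 * (y * (+ 4 * y + + 2)) + (1ℤ + + 3 * (z * (+ 3 * z + + 2))))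
        ≡ + 2 + + 3 * (x * (+ 8 * x + + 4) + y * (+ 8 * y + + 4) + z * (+ 6 * z + + 4))
      lemma = solve-∀

opaque
  -- 24j + 5 = 3 (2f + 1)² + 48 z² + 2 (6y + 1)²
  f₃-24j+5 : ∀ j → ∃[ f ] ∃[ z ] ∃[ y ] pronic f + + 4 * (z * z) + + 2 * (y * (+ 3 * y + 1ℤ)) ≡ + 2 * + j
  f₃-24j+5 j = build (f₃-6n+5′ (4 ℕ.* j))
    where
    Goal : Set
    Goal = ∃[ f ] ∃[ z ] ∃[ y ] pronic f + + 4 * (z * z) + + 2 * (y * (+ 3 * y + 1ℤ)) ≡ + 2 * + j
    build : ∃[ f ] ∃[ e ] ∃[ v ] + 6 * pronic f + + 6 * (e * e) + v * v ≡ + 3 * + (4 ℕ.* j) + 1ℤ → Goal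
    build (f , e , v , eq) = rooted (pentagonal-root v (+ 2 * + j - pronic f - e * e) (trans (isolate (pronic f) (e * e) (v * v))
        (trans (cong (λ t → t - + 6 * pronic f - + 6 * (e * e)) eq′) (collect (+ j) (pronic f) (e * e)))))
      where
      eq′ : + 6 * pronic f + + 6 * (e * e) + v * v ≡ + 12 * + j + 1ℤ
      eq′ = trans eq (trans (cong (λ t → + 3 * t + 1ℤ) (ℤₚ.pos-* 4 j)) (lemma (+ j)))
        where
        lemma : ∀ j → + 3 * (+ 4 * j) + 1ℤ ≡ + 12 * j + 1ℤ
        lemma = solve-∀
      isolate : ∀ F E V → V ≡ + 6 * F + + 6 * E + V - + 6 * F - + 6 * E
      isolate = solve-∀
      collect : ∀ j F E → + 12 * j + 1ℤ - + 6 * F - + 6 * E ≡ 1ℤ + + 6 * (+ 2 * j - F - E)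
      collect = solve-∀
      rooted : ∃[ y ] v * v ≡ 1ℤ + + 12 * (y * (+ 3 * y + 1ℤ)) → Goal
      rooted (y , y≡) = by-parity (parity e) (pronic-even f)
        where
        Y : ℤ
        Y = y * (+ 3 * y + 1ℤ)
        sixth : pronic f + e * e + + 2 * Y ≡ + 2 * + j
        sixth = cancel-* 6 (+-cancelˡ 1ℤ (trans (trans (expand (pronic f) (e * e) Y) (trans (cong (λ t → + 6 * pronic f + + 6 * (e * e) + t) (sym y≡)) eq′)) (regroup (+ j))))
          where
          expand : ∀ F E Y → 1ℤ + + 6 * (F + E + + 2 * Y) ≡ + 6 * F + + 6 * E + (1ℤ + + 12 * Y)
          expand = solve-∀
          regroup : ∀ j → + 12 * j + 1ℤ ≡ 1ℤ + + 6 * (+ 2 * j)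
          regroup = solve-∀
        by-parity : Even e ⊎ Odd e → ∃[ k ] pronic f ≡ k * (+ 4 * k + + 2) → Goal
        by-parity (inj₁ (z , refl)) _ = f , z , y , trans (lemma (pronic f) z Y) sixth
          where
          lemma : ∀ F z Y → F + + 4 * (z * z) + + 2 * Y ≡ F + + 2 * z * (+ 2 * z) + + 2 * Y
          lemma = solve-∀
        by-parity (inj₂ (h , h≡)) (k , k≡) = ⊥-elim (absurd-mod 2 1 {T = k * (+ 2 * k + 1ℤ) + + 2 * (h * h + h) + Y - + j + 1ℤ} (s≤s z≤n) ℕₚ.≤-refl
          (trans (cong₂ (λ s t → s + t * t + + 2 * Y) (sym k≡) (sym h≡)) sixth) (lemma k h Y (+ j)))
          where
          lemma : ∀ k h Y j → + 2 * (k * (+ 2 * k + 1ℤ) + + 2 * (h * h + h) + Y - j + 1ℤ)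
            ≡ k * (+ 4 * k + + 2) + (1ℤ + + 2 * h) * (1ℤ + + 2 * h) + + 2 * Y - + 2 * j + 1ℤ
          lemma = solve-∀

  -- 24j + 17 = 3 (2f + 1)² + 12 (2p + 1)² + 2 (6y + 1)²
  f₃-24j+17 : ∀ j → ∃[ f ] ∃[ p ] ∃[ y ] pronic f + + 4 * pronic p + + 2 * (y * (+ 3 * y + 1ℤ)) ≡ + 2 * + j
  f₃-24j+17 j = build (f₃-6n+5′ (4 ℕ.* j ℕ.+ 2))
    where
    Goal : Set
    Goal = ∃[ f ] ∃[ p ] ∃[ y ] pronic f + + 4 * pronic p + + 2 * (y * (+ 3 * y + 1ℤ)) ≡ + 2 * + j
    build : ∃[ f ] ∃[ e ] ∃[ v ] + 6 * pronic f + + 6 * (e * e) + v * v ≡ + 3 * + (4 ℕ.* j ℕ.+ 2) + 1ℤ → Goal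
    build (f , e , v , eq) = rooted (pentagonal-root v (+ 2 * + j + 1ℤ - pronic f - e * e) (trans (isolate (pronic f) (e * e) (v * v))
        (trans (cong (λ t → t - + 6 * pronic f - + 6 * (e * e)) eq′) (collect (+ j) (pronic f) (e * e)))))
      where
      eq′ : + 6 * pronic f + + 6 * (e * e) + v * v ≡ + 12 * + j + + 7
      eq′ = trans eq (trans (cong (λ t → + 3 * t + 1ℤ) (+-linear 4 2 j)) (lemma (+ j)))
        where
        lemma : ∀ j → + 3 * (+ 4 * j + + 2) + 1ℤ ≡ + 12 * j + + 7
        lemma = solve-∀
      isolate : ∀ F E V → V ≡ + 6 * F + + 6 * E + V - + 6 * F - + 6 * E
      isolate = solve-∀
      collect : ∀ j F E → + 12 * j + + 7 - + 6 * F - + 6 * E ≡ 1ℤ + + 6 * (+ 2 * j + 1ℤ - F - E)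
      collect = solve-∀
      rooted : ∃[ y ] v * v ≡ 1ℤ + + 12 * (y * (+ 3 * y + 1ℤ)) → Goal
      rooted (y , y≡) = by-parity (parity e) (pronic-even f)
        where
        Y : ℤ
        Y = y * (+ 3 * y + 1ℤ)
        sixth : pronic f + e * e + + 2 * Y ≡ + 2 * + j + 1ℤ
        sixth = cancel-* 6 (+-cancelˡ 1ℤ (trans (trans (expand (pronic f) (e * e) Y) (trans (cong (λ t → + 6 * pronic f + + 6 * (e * e) + t) (sym y≡)) eq′)) (regroup (+ j))))
          where
          expand : ∀ F E Y → 1ℤ + + 6 * (F + E + + 2 * Y) ≡ + 6 * F + + 6 * E + (1ℤ + + 12 * Y)
          expand = solve-∀
          regroup : ∀ j → + 12 * j + + 7 ≡ 1ℤ + + 6 * (+ 2 * j + 1ℤ)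
          regroup = solve-∀
        by-parity : Even e ⊎ Odd e → ∃[ k ] pronic f ≡ k * (+ 4 * k + + 2) → Goal
        by-parity (inj₂ (p , refl)) _ = f , p , y , +-cancelˡ 1ℤ (trans (lemma (pronic f) p Y) (trans sixth (ℤₚ.+-comm (+ 2 * + j) 1ℤ)))
          where
          lemma : ∀ F p Y → 1ℤ + (F + + 4 * (p * p + p) + + 2 * Y) ≡ F + (1ℤ + + 2 * p) * (1ℤ + + 2 * p) + + 2 * Y
          lemma = solve-∀
        by-parity (inj₁ (h , h≡)) (k , k≡) = ⊥-elim (absurd-mod 2 1 {T = k * (+ 2 * k + 1ℤ) + + 2 * (h * h) + Y - + j} (s≤s z≤n) ℕₚ.≤-refl
          (trans (cong₂ (λ s t → s + t * t + + 2 * Y) (sym k≡) (sym h≡)) sixth) (lemma k h Y (+ j)))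
          where
          lemma : ∀ k h Y j → + 2 * (k * (+ 2 * k + 1ℤ) + + 2 * (h * h) + Y - j)
            ≡ k * (+ 4 * k + + 2) + + 2 * h * (+ 2 * h) + + 2 * Y - (+ 2 * j + 1ℤ) + 1ℤ
          lemma = solve-∀

double-n : ∀ n → + 2 * (+ 2 * n) ≡ + 2 * (n + n)
double-n = solve-∀

double-n+1 : ∀ n → + 2 + + 2 * (+ 2 * n) ≡ + 2 * (1ℤ + (n + n))
double-n+1 = solve-∀

isolate-first : ∀ a b c → a ≡ a + b + c - b - c
isolate-first = solve-∀

universal-8-2-3-1-2-0 : Universal (+ 8) (+ 2) (+ 3) (+ 1) (+ 2) (+ 0)
universal-8-2-3-1-2-0 n =
  let (f , z , y , e) = f₃-24j+5 (n ℕ.+ n)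
      (k , k≡) = pentagonal-even y
      (x , x≡) = pronic≡4w f (+ n - z * z - k) (trans (isolate-first (pronic f) (+ 4 * (z * z)) (+ 2 * (y * (+ 3 * y + 1ℤ))))
        (trans (cong₂ (λ s t → s - + 4 * (z * z) - + 2 * t) e k≡) (lemma₁ (+ n) z k)))
  in x , y , z , cancel-* 2 (trans (double-n (+ n)) (trans (sym e)
       (trans (cong (λ t → t + + 4 * (z * z) + + 2 * (y * (+ 3 * y + 1ℤ))) x≡) (lemma₂ (x * (+ 8 * x + + 2)) (y * (+ 3 * y + 1ℤ)) z))))
  where
  lemma₁ : ∀ n z k → + 2 * (n + n) - + 4 * (z * z) - + 2 * (+ 2 * k) ≡ + 4 * (n - z * z - k)
  lemma₁ = solve-∀
  lemma₂ : ∀ X Y z → + 2 * X + + 4 * (z * z) + + 2 * Y ≡ + 2 * (X + Y + z * (+ 2 * z + + 0))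
  lemma₂ = solve-∀

universal-8-6-3-1-2-0 : Universal (+ 8) (+ 6) (+ 3) (+ 1) (+ 2) (+ 0)
universal-8-6-3-1-2-0 n =
  let (f , z , y , e) = f₃-24j+5 (suc (n ℕ.+ n))
      (k , k≡) = pentagonal-even y
      (x , x≡) = pronic≡4w+2 f (+ n - z * z - k) (trans (isolate-first (pronic f) (+ 4 * (z * z)) (+ 2 * (y * (+ 3 * y + 1ℤ))))
        (trans (cong₂ (λ s t → s - + 4 * (z * z) - + 2 * t) e k≡) (lemma₁ (+ n) z k)))
  in x , y , z , cancel-* 2 (+-cancelˡ (+ 2) (trans (double-n+1 (+ n)) (trans (sym e)
       (trans (cong (λ t → t + + 4 * (z * z) + + 2 * (y * (+ 3 * y + 1ℤ))) x≡) (lemma₂ (x * (+ 8 * x + + 6)) (y * (+ 3 * y + 1ℤ)) z)))))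
  where
  lemma₁ : ∀ n z k → + 2 * (1ℤ + (n + n)) - + 4 * (z * z) - + 2 * (+ 2 * k) ≡ + 4 * (n - z * z - k) + + 2
  lemma₁ = solve-∀
  lemma₂ : ∀ X Y z → + 2 * X + + 2 + + 4 * (z * z) + + 2 * Y ≡ + 2 + + 2 * (X + Y + z * (+ 2 * z + + 0))
  lemma₂ = solve-∀

universal-8-4-8-2-3-1 : Universal (+ 8) (+ 4) (+ 8) (+ 2) (+ 3) (+ 1)
universal-8-4-8-2-3-1 n =
  let (f , p , z , e) = f₃-24j+17 (n ℕ.+ n)
      (k , k≡) = pentagonal-even z
      (x , x≡) = pronic-even p
      (y , y≡) = pronic≡4w f (+ n - pronic p - k) (trans (isolate-first (pronic f) (+ 4 * pronic p) (+ 2 * (z * (+ 3 * z + 1ℤ))))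
        (trans (cong₂ (λ s t → s - + 4 * pronic p - + 2 * t) e k≡) (lemma₁ (+ n) (pronic p) k)))
  in x , y , z , cancel-* 2 (trans (double-n (+ n)) (trans (sym e)
       (trans (cong₂ (λ s t → s + + 4 * t + + 2 * (z * (+ 3 * z + 1ℤ))) y≡ x≡) (lemma₂ x (y * (+ 8 * y + + 2)) (z * (+ 3 * z + 1ℤ))))))
  where
  lemma₁ : ∀ n P k → + 2 * (n + n) - + 4 * P - + 2 * (+ 2 * k) ≡ + 4 * (n - P - k)
  lemma₁ = solve-∀
  lemma₂ : ∀ x Y Z → + 2 * Y + + 4 * (x * (+ 4 * x + + 2)) + + 2 * Z ≡ + 2 * (x * (+ 8 * x + + 4) + Y + Z)
  lemma₂ = solve-∀

universal-8-6-8-4-3-1 : Universal (+ 8) (+ 6) (+ 8) (+ 4) (+ 3) (+ 1)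
universal-8-6-8-4-3-1 n =
  let (f , p , z , e) = f₃-24j+17 (suc (n ℕ.+ n))
      (k , k≡) = pentagonal-even z
      (y , y≡) = pronic-even p
      (x , x≡) = pronic≡4w+2 f (+ n - pronic p - k) (trans (isolate-first (pronic f) (+ 4 * pronic p) (+ 2 * (z * (+ 3 * z + 1ℤ))))
        (trans (cong₂ (λ s t → s - + 4 * pronic p - + 2 * t) e k≡) (lemma₁ (+ n) (pronic p) k)))
  in x , y , z , cancel-* 2 (+-cancelˡ (+ 2) (trans (double-n+1 (+ n)) (trans (sym e)
       (trans (cong₂ (λ s t → s + + 4 * t + + 2 * (z * (+ 3 * z + 1ℤ))) x≡ y≡) (lemma₂ (x * (+ 8 * x + + 6)) y (z * (+ 3 * z + 1ℤ)))))))
  where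
  lemma₁ : ∀ n P k → + 2 * (1ℤ + (n + n)) - + 4 * P - + 2 * (+ 2 * k) ≡ + 4 * (n - P - k) + + 2
  lemma₁ = solve-∀
  lemma₂ : ∀ X y Z → + 2 * X + + 2 + + 4 * (y * (+ 4 * y + + 2)) + + 2 * Z ≡ + 2 + + 2 * (X + y * (+ 8 * y + + 4) + Z)
  lemma₂ = solve-∀

opaque
  -- 48n + 7 = 3 (2p + 1)² + 2 (2v + 1)² + 2 (2w + 1)²
  f₃-48n+7 : ∀ n → ∃[ p ] ∃[ v ] ∃[ w ] + 3 * pronic p + + 2 * pronic v + + 2 * pronic w ≡ + 12 * + n
  f₃-48n+7 n = build (f₃⇒diagonal (represents₃-6n+1 (8 ℕ.* n ℕ.+ 1)))
    where
    N : ℤ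
    N = + n
    Goal : Set
    Goal = ∃[ p ] ∃[ v ] ∃[ w ] + 3 * pronic p + + 2 * pronic v + + 2 * pronic w ≡ + 12 * N
    split : ∀ p a c → + 3 * pronic p + a * a + c * c ≡ + 12 * N + 1ℤ → Goal
    split p a c e = by-parity (parity (a + c)) (pronic-even p)
      where
      by-parity : Even (a + c) ⊎ Odd (a + c) → ∃[ y ] pronic p ≡ y * (+ 4 * y + + 2) → Goal
      by-parity (inj₁ (h , h≡)) (y , y≡) = ⊥-elim (absurd-mod 2 1 {T = + 3 * (y * (+ 2 * y + 1ℤ)) + + 2 * (h * h) - a * c - + 6 * N} (s≤s z≤n) ℕₚ.≤-refl
        (trans (cong₂ (λ s t → + 3 * s + t * t - + 2 * (a * c)) (sym y≡) (sym h≡)) (trans (square (pronic p) a c) e)) (even y h a c N))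
        where
        square : ∀ P a c → + 3 * P + (a + c) * (a + c) - + 2 * (a * c) ≡ + 3 * P + a * a + c * c
        square = solve-∀
        even : ∀ y h a c n → + 2 * (+ 3 * (y * (+ 2 * y + 1ℤ)) + + 2 * (h * h) - a * c - + 6 * n)
          ≡ + 3 * (y * (+ 4 * y + + 2)) + + 2 * h * (+ 2 * h) - + 2 * (a * c) - (+ 12 * n + 1ℤ) + 1ℤ
        even = solve-∀
      by-parity (inj₂ (v , v≡)) _ = p , v , a - 1ℤ - v , +-cancelˡ 1ℤ (trans (halves (pronic p) v a)
        (trans (cong (λ s → + 3 * pronic p + a * a + (s - a) * (s - a)) (sym v≡)) (trans (back (pronic p) a c) (trans e (ℤₚ.+-comm (+ 12 * N) 1ℤ)))))
        where
        halves : ∀ P v b → 1ℤ + (+ 3 * P + + 2 * (v * v + v) + + 2 * ((b - 1ℤ - v) * (b - 1ℤ - v) + (b - 1ℤ - v)))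
          ≡ + 3 * P + b * b + (1ℤ + + 2 * v - b) * (1ℤ + + 2 * v - b)
        halves = solve-∀
        back : ∀ P b c → + 3 * P + b * b + (b + c - b) * (b + c - b) ≡ + 3 * P + b * b + c * c
        back = solve-∀
    build : ∃[ A ] ∃[ B ] ∃[ C ] A * A + + 3 * (B * B) + C * C ≡ + (6 ℕ.* (8 ℕ.* n ℕ.+ 1) ℕ.+ 1) → Goal
    build (A , B , C , e) = choose (parity A) (parity B) (parity C)
      (bits-mod-4 {A} {B} {C} {3} {1} 3 (multiple (+ 12 * N + 1ℤ) (trans (unit-coefficient (A * A) (B * B) (C * C)) (trans e′ (residue-3 N)))) (parity A) (parity B) (parity C))
      where
      e′ : A * A + + 3 * (B * B) + C * C ≡ + 48 * N + + 7
      e′ = trans e (trans (+-linear 6 1 (8 ℕ.* n ℕ.+ 1)) (trans (cong (λ t → + 6 * t + 1ℤ) (+-linear 8 1 n)) (lemma N)))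
        where
        lemma : ∀ n → + 6 * (+ 8 * n + 1ℤ) + 1ℤ ≡ + 48 * n + + 7
        lemma = solve-∀
      unit-coefficient : ∀ x y z → x + + 3 * y + 1ℤ * z ≡ x + + 3 * y + z
      unit-coefficient = solve-∀
      residue-3 : ∀ N → + 48 * N + + 7 ≡ + 3 + (+ 12 * N + 1ℤ) * + 4
      residue-3 = solve-∀
      choose : (p : Even A ⊎ Odd A) (q : Even B ⊎ Odd B) (s : Even C ⊎ Odd C) → (bit p ℕ.+ 3 ℕ.* bit q ℕ.+ 1 ℕ.* bit s) % 4 ≡ 3 → Goal
      choose (inj₁ (a , refl)) (inj₂ (p , refl)) (inj₁ (c , refl)) _ = split p a c (cancel-* 4 (+-cancelˡ (+ 3) (trans (lemma p a c) (trans e′ (regroup N)))))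
        where
        lemma : ∀ p a c → + 3 + + 4 * (+ 3 * (p * p + p) + a * a + c * c) ≡ + 2 * a * (+ 2 * a) + + 3 * ((1ℤ + + 2 * p) * (1ℤ + + 2 * p)) + + 2 * c * (+ 2 * c)
        lemma = solve-∀
        regroup : ∀ N → + 48 * N + + 7 ≡ + 3 + + 4 * (+ 12 * N + 1ℤ)
        regroup = solve-∀
      choose (inj₁ _) (inj₁ _) (inj₁ _) ()
      choose (inj₁ _) (inj₁ _) (inj₂ _) ()
      choose (inj₁ _) (inj₂ _) (inj₂ _) ()
      choose (inj₂ _) (inj₁ _) (inj₁ _) ()
      choose (inj₂ _) (inj₁ _) (inj₂ _) ()
      choose (inj₂ _) (inj₂ _) (inj₁ _) ()
      choose (inj₂ _) (inj₂ _) (inj₂ _) ()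

  f₃-48n+7′ : ∀ n → ∃[ p ] ∃[ y ] ∃[ z ] pronic p + + 2 * (y * (+ 3 * y + 1ℤ)) + + 2 * (z * (+ 3 * z + 1ℤ)) ≡ + 4 * + n
  f₃-48n+7′ n = build (f₃-48n+7 n)
    where
    N : ℤ
    N = + n
    Goal : Set
    Goal = ∃[ p ] ∃[ y ] ∃[ z ] pronic p + + 2 * (y * (+ 3 * y + 1ℤ)) + + 2 * (z * (+ 3 * z + 1ℤ)) ≡ + 4 * N
    build : ∃[ p ] ∃[ v ] ∃[ w ] + 3 * pronic p + + 2 * pronic v + + 2 * pronic w ≡ + 12 * N → Goal
    build (p , v , w , e) = choose (mod-3-odd V (v , refl)) (mod-3-odd W (w , refl))
      where
      V W P : ℤ
      V = 1ℤ + + 2 * v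
      W = 1ℤ + + 2 * w
      P = pronic p
      total : V * V + W * W + + 6 * P ≡ + 24 * N + + 2
      total = trans (expand v w P) (trans (cong (λ t → + 2 + + 2 * t) e) (regroup N))
        where
        expand : ∀ v w P → (1ℤ + + 2 * v) * (1ℤ + + 2 * v) + (1ℤ + + 2 * w) * (1ℤ + + 2 * w) + + 6 * P
          ≡ + 2 + + 2 * (+ 3 * P + + 2 * (v * v + v) + + 2 * (w * w + w))
        expand = solve-∀
        regroup : ∀ N → + 2 + + 2 * (+ 12 * N) ≡ + 24 * N + + 2
        regroup = solve-∀
      wrong : ∀ r {s t T} → 1 ℕ.≤ r → r ℕ.< 3 → V * V ≡ s → W * W ≡ t → + 3 * T ≡ s + t + + 6 * P - (+ 24 * N + + 2) + + r → Goal
      wrong r 1≤r r<3 eV eW eq = ⊥-elim (absurd-mod 3 r 1≤r r<3 (trans (cong₂ (λ s t → s + t + + 6 * P) (sym eV) (sym eW)) total) eq)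
      choose : (∃[ u ] V ≡ + 3 * u) ⊎ (∃[ y ] V * V ≡ 1ℤ + + 12 * (y * (+ 3 * y + 1ℤ))) →
               (∃[ u ] W ≡ + 3 * u) ⊎ (∃[ y ] W * W ≡ 1ℤ + + 12 * (y * (+ 3 * y + 1ℤ))) → Goal
      choose (inj₂ (y , y≡)) (inj₂ (z , z≡)) = p , y , z , cancel-* 6 (+-cancelˡ (+ 2) (trans (lemma P (y * (+ 3 * y + 1ℤ)) (z * (+ 3 * z + 1ℤ)))
        (trans (cong₂ (λ s t → s + t + + 6 * P) (sym y≡) (sym z≡)) (trans total (regroup N)))))
        where
        lemma : ∀ P Y Z → + 2 + + 6 * (P + + 2 * Y + + 2 * Z) ≡ 1ℤ + + 12 * Y + (1ℤ + + 12 * Z) + + 6 * P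
        lemma = solve-∀
        regroup : ∀ N → + 24 * N + + 2 ≡ + 2 + + 6 * (+ 4 * N)
        regroup = solve-∀
      choose (inj₁ (u , u≡)) (inj₁ (t , t≡)) = wrong 2 {T = + 3 * (u * u) + + 3 * (t * t) + + 2 * P - + 8 * N} (s≤s z≤n) ℕₚ.≤-refl
        (cong (λ v → v * v) u≡) (cong (λ v → v * v) t≡) (lemma u t P N)
        where
        lemma : ∀ u t P N → + 3 * (+ 3 * (u * u) + + 3 * (t * t) + + 2 * P - + 8 * N) ≡ + 3 * u * (+ 3 * u) + + 3 * t * (+ 3 * t) + + 6 * P - (+ 24 * N + + 2) + + 2
        lemma = solve-∀
      choose (inj₁ (u , u≡)) (inj₂ (z , z≡)) = wrong 1 {T = + 3 * (u * u) + + 4 * (z * (+ 3 * z + 1ℤ)) + + 2 * P - + 8 * N} (s≤s z≤n) (s≤s (s≤s z≤n))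
        (cong (λ v → v * v) u≡) z≡ (lemma u (z * (+ 3 * z + 1ℤ)) P N)
        where
        lemma : ∀ u Z P N → + 3 * (+ 3 * (u * u) + + 4 * Z + + 2 * P - + 8 * N) ≡ + 3 * u * (+ 3 * u) + (1ℤ + + 12 * Z) + + 6 * P - (+ 24 * N + + 2) + 1ℤ
        lemma = solve-∀
      choose (inj₂ (z , z≡)) (inj₁ (u , u≡)) = wrong 1 {T = + 3 * (u * u) + + 4 * (z * (+ 3 * z + 1ℤ)) + + 2 * P - + 8 * N} (s≤s z≤n) (s≤s (s≤s z≤n))
        z≡ (cong (λ v → v * v) u≡) (lemma u (z * (+ 3 * z + 1ℤ)) P N)
        where
        lemma : ∀ u Z P N → + 3 * (+ 3 * (u * u) + + 4 * Z + + 2 * P - + 8 * N) ≡ 1ℤ + + 12 * Z + + 3 * u * (+ 3 * u) + + 6 * P - (+ 24 * N + + 2) + 1ℤ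
        lemma = solve-∀

universal-8-2-3-1-3-1 : Universal (+ 8) (+ 2) (+ 3) (+ 1) (+ 3) (+ 1)
universal-8-2-3-1-3-1 n =
  let (p , y , z , e) = f₃-48n+7′ n
      (i , i≡) = pentagonal-even y
      (j , j≡) = pentagonal-even z
      (x , x≡) = pronic≡4w p (+ n - i - j) (trans (isolate-first (pronic p) (+ 2 * (y * (+ 3 * y + 1ℤ))) (+ 2 * (z * (+ 3 * z + 1ℤ))))
        (trans (cong₂ (λ s t → s - + 2 * proj₁ t - + 2 * proj₂ t) e (cong₂ _,_ i≡ j≡)) (lemma₁ (+ n) i j)))
  in x , y , z , cancel-* 2 (trans (lemma₂ (+ n)) (trans (sym e)
       (trans (cong (λ t → t + + 2 * (y * (+ 3 * y + 1ℤ)) + + 2 * (z * (+ 3 * z + 1ℤ))) x≡) (lemma₃ (x * (+ 8 * x + + 2)) (y * (+ 3 * y + 1ℤ)) (z * (+ 3 * z + 1ℤ))))))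
  where
  lemma₁ : ∀ n i j → + 4 * n - + 2 * (+ 2 * i) - + 2 * (+ 2 * j) ≡ + 4 * (n - i - j)
  lemma₁ = solve-∀
  lemma₂ : ∀ n → + 2 * (+ 2 * n) ≡ + 4 * n
  lemma₂ = solve-∀
  lemma₃ : ∀ X Y Z → + 2 * X + + 2 * Y + + 2 * Z ≡ + 2 * (X + Y + Z)
  lemma₃ = solve-∀

OddRepresentation : ℤ → Set
OddRepresentation m = ∃[ A ] ∃[ B ] ∃[ p ] A * A + B * B + + 3 * ((1ℤ + + 2 * p) * (1ℤ + + 2 * p)) ≡ m

-- 4 (a² + 3b²) = (a + 3b)² + 3 (a - b)² makes the last variable odd when a and b have different parity.
quadruple : ∀ {m} a b c → a * a + + 3 * (b * b) + c * c ≡ m → (Even a → Even b → Even c → ⊥) → OddRepresentation (+ 4 * m)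
quadruple {m} a b c e ¬even = choose (parity a) (parity b) (parity c)
  where
  mixed : ∀ {m} a b c p → a - b ≡ 1ℤ + + 2 * p → a * a + + 3 * (b * b) + c * c ≡ m → OddRepresentation (+ 4 * m)
  mixed a b c p p≡ e = a + + 3 * b , + 2 * c , p , trans (cong (λ t → (a + + 3 * b) * (a + + 3 * b) + + 2 * c * (+ 2 * c) + + 3 * (t * t)) (sym p≡))
    (trans (lemma a b c) (cong (+ 4 *_) e))
    where
    lemma : ∀ a b c → (a + + 3 * b) * (a + + 3 * b) + + 2 * c * (+ 2 * c) + + 3 * ((a - b) * (a - b)) ≡ + 4 * (a * a + + 3 * (b * b) + c * c)
    lemma = solve-∀
  swap : ∀ a b c → c * c + + 3 * (b * b) + a * a ≡ a * a + + 3 * (b * b) + c * c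
  swap = solve-∀
  oe : ∀ g h → 1ℤ + + 2 * g - + 2 * h ≡ 1ℤ + + 2 * (g - h)
  oe = solve-∀
  eo : ∀ g h → + 2 * g - (1ℤ + + 2 * h) ≡ 1ℤ + + 2 * (g - h - 1ℤ)
  eo = solve-∀
  all-odd : ∀ g h k → (1ℤ + + 2 * g) * (1ℤ + + 2 * g) + + 3 * ((1ℤ + + 2 * h) * (1ℤ + + 2 * h)) + (1ℤ + + 2 * k) * (1ℤ + + 2 * k) ≡ m → OddRepresentation (+ 4 * m)
  all-odd g h k e = aligned (pronic-align g h)
    where
    aligned : ∃[ q ] pronic q ≡ pronic h × Even (g - q) → OddRepresentation (+ 4 * m)
    aligned (q , q≡ , s , s≡) = 1ℤ + + 2 * k + + 6 * s , + 4 * (1ℤ + + 2 * q) + + 4 * s , k - s , trans (expand q s k)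
      (trans (cong₂ (λ g P → + 4 * ((1ℤ + + 2 * g) * (1ℤ + + 2 * g) + + 3 * (1ℤ + + 4 * P) + (1ℤ + + 2 * k) * (1ℤ + + 2 * k)))
        (trans (cong (λ t → q + t) (sym s≡)) (back g q)) q≡) (trans (collect g h k) (cong (+ 4 *_) e)))
      where
      expand : ∀ q s k → (1ℤ + + 2 * k + + 6 * s) * (1ℤ + + 2 * k + + 6 * s) + (+ 4 * (1ℤ + + 2 * q) + + 4 * s) * (+ 4 * (1ℤ + + 2 * q) + + 4 * s)
        + + 3 * ((1ℤ + + 2 * (k - s)) * (1ℤ + + 2 * (k - s)))
        ≡ + 4 * ((1ℤ + + 2 * (q + + 2 * s)) * (1ℤ + + 2 * (q + + 2 * s)) + + 3 * (1ℤ + + 4 * (q * q + q)) + (1ℤ + + 2 * k) * (1ℤ + + 2 * k))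
      expand = solve-∀
      back : ∀ p q → q + (p - q) ≡ p
      back = solve-∀
      collect : ∀ g h k → + 4 * ((1ℤ + + 2 * g) * (1ℤ + + 2 * g) + + 3 * (1ℤ + + 4 * (h * h + h)) + (1ℤ + + 2 * k) * (1ℤ + + 2 * k))
        ≡ + 4 * ((1ℤ + + 2 * g) * (1ℤ + + 2 * g) + + 3 * ((1ℤ + + 2 * h) * (1ℤ + + 2 * h)) + (1ℤ + + 2 * k) * (1ℤ + + 2 * k))
      collect = solve-∀
  choose : Even a ⊎ Odd a → Even b ⊎ Odd b → Even c ⊎ Odd c → OddRepresentation (+ 4 * m)
  choose (inj₁ ea) (inj₁ eb) (inj₁ ec) = ⊥-elim (¬even ea eb ec)
  choose (inj₁ (g , refl)) (inj₂ (h , refl)) _ = mixed a b c (g - h - 1ℤ) (eo g h) e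
  choose (inj₂ (g , refl)) (inj₁ (h , refl)) _ = mixed a b c (g - h) (oe g h) e
  choose _ (inj₁ (h , refl)) (inj₂ (g , refl)) = mixed c b a (g - h) (oe g h) (trans (swap a b c) e)
  choose _ (inj₂ (h , refl)) (inj₁ (g , refl)) = mixed c b a (g - h - 1ℤ) (eo g h) (trans (swap a b c) e)
  choose (inj₂ (g , refl)) (inj₂ (h , refl)) (inj₂ (k , refl)) = all-odd g h k e

opaque
  f₃-12n+8 : ∀ n → OddRepresentation (+ 12 * + n + + 8)
  f₃-12n+8 n = go (suc n) n ℕₚ.≤-refl
    where
    not-all-even : ∀ r {a b c m} → 1 ℕ.≤ r → r ℕ.< 4 → a * a + + 3 * (b * b) + c * c ≡ + 4 * m + + r → Even a → Even b → Even c → ⊥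
    not-all-even r {m = m} 1≤r r<4 e (a , refl) (b , refl) (c , refl) = absurd-mod 4 r {T = a * a + + 3 * (b * b) + c * c - m} 1≤r r<4 e (lemma a b c m (+ r))
      where
      lemma : ∀ a b c m r → + 4 * (a * a + + 3 * (b * b) + c * c - m) ≡ + 2 * a * (+ 2 * a) + + 3 * (+ 2 * b * (+ 2 * b)) + + 2 * c * (+ 2 * c) - (+ 4 * m + r) + r
      lemma = solve-∀
    go : ∀ bound n → n ℕ.< bound → OddRepresentation (+ 12 * + n + + 8)
    go (suc bound) n (s≤s n≤bound) = by-half (half n)
      where
      by-half : ∃[ i ] (n ≡ i ℕ.+ i ⊎ n ≡ suc (i ℕ.+ i)) → OddRepresentation (+ 12 * + n + + 8)
      by-half (j , inj₂ refl) = from-diagonal (f₃⇒diagonal (represents₃-6n+5 j))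
        where
        regroup : ∀ j → + 4 * (+ 6 * j + + 5) ≡ + 12 * (1ℤ + (j + j)) + + 8
        regroup = solve-∀
        from-diagonal : ∃[ A ] ∃[ B ] ∃[ C ] A * A + + 3 * (B * B) + C * C ≡ + (6 ℕ.* j ℕ.+ 5) → OddRepresentation (+ 12 * + n + + 8)
        from-diagonal (A , B , C , e) = subst OddRepresentation (regroup (+ j)) (quadruple A B C e′ ¬even)
          where
          e′ : A * A + + 3 * (B * B) + C * C ≡ + 6 * + j + + 5
          e′ = trans e (+-linear 6 5 j)
          ¬even : Even A → Even B → Even C → ⊥
          ¬even (a , refl) (b , refl) (c , refl) = absurd-mod 2 1 {T = + 2 * (a * a) + + 6 * (b * b) + + 2 * (c * c) - + 3 * + j - + 2} (s≤s z≤n) ℕₚ.≤-refl e′ (lemma a b c (+ j))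
            where
            lemma : ∀ a b c j → + 2 * (+ 2 * (a * a) + + 6 * (b * b) + + 2 * (c * c) - + 3 * j - + 2)
              ≡ + 2 * a * (+ 2 * a) + + 3 * (+ 2 * b * (+ 2 * b)) + + 2 * c * (+ 2 * c) - (+ 6 * j + + 5) + 1ℤ
            lemma = solve-∀
      by-half (i , inj₁ refl) = by-half′ (half i)
        where
        by-half′ : ∃[ j ] (i ≡ j ℕ.+ j ⊎ i ≡ suc (j ℕ.+ j)) → OddRepresentation (+ 12 * + n + + 8)
        by-half′ (j , inj₁ refl) = from-diagonal (f₃⇒diagonal (represents₃-2[6n+1] j))
          where
          regroup : ∀ j → + 4 * (+ 12 * j + + 2) ≡ + 12 * ((j + j) + (j + j)) + + 8
          regroup = solve-∀
          from-diagonal : ∃[ A ] ∃[ B ] ∃[ C ] A * A + + 3 * (B * B) + C * C ≡ + 2 * + (6 ℕ.* j ℕ.+ 1) → OddRepresentation (+ 12 * + n + + 8)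
          from-diagonal (A , B , C , e) = subst OddRepresentation (regroup (+ j)) (quadruple A B C e′
            (not-all-even 2 {m = + 3 * + j} (s≤s z≤n) (s≤s (s≤s (s≤s z≤n))) (trans e′ (lemma′ (+ j)))))
            where
            lemma : ∀ j → + 2 * (+ 6 * j + 1ℤ) ≡ + 12 * j + + 2
            lemma = solve-∀
            lemma′ : ∀ j → + 12 * j + + 2 ≡ + 4 * (+ 3 * j) + + 2
            lemma′ = solve-∀
            e′ : A * A + + 3 * (B * B) + C * C ≡ + 12 * + j + + 2
            e′ = trans e (trans (cong (+ 2 *_) (+-linear 6 1 j)) (lemma (+ j)))
        by-half′ (j , inj₂ refl) = from-smaller (go bound j (ℕₚ.<-≤-trans (s≤s (ℕₚ.≤-trans (ℕₚ.m≤m+n j j) (ℕₚ.m≤m+n (j ℕ.+ j) _))) n≤bound))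
          where
          regroup : ∀ j → + 4 * (+ 12 * j + + 8) ≡ + 12 * (1ℤ + (j + j) + (1ℤ + (j + j))) + + 8
          regroup = solve-∀
          from-smaller : OddRepresentation (+ 12 * + j + + 8) → OddRepresentation (+ 12 * + n + + 8)
          from-smaller (A , B , p , e) = subst OddRepresentation (regroup (+ j)) (quadruple A (1ℤ + + 2 * p) B (trans (swap (A * A) (B * B) _) e) ¬even)
            where
            swap : ∀ x y z → x + + 3 * z + y ≡ x + y + + 3 * z
            swap = solve-∀
            ¬even : Even A → Even (1ℤ + + 2 * p) → Even B → ⊥
            ¬even _ (h , h≡) _ = absurd-mod 2 1 {T = h - p} (s≤s z≤n) ℕₚ.≤-refl (sym h≡) (lemma h p)
              where
              lemma : ∀ h p → + 2 * (h - p) ≡ + 2 * h - (1ℤ + + 2 * p) + 1ℤ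
              lemma = solve-∀

universal-8-4-6-4-6-2 : Universal (+ 8) (+ 4) (+ 6) (+ 4) (+ 6) (+ 2)
universal-8-4-6-4-6-2 n = build (f₃-12n+8 n)
  where
  N : ℤ
  N = + n
  Goal : Set
  Goal = ∃[ x ] ∃[ y ] ∃[ z ] + 2 * + n ≡ x * (+ 8 * x + + 4) + y * (+ 6 * y + + 4) + z * (+ 6 * z + + 2)
  sorted : ∀ A b p → Odd A → A * A + + 4 * (b * b) + + 12 * pronic p ≡ + 12 * N + + 5 → Goal
  sorted A b p oA e = choose (mod-3-odd A oA) (mod-3 b) (pronic-even p)
    where
    P : ℤ
    P = pronic p
    wrong : ∀ r {s t T} → 1 ℕ.≤ r → r ℕ.< 3 → A * A ≡ s → b * b ≡ t → + 3 * T ≡ s + + 4 * t + + 12 * P - (+ 12 * N + + 5) + + r → Goal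
    wrong r 1≤r r<3 eA eb eq = ⊥-elim (absurd-mod 3 r 1≤r r<3 (trans (cong₂ (λ s t → s + + 4 * t + + 12 * P) (sym eA) (sym eb)) e) eq)
    choose : (∃[ u ] A ≡ + 3 * u) ⊎ (∃[ z ] A * A ≡ 1ℤ + + 12 * (z * (+ 3 * z + 1ℤ))) →
             (∃[ u ] b ≡ + 3 * u) ⊎ (∃[ y ] b * b ≡ 1ℤ + + 3 * (y * (+ 3 * y + + 2))) → ∃[ x ] pronic p ≡ x * (+ 4 * x + + 2) → Goal
    choose (inj₂ (z , z≡)) (inj₂ (y , y≡)) (x , x≡) = x , y , z , cancel-* 6 (+-cancelˡ (+ 5) (trans (regroup N) (trans (sym e)
      (trans (cong₂ (λ s t → proj₁ s + + 4 * proj₂ s + + 12 * t) (cong₂ _,_ z≡ y≡) x≡) (lemma x y z)))))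
      where
      regroup : ∀ N → + 5 + + 6 * (+ 2 * N) ≡ + 12 * N + + 5
      regroup = solve-∀
      lemma : ∀ x y z → 1ℤ + + 12 * (z * (+ 3 * z + 1ℤ)) + + 4 * (1ℤ + + 3 * (y * (+ 3 * y + + 2))) + + 12 * (x * (+ 4 * x + + 2))
        ≡ + 5 + + 6 * (x * (+ 8 * x + + 4) + y * (+ 6 * y + + 4) + z * (+ 6 * z + + 2))
      lemma = solve-∀
    choose (inj₁ (u , u≡)) (inj₁ (t , t≡)) _ = wrong 2 {T = + 3 * (u * u) + + 12 * (t * t) + + 4 * P - + 4 * N - 1ℤ} (s≤s z≤n) ℕₚ.≤-refl
      (cong (λ v → v * v) u≡) (cong (λ v → v * v) t≡) (lemma u t P N)
      where
      lemma : ∀ u t P N → + 3 * (+ 3 * (u * u) + + 12 * (t * t) + + 4 * P - + 4 * N - 1ℤ)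
        ≡ + 3 * u * (+ 3 * u) + + 4 * (+ 3 * t * (+ 3 * t)) + + 12 * P - (+ 12 * N + + 5) + + 2
      lemma = solve-∀
    choose (inj₁ (u , u≡)) (inj₂ (y , y≡)) _ = wrong 1 {T = + 3 * (u * u) + + 4 * (y * (+ 3 * y + + 2)) + + 4 * P - + 4 * N} (s≤s z≤n) (s≤s (s≤s z≤n))
      (cong (λ v → v * v) u≡) y≡ (lemma u (y * (+ 3 * y + + 2)) P N)
      where
      lemma : ∀ u Y P N → + 3 * (+ 3 * (u * u) + + 4 * Y + + 4 * P - + 4 * N)
        ≡ + 3 * u * (+ 3 * u) + + 4 * (1ℤ + + 3 * Y) + + 12 * P - (+ 12 * N + + 5) + 1ℤ
      lemma = solve-∀
    choose (inj₂ (z , z≡)) (inj₁ (t , t≡)) _ = wrong 1 {T = + 4 * (z * (+ 3 * z + 1ℤ)) + + 12 * (t * t) + + 4 * P - + 4 * N - 1ℤ} (s≤s z≤n) (s≤s (s≤s z≤n))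
      z≡ (cong (λ v → v * v) t≡) (lemma (z * (+ 3 * z + 1ℤ)) t P N)
      where
      lemma : ∀ Z t P N → + 3 * (+ 4 * Z + + 12 * (t * t) + + 4 * P - + 4 * N - 1ℤ)
        ≡ 1ℤ + + 12 * Z + + 4 * (+ 3 * t * (+ 3 * t)) + + 12 * P - (+ 12 * N + + 5) + 1ℤ
      lemma = solve-∀
  build : OddRepresentation (+ 12 * N + + 8) → Goal
  build (A , B , p , e) = choose (parity A) (parity B)
    where
    e′ : A * A + B * B + + 12 * pronic p ≡ + 12 * N + + 5
    e′ = +-cancelˡ (+ 3) (trans (lemma (A * A) (B * B) p) (trans e (regroup N)))
      where
      lemma : ∀ x y p → + 3 + (x + y + + 12 * (p * p + p)) ≡ x + y + + 3 * ((1ℤ + + 2 * p) * (1ℤ + + 2 * p))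
      lemma = solve-∀
      regroup : ∀ N → + 12 * N + + 8 ≡ + 3 + (+ 12 * N + + 5)
      regroup = solve-∀
    choose : Even A ⊎ Odd A → Even B ⊎ Odd B → Goal
    choose (inj₂ oA) (inj₁ (b , refl)) = sorted A b p oA (trans (lemma (A * A) b (pronic p)) e′)
      where
      lemma : ∀ x b P → x + + 4 * (b * b) + + 12 * P ≡ x + + 2 * b * (+ 2 * b) + + 12 * P
      lemma = solve-∀
    choose (inj₁ (b , refl)) (inj₂ oB) = sorted B b p oB (trans (lemma (B * B) b (pronic p)) e′)
      where
      lemma : ∀ x b P → x + + 4 * (b * b) + + 12 * P ≡ + 2 * b * (+ 2 * b) + x + + 12 * P
      lemma = solve-∀
    choose (inj₁ (a , refl)) (inj₁ (b , refl)) = ⊥-elim (absurd-mod 2 1 {T = + 2 * (a * a) + + 2 * (b * b) + + 6 * pronic p - + 6 * N - + 2} (s≤s z≤n) ℕₚ.≤-refl e′ (lemma a b (pronic p) N))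
      where
      lemma : ∀ a b P N → + 2 * (+ 2 * (a * a) + + 2 * (b * b) + + 6 * P - + 6 * N - + 2) ≡ + 2 * a * (+ 2 * a) + + 2 * b * (+ 2 * b) + + 12 * P - (+ 12 * N + + 5) + 1ℤ
      lemma = solve-∀
    choose (inj₂ (a , refl)) (inj₂ (b , refl)) = ⊥-elim (absurd-mod 2 1 {T = + 2 * pronic a + + 2 * pronic b + + 6 * pronic p - + 6 * N - 1ℤ} (s≤s z≤n) ℕₚ.≤-refl e′ (lemma a b (pronic p) N))
      where
      lemma : ∀ a b P N → + 2 * (+ 2 * (a * a + a) + + 2 * (b * b + b) + + 6 * P - + 6 * N - 1ℤ)
        ≡ (1ℤ + + 2 * a) * (1ℤ + + 2 * a) + (1ℤ + + 2 * b) * (1ℤ + + 2 * b) + + 12 * P - (+ 12 * N + + 5) + 1ℤ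
      lemma = solve-∀

opaque
  -- f₅ is invariant under permutations of x + y, x + z, y + z up to sign, so y + z may be taken even.
  f₅-even : ∀ {m} → Represents f₅ m → ∃[ x ] ∃[ k ] ∃[ z ] eval f₅ x (+ 2 * k - z) z ≡ m
  f₅-even {m} (x , y , z , e) = choose (parity (y + z)) (parity (x + z)) (parity (x + y))
    where
    Goal : Set
    Goal = ∃[ x ] ∃[ k ] ∃[ z ] eval f₅ x (+ 2 * k - z) z ≡ m
    solved : ∀ x y z → Even (y + z) → eval f₅ x y z ≡ m → Goal
    solved x y z (k , k≡) e = x , k , z , trans (cong (λ y → eval f₅ x y z) (trans (cong (_- z) (sym k≡)) (cancel y z))) e
      where
      cancel : ∀ y z → y + z - z ≡ y
      cancel = solve-∀
    swap : ∀ x y z → 1ℤ * (y * y) + 1ℤ * (x * x) + + 2 * (z * z) + 1ℤ * (x * z) + 1ℤ * (y * z) + 1ℤ * (y * x)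
      ≡ 1ℤ * (x * x) + 1ℤ * (y * y) + + 2 * (z * z) + 1ℤ * (y * z) + 1ℤ * (x * z) + 1ℤ * (x * y)
    swap = solve-∀
    reflect : ∀ x y z →
        1ℤ * (y * y) + 1ℤ * (- (x + y + z) * - (x + y + z)) + + 2 * (z * z) + 1ℤ * (- (x + y + z) * z) + 1ℤ * (y * z) + 1ℤ * (y * - (x + y + z))
        ≡ 1ℤ * (x * x) + 1ℤ * (y * y) + + 2 * (z * z) + 1ℤ * (y * z) + 1ℤ * (x * z) + 1ℤ * (x * y)
    reflect = solve-∀
    choose : Even (y + z) ⊎ Odd (y + z) → Even (x + z) ⊎ Odd (x + z) → Even (x + y) ⊎ Odd (x + y) → Goal
    choose (inj₁ ev) _ _ = solved x y z ev e
    choose _ (inj₁ ev) _ = solved y x z ev (trans (swap x y z) e)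
    choose _ _ (inj₁ (h , h≡)) = solved y (- (x + y + z)) z (- h , trans (lemma x y z) (trans (cong -_ h≡) (neg h))) (trans (reflect x y z) e)
      where
      lemma : ∀ x y z → - (x + y + z) + z ≡ - (x + y)
      lemma = solve-∀
      neg : ∀ h → - (+ 2 * h) ≡ + 2 * - h
      neg = solve-∀
    choose (inj₂ (a , a≡)) (inj₂ (b , b≡)) (inj₂ (c , c≡)) = ⊥-elim (absurd-mod 2 1 {T = x + y + z - a - b - c - 1ℤ} (s≤s z≤n) ℕₚ.≤-refl
      (trans (lemma x y z) (cong₂ _+_ (cong₂ _+_ a≡ b≡) c≡)) (lemma′ x y z a b c))
      where
      lemma : ∀ x y z → + 2 * (x + y + z) ≡ y + z + (x + z) + (x + y)
      lemma = solve-∀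
      lemma′ : ∀ x y z a b c → + 2 * (x + y + z - a - b - c - 1ℤ) ≡ + 2 * (x + y + z) - (1ℤ + + 2 * a + (1ℤ + + 2 * b) + (1ℤ + + 2 * c)) + 1ℤ
      lemma′ = solve-∀

square-mod-5 : ∀ v → (∃[ w ] v ≡ + 5 * w) ⊎ (∃[ w ] v * v ≡ 1ℤ + + 5 * w) ⊎ (∃[ w ] v * v ≡ + 4 + + 5 * w)
square-mod-5 v = by-residue (division 5 v)
  where
  l₀ : ∀ q → 0ℤ + q * + 5 ≡ + 5 * q
  l₀ = solve-∀
  l₁ : ∀ q → (1ℤ + q * + 5) * (1ℤ + q * + 5) ≡ 1ℤ + + 5 * (+ 5 * (q * q) + + 2 * q)
  l₁ = solve-∀
  l₂ : ∀ q → (+ 2 + q * + 5) * (+ 2 + q * + 5) ≡ + 4 + + 5 * (+ 5 * (q * q) + + 4 * q)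
  l₂ = solve-∀
  l₃ : ∀ q → (+ 3 + q * + 5) * (+ 3 + q * + 5) ≡ + 4 + + 5 * (+ 5 * (q * q) + + 6 * q + 1ℤ)
  l₃ = solve-∀
  l₄ : ∀ q → (+ 4 + q * + 5) * (+ 4 + q * + 5) ≡ 1ℤ + + 5 * (+ 5 * (q * q) + + 8 * q + + 3)
  l₄ = solve-∀
  by-residue : ∃[ r ] ∃[ q ] r ℕ.< 5 × v ≡ + r + q * + 5 →
    (∃[ w ] v ≡ + 5 * w) ⊎ (∃[ w ] v * v ≡ 1ℤ + + 5 * w) ⊎ (∃[ w ] v * v ≡ + 4 + + 5 * w)
  by-residue (0 , q , _ , e) = inj₁ (q , trans e (l₀ q))
  by-residue (1 , q , _ , e) = inj₂ (inj₁ (+ 5 * (q * q) + + 2 * q , trans (cong (λ v → v * v) e) (l₁ q)))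
  by-residue (2 , q , _ , e) = inj₂ (inj₂ (+ 5 * (q * q) + + 4 * q , trans (cong (λ v → v * v) e) (l₂ q)))
  by-residue (3 , q , _ , e) = inj₂ (inj₂ (+ 5 * (q * q) + + 6 * q + 1ℤ , trans (cong (λ v → v * v) e) (l₃ q)))
  by-residue (4 , q , _ , e) = inj₂ (inj₁ (+ 5 * (q * q) + + 8 * q + + 3 , trans (cong (λ v → v * v) e) (l₄ q)))
  by-residue (suc (suc (suc (suc (suc _)))) , _ , s≤s (s≤s (s≤s (s≤s (s≤s ())))) , _)

anisotropic-5 : ∀ x y w → + 2 * (x * x) + y * y ≡ + 5 * w → (∃[ a ] x ≡ + 5 * a) × (∃[ b ] y ≡ + 5 * b)
anisotropic-5 x y w e = choose (square-mod-5 x) (square-mod-5 y) (vanishing (square-mod-5 x) (square-mod-5 y))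
  where
  Goal : Set
  Goal = (∃[ a ] x ≡ + 5 * a) × (∃[ b ] y ≡ + 5 * b)
  Class : ℤ → Set
  Class v = (∃[ w ] v ≡ + 5 * w) ⊎ (∃[ w ] v * v ≡ 1ℤ + + 5 * w) ⊎ (∃[ w ] v * v ≡ + 4 + + 5 * w)
  residue-of : ∀ {v} → Class v → ℕ
  residue-of (inj₁ _)        = 0
  residue-of (inj₂ (inj₁ _)) = 1
  residue-of (inj₂ (inj₂ _)) = 4
  square-≈ : ∀ {v} (c : Class v) → v * v ≈ + residue-of c mod 5
  square-≈ (inj₁ (a , refl))     = multiple (+ 5 * (a * a)) (lemma a)
    where
    lemma : ∀ a → + 5 * a * (+ 5 * a) ≡ 0ℤ + + 5 * (a * a) * + 5
    lemma = solve-∀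
  square-≈ (inj₂ (inj₁ (a , p))) = multiple a (trans p (cong (λ t → 1ℤ + t) (ℤₚ.*-comm (+ 5) a)))
  square-≈ (inj₂ (inj₂ (a , p))) = multiple a (trans p (cong (λ t → + 4 + t) (ℤₚ.*-comm (+ 5) a)))
  vanishing : (c : Class x) (d : Class y) → (2 ℕ.* residue-of c ℕ.+ residue-of d) % 5 ≡ 0
  vanishing c d = ≈-% (2 ℕ.* residue-of c ℕ.+ residue-of d) 0
    (≈-trans (≈-reflexive (cong (_+ + residue-of d) (ℤₚ.pos-* 2 (residue-of c))))
      (≈-trans (≈-sym (≈-+ (≈-*ˡ (+ 2) (square-≈ c)) (square-≈ d)))
        (multiple w (trans e (trans (ℤₚ.*-comm (+ 5) w) (sym (ℤₚ.+-identityˡ (w * + 5))))))))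
  choose : (c : Class x) (d : Class y) → (2 ℕ.* residue-of c ℕ.+ residue-of d) % 5 ≡ 0 → Goal
  choose (inj₁ a)        (inj₁ b)        _ = a , b
  choose (inj₁ _)        (inj₂ (inj₁ _)) ()
  choose (inj₁ _)        (inj₂ (inj₂ _)) ()
  choose (inj₂ (inj₁ _)) (inj₁ _)        ()
  choose (inj₂ (inj₁ _)) (inj₂ (inj₁ _)) ()
  choose (inj₂ (inj₁ _)) (inj₂ (inj₂ _)) ()
  choose (inj₂ (inj₂ _)) (inj₁ _)        ()
  choose (inj₂ (inj₂ _)) (inj₂ (inj₁ _)) ()
  choose (inj₂ (inj₂ _)) (inj₂ (inj₂ _)) ()

opaque
  f₅-40n+17 : ∀ n → ∃[ a ] ∃[ v ] ∃[ c ] + 5 * (a * a) + + 2 * (v * v) + + 10 * (c * c) ≡ + 40 * + n + + 17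
  f₅-40n+17 n = build (f₅-even (represents₅-5[40n+17] n))
    where
    M : ℤ
    M = + 40 * + n + + 17
    Goal : Set
    Goal = ∃[ a ] ∃[ v ] ∃[ c ] + 5 * (a * a) + + 2 * (v * v) + + 10 * (c * c) ≡ M
    reduced : ∀ a b z → + 5 * (a * a) + + 15 * (b * b) + + 2 * (z * (z - + 5 * b)) ≡ M → Goal
    reduced a b z e = choose (parity b)
      where
      product-even : ∀ c → ∃[ w ] z * (z - + 5 * (1ℤ + + 2 * c)) ≡ + 2 * w
      product-even c = by-parity (parity z)
        where
        by-parity : Even z ⊎ Odd z → ∃[ w ] z * (z - + 5 * (1ℤ + + 2 * c)) ≡ + 2 * w
        by-parity (inj₁ (h , refl)) = h * (+ 2 * h - + 5 * (1ℤ + + 2 * c)) , ℤₚ.*-assoc (+ 2) h _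
        by-parity (inj₂ (h , refl)) = (1ℤ + + 2 * h) * (h - + 2 - + 5 * c) , lemma h c
          where
          lemma : ∀ h c → (1ℤ + + 2 * h) * (1ℤ + + 2 * h - + 5 * (1ℤ + + 2 * c)) ≡ + 2 * ((1ℤ + + 2 * h) * (h - + 2 - + 5 * c))
          lemma = solve-∀
      impossible : ∀ c w → + 5 * (a * a) + + 15 * ((1ℤ + + 2 * c) * (1ℤ + + 2 * c)) + + 2 * (+ 2 * w) ≡ M → ⊥
      impossible c w e = by-parity (parity a)
        where
        by-parity : Even a ⊎ Odd a → ⊥
        by-parity (inj₁ (h , refl)) = absurd-mod 4 2 {T = + 5 * (h * h) + + 15 * (c * c + c) + w - + 10 * + n} (s≤s z≤n) (s≤s (s≤s (s≤s z≤n))) e (lemma h c w (+ n))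
          where
          lemma : ∀ h c w n → + 4 * (+ 5 * (h * h) + + 15 * (c * c + c) + w - + 10 * n)
            ≡ + 5 * (+ 2 * h * (+ 2 * h)) + + 15 * ((1ℤ + + 2 * c) * (1ℤ + + 2 * c)) + + 2 * (+ 2 * w) - (+ 40 * n + + 17) + + 2
          lemma = solve-∀
        by-parity (inj₂ (h , refl)) = absurd-mod 4 1 {T = + 5 * (h * h + h) + + 15 * (c * c + c) + w - + 10 * + n + 1ℤ} (s≤s z≤n) (s≤s (s≤s z≤n)) e (lemma h c w (+ n))
          where
          lemma : ∀ h c w n → + 4 * (+ 5 * (h * h + h) + + 15 * (c * c + c) + w - + 10 * n + 1ℤ)
            ≡ + 5 * ((1ℤ + + 2 * h) * (1ℤ + + 2 * h)) + + 15 * ((1ℤ + + 2 * c) * (1ℤ + + 2 * c)) + + 2 * (+ 2 * w) - (+ 40 * n + + 17) + 1ℤ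
          lemma = solve-∀
      choose : Even b ⊎ Odd b → Goal
      choose (inj₁ (c , refl)) = a , z - + 5 * c , c , trans (lemma a z c) e
        where
        lemma : ∀ a z c → + 5 * (a * a) + + 2 * ((z - + 5 * c) * (z - + 5 * c)) + + 10 * (c * c)
          ≡ + 5 * (a * a) + + 15 * (+ 2 * c * (+ 2 * c)) + + 2 * (z * (z - + 5 * (+ 2 * c)))
        lemma = solve-∀
      choose (inj₂ (c , refl)) = let (w , w≡) = product-even c in
        ⊥-elim (impossible c w (trans (cong (λ t → + 5 * (a * a) + + 15 * ((1ℤ + + 2 * c) * (1ℤ + + 2 * c)) + + 2 * t) (sym w≡)) e))
    build : ∃[ x ] ∃[ k ] ∃[ z ] eval f₅ x (+ 2 * k - z) z ≡ + 5 * + (40 ℕ.* n ℕ.+ 17) → Goal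
    build (x , k , z , e) = divide (anisotropic-5 (x + k) (+ 2 * z - k) (+ 2 * M - k * k) (trans (expand x k z) (trans (cong (λ t → + 2 * t - + 5 * (k * k)) e′) (collect M k))))
      where
      e′ : eval f₅ x (+ 2 * k - z) z ≡ + 5 * M
      e′ = trans e (cong (+ 5 *_) (+-linear 40 17 n))
      expand : ∀ x k z → + 2 * ((x + k) * (x + k)) + (+ 2 * z - k) * (+ 2 * z - k)
        ≡ + 2 * (1ℤ * (x * x) + 1ℤ * ((+ 2 * k - z) * (+ 2 * k - z)) + + 2 * (z * z) + 1ℤ * ((+ 2 * k - z) * z) + 1ℤ * (x * z) + 1ℤ * (x * (+ 2 * k - z)))
          - + 5 * (k * k)
      expand = solve-∀
      collect : ∀ M k → + 2 * (+ 5 * M) - + 5 * (k * k) ≡ + 5 * (+ 2 * M - k * k)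
      collect = solve-∀
      divide : (∃[ a ] x + k ≡ + 5 * a) × (∃[ b ] + 2 * z - k ≡ + 5 * b) → Goal
      divide ((a , a≡) , (b , b≡)) = reduced a b z (cancel-* 10 (trans (lemma₁ a b z)
        (trans (cong₂ (λ s t → + 2 * (s * s) + t * t + + 5 * ((+ 2 * z - t) * (+ 2 * z - t))) (sym a≡) (sym b≡))
          (trans (lemma₂ x k z) (trans (cong (+ 2 *_) e′) (lemma₃ M))))))
        where
        lemma₁ : ∀ a b z → + 10 * (+ 5 * (a * a) + + 15 * (b * b) + + 2 * (z * (z - + 5 * b)))
          ≡ + 2 * (+ 5 * a * (+ 5 * a)) + + 5 * b * (+ 5 * b) + + 5 * ((+ 2 * z - + 5 * b) * (+ 2 * z - + 5 * b))
        lemma₁ = solve-∀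
        lemma₂ : ∀ x k z → + 2 * ((x + k) * (x + k)) + (+ 2 * z - k) * (+ 2 * z - k) + + 5 * ((+ 2 * z - (+ 2 * z - k)) * (+ 2 * z - (+ 2 * z - k)))
          ≡ + 2 * (1ℤ * (x * x) + 1ℤ * ((+ 2 * k - z) * (+ 2 * k - z)) + + 2 * (z * z) + 1ℤ * ((+ 2 * k - z) * z) + 1ℤ * (x * z) + 1ℤ * (x * (+ 2 * k - z)))
        lemma₂ = solve-∀
        lemma₃ : ∀ M → + 2 * (+ 5 * M) ≡ + 10 * M
        lemma₃ = solve-∀

  -- 40n + 17 = 5 (2p + 1)² + 2 (10y + 1)² + 10 (2r + 1)²
  f₅-40n+17′ : ∀ n → ∃[ p ] ∃[ y ] ∃[ r ] pronic p + + 2 * (y * (+ 5 * y + 1ℤ)) + + 2 * pronic r ≡ + 2 * + n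
  f₅-40n+17′ n = build (f₅-40n+17 n)
    where
    N : ℤ
    N = + n
    Goal : Set
    Goal = ∃[ p ] ∃[ y ] ∃[ r ] pronic p + + 2 * (y * (+ 5 * y + 1ℤ)) + + 2 * pronic r ≡ + 2 * N
    finish : ∀ p v r → v * v + + 10 * pronic p + + 20 * pronic r ≡ + 20 * N + 1ℤ → Mod5 v → Goal
    finish p v r e (one₅ y y≡) = p , y , r , cancel-* 10 (+-cancelˡ 1ℤ (trans (lemma (pronic p) (y * (+ 5 * y + 1ℤ)) (pronic r))
      (trans (cong (λ t → t + + 10 * pronic p + + 20 * pronic r) (sym y≡)) (trans e (regroup N)))))
      where
      lemma : ∀ P Y R → 1ℤ + + 10 * (P + + 2 * Y + + 2 * R) ≡ 1ℤ + + 20 * Y + + 10 * P + + 20 * R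
      lemma = solve-∀
      regroup : ∀ N → + 20 * N + 1ℤ ≡ 1ℤ + + 10 * (+ 2 * N)
      regroup = solve-∀
    finish p v r e (zero₅ w w≡) = ⊥-elim (absurd-mod 5 1 {T = + 5 * (w * w) + + 2 * pronic p + + 4 * pronic r - + 4 * N} (s≤s z≤n) (s≤s (s≤s z≤n))
      (trans (cong (λ t → t * t + + 10 * pronic p + + 20 * pronic r) (sym w≡)) e) (lemma w (pronic p) (pronic r) N))
      where
      lemma : ∀ w P R N → + 5 * (+ 5 * (w * w) + + 2 * P + + 4 * R - + 4 * N) ≡ + 5 * w * (+ 5 * w) + + 10 * P + + 20 * R - (+ 20 * N + 1ℤ) + 1ℤ
      lemma = solve-∀
    finish p v r e (four₅ y y≡) = ⊥-elim (absurd-mod 5 2 {T = + 2 + + 4 * (y * (+ 5 * y + + 3)) + + 2 * pronic p + + 4 * pronic r - + 4 * N} (s≤s z≤n) (s≤s (s≤s (s≤s z≤n)))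
      (trans (cong (λ t → t + + 10 * pronic p + + 20 * pronic r) (sym y≡)) e) (lemma (y * (+ 5 * y + + 3)) (pronic p) (pronic r) N))
      where
      lemma : ∀ Y P R N → + 5 * (+ 2 + + 4 * Y + + 2 * P + + 4 * R - + 4 * N) ≡ + 9 + + 20 * Y + + 10 * P + + 20 * R - (+ 20 * N + 1ℤ) + + 2
      lemma = solve-∀
    odd-a : ∀ p v c → v * v + + 5 * (c * c) + + 10 * pronic p ≡ + 20 * N + + 6 → Goal
    odd-a p v c e = choose (parity v) (parity c) (pronic-even p)
      where
      choose : Even v ⊎ Odd v → Even c ⊎ Odd c → ∃[ k ] pronic p ≡ k * (+ 4 * k + + 2) → Goal
      choose (inj₂ ov) (inj₂ (r , refl)) _ = finish p v r (+-cancelˡ (+ 5) (trans (lemma (v * v) r (pronic p)) (trans e (regroup N)))) (mod-5-odd v ov)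
        where
        lemma : ∀ V r P → + 5 + (V + + 10 * P + + 20 * (r * r + r)) ≡ V + + 5 * ((1ℤ + + 2 * r) * (1ℤ + + 2 * r)) + + 10 * P
        lemma = solve-∀
        regroup : ∀ N → + 20 * N + + 6 ≡ + 5 + (+ 20 * N + 1ℤ)
        regroup = solve-∀
      choose (inj₁ (h , refl)) (inj₁ (r , refl)) (k , k≡) = ⊥-elim (absurd-mod 4 2 {T = h * h + + 5 * (r * r) + + 5 * (k * (+ 2 * k + 1ℤ)) - + 5 * N - 1ℤ} (s≤s z≤n) (s≤s (s≤s (s≤s z≤n)))
        (trans (cong (λ t → + 2 * h * (+ 2 * h) + + 5 * (+ 2 * r * (+ 2 * r)) + + 10 * t) (sym k≡)) e) (lemma h r k N))
        where
        lemma : ∀ h r k N → + 4 * (h * h + + 5 * (r * r) + + 5 * (k * (+ 2 * k + 1ℤ)) - + 5 * N - 1ℤ)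
          ≡ + 2 * h * (+ 2 * h) + + 5 * (+ 2 * r * (+ 2 * r)) + + 10 * (k * (+ 4 * k + + 2)) - (+ 20 * N + + 6) + + 2
        lemma = solve-∀
      choose (inj₁ (h , refl)) (inj₂ (r , refl)) _ = ⊥-elim (absurd-mod 2 1 {T = + 2 * (h * h) + + 10 * (r * r + r) + + 5 * pronic p - + 10 * N} (s≤s z≤n) ℕₚ.≤-refl e (lemma h r (pronic p) N))
        where
        lemma : ∀ h r P N → + 2 * (+ 2 * (h * h) + + 10 * (r * r + r) + + 5 * P - + 10 * N)
          ≡ + 2 * h * (+ 2 * h) + + 5 * ((1ℤ + + 2 * r) * (1ℤ + + 2 * r)) + + 10 * P - (+ 20 * N + + 6) + 1ℤ
        lemma = solve-∀
      choose (inj₂ (h , refl)) (inj₁ (r , refl)) _ = ⊥-elim (absurd-mod 2 1 {T = + 2 * (h * h + h) + + 10 * (r * r) + + 5 * pronic p - + 10 * N - + 2} (s≤s z≤n) ℕₚ.≤-refl e (lemma h r (pronic p) N))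
        where
        lemma : ∀ h r P N → + 2 * (+ 2 * (h * h + h) + + 10 * (r * r) + + 5 * P - + 10 * N - + 2)
          ≡ (1ℤ + + 2 * h) * (1ℤ + + 2 * h) + + 5 * (+ 2 * r * (+ 2 * r)) + + 10 * P - (+ 20 * N + + 6) + 1ℤ
        lemma = solve-∀
    build : ∃[ a ] ∃[ v ] ∃[ c ] + 5 * (a * a) + + 2 * (v * v) + + 10 * (c * c) ≡ + 40 * N + + 17 → Goal
    build (a , v , c , e) = choose (parity a)
      where
      choose : Even a ⊎ Odd a → Goal
      choose (inj₂ (p , refl)) = odd-a p v c (cancel-* 2 (+-cancelˡ (+ 5) (trans (lemma p v c) (trans e (regroup N)))))
        where
        lemma : ∀ p v c → + 5 + + 2 * (v * v + + 5 * (c * c) + + 10 * (p * p + p)) ≡ + 5 * ((1ℤ + + 2 * p) * (1ℤ + + 2 * p)) + + 2 * (v * v) + + 10 * (c * c)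
        lemma = solve-∀
        regroup : ∀ N → + 40 * N + + 17 ≡ + 5 + + 2 * (+ 20 * N + + 6)
        regroup = solve-∀
      choose (inj₁ (h , refl)) = ⊥-elim (absurd-mod 2 1 {T = + 10 * (h * h) + v * v + + 5 * (c * c) - + 20 * N - + 8} (s≤s z≤n) ℕₚ.≤-refl e (lemma h v c N))
        where
        lemma : ∀ h v c N → + 2 * (+ 10 * (h * h) + v * v + + 5 * (c * c) - + 20 * N - + 8)
          ≡ + 5 * (+ 2 * h * (+ 2 * h)) + + 2 * (v * v) + + 10 * (c * c) - (+ 40 * N + + 17) + 1ℤ
        lemma = solve-∀

heptagonal-even : ∀ y → ∃[ k ] y * (+ 5 * y + 1ℤ) ≡ + 2 * k
heptagonal-even y = by-parity (parity y)
  where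
  by-parity : Even y ⊎ Odd y → ∃[ k ] y * (+ 5 * y + 1ℤ) ≡ + 2 * k
  by-parity (inj₁ (h , refl)) = h * (+ 10 * h + 1ℤ) , lemma h
    where
    lemma : ∀ h → + 2 * h * (+ 5 * (+ 2 * h) + 1ℤ) ≡ + 2 * (h * (+ 10 * h + 1ℤ))
    lemma = solve-∀
  by-parity (inj₂ (h , refl)) = (1ℤ + + 2 * h) * (+ 5 * h + + 3) , lemma h
    where
    lemma : ∀ h → (1ℤ + + 2 * h) * (+ 5 * (1ℤ + + 2 * h) + 1ℤ) ≡ + 2 * ((1ℤ + + 2 * h) * (+ 5 * h + + 3))
    lemma = solve-∀

universal-8-2-5-1-4-2 : Universal (+ 8) (+ 2) (+ 5) (+ 1) (+ 4) (+ 2)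
universal-8-2-5-1-4-2 n =
  let (p , y , r , e) = f₅-40n+17′ (n ℕ.+ n)
      (k , k≡) = heptagonal-even y
      (z , z≡) = pronic-even r
      (x , x≡) = pronic≡4w p (+ n - k - z * (+ 2 * z + 1ℤ)) (trans (isolate-first (pronic p) (+ 2 * (y * (+ 5 * y + 1ℤ))) (+ 2 * pronic r))
        (trans (cong₂ (λ s t → s - + 2 * proj₁ t - + 2 * proj₂ t) e (cong₂ _,_ k≡ z≡)) (lemma₁ (+ n) k z)))
  in x , y , z , cancel-* 2 (trans (double-n (+ n)) (trans (sym e)
       (trans (cong₂ (λ s t → s + + 2 * (y * (+ 5 * y + 1ℤ)) + + 2 * t) x≡ z≡) (lemma₂ (x * (+ 8 * x + + 2)) (y * (+ 5 * y + 1ℤ)) z))))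
  where
  lemma₁ : ∀ n k z → + 2 * (n + n) - + 2 * (+ 2 * k) - + 2 * (z * (+ 4 * z + + 2)) ≡ + 4 * (n - k - z * (+ 2 * z + 1ℤ))
  lemma₁ = solve-∀
  lemma₂ : ∀ X Y z → + 2 * X + + 2 * Y + + 2 * (z * (+ 4 * z + + 2)) ≡ + 2 * (X + Y + z * (+ 4 * z + + 2))
  lemma₂ = solve-∀

universal-8-6-5-1-4-2 : Universal (+ 8) (+ 6) (+ 5) (+ 1) (+ 4) (+ 2)
universal-8-6-5-1-4-2 n =
  let (p , y , r , e) = f₅-40n+17′ (suc (n ℕ.+ n))
      (k , k≡) = heptagonal-even y
      (z , z≡) = pronic-even r
      (x , x≡) = pronic≡4w+2 p (+ n - k - z * (+ 2 * z + 1ℤ)) (trans (isolate-first (pronic p) (+ 2 * (y * (+ 5 * y + 1ℤ))) (+ 2 * pronic r))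
        (trans (cong₂ (λ s t → s - + 2 * proj₁ t - + 2 * proj₂ t) e (cong₂ _,_ k≡ z≡)) (lemma₁ (+ n) k z)))
  in x , y , z , cancel-* 2 (+-cancelˡ (+ 2) (trans (double-n+1 (+ n)) (trans (sym e)
       (trans (cong₂ (λ s t → s + + 2 * (y * (+ 5 * y + 1ℤ)) + + 2 * t) x≡ z≡) (lemma₂ (x * (+ 8 * x + + 6)) (y * (+ 5 * y + 1ℤ)) z)))))
  where
  lemma₁ : ∀ n k z → + 2 * (1ℤ + (n + n)) - + 2 * (+ 2 * k) - + 2 * (z * (+ 4 * z + + 2)) ≡ + 4 * (n - k - z * (+ 2 * z + 1ℤ)) + + 2
  lemma₁ = solve-∀
  lemma₂ : ∀ X Y z → + 2 * X + + 2 + + 2 * Y + + 2 * (z * (+ 4 * z + + 2)) ≡ + 2 + + 2 * (X + Y + z * (+ 4 * z + + 2))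
  lemma₂ = solve-∀

theorem2p1 : Universal (+ 8) (+ 2) (+ 3) (+ 1) (+ 2) (+ 0)
    × Universal (+ 8) (+ 2) (+ 3) (+ 1) (+ 3) (+ 1)
    × Universal (+ 8) (+ 2) (+ 4) (+ 2) (+ 2) (+ 0)
    × Universal (+ 8) (+ 2) (+ 4) (+ 2) (+ 4) (+ 0)
    × Universal (+ 8) (+ 2) (+ 5) (+ 1) (+ 4) (+ 2)
    × Universal (+ 8) (+ 2) (+ 5) (+ 3) (+ 5) (+ 1)
    × Universal (+ 8) (+ 4) (+ 6) (+ 4) (+ 6) (+ 2)
    × Universal (+ 8) (+ 4) (+ 8) (+ 2) (+ 3) (+ 1)
    × Universal (+ 8) (+ 4) (+ 8) (+ 4) (+ 6) (+ 4)
    × Universal (+ 8) (+ 6) (+ 3) (+ 1) (+ 2) (+ 0)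
    × Universal (+ 8) (+ 6) (+ 4) (+ 2) (+ 4) (+ 0)
    × Universal (+ 8) (+ 6) (+ 4) (+ 2) (+ 4) (+ 2)
    × Universal (+ 8) (+ 6) (+ 5) (+ 1) (+ 4) (+ 2)
    × Universal (+ 8) (+ 6) (+ 8) (+ 4) (+ 3) (+ 1)
theorem2p1 =
    universal-8-2-3-1-2-0
  , universal-8-2-3-1-3-1
  , universal-8-2-4-2-2-0
  , universal-8-2-4-2-4-0
  , universal-8-2-5-1-4-2
  , universal-8-2-5-3-5-1
  , universal-8-4-6-4-6-2
  , universal-8-4-8-2-3-1
  , universal-8-4-8-4-6-4
  , universal-8-6-3-1-2-0
  , universal-8-6-4-2-4-0
  , universal-8-6-4-2-4-2
  , universal-8-6-5-1-4-2
  , universal-8-6-8-4-3-1
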